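{- Let $m\ge 2$ and let $T$ be an $m$-uniform hypertree with $k$ edges and odd diameter $d=2p+1$, where $(k-d-1)(m-1)\ge 6$. Then $\lambda_1(T)\le \lambda_1(T_d(c_{p+1}=k-d))$, and equality holds only when $T=T_d(c_{p+1}=k-d)$.
   Context: A hypergraph has a finite vertex set and an edge set of non-empty subsets of the vertex set; it is $m$-uniform if all edges have cardinality $m$, and linear if two distinct edges share at most one vertex. The adjacency matrix of a linear $m$-uniform hypergraph $\mathcal{H}$ has $(i,j)$ entry $\frac{1}{m-1}$ if $i\ne j$ lie in a common edge, and $0$ otherwise; $\lambda_1(\mathcal{H})$ denotes its spectral radius. The degree of a vertex is the number of edges containing it; a vertex is pendant if its degree is one and non-pendant if its degree is larger. A loose path of length $d$, $P_L(d)=v_1e_1v_2e_2\dots v_de_dv_{d+1}$, is the $m$-uniform hypergraph with edges $e_1,\dots,e_d$ such that $e_{i-1}\cap e_i=\{v_i\}$ for $2\le i\le d$ (the $v_i$ distinct), non-consecutive edges are disjoint, and $v_1\in e_1$, $v_{d+1}\in e_d$ are pendant. A loose cycle of length $l\ge3$, $v_1e_1v_2e_2\dots v_le_lv_1$, is the $m$-uniform hypergraph with edges $e_1,\dots,e_l$ in which cyclically consecutive edges meet exactly in $v_i$ ($e_{i-1}\cap e_i=\{v_i\}$, indices mod $l$, the $v_i$ distinct) and non-consecutive edges are disjoint. A hypertree is a connected linear hypergraph containing no loose cycle in which every edge contains at most two non-pendant vertices. The diameter is the maximum distance between two vertices, distance being the minimum length (number of edges) of a path joining them. Attaching a pendant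 edge at a vertex $v$ means adding a new edge consisting of $v$ and $m-1$ new vertices. $T_d(c_2,\dots,c_d)$ is the hypertree obtained from $P_L(d)=v_1e_1v_2\dots v_de_dv_{d+1}$ by attaching $c_i$ pendant edges at $v_i$ for $i=2,\dots,d$; when only some of the $c_i$ are listed, the others are $0$. Equality of hypergraphs means isomorphism. -}

module Defs where

open import Data.Bool using (true; if_then_else_)
open import Data.Fin using (Fin; toℕ; fromℕ; fromℕ<; inject₁; _↑ˡ_) renaming (zero to fzero; suc to fsuc)
import Data.Fin.Properties as Fin
open import Data.Fin.Subset using (Subset; _∈_; _∩_; ∣_∣; ⁅_⁆; Nonempty; Empty) renaming (⊤ to full; ⊥ to empty)
open import Data.Fin.Subset.Properties using (_∈?_; x∈⁅x⁆)
open import Data.Integer using (+_)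
open import Data.List using (allFin; foldr)
open import Data.Nat using (ℕ; suc; _∸_; _≤_; _<_; s≤s; NonZero; >-nonZero; _⊔_)
  renaming (_+_ to _+ℕ_; _*_ to _*ℕ_)
open import Data.Nat.DivMod using (_mod_)
open import Data.Nat.GeneralisedArithmetic using (iterate)
import Data.Nat.Properties as ℕ
open import Data.Product using (∃; ∃₂; _×_; _,_; proj₁; proj₂)
open import Data.Rational using (ℚ; 0ℚ; 1ℚ; ½; _/_; Positive; NonNegative)
import Data.Rational as ℚ
import Data.Rational.Properties as ℚ
open import Data.Rational.Solver using (module +-*-Solver)
open import Data.Vec using (_++_; tabulate; lookup; here; there)
import Data.Vec.Functional as Vector
open import Data.Vec.Properties using (++-injectiveˡ; ++-injectiveʳ; lookup∘tabulate; lookup⇒[]=; []=⇒lookup)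
open import Function using (Injective; _↔_; _⇔_; Inverse)
open import Relation.Binary.PropositionalEquality using (_≡_; _≢_; refl; sym; trans; cong; cong₂; subst)
open import Relation.Nullary using (¬_; Dec; yes; does; contradiction)
open import Relation.Nullary.Decidable using (_×-dec_; ¬?; dec-true; toWitness)

-- Real numbers are Cauchy sequences of rationals, up to the setoid equality _≈_ below.
-- The Cauchy proofs are abstract only to keep the type checker from unfolding them.

Eventually : (ℕ → Set) → Set
Eventually P = ∃ λ N → ∀ n → N ≤ n → P n

IsCauchy : (ℕ → ℚ) → Set
IsCauchy x = ∀ ε → 0ℚ ℚ.< ε →
  ∃ λ N → ∀ i j → N ≤ i → N ≤ j → ℚ.∣ x i ℚ.- x j ∣ ℚ.≤ ε

record ℝ : Set where
  constructor mkℝ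
  field
    seq    : ℕ → ℚ
    cauchy : IsCauchy seq

open ℝ public

infix 4 _≈_ _≤ᴿ_

_≈_ : ℝ → ℝ → Set
x ≈ y = ∀ ε → 0ℚ ℚ.< ε → Eventually λ n → ℚ.∣ seq x n ℚ.- seq y n ∣ ℚ.≤ ε

_≤ᴿ_ : ℝ → ℝ → Set
x ≤ᴿ y = ∀ ε → 0ℚ ℚ.< ε → Eventually λ n → seq x n ℚ.≤ seq y n ℚ.+ ε

half+half : ∀ ε → ε ℚ.* ½ ℚ.+ ε ℚ.* ½ ≡ ε
half+half ε = trans (sym (ℚ.*-distribˡ-+ ε ½ ½)) (ℚ.*-identityʳ ε)

half-pos : ∀ {ε} → 0ℚ ℚ.< ε → 0ℚ ℚ.< ε ℚ.* ½
half-pos {ε} 0<ε = subst (ℚ._< ε ℚ.* ½) (ℚ.*-zeroˡ ½) (ℚ.*-monoˡ-<-pos ½ 0<ε)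

abstract
  const-cauchy : ∀ q → IsCauchy (λ _ → q)
  const-cauchy q ε 0<ε = 0 , λ _ _ _ _ →
    subst (ℚ._≤ ε) (cong ℚ.∣_∣ (sym (ℚ.+-inverseʳ q))) (ℚ.<⇒≤ 0<ε)

abstract
  neg-cauchy : ∀ {x} → IsCauchy x → IsCauchy (λ n → ℚ.- x n)
  neg-cauchy {x} cx ε 0<ε with cx ε 0<ε
  ... | N , h = N , λ i j N≤i N≤j →
    subst (ℚ._≤ ε) (trans (sym (ℚ.∣-p∣≡∣p∣ (x i ℚ.- x j))) (cong ℚ.∣_∣ (swap (x i) (x j)))) (h i j N≤i N≤j)
    where
    swap : ∀ a b → ℚ.- (a ℚ.- b) ≡ ℚ.- a ℚ.- ℚ.- b
    swap = solve 2 (λ a b → :- (a :- b) := :- a :- (:- b)) refl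
      where open +-*-Solver

abstract
  +-cauchy : ∀ {x y} → IsCauchy x → IsCauchy y → IsCauchy (λ n → x n ℚ.+ y n)
  +-cauchy {x} {y} cx cy ε 0<ε with cx (ε ℚ.* ½) (half-pos 0<ε) | cy (ε ℚ.* ½) (half-pos 0<ε)
  ... | M , f | N , g = M ⊔ N , λ i j hi hj → begin
      ℚ.∣ (x i ℚ.+ y i) ℚ.- (x j ℚ.+ y j) ∣     ≡⟨ cong ℚ.∣_∣ (split (x i) (y i) (x j) (y j)) ⟩
      ℚ.∣ (x i ℚ.- x j) ℚ.+ (y i ℚ.- y j) ∣     ≤⟨ ℚ.∣p+q∣≤∣p∣+∣q∣ (x i ℚ.- x j) (y i ℚ.- y j) ⟩
      ℚ.∣ x i ℚ.- x j ∣ ℚ.+ ℚ.∣ y i ℚ.- y j ∣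
        ≤⟨ ℚ.+-mono-≤ (f i j (ℕ.m⊔n≤o⇒m≤o M N hi) (ℕ.m⊔n≤o⇒m≤o M N hj))
                      (g i j (ℕ.m⊔n≤o⇒n≤o M N hi) (ℕ.m⊔n≤o⇒n≤o M N hj)) ⟩
      ε ℚ.* ½ ℚ.+ ε ℚ.* ½                       ≡⟨ half+half ε ⟩
      ε                                         ∎
    where
    open ℚ.≤-Reasoning
    split : ∀ a b c d → (a ℚ.+ b) ℚ.- (c ℚ.+ d) ≡ (a ℚ.- c) ℚ.+ (b ℚ.- d)
    split = solve 4 (λ a b c d → (a :+ b) :- (c :+ d) := (a :- c) :+ (b :- d)) refl
      where open +-*-Solver

bounded : ∀ {x} → IsCauchy x →
  ∃ λ B → Positive B × Eventually (λ n → ℚ.∣ x n ∣ ℚ.≤ B)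
bounded {x} cx with cx 1ℚ (toWitness {a? = 0ℚ ℚ.<? 1ℚ} _)
... | N , h = B , ℚ.pos+nonNeg⇒pos 1ℚ ℚ.∣ x N ∣ {{ℚ.∣-∣-nonNeg (x N)}} , N , λ n N≤n → begin
    ℚ.∣ x n ∣                            ≡⟨ cong ℚ.∣_∣ (split (x n) (x N)) ⟩
    ℚ.∣ (x n ℚ.- x N) ℚ.+ x N ∣          ≤⟨ ℚ.∣p+q∣≤∣p∣+∣q∣ (x n ℚ.- x N) (x N) ⟩
    ℚ.∣ x n ℚ.- x N ∣ ℚ.+ ℚ.∣ x N ∣      ≤⟨ ℚ.+-monoˡ-≤ ℚ.∣ x N ∣ (h n N N≤n ℕ.≤-refl) ⟩
    B                                    ∎
  where
  open ℚ.≤-Reasoning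
  B = 1ℚ ℚ.+ ℚ.∣ x N ∣
  split : ∀ a b → a ≡ (a ℚ.- b) ℚ.+ b
  split = solve 2 (λ a b → a := (a :- b) :+ b) refl
    where open +-*-Solver

*-bound : ∀ {a b A δ} → .{{NonNegative A}} →
  ℚ.∣ a ∣ ℚ.≤ A → ℚ.∣ b ∣ ℚ.≤ δ → ℚ.∣ a ℚ.* b ∣ ℚ.≤ A ℚ.* δ
*-bound {a} {b} {A} {δ} a≤A b≤δ = begin
    ℚ.∣ a ℚ.* b ∣           ≡⟨ ℚ.∣p*q∣≡∣p∣*∣q∣ a b ⟩
    ℚ.∣ a ∣ ℚ.* ℚ.∣ b ∣     ≤⟨ ℚ.*-monoʳ-≤-nonNeg ℚ.∣ b ∣ {{ℚ.∣-∣-nonNeg b}} a≤A ⟩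
    A ℚ.* ℚ.∣ b ∣           ≤⟨ ℚ.*-monoˡ-≤-nonNeg A b≤δ ⟩
    A ℚ.* δ                 ∎
  where open ℚ.≤-Reasoning

shrink : ∀ B → Positive B → ∀ {ε} → 0ℚ ℚ.< ε → ∃ λ δ → 0ℚ ℚ.< δ × B ℚ.* δ ≡ ε
shrink B B>0 {ε} 0<ε = 1/B ℚ.* ε , 0<δ , eq
  where
  instance
    _ = B>0
    B≢0 = ℚ.pos⇒nonZero B
  1/B = ℚ.1/ B
  instance
    1/B>0 = ℚ.1/pos⇒pos B
  0<δ : 0ℚ ℚ.< 1/B ℚ.* ε
  0<δ = subst (ℚ._< 1/B ℚ.* ε) (ℚ.*-zeroʳ 1/B) (ℚ.*-monoʳ-<-pos 1/B 0<ε)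
  eq : B ℚ.* (1/B ℚ.* ε) ≡ ε
  eq = trans (sym (ℚ.*-assoc B 1/B ε)) (trans (cong (ℚ._* ε) (ℚ.*-inverseʳ B)) (ℚ.*-identityˡ ε))

split-* : ∀ a b c d → a ℚ.* b ℚ.- c ℚ.* d ≡ a ℚ.* (b ℚ.- d) ℚ.+ d ℚ.* (a ℚ.- c)
split-* = solve 4 (λ a b c d → a :* b :- c :* d := a :* (b :- d) :+ d :* (a :- c)) refl
  where open +-*-Solver

*-close : ∀ {a b c d A B α β ε} → Positive A → Positive B →
  A ℚ.* α ≡ ε ℚ.* ½ → B ℚ.* β ≡ ε ℚ.* ½ →
  ℚ.∣ a ∣ ℚ.≤ A → ℚ.∣ d ∣ ℚ.≤ B → ℚ.∣ b ℚ.- d ∣ ℚ.≤ α → ℚ.∣ a ℚ.- c ∣ ℚ.≤ β →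
  ℚ.∣ a ℚ.* b ℚ.- c ℚ.* d ∣ ℚ.≤ ε
*-close {a} {b} {c} {d} {A} {B} {α} {β} {ε} A>0 B>0 Aα Bβ ha hd hbd hac = begin
    ℚ.∣ a ℚ.* b ℚ.- c ℚ.* d ∣                            ≡⟨ cong ℚ.∣_∣ (split-* a b c d) ⟩
    ℚ.∣ a ℚ.* (b ℚ.- d) ℚ.+ d ℚ.* (a ℚ.- c) ∣            ≤⟨ ℚ.∣p+q∣≤∣p∣+∣q∣ (a ℚ.* (b ℚ.- d)) (d ℚ.* (a ℚ.- c)) ⟩
    ℚ.∣ a ℚ.* (b ℚ.- d) ∣ ℚ.+ ℚ.∣ d ℚ.* (a ℚ.- c) ∣
      ≤⟨ ℚ.+-mono-≤ (*-bound {a} {b ℚ.- d} {{ℚ.pos⇒nonNeg A {{A>0}}}} ha hbd)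
                    (*-bound {d} {a ℚ.- c} {{ℚ.pos⇒nonNeg B {{B>0}}}} hd hac) ⟩
    A ℚ.* α ℚ.+ B ℚ.* β                                  ≡⟨ cong₂ ℚ._+_ Aα Bβ ⟩
    ε ℚ.* ½ ℚ.+ ε ℚ.* ½                                  ≡⟨ half+half ε ⟩
    ε                                                    ∎
  where open ℚ.≤-Reasoning

abstract
  *-cauchy : ∀ {x y} → IsCauchy x → IsCauchy y → IsCauchy (λ n → x n ℚ.* y n)
  *-cauchy {x} {y} cx cy ε 0<ε =
    let A , A>0 , K , xA = bounded cx
        B , B>0 , L , yB = bounded cy
        α , 0<α , Aα     = shrink A A>0 (half-pos 0<ε)
        β , 0<β , Bβ     = shrink B B>0 (half-pos 0<ε)
        M , f            = cx β 0<β
        N , g            = cy α 0<α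
    in (K ⊔ L) ⊔ (M ⊔ N) , λ i j hi hj →
      let KL≤i = ℕ.m⊔n≤o⇒m≤o (K ⊔ L) (M ⊔ N) hi
          MN≤i = ℕ.m⊔n≤o⇒n≤o (K ⊔ L) (M ⊔ N) hi
          KL≤j = ℕ.m⊔n≤o⇒m≤o (K ⊔ L) (M ⊔ N) hj
          MN≤j = ℕ.m⊔n≤o⇒n≤o (K ⊔ L) (M ⊔ N) hj
      in *-close {x i} {y i} {x j} {y j} A>0 B>0 Aα Bβ
           (xA i (ℕ.m⊔n≤o⇒m≤o K L KL≤i)) (yB j (ℕ.m⊔n≤o⇒n≤o K L KL≤j))
           (g i j (ℕ.m⊔n≤o⇒n≤o M N MN≤i) (ℕ.m⊔n≤o⇒n≤o M N MN≤j))
           (f i j (ℕ.m⊔n≤o⇒m≤o M N MN≤i) (ℕ.m⊔n≤o⇒m≤o M N MN≤j))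

infixl 6 _+ᴿ_
infixl 7 _*ᴿ_
infix  8 -ᴿ_

fromℚ : ℚ → ℝ
fromℚ q = mkℝ (λ _ → q) (const-cauchy q)

0ᴿ : ℝ
0ᴿ = fromℚ 0ℚ

_+ᴿ_ : ℝ → ℝ → ℝ
x +ᴿ y = mkℝ (λ n → seq x n ℚ.+ seq y n) (+-cauchy {seq x} {seq y} (cauchy x) (cauchy y))

-ᴿ_ : ℝ → ℝ
-ᴿ x = mkℝ (λ n → ℚ.- seq x n) (neg-cauchy {seq x} (cauchy x))

_*ᴿ_ : ℝ → ℝ → ℝ
x *ᴿ y = mkℝ (λ n → seq x n ℚ.* seq y n) (*-cauchy {seq x} {seq y} (cauchy x) (cauchy y))

infix 4 _≈ᶜ_
infixl 6 _+ᶜ_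
infixl 7 _*ᶜ_

record ℂ : Set where
  constructor _+i_
  field
    re im : ℝ

open ℂ public

_≈ᶜ_ : ℂ → ℂ → Set
z ≈ᶜ w = re z ≈ re w × im z ≈ im w

ℝ→ℂ : ℝ → ℂ
ℝ→ℂ x = x +i 0ᴿ

0ᶜ : ℂ
0ᶜ = ℝ→ℂ 0ᴿ

_+ᶜ_ : ℂ → ℂ → ℂ
z +ᶜ w = (re z +ᴿ re w) +i (im z +ᴿ im w)

_*ᶜ_ : ℂ → ℂ → ℂ
z *ᶜ w = (re z *ᴿ re w +ᴿ -ᴿ (im z *ᴿ im w)) +i (re z *ᴿ im w +ᴿ im z *ᴿ re w)

∣_∣² : ℂ → ℝ
∣ z ∣² = re z *ᴿ re z +ᴿ im z *ᴿ im z

∑ : ∀ {n} → (Fin n → ℂ) → ℂ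
∑ = Vector.foldr _+ᶜ_ 0ᶜ

Matrix : Set → ℕ → Set
Matrix A n = Fin n → Fin n → A

IsEigenvalue : ∀ {n} → Matrix ℂ n → ℂ → Set
IsEigenvalue {n} A z = ∃ λ (x : Fin n → ℂ) →
  ¬ (∀ i → x i ≈ᶜ 0ᶜ) × (∀ i → ∑ (λ j → A i j *ᶜ x j) ≈ᶜ z *ᶜ x i)

-- ρ is the largest modulus of an eigenvalue.  To avoid square roots, moduli are
-- compared with the nonnegative number ρ through their squares.
record IsSpectralRadius {n} (A : Matrix ℂ n) (ρ : ℝ) : Set where
  field
    nonNegative : 0ᴿ ≤ᴿ ρ
    attained    : ∃ λ z → IsEigenvalue A z × ∣ z ∣² ≈ ρ *ᴿ ρ
    upperBound  : ∀ z → IsEigenvalue A z → ∣ z ∣² ≤ᴿ ρ *ᴿ ρ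

-- The edge set is given by an injective enumeration, so ∣E∣ is the number of edges.
record Hypergraph : Set where
  field
    ∣V∣ ∣E∣  : ℕ
    edge     : Fin ∣E∣ → Subset ∣V∣
    distinct : Injective _≡_ _≡_ edge
    nonempty : ∀ e → Nonempty (edge e)

open Hypergraph public

Vertex Edge : Hypergraph → Set
Vertex H = Fin (∣V∣ H)
Edge H = Fin (∣E∣ H)

record _≅_ (G H : Hypergraph) : Set where
  field
    vertices  : Vertex G ↔ Vertex H
    edges     : Edge G ↔ Edge H
    incidence : ∀ v e → v ∈ edge G e ⇔ Inverse.to vertices v ∈ edge H (Inverse.to edges e)

Uniform : ℕ → Hypergraph → Set
Uniform m H = ∀ e → ∣ edge H e ∣ ≡ m

Linear : Hypergraph → Set
Linear H = ∀ e f → e ≢ f → ∣ edge H e ∩ edge H f ∣ ≤ 1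

degree : ∀ H → Vertex H → ℕ
degree H v = ∣ tabulate (λ e → lookup (edge H e) v) ∣

nonPendant : ∀ H → Subset (∣V∣ H)
nonPendant H = tabulate λ v → does (1 ℕ.<? degree H v)

-- A path u = v₁ e₁ v₂ … v_d e_d v_{d+1} = w with d edges.
record Path (H : Hypergraph) (u w : Vertex H) (d : ℕ) : Set where
  field
    vertex     : Fin (suc d) → Vertex H
    through    : Fin d → Edge H
    vertex-inj : Injective _≡_ _≡_ vertex
    edge-inj   : Injective _≡_ _≡_ through
    start      : vertex fzero ≡ u
    end        : vertex (fromℕ d) ≡ w
    source     : ∀ i → vertex (inject₁ i) ∈ edge H (through i)
    target     : ∀ i → vertex (fsuc i) ∈ edge H (through i)

Connected : Hypergraph → Set
Connected H = ∀ u w → ∃ λ d → Path H u w d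

IsDistance : ∀ H → Vertex H → Vertex H → ℕ → Set
IsDistance H u w d = Path H u w d × (∀ d′ → Path H u w d′ → d ≤ d′)

IsDiameter : Hypergraph → ℕ → Set
IsDiameter H d =
  (∃₂ λ u w → IsDistance H u w d) × (∀ u w d′ → IsDistance H u w d′ → d′ ≤ d)

next : ∀ {l} → Fin l → Fin l
next {suc l} i = suc (toℕ i) mod suc l

-- vertex i is the common vertex of the edges i − 1 and i, indices being read modulo l.
record LooseCycle (H : Hypergraph) (l : ℕ) : Set where
  field
    3≤l        : 3 ≤ l
    vertex     : Fin l → Vertex H
    around     : Fin l → Edge H
    vertex-inj : Injective _≡_ _≡_ vertex
    edge-inj   : Injective _≡_ _≡_ around
    meet       : ∀ i → edge H (around i) ∩ edge H (around (next i)) ≡ ⁅ vertex (next i) ⁆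
    disjoint   : ∀ i j → i ≢ j → next i ≢ j → next j ≢ i →
                 Empty (edge H (around i) ∩ edge H (around j))

record IsHypertree (H : Hypergraph) : Set where
  field
    connected : Connected H
    linear    : Linear H
    acyclic   : ∀ l → ¬ LooseCycle H l
    twoNonPendant : ∀ e → ∣ edge H e ∩ nonPendant H ∣ ≤ 2

adjacency : ∀ {m} → 2 ≤ m → (H : Hypergraph) → Matrix ℚ (∣V∣ H)
adjacency {m} 2≤m H i j =
  if does (¬? (i Fin.≟ j) ×-dec Fin.any? (λ e → (i ∈? edge H e) ×-dec (j ∈? edge H e)))
  then (+ 1 / (m ∸ 1)) {{>-nonZero (ℕ.m<n⇒0<n∸m 2≤m)}}
  else 0ℚ

IsSpectralRadiusOf : ∀ {m} → 2 ≤ m → Hypergraph → ℝ → Set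
IsSpectralRadiusOf 2≤m H = IsSpectralRadius λ i j → ℝ→ℂ (fromℚ (adjacency 2≤m H i j))

∈-++ˡ : ∀ {a b} {x : Fin a} {p : Subset a} (q : Subset b) → x ∈ p → x ↑ˡ b ∈ p ++ q
∈-++ˡ q here      = here
∈-++ˡ q (there i) = there (∈-++ˡ q i)

full≢empty : ∀ r → .{{NonZero r}} → full {r} ≢ empty
full≢empty (suc r) ()

-- The new edge consists of v and r = m − 1 new vertices, numbered after the old ones.
attachPendant : ∀ r → .{{NonZero r}} → (H : Hypergraph) → Vertex H → Hypergraph
attachPendant r H v = record
  { ∣V∣      = ∣V∣ H +ℕ r
  ; ∣E∣      = suc (∣E∣ H)
  ; edge     = edge′
  ; distinct = λ {e} {f} → inj e f
  ; nonempty = λ where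
      fzero    → v ↑ˡ r , ∈-++ˡ full (x∈⁅x⁆ v)
      (fsuc e) → let x , x∈e = nonempty H e in x ↑ˡ r , ∈-++ˡ empty x∈e
  }
  where
  edge′ : Fin (suc (∣E∣ H)) → Subset (∣V∣ H +ℕ r)
  edge′ fzero    = ⁅ v ⁆ ++ full
  edge′ (fsuc e) = edge H e ++ empty

  inj : ∀ e f → edge′ e ≡ edge′ f → e ≡ f
  inj fzero    fzero    _  = refl
  inj fzero    (fsuc f) eq = contradiction (++-injectiveʳ ⁅ v ⁆ (edge H f) eq) (full≢empty r)
  inj (fsuc e) fzero    eq = contradiction (++-injectiveʳ ⁅ v ⁆ (edge H e) (sym eq)) (full≢empty r)
  inj (fsuc e) (fsuc f) eq = cong fsuc (distinct H (++-injectiveˡ (edge H e) (edge H f) eq))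

does⇒ : ∀ {P : Set} (P? : Dec P) → does P? ≡ true → P
does⇒ (yes p) _ = p

module _ (r d : ℕ) where

  -- With r = m − 1: on the vertices 0,…,dr, put v_{i+1} at ir and let e_{i+1} be the
  -- interval [ir, (i+1)r].
  onEdge? : ∀ (i : Fin d) (v : Fin (suc (d *ℕ r))) →
    Dec (toℕ i *ℕ r ≤ toℕ v × toℕ v ≤ suc (toℕ i) *ℕ r)
  onEdge? i v = (toℕ i *ℕ r ℕ.≤? toℕ v) ×-dec (toℕ v ℕ.≤? suc (toℕ i) *ℕ r)

  pathEdge : Fin d → Subset (suc (d *ℕ r))
  pathEdge i = tabulate λ v → does (onEdge? i v)

  pathVertex-bound : ∀ (i : Fin (suc d)) → toℕ i *ℕ r < suc (d *ℕ r)
  pathVertex-bound i = s≤s (ℕ.*-monoˡ-≤ r (Fin.toℕ≤pred[n] i))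

  pathVertex : Fin (suc d) → Fin (suc (d *ℕ r))
  pathVertex i = fromℕ< {toℕ i *ℕ r} (pathVertex-bound i)

  toℕ-pathVertex : ∀ i → toℕ (pathVertex i) ≡ toℕ i *ℕ r
  toℕ-pathVertex i = Fin.toℕ-fromℕ< (pathVertex-bound i)

  start∈ : ∀ i → pathVertex (inject₁ i) ∈ pathEdge i
  start∈ i = lookup⇒[]= v (pathEdge i) 
    (trans (lookup∘tabulate (λ w → does (onEdge? i w)) v) (dec-true (onEdge? i v) (lower , upper)))
    where
    v = pathVertex (inject₁ i)
    eq : toℕ v ≡ toℕ i *ℕ r
    eq = trans (toℕ-pathVertex (inject₁ i)) (cong (_*ℕ r) (Fin.toℕ-inject₁ i))
    lower : toℕ i *ℕ r ≤ toℕ v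
    lower = ℕ.≤-reflexive (sym eq)
    upper : toℕ v ≤ suc (toℕ i) *ℕ r
    upper = ℕ.≤-trans (ℕ.≤-reflexive eq) (ℕ.m≤n+m (toℕ i *ℕ r) r)

  start∈⇒≤ : .{{_ : NonZero r}} → ∀ i j → pathVertex (inject₁ i) ∈ pathEdge j → toℕ j ≤ toℕ i
  start∈⇒≤ i j v∈ = ℕ.*-cancelʳ-≤ (toℕ j) (toℕ i) r
    (subst (toℕ j *ℕ r ≤_) (trans (toℕ-pathVertex (inject₁ i)) (cong (_*ℕ r) (Fin.toℕ-inject₁ i)))
      (proj₁ (does⇒ (onEdge? j v)
        (trans (sym (lookup∘tabulate (λ w → does (onEdge? j w)) v)) ([]=⇒lookup v∈)))))
    where v = pathVertex (inject₁ i)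

  pathEdge-inj : .{{_ : NonZero r}} → Injective _≡_ _≡_ pathEdge
  pathEdge-inj {i} {j} eq = Fin.toℕ-injective (ℕ.≤-antisym
    (start∈⇒≤ j i (subst (pathVertex (inject₁ j) ∈_) (sym eq) (start∈ j)))
    (start∈⇒≤ i j (subst (pathVertex (inject₁ i) ∈_) eq (start∈ i))))

  loosePath : .{{NonZero r}} → Hypergraph
  loosePath = record
    { ∣V∣      = suc (d *ℕ r)
    ; ∣E∣      = d
    ; edge     = pathEdge
    ; distinct = pathEdge-inj
    ; nonempty = λ i → pathVertex (inject₁ i) , start∈ i
    }

-- A hypergraph with distinguished vertices v₁,…,v_{d+1}.
Marked : ℕ → Set
Marked d = ∃ λ H → Fin (suc d) → Vertex H

attachAt : ∀ r → .{{NonZero r}} → ∀ {d} → Fin (suc d) → Marked d → Marked d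
attachAt r i (H , v) = attachPendant r H (v i) , λ j → v j ↑ˡ r

-- The position of v_{j+2} among v₁,…,v_{d+1}.
inner : ∀ {d} → Fin (d ∸ 1) → Fin (suc d)
inner {suc d} j = fsuc (inject₁ j)

-- T_d(c₂,…,c_d), where c j is the coefficient c_{j+2}.
T⟨_⟩ : ∀ d → (Fin (d ∸ 1) → ℕ) → ∀ {m} → 2 ≤ m → Hypergraph
T⟨ d ⟩ c {m} 2≤m = proj₁ (foldr attachAll (loosePath r d , pathVertex r d) (allFin (d ∸ 1)))
  where
  r = m ∸ 1
  instance
    r≢0 : NonZero r
    r≢0 = >-nonZero (ℕ.m<n⇒0<n∸m 2≤m)
  attachAll : Fin (d ∸ 1) → Marked d → Marked d
  attachAll j M = iterate (attachAt r (inner j)) M (c j)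

-- The coefficients with c_i = a and all others 0.
only : ∀ {n} → ℕ → ℕ → Fin n → ℕ
only i a j = if does (toℕ j +ℕ 2 ℕ.≟ i) then a else 0

{-# OPTIONS --safe #-}

-- Let x be a Perron vector of T and root T at a vertex u where x is largest among the
-- non-pendant vertices.  Every edge then has a parent vertex and r = m − 1 further vertices, so
-- that r xᵀAx is a sum over the edges of terms that increase with the entry at the parent.  A
-- path of length d splits into two chains that descend from its highest place.  Attaching both
-- chains and all remaining edges at u does not decrease the form, and if the chains do not have
-- lengths p and p + 1, comparing them level by level shows where their tails can be exchanged to
-- balance the lengths, again without decreasing the form.  What results is a vector of the same
-- norm on T_d(c_{p+1} = k − d).
--
-- The form of T_d(c_{p+1} = k − d) is bounded branch by branch, by a weighted Cauchy–Schwarz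
-- inequality on each edge; the weights come from an explicit eigenvector, whose eigenvalue is a
-- root of a polynomial.  Its positivity needs an eigenvalue of rA that is at least r + 2, and
-- (k − d − 1)(m − 1) ≥ 6 says that the star at the centre already provides one.
--
-- Equality leads back to T_d(c_{p+1} = k − d) itself, because raising x slightly at u or along
-- the shorter chain turns every change above into a gain of first order.  All of this may be
-- argued by contradiction: ≤ on the Cauchy reals is stable under double negation, and
-- isomorphism of finite hypergraphs is decidable.

module Submission where

-- Two facts about the spectral radii enter: on T, a nonzero y ≥ 0 with rλ₁ y ≤ rA y entrywise; on
-- the broom, rλ₁* ≥ s - 1 for a root s of `broomPoly`. For the second, an eigenvector for s - 1 is
-- written down with all denominators cleared. The weights of the matching upper bound do require
-- inverses and signs, which are decidable over ℚ but not over ℝ. The bound is therefore proved at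
-- rationals close to s where the polynomial is nonnegative, and passes to s in the limit.
--
-- The threshold r + 2 keeps the contributions κ of the branches under control: with a = s - n, the
-- estimate κ ≤ 2s/a reproduces itself along a path once a ≥ 4. At a = 4 a pendant edge has κ = s/3
-- and no branch has less. Putting this in for both arms leaves a positive multiple of 6 - (k - d -
-- 1)(m - 1), whence the constant 6.
--
-- The equality case asks for a gain of first order, so the exchange of tails is stated with an
-- increment t from the start; the inequality is its case t = 0.

module OrderedAlgebras where

  -- Ordered algebras over the rationals with a stable order

  open import Algebra.Bundles using (CommutativeRing; RawRing)
  import Algebra.Solver.Ring
  open import Algebra.Solver.Ring.AlmostCommutativeRing using (AlmostCommutativeRing; fromCommutativeRing; _-Raw-AlmostCommutative⟶_)
  open import Data.Empty using (⊥)
  open import Data.Maybe using (Maybe; just; nothing)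
  open import Data.Product using (∃; _×_; _,_)
  import Data.Rational as ℚ
  open import Data.Rational using (ℚ; 0ℚ; 1ℚ)
  import Data.Rational.Properties as ℚ
  open import Level using (0ℓ)
  open import Relation.Binary.PropositionalEquality as ≡ using (_≡_)
  open import Relation.Nullary using (¬_; yes; no)

  -- What the comparison uses of ℝ. The order is not decidable; `≤-stable` and `≰⇒¬¬>` are the
  -- substitute that permits arguments by contradiction, and `bounded` lets estimates be carried out
  -- with rational constants.
  record OrderedAlgebra : Set₁ where
    field
      commutativeRing : CommutativeRing 0ℓ 0ℓ

    open CommutativeRing commutativeRing public

    infix 4 _≤_ _<_

    field
      _≤_         : Carrier → Carrier → Set
      ≤-reflexive : ∀ {x y} → x ≈ y → x ≤ y
      ≤-trans     : ∀ {x y z} → x ≤ y → y ≤ z → x ≤ z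
      ≤-antisym   : ∀ {x y} → x ≤ y → y ≤ x → x ≈ y
      +-mono-≤    : ∀ {x y u v} → x ≤ y → u ≤ v → x + u ≤ y + v
      *-nonNeg    : ∀ {x y} → 0# ≤ x → 0# ≤ y → 0# ≤ x * y
      ι           : ℚ → Carrier
      ι-+         : ∀ p q → ι (p ℚ.+ q) ≈ ι p + ι q
      ι-*         : ∀ p q → ι (p ℚ.* q) ≈ ι p * ι q
      ι-neg       : ∀ p → ι (ℚ.- p) ≈ - ι p
      ι-0         : ι 0ℚ ≈ 0#
      ι-1         : ι 1ℚ ≈ 1#
      ι-mono      : ∀ {p q} → p ℚ.≤ q → ι p ≤ ι q
      ι-reflects  : ∀ {p q} → ι p ≤ ι q → p ℚ.≤ q
      bounded     : ∀ x → ∃ λ B → x ≤ ι B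
      ≤-stable    : ∀ {x y} → ¬ ¬ (x ≤ y) → x ≤ y
      abs         : Carrier → Carrier
      0≤abs       : ∀ x → 0# ≤ abs x
      x≤abs       : ∀ x → x ≤ abs x
      -x≤abs      : ∀ x → - x ≤ abs x
      abs²        : ∀ x → abs x * abs x ≈ x * x

    -- The rational gap makes strictness quantitative: two gaps can be multiplied, and half of one
    -- can be spent in an estimate.
    _<_ : Carrier → Carrier → Set
    x < y = ∃ λ δ → 0ℚ ℚ.< δ × x + ι δ ≤ y

    field
      ≰⇒¬¬> : ∀ {x y} → ¬ (x ≤ y) → ¬ ¬ (y < x)

  module OrderedAlgebraProperties (𝓡 : OrderedAlgebra) where
    open OrderedAlgebra 𝓡

    module ι-Solver where
      private
        almostCommutativeRing : AlmostCommutativeRing 0ℓ 0ℓ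
        almostCommutativeRing = fromCommutativeRing commutativeRing

        coefficients : RawRing 0ℓ 0ℓ
        coefficients = CommutativeRing.rawRing ℚ.+-*-commutativeRing

        morphism : coefficients -Raw-AlmostCommutative⟶ almostCommutativeRing
        morphism = record
          { ⟦_⟧ = ι ; +-homo = ι-+ ; *-homo = ι-* ; -‿homo = ι-neg ; 0-homo = ι-0 ; 1-homo = ι-1 }

        ι-≟ : ∀ p q → Maybe (ι p ≈ ι q)
        ι-≟ p q with p ℚ.≟ q
        ... | yes ≡.refl = just refl
        ... | no _       = nothing

      open Algebra.Solver.Ring coefficients almostCommutativeRing morphism ι-≟ public

    open ι-Solver using (solve; _:=_; _:+_; _:*_; _:-_; :-_; con)

    ≤-refl : ∀ {x} → x ≤ x
    ≤-refl = ≤-reflexive refl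

    ≤-respˡ : ∀ {x y z} → x ≈ y → x ≤ z → y ≤ z
    ≤-respˡ x≈y x≤z = ≤-trans (≤-reflexive (sym x≈y)) x≤z

    ≤-respʳ : ∀ {x y z} → y ≈ z → x ≤ y → x ≤ z
    ≤-respʳ y≈z x≤y = ≤-trans x≤y (≤-reflexive y≈z)

    ≤-by : ∀ {x y} d → 0# ≤ d → y ≈ x + d → x ≤ y
    ≤-by {x} d 0≤d y≈x+d = ≤-respʳ (sym y≈x+d) (≤-respˡ (+-identityʳ x) (+-mono-≤ ≤-refl 0≤d))

    0≤-diff : ∀ {x y} → x ≤ y → 0# ≤ y - x
    0≤-diff {x} {y} x≤y = ≤-respˡ (-‿inverseʳ x) (+-mono-≤ x≤y (≤-refl {x = - x}))

    +-nonNeg : ∀ {x y} → 0# ≤ x → 0# ≤ y → 0# ≤ x + y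
    +-nonNeg 0≤x 0≤y = ≤-respˡ (+-identityˡ 0#) (+-mono-≤ 0≤x 0≤y)

    *-monoˡ-≤ : ∀ {x y z} → 0# ≤ z → x ≤ y → z * x ≤ z * y
    *-monoˡ-≤ {x} {y} {z} 0≤z x≤y =
      ≤-by (z * (y - x)) (*-nonNeg 0≤z (0≤-diff x≤y)) (solve 3 (λ x y z → z :* y := z :* x :+ z :* (y :- x)) refl x y z)

    *-monoʳ-≤ : ∀ {x y z} → 0# ≤ z → x ≤ y → x * z ≤ y * z
    *-monoʳ-≤ {x} {y} {z} 0≤z x≤y =
      ≤-respˡ (*-comm z x) (≤-respʳ (*-comm z y) (*-monoˡ-≤ 0≤z x≤y))

    0≤ι : ∀ {q} → 0ℚ ℚ.≤ q → 0# ≤ ι q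
    0≤ι 0≤q = ≤-respˡ ι-0 (ι-mono 0≤q)

    ι0<⇒⊥ : ∀ {δ} → 0ℚ ℚ.< δ → ι δ ≤ 0# → ⊥
    ι0<⇒⊥ 0<δ h = ℚ.<-irrefl ≡.refl (ℚ.<-≤-trans 0<δ (ι-reflects (≤-respʳ (sym ι-0) h)))

    <⇒≤ : ∀ {x y} → x < y → x ≤ y
    <⇒≤ (δ , 0<δ , h) = ≤-trans (≤-by (ι δ) (0≤ι (ℚ.<⇒≤ 0<δ)) refl) h

    <⇒≱ : ∀ {x y} → x < y → y ≤ x → ⊥
    <⇒≱ {x} {y} (δ , 0<δ , h) y≤x = ι0<⇒⊥ 0<δ
      (≤-respˡ (solve 2 (λ x d → (x :+ d) :- x := d) refl x (ι δ))
      (≤-respʳ (-‿inverseʳ x) (+-mono-≤ (≤-trans h y≤x) (≤-refl {x = - x}))))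

    <-≤-trans : ∀ {x y z} → x < y → y ≤ z → x < z
    <-≤-trans (δ , 0<δ , h) y≤z = δ , 0<δ , ≤-trans h y≤z

    -- A case distinction in continuation form: while the goal is ⊥, an undecidable comparison may
    -- be treated as if it were decided.
    ≤-or-> : ∀ x y → (x ≤ y → ⊥) → (y < x → ⊥) → ⊥
    ≤-or-> x y f g = ≰⇒¬¬> f g

    ≤-or-≥ : ∀ x y → (x ≤ y → ⊥) → (y ≤ x → ⊥) → ⊥
    ≤-or-≥ x y f g = ≤-or-> x y f (λ y<x → g (<⇒≤ y<x))

    square-nonNeg : ∀ x → 0# ≤ x * x
    square-nonNeg x = ≤-stable λ k → ≤-or-≥ 0# x
      (λ 0≤x → k (*-nonNeg 0≤x 0≤x))
      (λ x≤0 → let 0≤-x = 0≤-diff x≤0 in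
        k (≤-respʳ (solve 1 (λ x → (con 0ℚ :- x) :* (con 0ℚ :- x) := x :* x) refl x)
            (*-nonNeg (≤-respʳ (+-congʳ (sym ι-0)) 0≤-x) (≤-respʳ (+-congʳ (sym ι-0)) 0≤-x))))

open OrderedAlgebras

-- The Cauchy reals as an ordered algebra

module Reals where
  open import Algebra.Bundles using (CommutativeRing)
  open import Data.Empty using (⊥; ⊥-elim)
  open import Data.Nat using (ℕ; _⊔_)
  import Data.Nat.Properties as ℕ
  open import Data.Product using (∃; _×_; _,_)
  import Data.Rational as ℚ
  open import Data.Rational using (ℚ; 0ℚ; 1ℚ; ½)
  import Data.Rational.Properties as ℚ
  open import Data.Rational.Solver using (module +-*-Solver)
  open import Data.Sum using (_⊎_; inj₁; inj₂)
  open import Defs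
  open import Level using (0ℓ)
  open import Relation.Binary.PropositionalEquality as ≡ using (_≡_; refl; sym; trans; cong; subst)
  open import Relation.Binary.Structures using (IsEquivalence)
  open import Relation.Nullary using (¬_; yes; no)

  module ℚLemmas where
    open +-*-Solver

    ≤-by : ∀ {x y} d → 0ℚ ℚ.≤ d → y ≡ x ℚ.+ d → x ℚ.≤ y
    ≤-by {x} d 0≤d refl = subst (ℚ._≤ x ℚ.+ d) (ℚ.+-identityʳ x) (ℚ.+-monoʳ-≤ x 0≤d)

    0≤-diff : ∀ {x y} → x ℚ.≤ y → 0ℚ ℚ.≤ y ℚ.- x
    0≤-diff {x} {y} x≤y = subst (ℚ._≤ y ℚ.- x) (ℚ.+-inverseʳ x) (ℚ.+-monoˡ-≤ (ℚ.- x) x≤y)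

    +-nonNeg : ∀ {x y} → 0ℚ ℚ.≤ x → 0ℚ ℚ.≤ y → 0ℚ ℚ.≤ x ℚ.+ y
    +-nonNeg 0≤x 0≤y = ℚ.+-mono-≤ 0≤x 0≤y

    *-nonNeg : ∀ {x y} → 0ℚ ℚ.≤ x → 0ℚ ℚ.≤ y → 0ℚ ℚ.≤ x ℚ.* y
    *-nonNeg {x} {y} 0≤x 0≤y = subst (ℚ._≤ x ℚ.* y) (ℚ.*-zeroʳ x)
      (ℚ.*-monoˡ-≤-nonNeg x {{ℚ.nonNegative 0≤x}} 0≤y)

    *-pos : ∀ {x y} → 0ℚ ℚ.< x → 0ℚ ℚ.< y → 0ℚ ℚ.< x ℚ.* y
    *-pos {x} {y} 0<x 0<y = subst (ℚ._< x ℚ.* y) (ℚ.*-zeroʳ x)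
      (ℚ.*-monoʳ-<-pos x {{ℚ.positive 0<x}} 0<y)

    ≰half : ∀ {δ} → 0ℚ ℚ.< δ → ¬ (δ ℚ.≤ δ ℚ.* ½)
    ≰half {δ} 0<δ δ≤½ = ℚ.<-irrefl refl (ℚ.<-≤-trans (half-pos 0<δ)
      (≤-by (h ℚ.- (h ℚ.+ h)) (0≤-diff (subst (ℚ._≤ h) (sym (half+half δ)) δ≤½)) (solve 1 (λ h → con 0ℚ := h :+ (h :- (h :+ h))) refl h)))
      where h = δ ℚ.* ½

    p≤∣p∣ : ∀ p → p ℚ.≤ ℚ.∣ p ∣
    p≤∣p∣ p with ℚ.≤-total 0ℚ p
    ... | inj₁ 0≤p = ℚ.≤-reflexive (sym (ℚ.0≤p⇒∣p∣≡p 0≤p))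
    ... | inj₂ p≤0 = ℚ.≤-trans p≤0 (ℚ.0≤∣p∣ p)

    ∣-∣≤⇒≤ : ∀ {a b δ} → ℚ.∣ a ℚ.- b ∣ ℚ.≤ δ → a ℚ.≤ b ℚ.+ δ
    ∣-∣≤⇒≤ {a} {b} {δ} h = ≤-by (δ ℚ.- (a ℚ.- b)) (0≤-diff (ℚ.≤-trans (p≤∣p∣ (a ℚ.- b)) h))
      (solve 3 (λ a b δ → b :+ δ := a :+ (δ :- (a :- b))) refl a b δ)

    ∣-∣-swap : ∀ a b → ℚ.∣ a ℚ.- b ∣ ≡ ℚ.∣ b ℚ.- a ∣
    ∣-∣-swap a b = trans (cong ℚ.∣_∣ (solve 2 (λ a b → a :- b := :- (b :- a)) refl a b)) (ℚ.∣-p∣≡∣p∣ (b ℚ.- a))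

    ∣-∣≤⇒≥ : ∀ {a b δ} → ℚ.∣ a ℚ.- b ∣ ℚ.≤ δ → b ℚ.≤ a ℚ.+ δ
    ∣-∣≤⇒≥ {a} {b} h = ∣-∣≤⇒≤ (subst (ℚ._≤ _) (∣-∣-swap a b) h)

    ∣∣≤ : ∀ {x δ} → x ℚ.≤ δ → ℚ.- x ℚ.≤ δ → ℚ.∣ x ∣ ℚ.≤ δ
    ∣∣≤ {x} x≤δ -x≤δ with ℚ.∣p∣≡p∨∣p∣≡-p x
    ... | inj₁ eq = subst (ℚ._≤ _) (sym eq) x≤δ
    ... | inj₂ eq = subst (ℚ._≤ _) (sym eq) -x≤δ

    ≤⇒∣-∣≤ : ∀ {a b δ} → a ℚ.≤ b ℚ.+ δ → b ℚ.≤ a ℚ.+ δ → ℚ.∣ a ℚ.- b ∣ ℚ.≤ δ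
    ≤⇒∣-∣≤ {a} {b} {δ} a≤ b≤ = ∣∣≤
      (≤-by ((b ℚ.+ δ) ℚ.- a) (0≤-diff a≤) (solve 3 (λ a b δ → δ := (a :- b) :+ ((b :+ δ) :- a)) refl a b δ))
      (≤-by ((a ℚ.+ δ) ℚ.- b) (0≤-diff b≤) (solve 3 (λ a b δ → δ := :- (a :- b) :+ ((a :+ δ) :- b)) refl a b δ))

  open ℚLemmas public using (p≤∣p∣; ∣-∣≤⇒≤; ∣-∣≤⇒≥; ≤⇒∣-∣≤)

  both : ∀ {P Q : ℕ → Set} → Eventually P → Eventually Q → Eventually (λ n → P n × Q n)
  both (M , f) (N , g) = M ⊔ N , λ n h → f n (ℕ.m⊔n≤o⇒m≤o M N h) , g n (ℕ.m⊔n≤o⇒n≤o M N h)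

  always : ∀ {P : ℕ → Set} → (∀ n → P n) → Eventually P
  always f = 0 , λ n _ → f n

  eventually-map : ∀ {P Q : ℕ → Set} → (∀ n → P n → Q n) → Eventually P → Eventually Q
  eventually-map f (N , g) = N , λ n h → f n (g n h)

  module RealProperties where
    open +-*-Solver

    pointwise : ∀ {x y} → (∀ n → seq x n ≡ seq y n) → x ≈ y
    pointwise {x} {y} eq ε 0<ε = always λ n → subst (λ a → ℚ.∣ seq x n ℚ.- a ∣ ℚ.≤ ε) (eq n)
      (subst (ℚ._≤ ε) (cong ℚ.∣_∣ (sym (ℚ.+-inverseʳ (seq x n)))) (ℚ.<⇒≤ 0<ε))

    pointwise-≤ : ∀ {x y} → Eventually (λ n → seq x n ℚ.≤ seq y n) → x ≤ᴿ y
    pointwise-≤ ev ε 0<ε = eventually-map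
      (λ n h → ℚ.≤-trans h (ℚLemmas.≤-by ε (ℚ.<⇒≤ 0<ε) refl)) ev

    ≤-reflexive : ∀ {x y} → x ≈ y → x ≤ᴿ y
    ≤-reflexive x≈y ε 0<ε = eventually-map (λ n → ∣-∣≤⇒≤) (x≈y ε 0<ε)

    ≤-antisym : ∀ {x y} → x ≤ᴿ y → y ≤ᴿ x → x ≈ y
    ≤-antisym x≤y y≤x ε 0<ε = eventually-map (λ n (a , b) → ≤⇒∣-∣≤ a b) (both (x≤y ε 0<ε) (y≤x ε 0<ε))

    ≈-sym : ∀ {x y} → x ≈ y → y ≈ x
    ≈-sym {x} {y} x≈y ε 0<ε = eventually-map
      (λ n → subst (ℚ._≤ ε) (ℚLemmas.∣-∣-swap (seq x n) (seq y n))) (x≈y ε 0<ε)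

    +-split : ∀ {a b c d ε} → a ℚ.≤ b ℚ.+ ε ℚ.* ½ → c ℚ.≤ d ℚ.+ ε ℚ.* ½ → a ℚ.+ c ℚ.≤ (b ℚ.+ d) ℚ.+ ε
    +-split {a} {b} {c} {d} {ε} h k = subst (a ℚ.+ c ℚ.≤_)
      (trans (solve 3 (λ b d e → (b :+ e) :+ (d :+ e) := (b :+ d) :+ (e :+ e)) refl b d (ε ℚ.* ½))
             (cong ((b ℚ.+ d) ℚ.+_) (half+half ε)))
      (ℚ.+-mono-≤ h k)

    +-mono-≤ : ∀ {x y u v} → x ≤ᴿ y → u ≤ᴿ v → (x +ᴿ u) ≤ᴿ (y +ᴿ v)
    +-mono-≤ {x} {y} {u} {v} x≤y u≤v ε 0<ε = eventually-map (λ n (a , b) → +-split {seq x n} {seq y n} {seq u n} {seq v n} a b)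
      (both (x≤y (ε ℚ.* ½) (half-pos 0<ε)) (u≤v (ε ℚ.* ½) (half-pos 0<ε)))

    ≤-trans : ∀ {x y z} → x ≤ᴿ y → y ≤ᴿ z → x ≤ᴿ z
    ≤-trans {x} {y} {z} x≤y y≤z ε 0<ε = eventually-map
      (λ n (a , b) → ℚ.≤-trans a (subst (seq y n ℚ.+ ε ℚ.* ½ ℚ.≤_)
        (trans (ℚ.+-assoc (seq z n) (ε ℚ.* ½) (ε ℚ.* ½)) (cong (seq z n ℚ.+_) (half+half ε)))
        (ℚ.+-monoˡ-≤ (ε ℚ.* ½) b)))
      (both (x≤y (ε ℚ.* ½) (half-pos 0<ε)) (y≤z (ε ℚ.* ½) (half-pos 0<ε)))

    ≈-refl : ∀ {x} → x ≈ x
    ≈-refl {x} = pointwise {x} {x} (λ _ → refl)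

    ≈-trans : ∀ {x y z} → x ≈ y → y ≈ z → x ≈ z
    ≈-trans {x} {y} {z} x≈y y≈z = ≤-antisym {x} {z}
      (≤-trans {x} {y} {z} (≤-reflexive {x} {y} x≈y) (≤-reflexive {y} {z} y≈z))
      (≤-trans {z} {y} {x} (≤-reflexive {z} {y} (≈-sym {y} {z} y≈z)) (≤-reflexive {y} {x} (≈-sym {x} {y} x≈y)))

    +-cong : ∀ {x y u v} → x ≈ y → u ≈ v → (x +ᴿ u) ≈ (y +ᴿ v)
    +-cong {x} {y} {u} {v} x≈y u≈v = ≤-antisym {x +ᴿ u} {y +ᴿ v}
      (+-mono-≤ {x} {y} {u} {v} (≤-reflexive {x} {y} x≈y) (≤-reflexive {u} {v} u≈v))
      (+-mono-≤ {y} {x} {v} {u} (≤-reflexive {y} {x} (≈-sym {x} {y} x≈y)) (≤-reflexive {v} {u} (≈-sym {u} {v} u≈v)))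

    neg-cong : ∀ {x y} → x ≈ y → (-ᴿ x) ≈ (-ᴿ y)
    neg-cong {x} {y} x≈y ε 0<ε = eventually-map
      (λ n → subst (ℚ._≤ ε) (trans (sym (ℚ.∣-p∣≡∣p∣ (seq x n ℚ.- seq y n)))
        (cong ℚ.∣_∣ (solve 2 (λ a b → :- (a :- b) := :- a :- (:- b)) refl (seq x n) (seq y n)))))
      (x≈y ε 0<ε)

    *-cong : ∀ {x y u v} → x ≈ y → u ≈ v → (x *ᴿ u) ≈ (y *ᴿ v)
    *-cong {x} {y} {u} {v} x≈y u≈v ε 0<ε =
      let A , A>0 , xA     = Defs.bounded (cauchy x)
          B , B>0 , vB     = Defs.bounded (cauchy v)
          α , 0<α , Aα     = shrink A A>0 (half-pos 0<ε)
          β , 0<β , Bβ     = shrink B B>0 (half-pos 0<ε)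
      in eventually-map
           (λ n ((ha , hd) , (hbd , hac)) → *-close {seq x n} {seq u n} {seq y n} {seq v n} A>0 B>0 Aα Bβ ha hd hbd hac)
           (both (both xA vB) (both (u≈v α 0<α) (x≈y β 0<β)))

    -- The terms of a nonnegative real may be slightly negative. A factor that is ≤ 0 at some late
    -- index is small there while the other one is bounded, so the product stays above -ε.
    *-nonNeg : ∀ {x y} → 0ᴿ ≤ᴿ x → 0ᴿ ≤ᴿ y → 0ᴿ ≤ᴿ (x *ᴿ y)
    *-nonNeg {x} {y} 0≤x 0≤y ε 0<ε =
      let A , A>0 , xA = Defs.bounded (cauchy x)
          B , B>0 , yB = Defs.bounded (cauchy y)
          α , 0<α , Aα = shrink A A>0 0<ε
          β , 0<β , Bβ = shrink B B>0 0<ε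
      in eventually-map (λ n ((ha , hb) , (la , lb)) → core A>0 B>0 Aα Bβ (seq x n) (seq y n) ha hb la lb)
           (both (both xA yB) (both (0≤x β 0<β) (0≤y α 0<α)))
      where
      small : ∀ {a δ} → 0ℚ ℚ.≤ a ℚ.+ δ → a ℚ.≤ 0ℚ → ℚ.∣ a ∣ ℚ.≤ δ
      small {a} {δ} l a≤0 = ℚLemmas.∣∣≤
        (ℚ.≤-trans (ℚ.≤-trans a≤0 (ℚ.neg-antimono-≤ a≤0)) -a≤δ) -a≤δ
        where
        -a≤δ : ℚ.- a ℚ.≤ δ
        -a≤δ = ℚLemmas.≤-by (a ℚ.+ δ) l (solve 2 (λ a d → d := :- a :+ (a :+ d)) refl a δ)
      lower : ∀ {a ε} → ℚ.∣ a ∣ ℚ.≤ ε → 0ℚ ℚ.≤ a ℚ.+ ε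
      lower {a} {ε} h = ℚLemmas.≤-by (ε ℚ.- ℚ.- a)
        (ℚLemmas.0≤-diff (ℚ.≤-trans (p≤∣p∣ (ℚ.- a)) (subst (ℚ._≤ ε) (sym (ℚ.∣-p∣≡∣p∣ a)) h)))
        (solve 2 (λ a e → a :+ e := con 0ℚ :+ (e :- (:- a))) refl a ε)
      core : ∀ {A B α β} → ℚ.Positive A → ℚ.Positive B → A ℚ.* α ≡ ε → B ℚ.* β ≡ ε → ∀ a b →
        ℚ.∣ a ∣ ℚ.≤ A → ℚ.∣ b ∣ ℚ.≤ B → 0ℚ ℚ.≤ a ℚ.+ β → 0ℚ ℚ.≤ b ℚ.+ α → 0ℚ ℚ.≤ a ℚ.* b ℚ.+ ε
      core {A} {B} {α} {β} A>0 B>0 Aα Bβ a b ha hb la lb with ℚ.≤-total 0ℚ a | ℚ.≤-total 0ℚ b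
      ... | inj₁ 0≤a | inj₁ 0≤b = ℚLemmas.+-nonNeg (ℚLemmas.*-nonNeg 0≤a 0≤b) (ℚ.<⇒≤ 0<ε)
      ... | _        | inj₂ b≤0 = lower (subst (ℚ.∣ a ℚ.* b ∣ ℚ.≤_) Aα (*-bound {a} {b} {{ℚ.pos⇒nonNeg A {{A>0}}}} ha (small lb b≤0)))
      ... | inj₂ a≤0 | _        = lower (subst (ℚ._≤ ε) (cong ℚ.∣_∣ (ℚ.*-comm b a))
                                    (subst (ℚ.∣ b ℚ.* a ∣ ℚ.≤_) Bβ (*-bound {b} {a} {{ℚ.pos⇒nonNeg B {{B>0}}}} hb (small la a≤0))))

    infix 4 _<ᴿ_
    _<ᴿ_ : ℝ → ℝ → Set
    x <ᴿ y = ∃ λ δ → 0ℚ ℚ.< δ × (x +ᴿ fromℚ δ) ≤ᴿ y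

    -- The tolerance ε turns the comparison into a decision about two rationals: one late term of
    -- each sequence is compared with threshold ε/2. Later terms move by at most δ = ε/8, a quarter
    -- of the threshold, which leaves room in either case.
    locate : ∀ x y ε → 0ℚ ℚ.< ε → Eventually (λ n → seq x n ℚ.≤ seq y n ℚ.+ ε) ⊎ (y <ᴿ x)
    locate x y ε 0<ε with cauchy x δ 0<δ | cauchy y δ 0<δ
      where
      δ = ε ℚ.* ½ ℚ.* ½ ℚ.* ½
      0<δ = half-pos (half-pos (half-pos 0<ε))
    ... | M , f | N , g = decide
      where
      δ = ε ℚ.* ½ ℚ.* ½ ℚ.* ½
      0<δ = half-pos (half-pos (half-pos 0<ε))
      K = M ⊔ N
      M≤K = ℕ.m≤m⊔n M N
      N≤K = ℕ.m≤n⊔m M N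
      a = seq x K
      b = seq y K
      eq4 : ε ℚ.* ½ ≡ (δ ℚ.+ δ) ℚ.+ (δ ℚ.+ δ)
      eq4 = solve 1 (λ e → e :* con ½ := ((e :* con ½ :* con ½ :* con ½) :+ (e :* con ½ :* con ½ :* con ½)) :+ ((e :* con ½ :* con ½ :* con ½) :+ (e :* con ½ :* con ½ :* con ½))) refl ε
      eq8 : ε ≡ ε ℚ.* ½ ℚ.+ ((δ ℚ.+ δ) ℚ.+ (δ ℚ.+ δ))
      eq8 = trans (sym (half+half ε)) (cong (ε ℚ.* ½ ℚ.+_) eq4)
      0≤δ = ℚ.<⇒≤ 0<δ
      decide : Eventually (λ n → seq x n ℚ.≤ seq y n ℚ.+ ε) ⊎ (y <ᴿ x)
      decide with a ℚ.≤? b ℚ.+ ε ℚ.* ½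
      ... | yes a≤b = inj₁ (K , λ n h → near {seq x n} {seq y n} (∣-∣≤⇒≤ {seq x n} {a} (f n K (ℕ.≤-trans M≤K h) M≤K)) (∣-∣≤⇒≥ {seq y n} {b} (g n K (ℕ.≤-trans N≤K h) N≤K)))
        where
        near : ∀ {u v} → u ℚ.≤ a ℚ.+ δ → b ℚ.≤ v ℚ.+ δ → u ℚ.≤ v ℚ.+ ε
        near {u} {v} u≤ b≤ = ℚLemmas.≤-by
          (((((a ℚ.+ δ) ℚ.- u) ℚ.+ ((v ℚ.+ δ) ℚ.- b)) ℚ.+ ((b ℚ.+ ε ℚ.* ½) ℚ.- a)) ℚ.+ (δ ℚ.+ δ))
          (ℚLemmas.+-nonNeg (ℚLemmas.+-nonNeg (ℚLemmas.+-nonNeg (ℚLemmas.0≤-diff u≤) (ℚLemmas.0≤-diff b≤)) (ℚLemmas.0≤-diff a≤b)) (ℚLemmas.+-nonNeg 0≤δ 0≤δ))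
          (trans (cong (v ℚ.+_) eq8)
            (solve 6 (λ u v a b d h → v :+ (h :+ ((d :+ d) :+ (d :+ d))) :=
               u :+ (((((a :+ d) :- u) :+ ((v :+ d) :- b)) :+ ((b :+ h) :- a)) :+ (d :+ d))) refl u v a b δ (ε ℚ.* ½)))
      ... | no a≰b = inj₂ (δ , 0<δ , pointwise-≤ {y +ᴿ fromℚ δ} {x}
                       (K , λ n h → apart {seq x n} {seq y n} (∣-∣≤⇒≥ {seq x n} {a} (f n K (ℕ.≤-trans M≤K h) M≤K)) (∣-∣≤⇒≤ {seq y n} {b} (g n K (ℕ.≤-trans N≤K h) N≤K))))
        where
        apart : ∀ {u v} → a ℚ.≤ u ℚ.+ δ → v ℚ.≤ b ℚ.+ δ → v ℚ.+ δ ℚ.≤ u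
        apart {u} {v} a≤ v≤ = ℚLemmas.≤-by
          (((((u ℚ.+ δ) ℚ.- a) ℚ.+ ((b ℚ.+ δ) ℚ.- v)) ℚ.+ (a ℚ.- (b ℚ.+ ε ℚ.* ½))) ℚ.+ δ)
          (ℚLemmas.+-nonNeg (ℚLemmas.+-nonNeg (ℚLemmas.+-nonNeg (ℚLemmas.0≤-diff a≤) (ℚLemmas.0≤-diff v≤)) (ℚLemmas.0≤-diff (ℚ.<⇒≤ (ℚ.≰⇒> a≰b)))) 0≤δ)
          (trans (solve 5 (λ u v a b d → u := (v :+ d) :+ (((((u :+ d) :- a) :+ ((b :+ d) :- v)) :+ (a :- (b :+ ((d :+ d) :+ (d :+ d))))) :+ d)) refl u v a b δ)
            (cong (λ h → (v ℚ.+ δ) ℚ.+ (((((u ℚ.+ δ) ℚ.- a) ℚ.+ ((b ℚ.+ δ) ℚ.- v)) ℚ.+ (a ℚ.- (b ℚ.+ h))) ℚ.+ δ)) (sym eq4)))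

    -- The source of stability under double negation: for each ε, `locate` yields either the
    -- required estimate or the excluded gap.
    ≮⇒≥ : ∀ {x y} → ¬ (y <ᴿ x) → x ≤ᴿ y
    ≮⇒≥ {x} {y} y≮x ε 0<ε with locate x y ε 0<ε
    ... | inj₁ h   = h
    ... | inj₂ y<x = ⊥-elim (y≮x y<x)

    fromℚ-mono : ∀ {p q} → p ℚ.≤ q → fromℚ p ≤ᴿ fromℚ q
    fromℚ-mono {p} {q} p≤q = pointwise-≤ {fromℚ p} {fromℚ q} (always λ _ → p≤q)

    -- If p > q, the tolerance (p - q)/2 is violated at every index of the constant sequences.
    fromℚ-reflects : ∀ {p q} → fromℚ p ≤ᴿ fromℚ q → p ℚ.≤ q
    fromℚ-reflects {p} {q} h with p ℚ.≤? q
    ... | yes p≤q = p≤q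
    ... | no p≰q with h ((p ℚ.- q) ℚ.* ½) (half-pos 0<p-q)
      where
      0<p-q : 0ℚ ℚ.< p ℚ.- q
      0<p-q = subst (ℚ._< p ℚ.- q) (ℚ.+-inverseʳ q) (ℚ.+-monoˡ-< (ℚ.- q) (ℚ.≰⇒> p≰q))
    ... | N , g = ⊥-elim (ℚ.<-irrefl refl (ℚ.<-≤-trans (half-pos 0<p-q) bad))
      where
      0<p-q : 0ℚ ℚ.< p ℚ.- q
      0<p-q = subst (ℚ._< p ℚ.- q) (ℚ.+-inverseʳ q) (ℚ.+-monoˡ-< (ℚ.- q) (ℚ.≰⇒> p≰q))
      bad : (p ℚ.- q) ℚ.* ½ ℚ.≤ 0ℚ
      bad = ℚLemmas.≤-by ((q ℚ.+ (p ℚ.- q) ℚ.* ½) ℚ.- p) (ℚLemmas.0≤-diff (g N ℕ.≤-refl))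
        (solve 2 (λ p q → con 0ℚ := (p :- q) :* con ½ :+ ((q :+ (p :- q) :* con ½) :- p)) refl p q)

    <⇒≱ : ∀ {x y} → y <ᴿ x → x ≤ᴿ y → ⊥
    <⇒≱ {x} {y} (δ , 0<δ , h) x≤y = ℚ.<-irrefl refl (ℚ.<-≤-trans 0<δ (fromℚ-reflects {δ} {0ℚ}
      (≤-trans {fromℚ δ} {(y +ᴿ fromℚ δ) +ᴿ -ᴿ y} {0ᴿ}
        (≤-reflexive {fromℚ δ} {(y +ᴿ fromℚ δ) +ᴿ -ᴿ y}
          (pointwise {fromℚ δ} {(y +ᴿ fromℚ δ) +ᴿ -ᴿ y} λ n → solve 2 (λ y d → d := (y :+ d) :- y) refl (seq y n) δ))
        (≤-trans {(y +ᴿ fromℚ δ) +ᴿ -ᴿ y} {y +ᴿ -ᴿ y} {0ᴿ}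
          (+-mono-≤ {y +ᴿ fromℚ δ} {y} { -ᴿ y} { -ᴿ y} (≤-trans {y +ᴿ fromℚ δ} {x} {y} h x≤y) (≤-reflexive { -ᴿ y} { -ᴿ y} (≈-refl { -ᴿ y})))
          (≤-reflexive {y +ᴿ -ᴿ y} {0ᴿ} (pointwise {y +ᴿ -ᴿ y} {0ᴿ} λ n → ℚ.+-inverseʳ (seq y n)))))))

    upper : ∀ x → ∃ λ B → x ≤ᴿ fromℚ B
    upper x = let B , _ , h = Defs.bounded (cauchy x) in
      B , pointwise-≤ {x} {fromℚ B} (eventually-map (λ n k → ℚ.≤-trans (p≤∣p∣ (seq x n)) k) h)

    abs : ℝ → ℝ
    abs x = mkℝ (λ n → ℚ.∣ seq x n ∣) abs-cauchy
      where
      reverse-triangle : ∀ a b → ℚ.∣ a ∣ ℚ.≤ ℚ.∣ b ∣ ℚ.+ ℚ.∣ a ℚ.- b ∣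
      reverse-triangle a b = subst (λ c → ℚ.∣ c ∣ ℚ.≤ ℚ.∣ b ∣ ℚ.+ ℚ.∣ a ℚ.- b ∣) (solve 2 (λ a b → b :+ (a :- b) := a) refl a b)
        (ℚ.∣p+q∣≤∣p∣+∣q∣ b (a ℚ.- b))
      abstract
        abs-cauchy : IsCauchy (λ n → ℚ.∣ seq x n ∣)
        abs-cauchy ε 0<ε = let N , h = cauchy x ε 0<ε in N , λ i j hi hj → ≤⇒∣-∣≤
          (ℚ.≤-trans (reverse-triangle (seq x i) (seq x j)) (ℚ.+-monoʳ-≤ ℚ.∣ seq x j ∣ (h i j hi hj)))
          (ℚ.≤-trans (reverse-triangle (seq x j) (seq x i)) (ℚ.+-monoʳ-≤ ℚ.∣ seq x i ∣ (h j i hj hi)))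

    ∣∣² : ∀ a → ℚ.∣ a ∣ ℚ.* ℚ.∣ a ∣ ≡ a ℚ.* a
    ∣∣² a with ℚ.∣p∣≡p∨∣p∣≡-p a
    ... | inj₁ eq = ≡.cong₂ ℚ._*_ eq eq
    ... | inj₂ eq = trans (≡.cong₂ ℚ._*_ eq eq) (solve 1 (λ a → :- a :* :- a := a :* a) refl a)

    commutativeRing : CommutativeRing 0ℓ 0ℓ
    commutativeRing = record
      { Carrier = ℝ ; _≈_ = _≈_ ; _+_ = _+ᴿ_ ; _*_ = _*ᴿ_ ; -_ = -ᴿ_ ; 0# = 0ᴿ ; 1# = fromℚ 1ℚ
      ; isCommutativeRing = record
        { isRing = record
          { +-isAbelianGroup = record
            { isGroup = record
              { isMonoid = record
                { isSemigroup = record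
                  { isMagma = record
                    { isEquivalence = isEquivalence
                    ; ∙-cong = λ {x} {y} {u} {v} → +-cong {x} {y} {u} {v} }
                  ; assoc = λ x y z → pointwise {(x +ᴿ y) +ᴿ z} {x +ᴿ (y +ᴿ z)} λ n → ℚ.+-assoc (seq x n) (seq y n) (seq z n) }
                ; identity = (λ x → pointwise {0ᴿ +ᴿ x} {x} λ n → ℚ.+-identityˡ (seq x n))
                           , (λ x → pointwise {x +ᴿ 0ᴿ} {x} λ n → ℚ.+-identityʳ (seq x n)) }
              ; inverse = (λ x → pointwise {(-ᴿ x) +ᴿ x} {0ᴿ} λ n → ℚ.+-inverseˡ (seq x n))
                        , (λ x → pointwise {x +ᴿ (-ᴿ x)} {0ᴿ} λ n → ℚ.+-inverseʳ (seq x n))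
              ; ⁻¹-cong = λ {x} {y} → neg-cong {x} {y} }
            ; comm = λ x y → pointwise {x +ᴿ y} {y +ᴿ x} λ n → ℚ.+-comm (seq x n) (seq y n) }
          ; *-cong = λ {x} {y} {u} {v} → *-cong {x} {y} {u} {v}
          ; *-assoc = λ x y z → pointwise {(x *ᴿ y) *ᴿ z} {x *ᴿ (y *ᴿ z)} λ n → ℚ.*-assoc (seq x n) (seq y n) (seq z n)
          ; *-identity = (λ x → pointwise {fromℚ 1ℚ *ᴿ x} {x} λ n → ℚ.*-identityˡ (seq x n))
                       , (λ x → pointwise {x *ᴿ fromℚ 1ℚ} {x} λ n → ℚ.*-identityʳ (seq x n))
          ; distrib = (λ x y z → pointwise {x *ᴿ (y +ᴿ z)} {(x *ᴿ y) +ᴿ (x *ᴿ z)} λ n → ℚ.*-distribˡ-+ (seq x n) (seq y n) (seq z n))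
                    , (λ x y z → pointwise {(y +ᴿ z) *ᴿ x} {(y *ᴿ x) +ᴿ (z *ᴿ x)} λ n → ℚ.*-distribʳ-+ (seq x n) (seq y n) (seq z n)) }
        ; *-comm = λ x y → pointwise {x *ᴿ y} {y *ᴿ x} λ n → ℚ.*-comm (seq x n) (seq y n) } }
      where
      isEquivalence : IsEquivalence _≈_
      isEquivalence = record
        { refl  = λ {x} → ≈-refl {x}
        ; sym   = λ {x} {y} → ≈-sym {x} {y}
        ; trans = λ {x} {y} {z} → ≈-trans {x} {y} {z} }

    orderedAlgebra : OrderedAlgebra
    orderedAlgebra = record
      { commutativeRing = commutativeRing
      ; _≤_ = _≤ᴿ_
      ; ≤-reflexive = λ {x} {y} → ≤-reflexive {x} {y}
      ; ≤-trans = λ {x} {y} {z} → ≤-trans {x} {y} {z}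
      ; ≤-antisym = λ {x} {y} → ≤-antisym {x} {y}
      ; +-mono-≤ = λ {x} {y} {u} {v} → +-mono-≤ {x} {y} {u} {v}
      ; *-nonNeg = λ {x} {y} → *-nonNeg {x} {y}
      ; ι = fromℚ
      ; ι-+ = λ p q → pointwise {fromℚ (p ℚ.+ q)} {fromℚ p +ᴿ fromℚ q} λ _ → refl
      ; ι-* = λ p q → pointwise {fromℚ (p ℚ.* q)} {fromℚ p *ᴿ fromℚ q} λ _ → refl
      ; ι-neg = λ p → pointwise {fromℚ (ℚ.- p)} { -ᴿ fromℚ p} λ _ → refl
      ; ι-0 = ≈-refl {0ᴿ}
      ; ι-1 = ≈-refl {fromℚ 1ℚ}
      ; ι-mono = fromℚ-mono
      ; ι-reflects = fromℚ-reflects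
      ; bounded = upper
      ; abs = abs
      ; 0≤abs = λ x → pointwise-≤ {0ᴿ} {abs x} (always λ n → ℚ.0≤∣p∣ (seq x n))
      ; x≤abs = λ x → pointwise-≤ {x} {abs x} (always λ n → p≤∣p∣ (seq x n))
      ; -x≤abs = λ x → pointwise-≤ { -ᴿ x} {abs x} (always λ n → subst (ℚ.- seq x n ℚ.≤_) (ℚ.∣-p∣≡∣p∣ (seq x n)) (p≤∣p∣ (ℚ.- seq x n)))
      ; abs² = λ x → pointwise {abs x *ᴿ abs x} {x *ᴿ x} λ n → ∣∣² (seq x n)
      ; ≤-stable = λ {x} {y} ¬¬x≤y → ≮⇒≥ {x} {y} λ y<x → ¬¬x≤y (<⇒≱ {x} {y} y<x)
      ; ≰⇒¬¬> = λ {x} {y} x≰y y≮x → x≰y (≮⇒≥ {x} {y} y≮x)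
      }

open Reals

-- Quadratic forms on chains of edges: exchange of tails and weighted bounds

module Blocks where
  open import Data.Empty using (⊥)
  open import Data.Fin using () renaming (zero to fzero; suc to fsuc)
  open import Data.List using (List; []; _∷_; _++_; length; map)
  open import Data.List.Relation.Unary.All using (All; []; _∷_)
  import Data.Nat as ℕ
  open import Data.Nat using (ℕ; zero; suc)
  open import Data.Product using (∃; ∃₂; _×_; _,_; proj₁; proj₂)
  import Data.Rational as ℚ
  open import Data.Rational using (ℚ; 0ℚ; 1ℚ; ½)
  import Data.Rational.Properties as ℚ
  open import Data.Rational.Solver using (module +-*-Solver)
  open import Data.Sum using (_⊎_; inj₁; inj₂)
  open import Data.Vec.Functional using (Vector)
  open import Defs using (half+half; half-pos)
  open import Relation.Binary.PropositionalEquality as ≡ using (_≡_)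
  open import Relation.Nullary using (¬_)
  open import Relation.Nullary.Decidable using (toWitness)

  fromℕℚ : ℕ → ℚ
  fromℕℚ zero    = 0ℚ
  fromℕℚ (suc n) = 1ℚ ℚ.+ fromℕℚ n

  module BlockForms (𝓡 : OrderedAlgebra) (n : ℕ) where
    open OrderedAlgebra 𝓡
    open OrderedAlgebraProperties 𝓡
    open ι-Solver using (solve; _:=_; _:+_; _:*_; _:-_; :-_; con)
    open import Algebra.Properties.Semiring.Sum semiring public using (sum)

    -- The entries of a vector on an edge without its parent vertex: first the child at which the
    -- tree may continue, then the n others.
    Block : Set
    Block = Carrier × Vector Carrier n

    top rest restNorm blockSum blockNorm : Block → Carrier
    top = proj₁
    rest (_ , W) = sum W
    restNorm (_ , W) = sum λ t → W t * W t
    blockSum B = top B + rest B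
    blockNorm B = top B * top B + restNorm B

    -- The square of the sum minus the sum of the squares, that is, twice the sum of all products of
    -- two entries on the edge: its share of xᵀ(rA)x, where r = n + 1.
    edgeForm : Carrier → Block → Carrier
    edgeForm q B = (q + blockSum B) * (q + blockSum B) - (q * q + blockNorm B)

    arm : Carrier → List Block → Carrier
    arm q []       = 0#
    arm q (B ∷ Bs) = edgeForm q B + arm (top B) Bs

    pendants : Carrier → List Block → Carrier
    pendants q []       = 0#
    pendants q (B ∷ Bs) = edgeForm q B + pendants q Bs

    norms : List Block → Carrier
    norms []       = 0#
    norms (B ∷ Bs) = blockNorm B + norms Bs

    lastTop : Carrier → List Block → Carrier
    lastTop q []       = q
    lastTop q (B ∷ Bs) = lastTop (top B) Bs

    arm-++ : ∀ q Bs Cs → arm q (Bs ++ Cs) ≈ arm q Bs + arm (lastTop q Bs) Cs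
    arm-++ q []       Cs = sym (+-identityˡ _)
    arm-++ q (B ∷ Bs) Cs = trans (+-congˡ (arm-++ (top B) Bs Cs)) (sym (+-assoc _ _ _))

    norms-++ : ∀ Bs Cs → norms (Bs ++ Cs) ≈ norms Bs + norms Cs
    norms-++ []       Cs = sym (+-identityˡ _)
    norms-++ (B ∷ Bs) Cs = trans (+-congˡ (norms-++ Bs Cs)) (sym (+-assoc _ _ _))

    shift : ℚ → Block → Block
    shift t (c , W) = c + ι t , W

    NonNegBlock PosBlock : Block → Set
    NonNegBlock (c , W) = 0# ≤ c × (∀ i → 0# ≤ W i)
    PosBlock    (c , W) = 0# < c × (∀ i → 0# ≤ W i)

    sum-nonNeg : ∀ {m} (f : Vector Carrier m) → (∀ i → 0# ≤ f i) → 0# ≤ sum f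
    sum-nonNeg {zero}  f h = ≤-refl
    sum-nonNeg {suc m} f h = +-nonNeg (h fzero) (sum-nonNeg (λ i → f (fsuc i)) λ i → h (fsuc i))

    blockSum-nonNeg : ∀ {B} → NonNegBlock B → 0# ≤ blockSum B
    blockSum-nonNeg {_ , W} (0≤c , 0≤W) = +-nonNeg 0≤c (sum-nonNeg W 0≤W)

    blockSum-pos : ∀ {B} → PosBlock B → 0# < blockSum B
    blockSum-pos {c , W} (0<c , 0≤W) =
      <-≤-trans 0<c (≤-by (sum W) (sum-nonNeg W 0≤W) refl)

    -- δ is a rate of gain per unit of t. At t = 0 this is the plain comparison behind the
    -- inequality; small t > 0 serve the equality case.
    Exchanged : (t : ℚ) (y z : Carrier) (Ys Zs : List Block) (δ : Carrier) → Set
    Exchanged t y z Ys Zs δ = ∃₂ λ Ys′ Zs′ →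
      length Ys′ ≡ length Zs × length Zs′ ≡ length Ys ×
      norms Ys′ + norms Zs′ ≈ norms Ys + norms (map (shift t) Zs) ×
      (arm y Ys + arm (z + ι t) (map (shift t) Zs)) + ι t * δ ≤ arm y Ys′ + arm (z + ι t) Zs′

    private
      2ℚ : ℚ
      2ℚ = 1ℚ ℚ.+ 1ℚ

      0≤2 : 0# ≤ ι 2ℚ
      0≤2 = 0≤ι (toWitness {a? = 0ℚ ℚ.≤? 2ℚ} _)

      length-shift : ∀ t Bs → length (map (shift t) Bs) ≡ length Bs
      length-shift t []       = ≡.refl
      length-shift t (_ ∷ Bs) = ≡.cong suc (length-shift t Bs)

      -- All squares cancel; only the cross terms between a parent and the sum of its block change,
      -- which makes the gain a product of two differences.
      swap-blocks : ∀ y z B C P Q →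
        ((edgeForm y B + P) + (edgeForm z C + Q)) + ι 2ℚ * ((z - y) * (blockSum B - blockSum C)) ≈
        (edgeForm y C + Q) + (edgeForm z B + P)
      swap-blocks y z B C P Q = solve 8 (λ y z S T M N P Q →
        (((((y :+ S) :* (y :+ S) :- (y :* y :+ M)) :+ P) :+ (((z :+ T) :* (z :+ T) :- (z :* z :+ N)) :+ Q))
          :+ con 2ℚ :* ((z :- y) :* (S :- T)))
        := (((y :+ T) :* (y :+ T) :- (y :* y :+ N)) :+ Q) :+ (((z :+ S) :* (z :+ S) :- (z :* z :+ M)) :+ P))
        refl y z (blockSum B) (blockSum C) (blockNorm B) (blockNorm C) P Q

      -- Each rest stays with its own parent and acts together with it as a single entry, against
      -- which the tops are exchanged.
      swap-tops : ∀ y z B C P Q →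
        ((edgeForm y B + P) + (edgeForm z C + Q)) + ι 2ℚ * ((z + rest C - (y + rest B)) * (top B - top C)) ≈
        (edgeForm y (top C , proj₂ B) + Q) + (edgeForm z (top B , proj₂ C) + P)
      swap-tops y z B C P Q = solve 10 (λ y z b c V W M N P Q →
        (((((y :+ (b :+ V)) :* (y :+ (b :+ V)) :- (y :* y :+ (b :* b :+ M))) :+ P)
          :+ (((z :+ (c :+ W)) :* (z :+ (c :+ W)) :- (z :* z :+ (c :* c :+ N))) :+ Q))
          :+ con 2ℚ :* ((z :+ W :- (y :+ V)) :* (b :- c)))
        := (((y :+ (c :+ V)) :* (y :+ (c :+ V)) :- (y :* y :+ (c :* c :+ M))) :+ Q)
           :+ (((z :+ (b :+ W)) :* (z :+ (b :+ W)) :- (z :* z :+ (b :* b :+ N))) :+ P))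
        refl y z (top B) (top C) (rest B) (rest C) (restNorm B) (restNorm C) P Q

      gain : ∀ {y z d t δ} → y ≤ z → 0# ≤ t → δ ≤ d → 0# ≤ d →
        t * (ι 2ℚ * δ) ≤ ι 2ℚ * ((z + t - y) * d)
      gain {y} {z} {d} {t} {δ} y≤z 0≤t h k = ≤-trans
        (≤-by (ι 2ℚ * (t * (d - δ))) (*-nonNeg 0≤2 (*-nonNeg 0≤t (0≤-diff h)))
          (solve 4 (λ t D δ two → two :* (t :* D) := t :* (two :* δ) :+ two :* (t :* (D :- δ))) refl t d δ (ι 2ℚ)))
        (*-monoˡ-≤ 0≤2 (*-monoʳ-≤ k (≤-by (z - y) (0≤-diff y≤z)
          (solve 3 (λ y z t → z :+ t :- y := t :+ (z :- y)) refl y z t))))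

      2*½ : ∀ δ → ι 2ℚ * (ι (δ ℚ.* ½)) ≈ ι δ
      2*½ δ = trans (sym (ι-* 2ℚ (δ ℚ.* ½))) (reflexive (≡.cong ι (≡.trans (ℚ.*-distribʳ-+ (δ ℚ.* ½) 1ℚ 1ℚ)
        (≡.trans (≡.cong₂ ℚ._+_ (ℚ.*-identityˡ (δ ℚ.* ½)) (ℚ.*-identityˡ (δ ℚ.* ½))) (half+half δ)))))

      half-room : ∀ {c d δ t} → d + ι δ ≤ c → t ℚ.≤ δ ℚ.* ½ → ι (δ ℚ.* ½) ≤ c - (d + ι t)
      half-room {c} {d} {δ} {t} h t≤ = ≤-by ((c - (d + ι δ)) + (ι (δ ℚ.* ½) - ι t))
        (+-nonNeg (0≤-diff h) (0≤-diff (ι-mono t≤)))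
        (trans (solve 5 (λ c d t h δ → c :- (d :+ t) := h :+ ((c :- (d :+ δ)) :+ (h :- t)) :+ (δ :- (h :+ h))) refl c d (ι t) (ι (δ ℚ.* ½)) (ι δ))
          (trans (+-congˡ (trans (+-congˡ (-‿cong (trans (sym (ι-+ (δ ℚ.* ½) (δ ℚ.* ½))) (reflexive (≡.cong ι (half+half δ)))))) (-‿inverseʳ (ι δ))))
            (+-identityʳ _)))

    -- Walk down both arms while the tops of Ys stay below those of Zs and exchange what is left
    -- as soon as this fails; whether the rest of that edge goes along depends on its sum.
    -- Raising the top entries of Zs by t turns the exchange into a gain of first order in t.
    exchange : ∀ y z → y ≤ z → ∀ Ys Zs → length Zs ℕ.< length Ys → All NonNegBlock Ys →
      ¬ ¬ (∃₂ λ δ τ → 0ℚ ℚ.< τ × (All PosBlock Ys → 0# < δ) ×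
        (∀ t → 0ℚ ℚ.≤ t → t ℚ.≤ τ → Exchanged t y z Ys Zs δ))
    -- Nothing is left on the shorter side, so all of the longer arm moves from y to z + t. Only its
    -- first edge notices, by 2 (z + t - y) times its block sum.
    exchange y z y≤z (B ∷ Ys) [] _ (0≤B ∷ _) k = k
      ( ι 2ℚ * blockSum B , 1ℚ , toWitness {a? = 0ℚ ℚ.<? 1ℚ} _
      , (λ { (0<B ∷ _) → let δ , 0<δ , h = blockSum-pos 0<B in
           δ , 0<δ , ≤-trans h (≤-by (blockSum B) (blockSum-nonNeg 0≤B)
             (solve 1 (λ s → con 2ℚ :* s := s :+ s) refl (blockSum B))) })
      , λ t 0≤t _ → [] , B ∷ Ys , ≡.refl , ≡.refl
        , +-comm _ _
        , ≤-respˡ (+-congʳ (sym (+-identityʳ _))) (≤-respʳ (sym (+-identityˡ _))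
            (≤-by (ι 2ℚ * ((z - y) * blockSum B)) (*-nonNeg 0≤2 (*-nonNeg (0≤-diff y≤z) (blockSum-nonNeg 0≤B)))
            (solve 6 (λ y z t S N A →
               (((z :+ t :+ S) :* (z :+ t :+ S) :- ((z :+ t) :* (z :+ t) :+ N)) :+ A)
               := ((((y :+ S) :* (y :+ S) :- (y :* y :+ N)) :+ A) :+ t :* (con 2ℚ :* S)) :+ con 2ℚ :* ((z :- y) :* S))
               refl y z (ι t) (blockSum B) (blockNorm B) (arm (top B) Ys)))) )
    exchange y z y≤z (B ∷ Ys) (C ∷ Zs) (ℕ.s≤s lt) (0≤B ∷ 0≤Ys) k = ≤-or-> (top B) (top C) keep cut
      where
      keep : top B ≤ top C → ⊥
      keep b≤c = exchange (top B) (top C) b≤c Ys Zs lt 0≤Ys λ (δ , τ , 0<τ , pos , ex) → k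
        (δ , τ , 0<τ , (λ { (_ ∷ 0<Ys) → pos 0<Ys }) , λ t 0≤t t≤τ →
          let Ys′ , Zs′ , lY , lZ , eqN , le = ex t 0≤t t≤τ in
          B ∷ Ys′ , shift t C ∷ Zs′ , ≡.cong suc lY , ≡.cong suc lZ
          , trans (interchange _ _ _ _) (trans (+-congˡ eqN) (interchange _ _ _ _))
          , ≤-respˡ (regroup _ _ _ _ _) (≤-respʳ (interchange _ _ _ _)
              (+-mono-≤ (≤-refl {edgeForm y B + edgeForm (z + ι t) (shift t C)}) le)))
        where
        interchange : ∀ a b c d → (a + c) + (b + d) ≈ (a + b) + (c + d)
        interchange = solve 4 (λ a b c d → (a :+ c) :+ (b :+ d) := (a :+ b) :+ (c :+ d)) refl
        regroup : ∀ a b c d e → (a + b) + ((c + d) + e) ≈ ((a + c) + (b + d)) + e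
        regroup = solve 5 (λ a b c d e → (a :+ b) :+ ((c :+ d) :+ e) := ((a :+ c) :+ (b :+ d)) :+ e) refl
      cut : top C < top B → ⊥
      cut (δ , 0<δ , c+δ≤b) = ≤-or-≥ (rest C) (rest B) (λ h → k (answer (inj₁ h))) (λ h → k (answer (inj₂ h)))
        where
        -- Raising the shorter arm may consume half of the gap δ between the tops; the other half
        -- pays for the gain.
        τ : ℚ
        τ = δ ℚ.* ½
        room : ∀ {t} → t ℚ.≤ τ → ι τ ≤ top B - (top C + ι t)
        room = half-room c+δ≤b
        answer : rest C ≤ rest B ⊎ rest B ≤ rest C → ∃₂ λ δ τ → 0ℚ ℚ.< τ × (All PosBlock (B ∷ Ys) → 0# < δ) ×
          (∀ t → 0ℚ ℚ.≤ t → t ℚ.≤ τ → Exchanged t y z (B ∷ Ys) (C ∷ Zs) δ)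
        answer (inj₁ w) = ι 2ℚ * ι τ , τ , half-pos 0<δ , (λ _ → δ , 0<δ , ≤-reflexive (trans (+-identityˡ _) (sym (2*½ δ))))
          , λ t 0≤t t≤τ → map (shift t) (C ∷ Zs) , B ∷ Ys , ≡.cong suc (length-shift t Zs) , ≡.refl
          , +-comm _ _
          , ≤-trans (+-mono-≤ ≤-refl (gain y≤z (0≤ι 0≤t) (≤-trans (room t≤τ) (more t))
                        (≤-trans (0≤ι (ℚ.<⇒≤ (half-pos 0<δ))) (≤-trans (room t≤τ) (more t)))))
              (≤-reflexive (swap-blocks y (z + ι t) B (shift t C) _ _))
          where
          more : ∀ t → top B - (top C + ι t) ≤ blockSum B - blockSum (shift t C)
          more t = ≤-by (rest B - rest C) (0≤-diff w)
            (solve 5 (λ b c t v w → (b :+ v) :- ((c :+ t) :+ w) := (b :- (c :+ t)) :+ (v :- w)) refl (top B) (top C) (ι t) (rest B) (rest C))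
        answer (inj₂ w) = ι 2ℚ * ι τ , τ , half-pos 0<δ , (λ _ → δ , 0<δ , ≤-reflexive (trans (+-identityˡ _) (sym (2*½ δ))))
          , λ t 0≤t t≤τ → (top C + ι t , proj₂ B) ∷ map (shift t) Zs , (top B , proj₂ C) ∷ Ys
          , ≡.cong suc (length-shift t Zs) , ≡.refl
          , solve 6 (λ b c M N P Q → ((c :* c :+ M) :+ P) :+ ((b :* b :+ N) :+ Q) := ((b :* b :+ M) :+ Q) :+ ((c :* c :+ N) :+ P)) refl
              (top B) (top C + ι t) (restNorm B) (restNorm C) _ _
          , ≤-trans (+-mono-≤ ≤-refl (≤-trans (gain y≤z (0≤ι 0≤t) (room t≤τ) (0≤room t≤τ))
                (*-monoˡ-≤ 0≤2 (*-monoʳ-≤ (0≤room t≤τ) (≤-by (rest C - rest B) (0≤-diff w)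
                  (solve 5 (λ y z t v w → (z :+ t :+ w) :- (y :+ v) := (z :+ t :- y) :+ (w :- v)) refl y z (ι t) (rest B) (rest C)))))))
              (≤-reflexive (swap-tops y (z + ι t) B (shift t C) _ _))
          where
          0≤room : ∀ {t} → t ℚ.≤ τ → 0# ≤ top B - (top C + ι t)
          0≤room t≤τ = ≤-trans (0≤ι (ℚ.<⇒≤ (half-pos 0<δ))) (room t≤τ)

  -- G, C and H weight the three kinds of vertices of an edge: its upper vertex, its lower
  -- vertex and its n other vertices.  A cut-off subtree at the lower vertex contributes κ′ − 1
  -- there, and κ − 1 is then the contribution of the whole branch at the upper vertex.
  record EdgeWeights (n : ℕ) (μ κ κ′ : ℚ) : Set where
    field
      G C H : ℚ
      0<G   : 0ℚ ℚ.< G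
      0<C   : 0ℚ ℚ.< C
      0<H   : 0ℚ ℚ.< H
      total : ℚ
      total≡ : total ≡ G ℚ.+ C ℚ.+ fromℕℚ n ℚ.* H
      upper : κ ℚ.* G ≡ total
      lower : (μ ℚ.+ 1ℚ ℚ.+ 1ℚ ℚ.- κ′) ℚ.* C ≡ total
      other : (μ ℚ.+ 1ℚ) ℚ.* H ≡ total

  inverse : ∀ {p} → 0ℚ ℚ.< p → ∃ λ q → 0ℚ ℚ.≤ q × q ℚ.* p ≡ 1ℚ
  inverse {p} 0<p = ℚ.1/ p , ℚ.<⇒≤ (ℚ.positive⁻¹ (ℚ.1/ p) {{ℚ.1/pos⇒pos p}}) , ℚ.*-inverseˡ p
    where
    instance
      p>0 = ℚ.positive 0<p
      p≢0 = ℚ.pos⇒nonZero p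

  0≤fromℕℚ : ∀ n → 0ℚ ℚ.≤ fromℕℚ n
  0≤fromℕℚ zero    = ℚ.≤-refl
  0≤fromℕℚ (suc n) = ℚLemmas.+-nonNeg (toWitness {a? = 0ℚ ℚ.≤? 1ℚ} _) (0≤fromℕℚ n)

  module BlockBounds (𝓡 : OrderedAlgebra) (n : ℕ) where
    open OrderedAlgebra 𝓡
    open OrderedAlgebraProperties 𝓡
    open BlockForms 𝓡 n
    open ι-Solver using (solve; _:=_; _:+_; _:*_; _:-_; :-_; con)

    private
      2ℚ : ℚ
      2ℚ = 1ℚ ℚ.+ 1ℚ

    two-products : ∀ α β a b → 0# ≤ α → α * β ≈ 1# → ι 2ℚ * (a * b) ≤ α * (a * a) + β * (b * b)
    two-products α β a b 0≤α αβ≈1 = ≤-by (α * ((a - β * b) * (a - β * b))) (*-nonNeg 0≤α (square-nonNeg _))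
      (sym (trans (solve 4 (λ α β a b → con 2ℚ :* (a :* b) :+ α :* ((a :- β :* b) :* (a :- β :* b))
          := (α :* (a :* a) :+ (α :* β) :* (β :* (b :* b))) :+ con 2ℚ :* ((con 1ℚ :- α :* β) :* (a :* b))) refl α β a b)
        (trans (+-cong (+-congˡ (trans (*-congʳ αβ≈1) (*-identityˡ _)))
                       (trans (*-congˡ (trans (*-congʳ (trans (+-cong ι-1 (-‿cong αβ≈1)) (-‿inverseʳ 1#))) (zeroˡ _))) (zeroʳ _)))
               (+-identityʳ _))))

    two-products-sum : ∀ {m} α β a (W : Vector Carrier m) → 0# ≤ α → α * β ≈ 1# →
      ι 2ℚ * (a * sum W) ≤ ι (fromℕℚ m) * (α * (a * a)) + β * sum (λ i → W i * W i)
    two-products-sum {zero} α β a W 0≤α αβ≈1 = ≤-reflexive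
      (trans (trans (*-congˡ (zeroʳ a)) (zeroʳ _))
        (sym (trans (+-cong (trans (*-congʳ ι-0) (zeroˡ _)) (zeroʳ β)) (+-identityʳ 0#))))
    two-products-sum {suc m} α β a W 0≤α αβ≈1 = ≤-respʳ
      (trans (solve 5 (λ x m b w S → (x :+ b :* w) :+ (m :* x :+ b :* S) := (x :+ m :* x) :+ b :* (w :+ S))
                      refl (α * (a * a)) (ι (fromℕℚ m)) β (W fzero * W fzero) (sum λ i → W (fsuc i) * W (fsuc i)))
        (+-congʳ (trans (+-congʳ (sym (*-identityˡ _))) (trans (sym (distribʳ _ _ _))
          (*-congʳ (trans (+-congʳ (sym ι-1)) (sym (ι-+ 1ℚ (fromℕℚ m)))))))))
      (≤-respˡ (solve 3 (λ a w S → con 2ℚ :* (a :* w) :+ con 2ℚ :* (a :* S) := con 2ℚ :* (a :* (w :+ S))) refl a (W fzero) (sum λ i → W (fsuc i)))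
        (+-mono-≤ (two-products α β a (W fzero) 0≤α αβ≈1) (two-products-sum α β a (λ i → W (fsuc i)) 0≤α αβ≈1)))

    0≤1 : 0# ≤ 1#
    0≤1 = ≤-respʳ ι-1 (0≤ι (toWitness {a? = 0ℚ ℚ.≤? 1ℚ} _))

    cauchy-schwarz : ∀ {m} (W : Vector Carrier m) → sum W * sum W ≤ ι (fromℕℚ m) * sum (λ i → W i * W i)
    cauchy-schwarz {zero}  W = ≤-reflexive (trans (zeroˡ _) (sym (zeroʳ _)))
    cauchy-schwarz {suc m} W = ≤-respˡ
        (solve 2 (λ w S → (w :* w :+ con 2ℚ :* (w :* S)) :+ S :* S := (w :+ S) :* (w :+ S)) refl w S)
      (≤-trans (+-mono-≤ (+-mono-≤ ≤-refl (two-products-sum 1# 1# w (λ i → W (fsuc i)) 0≤1 (*-identityˡ 1#))) (cauchy-schwarz λ i → W (fsuc i)))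
        (≤-reflexive (trans (+-congʳ (+-congˡ (+-cong (*-congˡ (*-identityˡ _)) (*-identityˡ _))))
          (trans (solve 3 (λ w2 m N → (w2 :+ (m :* w2 :+ N)) :+ m :* N := (con 1ℚ :+ m) :* (w2 :+ N)) refl (w * w) (ι (fromℕℚ m)) N)
            (*-congʳ (sym (ι-+ 1ℚ (fromℕℚ m))))))))
      where
      w = W fzero
      S = sum λ i → W (fsuc i)
      N = sum λ i → W (fsuc i) * W (fsuc i)

    module _ {μ κ κ′ : ℚ} (weights : EdgeWeights n μ κ κ′) where
      open EdgeWeights weights

      private
        G⁻ = proj₁ (inverse 0<G)
        C⁻ = proj₁ (inverse 0<C)
        H⁻ = proj₁ (inverse 0<H)
        GG = proj₂ (proj₂ (inverse 0<G))
        CC = proj₂ (proj₂ (inverse 0<C))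
        HH = proj₂ (proj₂ (inverse 0<H))
        0≤G⁻ = proj₁ (proj₂ (inverse 0<G))
        0≤C⁻ = proj₁ (proj₂ (inverse 0<C))
        N = fromℕℚ n

        unit : ∀ p q p⁻ q⁻ → p⁻ ℚ.* p ≡ 1ℚ → q⁻ ℚ.* q ≡ 1ℚ → ι (p ℚ.* q⁻) * ι (q ℚ.* p⁻) ≈ 1#
        unit p q p⁻ q⁻ hp hq = trans (sym (ι-* _ _)) (trans (reflexive (≡.cong ι
          (≡.trans (S.solve 4 (λ p q p⁻ q⁻ → (p S.:* q⁻) S.:* (q S.:* p⁻) S.:= (p⁻ S.:* p) S.:* (q⁻ S.:* q)) ≡.refl p q p⁻ q⁻)
            (≡.trans (≡.cong₂ ℚ._*_ hp hq) (ℚ.*-identityˡ 1ℚ))))) ι-1)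
          where module S = +-*-Solver

        divide : ∀ x d d⁻ y → d⁻ ℚ.* d ≡ 1ℚ → x ℚ.* d ≡ y → x ≡ y ℚ.* d⁻
        divide x d d⁻ y h k = ≡.trans (≡.sym (ℚ.*-identityʳ x)) (≡.trans (≡.cong (x ℚ.*_) (≡.trans (≡.sym h) (ℚ.*-comm d⁻ d)))
          (≡.trans (≡.sym (ℚ.*-assoc x d d⁻)) (≡.cong (ℚ._* d⁻) k)))

        κ≡ : κ ℚ.- 1ℚ ≡ C ℚ.* G⁻ ℚ.+ N ℚ.* (H ℚ.* G⁻)
        κ≡ = ≡.trans (≡.cong (ℚ._- 1ℚ) (≡.trans (divide κ G G⁻ total GG upper) (≡.cong (ℚ._* G⁻) total≡)))
          (≡.trans (≡.cong (λ u → (G ℚ.+ C ℚ.+ N ℚ.* H) ℚ.* G⁻ ℚ.- u) (≡.sym GG))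
            (solve′ 5 (λ G C N H i → (G ⊕ C ⊕ N ⊗ H) ⊗ i ⊖ i ⊗ G ⊜ C ⊗ i ⊕ N ⊗ (H ⊗ i)) ≡.refl G C N H G⁻))
          where open +-*-Solver renaming (solve to solve′; _:+_ to _⊕_; _:*_ to _⊗_; _:-_ to _⊖_; _:=_ to _⊜_)

        κ′≡ : κ′ ℚ.- 1ℚ ≡ μ ℚ.- (G ℚ.* C⁻ ℚ.+ N ℚ.* (H ℚ.* C⁻))
        κ′≡ = ≡.trans (solve′ 2 (λ κ μ → κ ⊖ con′ 1ℚ ⊜ μ ⊖ ((μ ⊕ con′ 1ℚ ⊕ con′ 1ℚ ⊖ κ) ⊖ con′ 1ℚ)) ≡.refl κ′ μ)
          (≡.cong (λ u → μ ℚ.- u) (≡.trans (≡.cong₂ ℚ._-_ (≡.trans (divide (μ ℚ.+ 1ℚ ℚ.+ 1ℚ ℚ.- κ′) C C⁻ total CC lower) (≡.cong (ℚ._* C⁻) total≡)) (≡.sym CC))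
            (solve′ 5 (λ G C N H i → (G ⊕ C ⊕ N ⊗ H) ⊗ i ⊖ i ⊗ C ⊜ G ⊗ i ⊕ N ⊗ (H ⊗ i)) ≡.refl G C N H C⁻)))
          where open +-*-Solver renaming (solve to solve′; _:+_ to _⊕_; _:*_ to _⊗_; _:-_ to _⊖_; _:=_ to _⊜_; con to con′)

        μ≡ : μ ≡ G ℚ.* H⁻ ℚ.+ C ℚ.* H⁻ ℚ.+ N ℚ.- 1ℚ
        μ≡ = ≡.trans (solve′ 1 (λ μ → μ ⊜ (μ ⊕ con′ 1ℚ) ⊖ con′ 1ℚ) ≡.refl μ)
          (≡.cong (ℚ._- 1ℚ) (≡.trans (≡.trans (divide (μ ℚ.+ 1ℚ) H H⁻ total HH other) (≡.cong (ℚ._* H⁻) total≡))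
            (≡.trans (solve′ 5 (λ G C N H i → (G ⊕ C ⊕ N ⊗ H) ⊗ i ⊜ G ⊗ i ⊕ C ⊗ i ⊕ N ⊗ (i ⊗ H)) ≡.refl G C N H H⁻)
              (≡.cong (G ℚ.* H⁻ ℚ.+ C ℚ.* H⁻ ℚ.+_) (≡.trans (≡.cong (N ℚ.*_) HH) (ℚ.*-identityʳ N))))))
          where open +-*-Solver renaming (solve to solve′; _:+_ to _⊕_; _:*_ to _⊗_; _:-_ to _⊖_; _:=_ to _⊜_; con to con′)

        a₁ = ι (C ℚ.* G⁻)
        b₁ = ι (G ℚ.* C⁻)
        a₂ = ι (H ℚ.* G⁻)
        b₂ = ι (G ℚ.* H⁻)
        a₃ = ι (H ℚ.* C⁻)
        b₃ = ι (C ℚ.* H⁻)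

        ικ : ι (κ ℚ.- 1ℚ) ≈ a₁ + ι N * a₂
        ικ = trans (reflexive (≡.cong ι κ≡)) (trans (ι-+ _ _) (+-congˡ (ι-* _ _)))

        ικ′ : ι (κ′ ℚ.- 1ℚ) ≈ ι μ - (b₁ + ι N * a₃)
        ικ′ = trans (reflexive (≡.cong ι κ′≡)) (trans (ι-+ _ _) (+-congˡ (trans (ι-neg _) (-‿cong (trans (ι-+ _ _) (+-congˡ (ι-* _ _)))))))

        ιμ : ι μ ≈ b₂ + b₃ + ι N - 1#
        ιμ = trans (reflexive (≡.cong ι μ≡)) (trans (ι-+ _ _) (+-cong (trans (ι-+ _ _) (+-congʳ (ι-+ _ _))) (trans (ι-neg _) (-‿cong ι-1))))

      -- Each product of two entries is split according to the quotient of their weights, so an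
      -- entry of weight w collects the coefficient `total`/w - 1. The equations of `EdgeWeights`
      -- make this κ - 1 at the upper vertex, μ + 1 - κ′ at the lower one and μ elsewhere; the term
      -- κ′ - 1 completes μ at the lower vertex.
      edge-bound : ∀ q B → edgeForm q B + ι (κ′ ℚ.- 1ℚ) * (top B * top B) ≤ ι (κ ℚ.- 1ℚ) * (q * q) + ι μ * blockNorm B
      edge-bound q B = ≤-by
          ((((a₁ * (q * q) + b₁ * (c * c)) - ι 2ℚ * (q * c)) + ((ι N * (a₂ * (q * q)) + b₂ * M) - ι 2ℚ * (q * w)))
            + (((ι N * (a₃ * (c * c)) + b₃ * M) - ι 2ℚ * (c * w)) + (ι N * M - w * w)))
          (+-nonNeg
            (+-nonNeg (0≤-diff (two-products a₁ b₁ q c (0≤ι (ℚLemmas.*-nonNeg (ℚ.<⇒≤ 0<C) 0≤G⁻)) (unit C G C⁻ G⁻ CC GG)))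
                      (0≤-diff (two-products-sum a₂ b₂ q W (0≤ι (ℚLemmas.*-nonNeg (ℚ.<⇒≤ 0<H) 0≤G⁻)) (unit H G H⁻ G⁻ HH GG))))
            (+-nonNeg (0≤-diff (two-products-sum a₃ b₃ c W (0≤ι (ℚLemmas.*-nonNeg (ℚ.<⇒≤ 0<H) 0≤C⁻)) (unit H C H⁻ C⁻ HH CC)))
                      (0≤-diff (cauchy-schwarz W))))
          (trans (+-congʳ (*-congʳ ικ)) (trans (+-congˡ (trans (distribˡ (ι μ) _ _) (+-congˡ (*-congʳ (trans ιμ (+-congˡ (-‿cong (sym ι-1))))))))
            (trans (solve 12 (λ q c w M μ N a₁ b₁ a₂ b₂ a₃ b₃ →
                (a₁ :+ N :* a₂) :* (q :* q) :+ (μ :* (c :* c) :+ (b₂ :+ b₃ :+ N :- con 1ℚ) :* M)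
                := (((q :+ (c :+ w)) :* (q :+ (c :+ w)) :- (q :* q :+ (c :* c :+ M))) :+ (μ :- (b₁ :+ N :* a₃)) :* (c :* c))
                   :+ ((((a₁ :* (q :* q) :+ b₁ :* (c :* c)) :- con 2ℚ :* (q :* c)) :+ ((N :* (a₂ :* (q :* q)) :+ b₂ :* M) :- con 2ℚ :* (q :* w)))
                       :+ (((N :* (a₃ :* (c :* c)) :+ b₃ :* M) :- con 2ℚ :* (c :* w)) :+ (N :* M :- w :* w))))
               refl q c w M (ι μ) (ι N) a₁ b₁ a₂ b₂ a₃ b₃)
             (+-congʳ (+-congˡ (*-congʳ (sym ικ′)))))))
        where
        c = top B
        W = proj₂ B
        w = sum W
        M = restNorm B

    module _ {μ : ℚ} (κ : ℕ → ℚ) (κ₀ : κ 0 ≡ 1ℚ) (weights : ∀ j → EdgeWeights n μ (κ (suc j)) (κ j)) where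

      private
        ι[κ₀-1] : ∀ x → ι (κ 0 ℚ.- 1ℚ) * x ≈ 0#
        ι[κ₀-1] x = trans (*-congʳ (trans (reflexive (≡.cong ι (≡.trans (≡.cong (ℚ._- 1ℚ) κ₀) (ℚ.+-inverseʳ 1ℚ)))) ι-0)) (zeroˡ x)

      -- What hangs below an edge has been bounded by a multiple of the square at its lower vertex,
      -- and `edge-bound` passes this on to the upper vertex. κ 0 = 1 says that nothing hangs below
      -- the last edge.
      arm-bound : ∀ q Bs → arm q Bs ≤ ι (κ (length Bs) ℚ.- 1ℚ) * (q * q) + ι μ * norms Bs
      arm-bound q []       = ≤-reflexive (sym (trans (+-cong (ι[κ₀-1] _) (zeroʳ _)) (+-identityʳ 0#)))
      arm-bound q (B ∷ Bs) = ≤-trans (+-mono-≤ ≤-refl (arm-bound (top B) Bs))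
        (≤-respˡ (+-assoc _ _ _)
          (≤-trans (+-mono-≤ (edge-bound (weights (length Bs)) q B) ≤-refl)
            (≤-reflexive (trans (+-assoc _ _ _) (+-congˡ (sym (distribˡ _ _ _)))))))

      pendants-bound : ∀ q Bs → pendants q Bs ≤ (ι (fromℕℚ (length Bs)) * ι (κ 1 ℚ.- 1ℚ)) * (q * q) + ι μ * norms Bs
      pendants-bound q []       = ≤-reflexive (sym (trans (+-cong (trans (*-congʳ (trans (*-congʳ ι-0) (zeroˡ _))) (zeroˡ _)) (zeroʳ _)) (+-identityʳ 0#)))
      pendants-bound q (B ∷ Bs) = ≤-trans (+-mono-≤ (≤-respˡ (trans (+-congˡ (ι[κ₀-1] _)) (+-identityʳ _)) (edge-bound (weights 0) q B)) (pendants-bound q Bs))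
        (≤-reflexive (trans (solve 6 (λ k Q L M P m → (k :* Q :+ m :* M) :+ ((L :* k) :* Q :+ m :* P) := ((con 1ℚ :+ L) :* k) :* Q :+ m :* (M :+ P))
            refl (ι (κ 1 ℚ.- 1ℚ)) (q * q) (ι (fromℕℚ (length Bs))) (blockNorm B) (norms Bs) (ι μ))
          (+-congʳ (*-congʳ (*-congʳ (sym (ι-+ 1ℚ _)))))))

      -- The hypothesis is the one condition left over at the root: the contributions of all
      -- branches there must fit under μ.
      broom-bound : ∀ q Ys Zs Ps →
        (κ (length Ys) ℚ.- 1ℚ) ℚ.+ (κ (length Zs) ℚ.- 1ℚ) ℚ.+ fromℕℚ (length Ps) ℚ.* (κ 1 ℚ.- 1ℚ) ℚ.≤ μ →
        arm q Ys + arm q Zs + pendants q Ps ≤ ι μ * (q * q + (norms Ys + norms Zs + norms Ps))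
      broom-bound q Ys Zs Ps h = ≤-trans (+-mono-≤ (+-mono-≤ (arm-bound q Ys) (arm-bound q Zs)) (pendants-bound q Ps))
        (≤-trans (≤-reflexive (solve 8 (λ a b c Q m A B C →
            ((a :* Q :+ m :* A) :+ (b :* Q :+ m :* B)) :+ (c :* Q :+ m :* C) := ((a :+ b) :+ c) :* Q :+ m :* ((A :+ B) :+ C))
            refl _ _ _ (q * q) (ι μ) (norms Ys) (norms Zs) (norms Ps)))
        (≤-trans (+-mono-≤ (*-monoʳ-≤ (square-nonNeg q) (≤-respˡ (trans (ι-+ _ _) (+-cong (ι-+ _ _) (ι-* _ _))) (ι-mono h))) ≤-refl)
          (≤-reflexive (sym (distribˡ _ _ _)))))

open Blocks

-- Roots by bisection, and the polynomials of loose paths and brooms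

module Polynomials where
  import Data.Integer as ℤ
  open import Data.Integer using (+_)
  import Data.Integer.Properties as ℤ
  import Data.Nat as ℕ
  open import Data.Nat using (ℕ; zero; suc)
  import Data.Nat.Properties as ℕ
  open import Data.Product using (∃; _×_; _,_; proj₁; proj₂)
  import Data.Rational as ℚ
  open import Data.Rational using (ℚ; 0ℚ; 1ℚ; ½)
  import Data.Rational.Properties as ℚ
  open import Data.Rational.Solver using (module +-*-Solver)
  import Data.Rational.Unnormalised as ℚᵘ
  import Data.Rational.Unnormalised.Properties as ℚᵘ
  open import Data.Sum using (inj₁; inj₂)
  open import Defs hiding (bounded) renaming (_≈_ to _≈ᴿ_)
  open import Relation.Binary.PropositionalEquality as ≡ using (_≡_; refl; sym; trans; cong; subst)
  open import Relation.Nullary using (no)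
  open import Relation.Nullary.Decidable using (toWitness)

  infixl 6 _⊕_
  infixl 7 _⊗_
  infix  8 ⊝_

  -- Syntax lets one polynomial be evaluated both at rationals, where signs are decidable, and at
  -- its real root.
  data Poly : Set where
    X       : Poly
    const   : ℚ → Poly
    _⊕_ _⊗_ : Poly → Poly → Poly
    ⊝_      : Poly → Poly

  ⟦_⟧ : Poly → ℚ → ℚ
  ⟦ X ⟧     x = x
  ⟦ const q ⟧ x = q
  ⟦ e ⊕ f ⟧ x = ⟦ e ⟧ x ℚ.+ ⟦ f ⟧ x
  ⟦ e ⊗ f ⟧ x = ⟦ e ⟧ x ℚ.* ⟦ f ⟧ x
  ⟦ ⊝ e ⟧   x = ℚ.- ⟦ e ⟧ x

  module PolyEvaluation (𝓡 : OrderedAlgebra) where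
    open OrderedAlgebra 𝓡 renaming (refl to ≈-refl)

    eval : Poly → Carrier → Carrier
    eval X       x = x
    eval (const q) x = ι q
    eval (e ⊕ f) x = eval e x + eval f x
    eval (e ⊗ f) x = eval e x * eval f x
    eval (⊝ e)   x = - eval e x

    eval-cong : ∀ e {x y} → x ≈ y → eval e x ≈ eval e y
    eval-cong X       h = h
    eval-cong (const q) h = ≈-refl
    eval-cong (e ⊕ f) h = +-cong (eval-cong e h) (eval-cong f h)
    eval-cong (e ⊗ f) h = *-cong (eval-cong e h) (eval-cong f h)
    eval-cong (⊝ e)   h = -‿cong (eval-cong e h)

  open PolyEvaluation RealProperties.orderedAlgebra public using () renaming (eval to evalᴿ; eval-cong to evalᴿ-cong)

  seq-evalᴿ : ∀ e x n → seq (evalᴿ e x) n ≡ ⟦ e ⟧ (seq x n)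
  seq-evalᴿ X       x n = refl
  seq-evalᴿ (const q) x n = refl
  seq-evalᴿ (e ⊕ f) x n = ≡.cong₂ ℚ._+_ (seq-evalᴿ e x n) (seq-evalᴿ f x n)
  seq-evalᴿ (e ⊗ f) x n = ≡.cong₂ ℚ._*_ (seq-evalᴿ e x n) (seq-evalᴿ f x n)
  seq-evalᴿ (⊝ e)   x n = cong ℚ.-_ (seq-evalᴿ e x n)

  fromℕℚ≡/1 : ∀ n → fromℕℚ n ≡ + n ℚ./ 1
  fromℕℚ≡/1 zero    = refl
  fromℕℚ≡/1 (suc n) = trans (cong (1ℚ ℚ.+_) (fromℕℚ≡/1 n)) (ℚ.toℚᵘ-injective (ℚᵘ.≃-trans
    (ℚ.toℚᵘ-homo-+ 1ℚ (+ n ℚ./ 1))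
    (ℚᵘ.≃-trans (ℚᵘ.+-congʳ (ℚ.toℚᵘ 1ℚ) (ℚ.toℚᵘ-fromℚᵘ (ℚᵘ.mkℚᵘ (+ n) 0)))
    (ℚᵘ.≃-trans (ℚᵘ.*≡* (cong (ℤ._* + 1) (cong (λ k → (+ 1) ℤ.+ k) (ℤ.*-identityʳ (+ n)))))
      (ℚᵘ.≃-sym (ℚ.toℚᵘ-fromℚᵘ (ℚᵘ.mkℚᵘ (+ suc n) 0)))))))

  -- The absolute value of the numerator suffices, the denominator being at least 1.
  archimedean : ∀ q → ∃ λ n → q ℚ.≤ fromℕℚ n
  archimedean q@record{} = n , subst (q ℚ.≤_) (sym (fromℕℚ≡/1 n)) (ℚ.toℚᵘ-cancel-≤ (ℚᵘ.≤-trans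
      (ℚᵘ.*≤* (ℤ.≤-trans (ℤ.≤-reflexive (ℤ.*-identityʳ (ℚ.↥ q))) (ℤ.≤-trans (i≤∣i∣ (ℚ.↥ q))
        (subst (ℤ._≤ + n ℤ.* ℚ.↧ q) (ℤ.*-identityʳ (+ n)) (ℤ.*-monoˡ-≤-nonNeg (+ n) (ℤ.+≤+ (ℕ.s≤s ℕ.z≤n)))))))
      (ℚᵘ.≤-reflexive (ℚᵘ.≃-sym (ℚ.toℚᵘ-fromℚᵘ (ℚᵘ.mkℚᵘ (+ n) 0))))))
    where
    n = ℤ.∣ ℚ.↥ q ∣
    i≤∣i∣ : ∀ i → i ℤ.≤ + ℤ.∣ i ∣
    i≤∣i∣ (+ _)      = ℤ.≤-refl
    i≤∣i∣ ℤ.-[1+ _ ] = ℤ.-≤+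

  module Bisection (P : ℚ → ℚ) (a b : ℚ) (a≤b : a ℚ.≤ b) (Pa≤0 : P a ℚ.≤ 0ℚ) (0≤Pb : 0ℚ ℚ.≤ P b) where
    open +-*-Solver using (solve; _:=_; _:+_; _:*_; _:-_; :-_; con)

    record Bracket : Set where
      field
        low high : ℚ
        a≤low    : a ℚ.≤ low
        low≤high : low ℚ.≤ high
        P-low    : P low ℚ.≤ 0ℚ
        P-high   : 0ℚ ℚ.≤ P high

    open Bracket public

    middle : ℚ → ℚ → ℚ
    middle l h = (l ℚ.+ h) ℚ.* ½

    low≤middle : ∀ {l h} → l ℚ.≤ h → l ℚ.≤ middle l h
    low≤middle {l} {h} l≤h = ℚLemmas.≤-by ((h ℚ.- l) ℚ.* ½)
      (ℚLemmas.*-nonNeg (ℚLemmas.0≤-diff l≤h) (toWitness {a? = 0ℚ ℚ.≤? ½} _))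
      (solve 2 (λ l h → (l :+ h) :* con ½ := l :+ (h :- l) :* con ½) refl l h)

    middle≤high : ∀ {l h} → l ℚ.≤ h → middle l h ℚ.≤ h
    middle≤high {l} {h} l≤h = ℚLemmas.≤-by ((h ℚ.- l) ℚ.* ½)
      (ℚLemmas.*-nonNeg (ℚLemmas.0≤-diff l≤h) (toWitness {a? = 0ℚ ℚ.≤? ½} _))
      (solve 2 (λ l h → h := (l :+ h) :* con ½ :+ (h :- l) :* con ½) refl l h)

    width : Bracket → ℚ
    width B = high B ℚ.- low B

    halve : ∀ B → ∃ λ B′ → low B ℚ.≤ low B′ × high B′ ℚ.≤ high B × width B′ ≡ width B ℚ.* ½
    halve B with ℚ.≤-total 0ℚ (P (middle (low B) (high B)))
    ... | inj₁ 0≤Pm = record { low = low B ; high = middle (low B) (high B) ; a≤low = a≤low B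
                             ; low≤high = low≤middle (low≤high B) ; P-low = P-low B ; P-high = 0≤Pm }
                    , ℚ.≤-refl , middle≤high (low≤high B)
                    , solve 2 (λ l h → (l :+ h) :* con ½ :- l := (h :- l) :* con ½) refl (low B) (high B)
    ... | inj₂ Pm≤0 = record { low = middle (low B) (high B) ; high = high B ; a≤low = ℚ.≤-trans (a≤low B) (low≤middle (low≤high B))
                             ; low≤high = middle≤high (low≤high B) ; P-low = Pm≤0 ; P-high = P-high B }
                    , low≤middle (low≤high B) , ℚ.≤-refl
                    , solve 2 (λ l h → h :- (l :+ h) :* con ½ := (h :- l) :* con ½) refl (low B) (high B)

    bracket : ℕ → Bracket
    bracket zero    = record { low = a ; high = b ; a≤low = ℚ.≤-refl ; low≤high = a≤b ; P-low = Pa≤0 ; P-high = 0≤Pb }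
    bracket (suc i) = proj₁ (halve (bracket i))

    nested : ∀ i j → low (bracket i) ℚ.≤ low (bracket (j ℕ.+ i)) × high (bracket (j ℕ.+ i)) ℚ.≤ high (bracket i)
    nested i zero    = ℚ.≤-refl , ℚ.≤-refl
    nested i (suc j) = let l , h = nested i j ; _ , l′ , h′ , _ = halve (bracket (j ℕ.+ i)) in
      ℚ.≤-trans l l′ , ℚ.≤-trans h′ h

    nested′ : ∀ {i j} → i ℕ.≤ j → low (bracket i) ℚ.≤ low (bracket j) × high (bracket j) ℚ.≤ high (bracket i)
    nested′ {i} {j} i≤j = subst (λ k → low (bracket i) ℚ.≤ low (bracket k) × high (bracket k) ℚ.≤ high (bracket i))
      (ℕ.m∸n+n≡m i≤j) (nested i (j ℕ.∸ i))

    -- Slower than the true decay, but enough for convergence. With w the old width, (1 + i) w/2 is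
    -- the mean of w and i w, and both are at most b - a.
    width-bound : ∀ i → fromℕℚ i ℚ.* width (bracket i) ℚ.≤ b ℚ.- a
    width-bound zero    = subst (ℚ._≤ b ℚ.- a) (sym (ℚ.*-zeroˡ (b ℚ.- a))) (ℚLemmas.0≤-diff a≤b)
    width-bound (suc i) = ℚ.≤-trans (ℚLemmas.≤-by (((b ℚ.- a) ℚ.- w) ℚ.* ½ ℚ.+ (f ℚ.* w) ℚ.* 0ℚ)
        (ℚLemmas.+-nonNeg (ℚLemmas.*-nonNeg (ℚLemmas.0≤-diff (w≤ i)) (toWitness {a? = 0ℚ ℚ.≤? ½} _))
          (ℚ.≤-reflexive (sym (ℚ.*-zeroʳ (f ℚ.* w)))))
        (trans (solve 3 (λ d f w → d :* con ½ :+ (f :* w) :* con ½ := (con 1ℚ :+ f) :* (w :* con ½) :+ ((d :- w) :* con ½ :+ (f :* w) :* con 0ℚ)) refl (b ℚ.- a) f w)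
               (cong (λ u → (1ℚ ℚ.+ f) ℚ.* u ℚ.+ (((b ℚ.- a) ℚ.- w) ℚ.* ½ ℚ.+ (f ℚ.* w) ℚ.* 0ℚ)) (sym half))))
      (subst ((b ℚ.- a) ℚ.* ½ ℚ.+ (f ℚ.* w) ℚ.* ½ ℚ.≤_) (half+half (b ℚ.- a))
        (ℚ.+-monoʳ-≤ ((b ℚ.- a) ℚ.* ½) (ℚ.*-monoʳ-≤-nonNeg ½ (width-bound i))))
      where
      f = fromℕℚ i
      w = width (bracket i)
      half : width (bracket (suc i)) ≡ w ℚ.* ½
      half = proj₂ (proj₂ (proj₂ (halve (bracket i))))
      w≤ : ∀ i → width (bracket i) ℚ.≤ b ℚ.- a
      w≤ i = let l , h = nested′ {0} {i} ℕ.z≤n in ℚ.+-mono-≤ h (ℚ.neg-antimono-≤ l)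

    width-small : ∀ ε → 0ℚ ℚ.< ε → ∃ λ N → width (bracket N) ℚ.≤ ε
    width-small ε 0<ε = N , ℚ.*-cancelˡ-≤-pos (fromℕℚ N) {{ℚ.positive 0<N}} (ℚ.≤-trans (width-bound N)
        (ℚ.≤-trans (ℚLemmas.≤-by ε (ℚ.<⇒≤ 0<ε) refl)
        (ℚ.≤-trans (ℚ.≤-reflexive eq) (ℚ.*-monoʳ-≤-nonNeg ε {{ℚ.nonNegative (ℚ.<⇒≤ 0<ε)}} (ℚ.+-monoʳ-≤ 1ℚ (proj₂ (archimedean q)))))))
      where
      e⁻ = proj₁ (inverse 0<ε)
      q = (b ℚ.- a) ℚ.* e⁻
      N = suc (proj₁ (archimedean q))
      0<N : 0ℚ ℚ.< fromℕℚ N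
      0<N = ℚ.<-≤-trans (toWitness {a? = 0ℚ ℚ.<? 1ℚ} _) (ℚLemmas.≤-by (fromℕℚ (proj₁ (archimedean q))) (0≤fromℕℚ (proj₁ (archimedean q))) refl)
      eq : (b ℚ.- a) ℚ.+ ε ≡ (1ℚ ℚ.+ q) ℚ.* ε
      eq = trans (cong (λ u → u ℚ.+ ε) (sym (trans (cong ((b ℚ.- a) ℚ.*_) (proj₂ (proj₂ (inverse 0<ε)))) (ℚ.*-identityʳ (b ℚ.- a)))))
        (solve 3 (λ d i e → d :* (i :* e) :+ e := (con 1ℚ :+ d :* i) :* e) refl (b ℚ.- a) e⁻ ε)

    high-close : ∀ ε → 0ℚ ℚ.< ε → ∃ λ N → ∀ i j → N ℕ.≤ i → N ℕ.≤ j →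
      high (bracket i) ℚ.≤ high (bracket j) ℚ.+ ε × high (bracket i) ℚ.≤ low (bracket j) ℚ.+ ε
    high-close ε 0<ε = let N , wN = width-small ε 0<ε in N , λ i j hi hj →
      let li , ui = nested′ {N} {i} hi ; lj , uj = nested′ {N} {j} hj
          high≤ : high (bracket N) ℚ.≤ low (bracket N) ℚ.+ ε
          high≤ = ℚLemmas.≤-by (ε ℚ.- width (bracket N)) (ℚLemmas.0≤-diff wN)
            (solve 3 (λ l h e → l :+ e := h :+ (e :- (h :- l))) refl (low (bracket N)) (high (bracket N)) ε)
          i≤lj = ℚ.≤-trans (ℚ.≤-trans ui high≤) (ℚ.+-monoˡ-≤ ε lj)
      in ℚ.≤-trans i≤lj (ℚ.+-monoˡ-≤ ε (low≤high (bracket j))) , i≤lj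

    abstract
      high-cauchy : IsCauchy (λ i → high (bracket i))
      high-cauchy ε 0<ε = let N , h = high-close ε 0<ε in
        N , λ i j hi hj → ≤⇒∣-∣≤ (proj₁ (h i j hi hj)) (proj₁ (h j i hj hi))

      low-cauchy : IsCauchy (λ i → low (bracket i))
      low-cauchy ε 0<ε = let N , h = high-close ε 0<ε in
        N , λ i j hi hj → ≤⇒∣-∣≤ (ℚ.≤-trans (low≤high (bracket i)) (proj₂ (h i j hi hj))) (ℚ.≤-trans (low≤high (bracket j)) (proj₂ (h j i hj hi)))

    root low-root : ℝ
    root     = mkℝ (λ i → high (bracket i)) high-cauchy
    low-root = mkℝ (λ i → low (bracket i)) low-cauchy

    root≈low-root : root ≈ᴿ low-root
    root≈low-root ε 0<ε = let N , h = high-close ε 0<ε in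
      N , λ i hi → ≤⇒∣-∣≤ (proj₂ (h i i hi hi))
        (ℚ.≤-trans (low≤high (bracket i)) (ℚLemmas.≤-by ε (ℚ.<⇒≤ 0<ε) refl))

  -- The upper and the lower ends of the brackets represent the same real, and P is ≥ 0 along the
  -- one and ≤ 0 along the other. The representative by upper ends is returned because the root will
  -- be approached through rationals at which P is nonnegative.
  poly-root : ∀ P a b → a ℚ.≤ b → ⟦ P ⟧ a ℚ.≤ 0ℚ → 0ℚ ℚ.≤ ⟦ P ⟧ b →
    ∃ λ x → evalᴿ P x ≈ᴿ 0ᴿ × (∀ i → a ℚ.≤ seq x i × 0ℚ ℚ.≤ ⟦ P ⟧ (seq x i))
  poly-root P a b a≤b Pa≤0 0≤Pb = root
    , ≤-antisym {evalᴿ P root} {0ᴿ}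
        (≤-trans {evalᴿ P root} {evalᴿ P low-root} {0ᴿ}
          (≤-reflexive {evalᴿ P root} {evalᴿ P low-root} (evalᴿ-cong P {root} {low-root} root≈low-root))
          (pointwise-≤ {evalᴿ P low-root} {0ᴿ} (always λ i → subst (ℚ._≤ 0ℚ) (sym (seq-evalᴿ P low-root i)) (P-low (bracket i)))))
        (pointwise-≤ {0ᴿ} {evalᴿ P root} (always λ i → subst (0ℚ ℚ.≤_) (sym (seq-evalᴿ P root i)) (P-high (bracket i))))
    , λ i → ℚ.≤-trans (a≤low (bracket i)) (low≤high (bracket i)) , P-high (bracket i)
    where
    open Bisection ⟦ P ⟧ a b a≤b Pa≤0 0≤Pb
    open RealProperties

  fromℕℚ-+ : ∀ a b → fromℕℚ (a ℕ.+ b) ≡ fromℕℚ a ℚ.+ fromℕℚ b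
  fromℕℚ-+ zero    b = sym (ℚ.+-identityˡ (fromℕℚ b))
  fromℕℚ-+ (suc a) b = trans (cong (1ℚ ℚ.+_) (fromℕℚ-+ a b)) (sym (ℚ.+-assoc 1ℚ (fromℕℚ a) (fromℕℚ b)))

  fromℕℚ-* : ∀ a b → fromℕℚ (a ℕ.* b) ≡ fromℕℚ a ℚ.* fromℕℚ b
  fromℕℚ-* zero    b = sym (ℚ.*-zeroˡ (fromℕℚ b))
  fromℕℚ-* (suc a) b = trans (fromℕℚ-+ b (a ℕ.* b)) (trans (cong (fromℕℚ b ℚ.+_) (fromℕℚ-* a b))
    (solve 2 (λ a b → b :+ a :* b := (con 1ℚ :+ a) :* b) refl (fromℕℚ a) (fromℕℚ b)))
    where open +-*-Solver using (solve; _:=_; _:+_; _:*_; _:-_; :-_; con)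

  fromℕℚ-mono : ∀ {a b} → a ℕ.≤ b → fromℕℚ a ℚ.≤ fromℕℚ b
  fromℕℚ-mono {b = b} ℕ.z≤n = 0≤fromℕℚ b
  fromℕℚ-mono (ℕ.s≤s h) = ℚ.+-monoʳ-≤ 1ℚ (fromℕℚ-mono h)

  -- Up to powers of X, the entries of a positive vector on a loose path that satisfies the
  -- eigenvalue equation for n + 1 times the adjacency matrix and the eigenvalue X − 1 at every
  -- vertex but one end: G j at the j-th vertex from the other end and H j at the n other
  -- vertices of the edge above it, whose entries add up to K (j + 1).
  module PathPolynomials (n : ℕ) where
    N : Poly
    N = const (fromℕℚ n)

    Gᵖ Hᵖ Kᵖ : ℕ → Poly
    Gᵖ zero    = const 1ℚ
    Gᵖ (suc j) = (X ⊕ ⊝ N) ⊗ Hᵖ j ⊕ ⊝ (X ⊗ Gᵖ j)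
    Hᵖ j       = (X ⊕ const 1ℚ) ⊗ Gᵖ j ⊕ ⊝ (Kᵖ j)
    Kᵖ zero    = const 1ℚ
    Kᵖ (suc j) = X ⊗ Hᵖ j

    -- Vanishes when the equation also holds at a vertex that carries c pendant edges and the
    -- ends of loose paths of lengths p and p + 1.
    broomPoly : (p c : ℕ) → Poly
    broomPoly p c =
      (X ⊕ const (fromℕℚ c) ⊕ const 1ℚ) ⊗ ((X ⊕ ⊝ N ⊕ ⊝ const 1ℚ) ⊗ (Gᵖ p ⊗ Gᵖ (suc p)))
      ⊕ ⊝ ((X ⊕ ⊝ N ⊕ ⊝ const 1ℚ) ⊗ (Gᵖ (suc p) ⊗ Kᵖ p ⊕ Gᵖ p ⊗ Kᵖ (suc p)))
      ⊕ ⊝ (const (fromℕℚ c) ⊗ (X ⊗ (Gᵖ p ⊗ Gᵖ (suc p))))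

    4ℚ : ℚ
    4ℚ = fromℕℚ 4

    0≤1ℚ : 0ℚ ℚ.≤ 1ℚ
    0≤1ℚ = toWitness {a? = 0ℚ ℚ.≤? 1ℚ} _

    0≤4ℚ : 0ℚ ℚ.≤ 4ℚ
    0≤4ℚ = toWitness {a? = 0ℚ ℚ.≤? 4ℚ} _

    -- Since X - 1 is the eigenvalue of rA and r = n + 1, this is the threshold r + 2 shifted by
    -- one.
    lowest : ℚ
    lowest = fromℕℚ n ℚ.+ 4ℚ

    module At (s : ℚ) (low : lowest ℚ.≤ s) where
      open +-*-Solver using (solve; _:=_; _:+_; _:*_; _:-_; :-_; con)

      N′ a 2ℚ : ℚ
      N′ = fromℕℚ n
      a = s ℚ.- N′
      2ℚ = 1ℚ ℚ.+ 1ℚ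

      G H K : ℕ → ℚ
      G j = ⟦ Gᵖ j ⟧ s
      H j = ⟦ Hᵖ j ⟧ s
      K j = ⟦ Kᵖ j ⟧ s

      0≤N : 0ℚ ℚ.≤ N′
      0≤N = 0≤fromℕℚ n

      0≤a-4 : 0ℚ ℚ.≤ a ℚ.- 4ℚ
      0≤a-4 = subst (0ℚ ℚ.≤_) (solve 3 (λ s N f → s :- (N :+ f) := (s :- N) :- f) refl s N′ 4ℚ) (ℚLemmas.0≤-diff low)

      0≤s : 0ℚ ℚ.≤ s
      0≤s = ℚ.≤-trans (ℚLemmas.+-nonNeg 0≤N 0≤4ℚ) low

      0<s : 0ℚ ℚ.< s
      0<s = ℚ.<-≤-trans (ℚ.<-≤-trans (toWitness {a? = 0ℚ ℚ.<? 4ℚ} _) (ℚLemmas.≤-by N′ 0≤N (ℚ.+-comm N′ 4ℚ))) low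

      0<a : 0ℚ ℚ.< a
      0<a = ℚ.<-≤-trans (toWitness {a? = 0ℚ ℚ.<? 4ℚ} _) (ℚLemmas.≤-by (a ℚ.- 4ℚ) 0≤a-4 (solve 2 (λ a f → a := f :+ (a :- f)) refl a 4ℚ))

      0<a-1 : 0ℚ ℚ.< a ℚ.- 1ℚ
      0<a-1 = ℚ.<-≤-trans (toWitness {a? = 0ℚ ℚ.<? 4ℚ ℚ.- 1ℚ} _) (ℚLemmas.≤-by (a ℚ.- 4ℚ) 0≤a-4 (solve 1 (λ a → a :- con 1ℚ := (con 4ℚ :- con 1ℚ) :+ (a :- con 4ℚ)) refl a))

      -- The last field says K/G ≤ 2s/a. For a ≥ 4 it implies a H ≥ (2s + 4) G, hence H > 0, and in
      -- the next step G does not decrease and the same bound for K/G returns.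
      record Growth (j : ℕ) : Set where
        field
          1≤G   : 1ℚ ℚ.≤ G j
          G≤K   : G j ℚ.≤ K j
          aK≤2sG : a ℚ.* K j ℚ.≤ 2ℚ ℚ.* s ℚ.* G j

        0≤G : 0ℚ ℚ.≤ G j
        0≤G = ℚ.≤-trans 0≤1ℚ 1≤G

        aH≥ : (2ℚ ℚ.* s ℚ.+ 4ℚ) ℚ.* G j ℚ.≤ a ℚ.* H j
        aH≥ = ℚLemmas.≤-by ((a ℚ.- 4ℚ) ℚ.* ((s ℚ.+ 1ℚ) ℚ.* G j) ℚ.+ (2ℚ ℚ.* s ℚ.* G j ℚ.- a ℚ.* K j))
          (ℚLemmas.+-nonNeg (ℚLemmas.*-nonNeg 0≤a-4 (ℚLemmas.*-nonNeg (ℚLemmas.+-nonNeg 0≤s 0≤1ℚ) 0≤G)) (ℚLemmas.0≤-diff aK≤2sG))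
          (solve 4 (λ a s G K → a :* ((s :+ con 1ℚ) :* G :+ :- K) :=
             (con 2ℚ :* s :+ con 4ℚ) :* G :+ ((a :- con 4ℚ) :* ((s :+ con 1ℚ) :* G) :+ (con 2ℚ :* s :* G :- a :* K))) refl a s (G j) (K j))

        0<H : 0ℚ ℚ.< H j
        0<H = ℚ.*-cancelˡ-<-nonNeg a {{ℚ.nonNegative (ℚ.<⇒≤ 0<a)}}
          (subst (ℚ._< a ℚ.* H j) (sym (ℚ.*-zeroʳ a)) (ℚ.<-≤-trans (ℚLemmas.*-pos 0<2s+4 0<G) aH≥))
          where
          0<G : 0ℚ ℚ.< G j
          0<G = ℚ.<-≤-trans (toWitness {a? = 0ℚ ℚ.<? 1ℚ} _) 1≤G
          0<2s+4 : 0ℚ ℚ.< 2ℚ ℚ.* s ℚ.+ 4ℚ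
          0<2s+4 = ℚ.<-≤-trans (toWitness {a? = 0ℚ ℚ.<? 4ℚ} _)
            (ℚLemmas.≤-by (2ℚ ℚ.* s) (ℚLemmas.*-nonNeg (toWitness {a? = 0ℚ ℚ.≤? 2ℚ} _) 0≤s) (ℚ.+-comm (2ℚ ℚ.* s) 4ℚ))

      growth : ∀ j → Growth j
      growth zero = record
        { 1≤G = ℚ.≤-refl
        ; G≤K = ℚ.≤-refl
        ; aK≤2sG = ℚLemmas.≤-by (s ℚ.+ N′) (ℚLemmas.+-nonNeg 0≤s 0≤N)
            (solve 2 (λ s N → con 2ℚ :* s :* con 1ℚ := (s :- N) :* con 1ℚ :+ (s :+ N)) refl s N′) }
      growth (suc j) = record
        { 1≤G = ℚ.≤-trans 1≤G G≤G′
        ; G≤K = ℚLemmas.≤-by (N′ ℚ.* H j ℚ.+ s ℚ.* G j) (ℚLemmas.+-nonNeg (ℚLemmas.*-nonNeg 0≤N (ℚ.<⇒≤ 0<H)) (ℚLemmas.*-nonNeg 0≤s 0≤G))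
            (solve 4 (λ s N G H → s :* H := ((s :+ :- N) :* H :+ :- (s :* G)) :+ (N :* H :+ s :* G)) refl s N′ (G j) (H j))
        ; aK≤2sG = ℚLemmas.≤-by (s ℚ.* ((a ℚ.* H j ℚ.- (2ℚ ℚ.* s ℚ.+ 4ℚ) ℚ.* G j) ℚ.+ 4ℚ ℚ.* G j))
            (ℚLemmas.*-nonNeg 0≤s (ℚLemmas.+-nonNeg (ℚLemmas.0≤-diff aH≥) (ℚLemmas.*-nonNeg 0≤4ℚ 0≤G)))
            (solve 4 (λ a s G H → con 2ℚ :* s :* (a :* H :+ :- (s :* G)) := a :* (s :* H) :+ s :* ((a :* H :- (con 2ℚ :* s :+ con 4ℚ) :* G) :+ con 4ℚ :* G)) refl a s (G j) (H j))
        }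
        where
        open Growth (growth j)
        G≤G′ : G j ℚ.≤ G (suc j)
        G≤G′ = ℚLemmas.≤-by ((a ℚ.* H j ℚ.- (2ℚ ℚ.* s ℚ.+ 4ℚ) ℚ.* G j) ℚ.+ (s ℚ.+ (4ℚ ℚ.- 1ℚ)) ℚ.* G j)
          (ℚLemmas.+-nonNeg (ℚLemmas.0≤-diff aH≥) (ℚLemmas.*-nonNeg (ℚLemmas.+-nonNeg 0≤s (toWitness {a? = 0ℚ ℚ.≤? 4ℚ ℚ.- 1ℚ} _)) 0≤G))
          (solve 4 (λ a s G H → a :* H :+ :- (s :* G) := G :+ ((a :* H :- (con 2ℚ :* s :+ con 4ℚ) :* G) :+ (s :+ (con 4ℚ :- con 1ℚ)) :* G)) refl a s (G j) (H j))

      0<G : ∀ j → 0ℚ ℚ.< G j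
      0<G j = ℚ.<-≤-trans (toWitness {a? = 0ℚ ℚ.<? 1ℚ} _) (Growth.1≤G (growth j))

      -- A branch contributes at least as much as a pendant edge.
      sG≤[a-1]K : ∀ j → s ℚ.* G (suc j) ℚ.≤ (a ℚ.- 1ℚ) ℚ.* K (suc j)
      sG≤[a-1]K j = ℚLemmas.≤-by (s ℚ.* (K j ℚ.- G j)) (ℚLemmas.*-nonNeg 0≤s (ℚLemmas.0≤-diff (Growth.G≤K (growth j))))
        (solve 4 (λ a s G K → (a :- con 1ℚ) :* (s :* ((s :+ con 1ℚ) :* G :+ :- K)) :=
          s :* (a :* ((s :+ con 1ℚ) :* G :+ :- K) :+ :- (s :* G)) :+ s :* (K :- G)) refl a s (G j) (K j))

      -- κ j - 1 is what a path of j edges contributes at the vertex from which it hangs.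
      κ : ℕ → ℚ
      κ j = K j ℚ.* proj₁ (inverse (0<G j))

      κG : ∀ j → κ j ℚ.* G j ≡ K j
      κG j = trans (ℚ.*-assoc (K j) _ (G j)) (trans (cong (K j ℚ.*_) (proj₂ (proj₂ (inverse (0<G j))))) (ℚ.*-identityʳ (K j)))

      κ₀ : κ 0 ≡ 1ℚ
      κ₀ = trans (sym (ℚ.*-identityʳ (κ 0))) (κG 0)

      -- The entries of the path eigenvector on one edge. Consecutive levels differ by a power of s,
      -- hence the factor s at the lower vertex; the sum over the edge is then K (j + 1).
      weights : ∀ j → EdgeWeights n (s ℚ.- 1ℚ) (κ (suc j)) (κ j)
      weights j = record
        { G = G (suc j) ; C = s ℚ.* G j ; H = H j
        ; 0<G = 0<G (suc j) ; 0<C = ℚLemmas.*-pos 0<s (0<G j) ; 0<H = Growth.0<H (growth j)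
        ; total = K (suc j)
        ; total≡ = solve 4 (λ s N G H → s :* H := ((s :+ :- N) :* H :+ :- (s :* G)) :+ s :* G :+ N :* H) refl s N′ (G j) (H j)
        ; upper = κG (suc j)
        ; lower = trans (solve 3 (λ s k G → (s :- con 1ℚ :+ con 1ℚ :+ con 1ℚ :- k) :* (s :* G) := s :* ((s :+ con 1ℚ) :* G :+ :- (k :* G))) refl s (κ j) (G j))
                    (cong (λ u → s ℚ.* ((s ℚ.+ 1ℚ) ℚ.* G j ℚ.+ ℚ.- u)) (κG j))
        ; other = solve 2 (λ s H → (s :- con 1ℚ :+ con 1ℚ) :* H := s :* H) refl s (H j)
        }

      κ₁ : κ 1 ℚ.* (a ℚ.- 1ℚ) ≡ s
      κ₁ = ℚ-cancel (trans (solve 3 (λ k s N → (k :* ((s :- N) :- con 1ℚ)) :* s := k :* ((s :+ :- N) :* ((s :+ con 1ℚ) :* con 1ℚ :+ :- con 1ℚ) :+ :- (s :* con 1ℚ))) refl (κ 1) s N′)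
          (trans (κG 1) (solve 1 (λ s → s :* ((s :+ con 1ℚ) :* con 1ℚ :+ :- con 1ℚ) := s :* s) refl s)))
        where
        ℚ-cancel : ∀ {x y} → x ℚ.* s ≡ y ℚ.* s → x ≡ y
        ℚ-cancel h = ℚ.≤-antisym (ℚ.*-cancelʳ-≤-pos s {{ℚ.positive 0<s}} (ℚ.≤-reflexive h)) (ℚ.*-cancelʳ-≤-pos s {{ℚ.positive 0<s}} (ℚ.≤-reflexive (sym h)))

      -- The polynomial is the slack d of this inequality multiplied by the positive denominator D,
      -- so both have the same sign.
      broom-condition : ∀ p c → 0ℚ ℚ.≤ ⟦ broomPoly p c ⟧ s →
        (κ (suc p) ℚ.- 1ℚ) ℚ.+ (κ p ℚ.- 1ℚ) ℚ.+ fromℕℚ c ℚ.* (κ 1 ℚ.- 1ℚ) ℚ.≤ s ℚ.- 1ℚ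
      broom-condition p c 0≤P = ℚLemmas.≤-by _ 0≤d
        (solve 5 (λ s k l m c → s :- con 1ℚ := ((l :- con 1ℚ) :+ (k :- con 1ℚ) :+ c :* (m :- con 1ℚ)) :+ (s :+ c :+ con 1ℚ :- (k :+ l) :- c :* m))
          refl s (κ p) (κ (suc p)) (κ 1) c′)
        where
        c′ = fromℕℚ c
        D d : ℚ
        D = (a ℚ.- 1ℚ) ℚ.* (G p ℚ.* G (suc p))
        d = s ℚ.+ c′ ℚ.+ 1ℚ ℚ.- (κ p ℚ.+ κ (suc p)) ℚ.- c′ ℚ.* κ 1
        P≡ : ⟦ broomPoly p c ⟧ s ≡ D ℚ.* d
        -- K p, K (p + 1) and the last factor s are expressed through κ, after which D can be
        -- factored out.
        P≡ = trans (cong₅ (sym (κG p)) (sym (κG (suc p))) (sym κ₁))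
          (solve 8 (λ s c N g h k l m → (s :+ c :+ con 1ℚ) :* ((s :+ :- N :+ :- con 1ℚ) :* (g :* h)) :+ :- ((s :+ :- N :+ :- con 1ℚ) :* (h :* (k :* g) :+ g :* (l :* h)))
               :+ :- (c :* ((m :* ((s :- N) :- con 1ℚ)) :* (g :* h)))
            := ((s :- N) :- con 1ℚ) :* (g :* h) :* (s :+ c :+ con 1ℚ :- (k :+ l) :- c :* m)) refl s c′ N′ (G p) (G (suc p)) (κ p) (κ (suc p)) (κ 1))
          where
          cong₅ : ∀ {k k′ l l′ t t′} → k ≡ k′ → l ≡ l′ → t ≡ t′ →
            (s ℚ.+ c′ ℚ.+ 1ℚ) ℚ.* ((s ℚ.+ ℚ.- N′ ℚ.+ ℚ.- 1ℚ) ℚ.* (G p ℚ.* G (suc p))) ℚ.+ ℚ.- ((s ℚ.+ ℚ.- N′ ℚ.+ ℚ.- 1ℚ) ℚ.* (G (suc p) ℚ.* k ℚ.+ G p ℚ.* l)) ℚ.+ ℚ.- (c′ ℚ.* (t ℚ.* (G p ℚ.* G (suc p)))) ≡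
            (s ℚ.+ c′ ℚ.+ 1ℚ) ℚ.* ((s ℚ.+ ℚ.- N′ ℚ.+ ℚ.- 1ℚ) ℚ.* (G p ℚ.* G (suc p))) ℚ.+ ℚ.- ((s ℚ.+ ℚ.- N′ ℚ.+ ℚ.- 1ℚ) ℚ.* (G (suc p) ℚ.* k′ ℚ.+ G p ℚ.* l′)) ℚ.+ ℚ.- (c′ ℚ.* (t′ ℚ.* (G p ℚ.* G (suc p))))
          cong₅ refl refl refl = refl
        0≤d : 0ℚ ℚ.≤ d
        0≤d = ℚ.*-cancelˡ-≤-pos D {{ℚ.positive (ℚLemmas.*-pos 0<a-1 (ℚLemmas.*-pos (0<G p) (0<G (suc p))))}}
          (subst (ℚ._≤ D ℚ.* d) (sym (ℚ.*-zeroʳ D)) (subst (0ℚ ℚ.≤_) P≡ 0≤P))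

    -- Here a = 4, and `sG≤[a-1]K` replaces each arm by a pendant edge. The c + 1 attached edges and
    -- the two substitutes then give the upper bound G G′ (6 - c r).
    broom-lowest : ∀ p c → 6 ℕ.≤ c ℕ.* suc n → ⟦ broomPoly (suc p) (suc c) ⟧ lowest ℚ.≤ 0ℚ
    broom-lowest p c 6≤cr = ℚLemmas.≤-by
        ((GG ℚ.* (c′ ℚ.* r ℚ.- 6ℚ)) ℚ.+
          (G (suc (suc p)) ℚ.* ((a ℚ.- 1ℚ) ℚ.* K (suc p) ℚ.- s ℚ.* G (suc p)) ℚ.+ G (suc p) ℚ.* ((a ℚ.- 1ℚ) ℚ.* K (suc (suc p)) ℚ.- s ℚ.* G (suc (suc p)))))
        (ℚLemmas.+-nonNeg (ℚLemmas.*-nonNeg (ℚLemmas.*-nonNeg (0≤G (suc p)) (0≤G (suc (suc p)))) (ℚLemmas.0≤-diff 6≤cr′))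
          (ℚLemmas.+-nonNeg (ℚLemmas.*-nonNeg (0≤G (suc (suc p))) (ℚLemmas.0≤-diff (sG≤[a-1]K p))) (ℚLemmas.*-nonNeg (0≤G (suc p)) (ℚLemmas.0≤-diff (sG≤[a-1]K (suc p))))))
        (solve 6 (λ c N g h k l →
            con 0ℚ := ((N :+ con 4ℚ) :+ (con 1ℚ :+ c) :+ con 1ℚ) :* (((N :+ con 4ℚ) :+ :- N :+ :- con 1ℚ) :* (g :* h))
              :+ :- (((N :+ con 4ℚ) :+ :- N :+ :- con 1ℚ) :* (h :* k :+ g :* l))
              :+ :- ((con 1ℚ :+ c) :* ((N :+ con 4ℚ) :* (g :* h)))
            :+ (g :* h :* (c :* (con 1ℚ :+ N) :- con 6ℚ)
               :+ (h :* (((N :+ con 4ℚ) :- N :- con 1ℚ) :* k :- (N :+ con 4ℚ) :* g)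
                 :+ g :* (((N :+ con 4ℚ) :- N :- con 1ℚ) :* l :- (N :+ con 4ℚ) :* h))))
          refl c′ N′ (G (suc p)) (G (suc (suc p))) (K (suc p)) (K (suc (suc p))))
      where
      open +-*-Solver using (solve; _:=_; _:+_; _:*_; _:-_; :-_; con)
      open At lowest ℚ.≤-refl using (G; K; a; N′; sG≤[a-1]K; 0<G)
      s = lowest
      6ℚ = fromℕℚ 6
      c′ = fromℕℚ c
      r = fromℕℚ (suc n)
      GG = G (suc p) ℚ.* G (suc (suc p))
      0≤G : ∀ j → 0ℚ ℚ.≤ G j
      0≤G j = ℚ.<⇒≤ (0<G j)
      6≤cr′ : 6ℚ ℚ.≤ c′ ℚ.* r
      6≤cr′ = subst (6ℚ ℚ.≤_) (fromℕℚ-* c (suc n)) (fromℕℚ-mono 6≤cr)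

    -- Chosen so that, after K/G ≤ 2s/a is used for both arms, the remaining terms combine to r (c +
    -- 1)(s - 1) G G′.
    highest : ℕ → ℚ
    highest c = lowest ℚ.+ fromℕℚ (suc n) ℚ.* (fromℕℚ c ℚ.+ 1ℚ)

    lowest≤highest : ∀ c → lowest ℚ.≤ highest c
    lowest≤highest c = ℚLemmas.≤-by _ (ℚLemmas.*-nonNeg (0≤fromℕℚ (suc n)) (ℚLemmas.+-nonNeg (0≤fromℕℚ c) 0≤1ℚ)) refl

    broom-highest : ∀ p c → 0ℚ ℚ.≤ ⟦ broomPoly p c ⟧ (highest c)
    broom-highest p c = subst (0ℚ ℚ.≤_) eq
      (ℚLemmas.+-nonNeg (ℚLemmas.*-nonNeg (ℚLemmas.*-nonNeg (0≤G p) (0≤G (suc p))) (ℚLemmas.*-nonNeg 0≤s-1 (ℚLemmas.*-nonNeg (0≤fromℕℚ (suc n)) (ℚLemmas.+-nonNeg (0≤fromℕℚ c) 0≤1ℚ))))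
        (ℚLemmas.+-nonNeg (ℚLemmas.+-nonNeg (ℚLemmas.*-nonNeg (0≤G (suc p)) (ℚLemmas.0≤-diff (Growth.aK≤2sG (growth p)))) (ℚLemmas.*-nonNeg (0≤G p) (ℚLemmas.0≤-diff (Growth.aK≤2sG (growth (suc p))))))
          (ℚLemmas.+-nonNeg (ℚLemmas.*-nonNeg (0≤G (suc p)) (0≤K p)) (ℚLemmas.*-nonNeg (0≤G p) (0≤K (suc p))))))
      where
      open +-*-Solver using (solve; _:=_; _:+_; _:*_; _:-_; :-_; con)
      open At (highest c) (lowest≤highest c)
      c′ = fromℕℚ c
      s = highest c
      0≤G : ∀ j → 0ℚ ℚ.≤ G j
      0≤G j = ℚ.<⇒≤ (0<G j)
      0≤K : ∀ j → 0ℚ ℚ.≤ K j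
      0≤K j = ℚ.≤-trans (0≤G j) (Growth.G≤K (growth j))
      0≤s-1 : 0ℚ ℚ.≤ s ℚ.- 1ℚ
      0≤s-1 = ℚLemmas.0≤-diff (ℚ.≤-trans (ℚ.≤-trans (toWitness {a? = 1ℚ ℚ.≤? 4ℚ} _) (ℚLemmas.≤-by N′ 0≤N (ℚ.+-comm N′ 4ℚ))) (lowest≤highest c))
      eq : (G p ℚ.* G (suc p)) ℚ.* ((s ℚ.- 1ℚ) ℚ.* (fromℕℚ (suc n) ℚ.* (c′ ℚ.+ 1ℚ)))
         ℚ.+ ((G (suc p) ℚ.* (2ℚ ℚ.* s ℚ.* G p ℚ.- a ℚ.* K p) ℚ.+ G p ℚ.* (2ℚ ℚ.* s ℚ.* G (suc p) ℚ.- a ℚ.* K (suc p)))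
         ℚ.+ (G (suc p) ℚ.* K p ℚ.+ G p ℚ.* K (suc p))) ≡ ⟦ broomPoly p c ⟧ (highest c)
      eq = solve 6 (λ c N g h k l →
          let r = con 1ℚ :+ N
              s = (N :+ con 4ℚ) :+ r :* (c :+ con 1ℚ) in
          (g :* h) :* ((s :- con 1ℚ) :* (r :* (c :+ con 1ℚ))) :+ ((h :* (con 2ℚ :* s :* g :- (s :- N) :* k) :+ g :* (con 2ℚ :* s :* h :- (s :- N) :* l)) :+ (h :* k :+ g :* l))
          := (s :+ c :+ con 1ℚ) :* ((s :+ :- N :+ :- con 1ℚ) :* (g :* h)) :+ :- ((s :+ :- N :+ :- con 1ℚ) :* (h :* k :+ g :* l)) :+ :- (c :* (s :* (g :* h))))
        refl c′ N′ (G p) (G (suc p)) (K p) (K (suc p))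

open Polynomials

-- Rooting a hypertree and sorting its edges along a longest path

module Trees where
  open import Data.Bool using (true; false)
  open import Data.Empty using (⊥; ⊥-elim)
  open import Data.Fin using (Fin; toℕ; fromℕ; inject₁) renaming (zero to fzero; suc to fsuc)
  open import Data.Fin.Permutation.Components using (transpose; transpose-inverse)
  import Data.Fin.Properties as Fin
  open import Data.Fin.Relation.Unary.Top using (view; ‵fromℕ; ‵inject₁)
  open import Data.Fin.Subset using (Subset; _∩_; ∣_∣; ⁅_⁆; Empty) renaming (_∈_ to _∈ˢ_)
  open import Data.Fin.Subset.Properties using (_∈?_; x∈⁅x⁆; x∈⁅y⁆⇒x≡y; x∈p∩q⁺; x∈p∩q⁻; ⊆-antisym)
  open import Data.List using (List; []; _∷_; _++_; length; allFin; tabulate; lookup)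
  open import Data.List.Membership.Propositional using (_∈_)
  open import Data.List.Membership.Propositional.Properties using (∈-∃++; ∈-allFin)
  import Data.List.Properties as List
  open import Data.List.Relation.Binary.Permutation.Propositional using (_↭_; ↭-refl; ↭-sym; ↭-trans; prep)
  open import Data.List.Relation.Binary.Permutation.Propositional.Properties using (shift; ∈-resp-↭; ++⁺ʳ; ↭-length)
  import Data.List.Relation.Unary.All as All
  open import Data.List.Relation.Unary.All using (All; []; _∷_)
  open import Data.List.Relation.Unary.AllPairs using ([]; _∷_)
  open import Data.List.Relation.Unary.Any using (here; there)
  open import Data.List.Relation.Unary.Unique.Propositional using (Unique)
  open import Data.List.Relation.Unary.Unique.Propositional.Properties using (tabulate⁺)
  import Data.Nat as ℕ
  open import Data.Nat using (ℕ; zero; suc; _≤_; _<_; s≤s; z≤n)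
  import Data.Nat.DivMod as ℕ
  open import Data.Nat.Induction using (<-rec)
  import Data.Nat.Properties as ℕ
  open import Data.Product using (∃; ∃₂; _×_; _,_; proj₁; proj₂)
  open import Data.Sum using (_⊎_; inj₁; inj₂)
  open import Data.Unit using (⊤; tt)
  import Data.Vec as Vec
  open import Data.Vec using ([]; _∷_; here; there)
  open import Data.Vec.Properties using (lookup∘tabulate; lookup⇒[]=; []=⇒lookup)
  open import Defs hiding (_≈_; bounded)
  open import Function using (Injective)
  open import Relation.Binary.Definitions using (tri<; tri≈; tri>)
  open import Relation.Binary.PropositionalEquality using (_≡_; _≢_; refl; sym; trans; cong; subst)
  open import Relation.Nullary using (¬_; Dec; yes; no)
  open import Relation.Nullary.Decidable using (_×-dec_; ¬?; map′; dec-true; dec-false)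

  enum : ∀ {n} (p : Subset n) → Fin ∣ p ∣ → Fin n
  enum (true  ∷ p) fzero    = fzero
  enum (true  ∷ p) (fsuc i) = fsuc (enum p i)
  enum (false ∷ p) i        = fsuc (enum p i)

  enum∈ : ∀ {n} (p : Subset n) i → enum p i ∈ˢ p
  enum∈ (true  ∷ p) fzero    = here
  enum∈ (true  ∷ p) (fsuc i) = there (enum∈ p i)
  enum∈ (false ∷ p) i        = there (enum∈ p i)

  enum-injective : ∀ {n} (p : Subset n) → Injective _≡_ _≡_ (enum p)
  enum-injective (true  ∷ p) {fzero}  {fzero}  _  = refl
  enum-injective (true  ∷ p) {fsuc i} {fsuc j} eq = cong fsuc (enum-injective p (Fin.suc-injective eq))
  enum-injective (false ∷ p) eq = enum-injective p (Fin.suc-injective eq)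

  enum-surjective : ∀ {n} (p : Subset n) {x} → x ∈ˢ p → ∃ λ i → enum p i ≡ x
  enum-surjective (true  ∷ p) here        = fzero , refl
  enum-surjective (true  ∷ p) (there x∈p) = let i , eq = enum-surjective p x∈p in fsuc i , cong fsuc eq
  enum-surjective (false ∷ p) (there x∈p) = let i , eq = enum-surjective p x∈p in i , cong fsuc eq

  injection⇒≤∣∣ : ∀ {k n} (p : Subset n) (f : Fin k → Fin n) → Injective _≡_ _≡_ f → (∀ i → f i ∈ˢ p) → k ≤ ∣ p ∣
  injection⇒≤∣∣ p f inj f∈ = Fin.injective⇒≤ {f = λ i → proj₁ (enum-surjective p (f∈ i))}
    λ {i} {j} eq → inj (trans (sym (proj₂ (enum-surjective p (f∈ i)))) (trans (cong (enum p) eq) (proj₂ (enum-surjective p (f∈ j)))))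

  ∣∣≤1⇒≡ : ∀ {n} {p : Subset n} {x y} → ∣ p ∣ ≤ 1 → x ∈ˢ p → y ∈ˢ p → x ≡ y
  ∣∣≤1⇒≡ {p = p} {x} {y} h x∈p y∈p with x Fin.≟ y
  ... | yes x≡y = x≡y
  ... | no x≢y = ⊥-elim (ℕ.1+n≰n (ℕ.≤-trans (injection⇒≤∣∣ p f f-injective f∈) h))
    where
    f : Fin 2 → Fin _
    f fzero    = x
    f (fsuc _) = y
    f-injective : Injective _≡_ _≡_ f
    f-injective {fzero}  {fzero}  _  = refl
    f-injective {fzero}  {fsuc _} eq = ⊥-elim (x≢y eq)
    f-injective {fsuc _} {fzero}  eq = ⊥-elim (x≢y (sym eq))
    f-injective {fsuc fzero} {fsuc fzero} _ = refl
    f∈ : ∀ i → f i ∈ˢ p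
    f∈ fzero    = x∈p
    f∈ (fsuc _) = y∈p

  next-inject₁ : ∀ {n} (i : Fin n) → next (inject₁ i) ≡ fsuc i
  next-inject₁ {n} i = Fin.toℕ-injective (trans (Fin.toℕ-fromℕ< _)
    (trans (ℕ.m<n⇒m%n≡m (s≤s (subst (_< n) (sym (Fin.toℕ-inject₁ i)) (Fin.toℕ<n i)))) (cong suc (Fin.toℕ-inject₁ i))))

  next-fromℕ : ∀ n → next (fromℕ n) ≡ fzero
  next-fromℕ n = Fin.toℕ-injective (trans (Fin.toℕ-fromℕ< _)
    (trans (cong (λ k → suc k ℕ.% suc n) (Fin.toℕ-fromℕ n)) (ℕ.n%n≡0 (suc n))))

  module Walks (T : Hypergraph) where

    -- Repetitions are allowed, so walks can be cut and joined freely. The predicate A mostly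
    -- forbids one particular edge.
    data Walk (A : Edge T → Set) (w : Vertex T) : Vertex T → ℕ → Set where
      stop : Walk A w w 0
      step : ∀ {v x n} e → A e → v ∈ˢ edge T e → x ∈ˢ edge T e → Walk A w x n → Walk A w v (suc n)

    module _ {A : Edge T → Set} where

      vertexAt : ∀ {w v n} → Walk A w v n → Fin (suc n) → Vertex T
      vertexAt {v = v} W          fzero    = v
      vertexAt (step _ _ _ _ W) (fsuc i) = vertexAt W i

      edgeAt : ∀ {w v n} → Walk A w v n → Fin n → Edge T
      edgeAt (step e _ _ _ W) fzero    = e
      edgeAt (step e _ _ _ W) (fsuc i) = edgeAt W i

      allowedAt : ∀ {w v n} (W : Walk A w v n) i → A (edgeAt W i)
      allowedAt (step _ a _ _ W) fzero    = a
      allowedAt (step _ _ _ _ W) (fsuc i) = allowedAt W i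

      sourceAt : ∀ {w v n} (W : Walk A w v n) i → vertexAt W (inject₁ i) ∈ˢ edge T (edgeAt W i)
      sourceAt (step _ _ v∈e _ W) fzero    = v∈e
      sourceAt (step _ _ _ _ W)   (fsuc i) = sourceAt W i

      targetAt : ∀ {w v n} (W : Walk A w v n) i → vertexAt W (fsuc i) ∈ˢ edge T (edgeAt W i)
      targetAt (step _ _ _ x∈e W) fzero    = x∈e
      targetAt (step _ _ _ _ W)   (fsuc i) = targetAt W i

      lastAt : ∀ {w v n} (W : Walk A w v n) → vertexAt W (fromℕ n) ≡ w
      lastAt stop             = refl
      lastAt (step _ _ _ _ W) = lastAt W

      drop : ∀ {w v n} (W : Walk A w v n) (i : Fin (suc n)) → Walk A w (vertexAt W i) (n ℕ.∸ toℕ i)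
      drop W                fzero    = W
      drop (step _ _ _ _ W) (fsuc i) = drop W i

      take : ∀ {w v n} (W : Walk A w v n) (i : Fin (suc n)) → Walk A (vertexAt W i) v (toℕ i)
      take W                         fzero    = stop
      take (step e a v∈e x∈e W) (fsuc i) = step e a v∈e x∈e (take W i)

      append : ∀ {w v x m n} → Walk A w v m → Walk A x w n → Walk A x v (m ℕ.+ n)
      append stop                     V = V
      append (step e a v∈e x∈e W) V = step e a v∈e x∈e (append W V)

      reverse : ∀ {w v n} → Walk A w v n → Walk A v w n
      reverse stop = stop
      reverse {n = suc n} (step e a v∈e x∈e W) =
        subst (Walk A _ _) (ℕ.+-comm n 1) (append (reverse W) (step e a x∈e v∈e stop))

    map-walk : ∀ {A B : Edge T → Set} {w v n} (W : Walk A w v n) → (∀ i → B (edgeAt W i)) → Walk B w v n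
    map-walk stop                     h = stop
    map-walk (step e _ v∈e x∈e W) h = step e (h fzero) v∈e x∈e (map-walk W λ i → h (fsuc i))

    module Tree (linear : Linear T) (acyclic : ∀ l → ¬ LooseCycle T l) where

      meet-unique : ∀ {e f x y} → e ≢ f → x ∈ˢ edge T e → x ∈ˢ edge T f → y ∈ˢ edge T e → y ∈ˢ edge T f → x ≡ y
      meet-unique {e} {f} e≢f x∈e x∈f y∈e y∈f =
        ∣∣≤1⇒≡ (linear e f e≢f) (x∈p∩q⁺ (x∈e , x∈f)) (x∈p∩q⁺ (y∈e , y∈f))

      meet≡ : ∀ {e f x} → e ≢ f → x ∈ˢ edge T e → x ∈ˢ edge T f → edge T e ∩ edge T f ≡ ⁅ x ⁆
      meet≡ {e} {f} {x} e≢f x∈e x∈f = ⊆-antisym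
        (λ y∈ → let y∈e , y∈f = x∈p∩q⁻ (edge T e) (edge T f) y∈ in
          subst (_∈ˢ ⁅ x ⁆) (meet-unique e≢f x∈e x∈f y∈e y∈f) (x∈⁅x⁆ x))
        (λ y∈ → subst (_∈ˢ edge T e ∩ edge T f) (sym (x∈⁅y⁆⇒x≡y x y∈)) (x∈p∩q⁺ (x∈e , x∈f)))

      Detour : ℕ → Set
      Detour n = ∃ λ e → ∃₂ λ a b → a ≢ b × a ∈ˢ edge T e × b ∈ˢ edge T e × Walk (_≢ e) b a n

      -- A shortest detour closes up to a loose cycle.
      module Shortest {e a b n} (none : ∀ {m} → m < n → ¬ Detour m)
        (a≢b : a ≢ b) (a∈e : a ∈ˢ edge T e) (b∈e : b ∈ˢ edge T e) (W : Walk (_≢ e) b a n) where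

        short : ∀ {m x y} → m < n → x ≢ y → x ∈ˢ edge T e → y ∈ˢ edge T e → Walk (_≢ e) y x m → ⊥
        short m<n x≢y x∈e y∈e V = none m<n (e , _ , _ , x≢y , x∈e , y∈e , V)

        private
          jump : ∀ {k i j} → i ≤ j → j < n → k ≤ i → k ℕ.+ (n ℕ.∸ suc j) < n
          jump {k} {i} {j} i≤j j<n k≤i = ℕ.≤-trans (s≤s (ℕ.+-monoˡ-≤ (n ℕ.∸ suc j) (ℕ.≤-trans k≤i i≤j)))
            (ℕ.≤-reflexive (ℕ.m+[n∸m]≡n j<n))

        vertexAt-distinct : ∀ i j → toℕ i < toℕ j → vertexAt W i ≢ vertexAt W j
        vertexAt-distinct i j i<j eq = short
          (ℕ.≤-trans (ℕ.+-monoˡ-< (n ℕ.∸ toℕ j) i<j) (ℕ.≤-reflexive (ℕ.m+[n∸m]≡n (ℕ.≤-pred (Fin.toℕ<n j)))))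
          a≢b a∈e b∈e (append (take W i) (subst (λ x → Walk _ b x (n ℕ.∸ toℕ j)) (sym eq) (drop W j)))

        edgeAt-distinct : ∀ i j → toℕ i < toℕ j → edgeAt W i ≢ edgeAt W j
        edgeAt-distinct i j i<j eq = short
          (subst (_< n) (sym (ℕ.+-suc (toℕ (inject₁ i)) _)) (jump i<j (Fin.toℕ<n j) (s≤s (ℕ.≤-reflexive (Fin.toℕ-inject₁ i)))))
          a≢b a∈e b∈e (append (take W (inject₁ i))
            (step (edgeAt W j) (allowedAt W j) (subst (λ f → vertexAt W (inject₁ i) ∈ˢ edge T f) eq (sourceAt W i)) (targetAt W j) (drop W (fsuc j))))

        edgeAt-disjoint : ∀ i j {c} → suc (toℕ i) < toℕ j → c ∈ˢ edge T (edgeAt W i) → c ∈ˢ edge T (edgeAt W j) → ⊥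
        edgeAt-disjoint i j i+1<j c∈i c∈j = short
          (subst (_< n) (sym (trans (ℕ.+-suc (toℕ (inject₁ i)) _) (cong suc (ℕ.+-suc (toℕ (inject₁ i)) _))))
            (jump i+1<j (Fin.toℕ<n j) (s≤s (s≤s (ℕ.≤-reflexive (Fin.toℕ-inject₁ i))))))
          a≢b a∈e b∈e (append (take W (inject₁ i))
            (step (edgeAt W i) (allowedAt W i) (sourceAt W i) c∈i
            (step (edgeAt W j) (allowedAt W j) c∈j (targetAt W j) (drop W (fsuc j)))))

        inner-disjoint : ∀ i {c} → 0 < toℕ i → suc (toℕ i) < n → c ∈ˢ edge T e → c ∈ˢ edge T (edgeAt W i) → ⊥
        -- A common vertex c ≠ a lets the detour stop at c; if c = a, it can start with edge i.
        -- Either way it becomes shorter.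
        inner-disjoint i {c} 0<i i+1<n c∈e c∈i with c Fin.≟ a
        ... | no c≢a = short (subst (_< n) (sym (trans (ℕ.+-comm (toℕ (inject₁ i)) 1) (cong suc (Fin.toℕ-inject₁ i)))) i+1<n)
                (λ a≡c → c≢a (sym a≡c)) a∈e c∈e
                (append (take W (inject₁ i)) (step (edgeAt W i) (allowedAt W i) (sourceAt W i) c∈i stop))
        ... | yes refl = short (jump {1} 0<i (Fin.toℕ<n i) ℕ.≤-refl) a≢b a∈e b∈e
                (step (edgeAt W i) (allowedAt W i) c∈i (targetAt W i) (drop W (fsuc i)))

        -- A single edge from a to b would share two vertices with e. The closed walk thus has the
        -- three edges that a loose cycle requires.
        2≤n : ∀ {n} → Walk (_≢ e) b a n → 2 ≤ n
        2≤n stop = ⊥-elim (a≢b refl)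
        2≤n (step f f≢e a∈f b∈f stop) = ⊥-elim (a≢b (meet-unique f≢e a∈f a∈e b∈f b∈e))
        2≤n (step _ _ _ _ (step _ _ _ _ _)) = s≤s (s≤s z≤n)

        around : Fin (suc n) → Edge T
        around fzero    = e
        around (fsuc i) = edgeAt W i

        -- With e in position 0, the corner in each position is the vertex shared with the
        -- cyclically preceding edge, as `LooseCycle` prescribes.
        corner : Fin (suc n) → Vertex T
        corner fzero    = b
        corner (fsuc i) = vertexAt W (inject₁ i)

        around-injective : Injective _≡_ _≡_ around
        around-injective {fzero}  {fzero}  _  = refl
        around-injective {fzero}  {fsuc j} eq = ⊥-elim (allowedAt W j (sym eq))
        around-injective {fsuc i} {fzero}  eq = ⊥-elim (allowedAt W i eq)
        around-injective {fsuc i} {fsuc j} eq with ℕ.<-cmp (toℕ i) (toℕ j)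
        ... | tri< i<j _ _ = ⊥-elim (edgeAt-distinct i j i<j eq)
        ... | tri≈ _ i≡j _ = cong fsuc (Fin.toℕ-injective i≡j)
        ... | tri> _ _ j<i = ⊥-elim (edgeAt-distinct j i j<i (sym eq))

        vertexAt-injective : Injective _≡_ _≡_ (vertexAt W)
        vertexAt-injective {i} {j} eq with ℕ.<-cmp (toℕ i) (toℕ j)
        ... | tri< i<j _ _ = ⊥-elim (vertexAt-distinct i j i<j eq)
        ... | tri≈ _ i≡j _ = Fin.toℕ-injective i≡j
        ... | tri> _ _ j<i = ⊥-elim (vertexAt-distinct j i j<i (sym eq))

        corner-injective : Injective _≡_ _≡_ corner
        corner-injective {fzero}  {fzero}  _  = refl
        corner-injective {fzero}  {fsuc j} eq = ⊥-elim (Fin.fromℕ≢inject₁ {i = j} (vertexAt-injective (trans (lastAt W) eq)))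
        corner-injective {fsuc i} {fzero}  eq = ⊥-elim (Fin.fromℕ≢inject₁ {i = i} (vertexAt-injective (trans (lastAt W) (sym eq))))
        corner-injective {fsuc i} {fsuc j} eq = cong fsuc (Fin.inject₁-injective (vertexAt-injective eq))

        corner∈around : ∀ i → corner i ∈ˢ edge T (around i)
        corner∈around fzero    = b∈e
        corner∈around (fsuc i) = sourceAt W i

        corner-next∈around : ∀ i → corner (next i) ∈ˢ edge T (around i)
        corner-next∈around i with view i
        ... | ‵inject₁ j = subst (λ k → corner k ∈ˢ edge T (around (inject₁ j))) (sym (next-inject₁ j)) (corner-suc j)
          where
          corner-suc : ∀ j → vertexAt W (inject₁ j) ∈ˢ edge T (around (inject₁ j))
          corner-suc fzero    = a∈e
          corner-suc (fsuc j) = targetAt W (inject₁ j)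
        ... | ‵fromℕ = subst (λ k → corner k ∈ˢ edge T (around (fromℕ n))) (sym (next-fromℕ n)) (last-corner W refl refl)
          where
          last-corner : ∀ {m} (V : Walk (_≢ e) b a m) (eq : m ≡ n) → subst (Walk (_≢ e) b a) eq V ≡ W → b ∈ˢ edge T (around (fromℕ n))
          last-corner stop refl refl = b∈e
          last-corner {suc m} V@(step _ _ _ _ _) refl refl = subst (_∈ˢ edge T (edgeAt V (fromℕ m))) (lastAt V) (targetAt V (fromℕ m))

        next≢ : ∀ (i : Fin (suc n)) → next i ≢ i
        next≢ i eq with view i
        ... | ‵inject₁ j = ℕ.1+n≢n (trans (cong toℕ (trans (sym (next-inject₁ j)) eq)) (Fin.toℕ-inject₁ j))
        ... | ‵fromℕ = ℕ.<⇒≢ (ℕ.<-≤-trans (s≤s z≤n) (2≤n W)) (trans (cong toℕ (trans (sym (next-fromℕ n)) eq)) (Fin.toℕ-fromℕ n))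

        looseCycle : LooseCycle T (suc n)
        looseCycle = record
          { 3≤l = s≤s (2≤n W)
          ; vertex = corner
          ; around = around
          ; vertex-inj = corner-injective
          ; edge-inj = around-injective
          ; meet = λ i → meet≡ (λ eq → next≢ i (sym (around-injective eq))) (corner-next∈around i) (corner∈around (next i))
          ; disjoint = disjoint
          }
          where
          next-suc : ∀ (j : Fin n) {k : Fin (suc n)} → toℕ k ≡ suc (suc (toℕ j)) → next (fsuc j) ≡ k
          next-suc j {fsuc k} eq = trans (cong next (Fin.toℕ-injective (trans (sym (ℕ.suc-injective eq)) (sym (Fin.toℕ-inject₁ k))))) (next-inject₁ k)
          next-last : ∀ (j : Fin n) → suc (toℕ j) ≡ n → next (fsuc j) ≡ fzero
          next-last j eq = trans (cong next (Fin.toℕ-injective (trans eq (sym (Fin.toℕ-fromℕ n))))) (next-fromℕ n)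
          next-zero : ∀ (j : Fin n) → toℕ j ≡ 0 → next fzero ≡ fsuc j
          next-zero fzero _ = next-inject₁ fzero
          with-e : ∀ j → next fzero ≢ fsuc j → next (fsuc j) ≢ fzero → ∀ {c} → c ∈ˢ edge T e → c ∈ˢ edge T (edgeAt W j) → ⊥
          with-e j h k = inner-disjoint j (ℕ.n≢0⇒n>0 λ eq → h (next-zero j eq)) (ℕ.≤∧≢⇒< (Fin.toℕ<n j) λ eq → k (next-last j eq))
          disjoint : ∀ i j → i ≢ j → next i ≢ j → next j ≢ i → Empty (edge T (around i) ∩ edge T (around j))
          disjoint i j i≢j h k (c , c∈) with x∈p∩q⁻ (edge T (around i)) (edge T (around j)) c∈
          disjoint fzero    fzero    i≢j h k (c , c∈) | _ = i≢j refl
          disjoint fzero    (fsuc j) i≢j h k (c , c∈) | c∈i , c∈j = with-e j h k c∈i c∈j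
          disjoint (fsuc i) fzero    i≢j h k (c , c∈) | c∈i , c∈j = with-e i k h c∈j c∈i
          disjoint (fsuc i) (fsuc j) i≢j h k (c , c∈) | c∈i , c∈j with ℕ.<-cmp (toℕ i) (toℕ j)
          ... | tri< i<j _ _ = edgeAt-disjoint i j (ℕ.≤∧≢⇒< i<j λ eq → h (next-suc i (cong suc (sym eq)))) c∈i c∈j
          ... | tri≈ _ i≡j _ = i≢j (cong fsuc (Fin.toℕ-injective i≡j))
          ... | tri> _ _ j<i = edgeAt-disjoint j i (ℕ.≤∧≢⇒< j<i λ eq → k (next-suc j (cong suc (sym eq)))) c∈j c∈i

      -- The form in which acyclicity is used. Induction on the length supplies the minimality that
      -- `Shortest` asks for.
      no-detour : ∀ n → ¬ Detour n
      no-detour = <-rec (λ n → ¬ Detour n) λ n rec (e , a , b , a≢b , a∈e , b∈e , W) →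
        acyclic (suc n) (Shortest.looseCycle (λ m<n → rec m<n) a≢b a∈e b∈e W)

  least : ∀ {P : ℕ → Set} → (∀ n → Dec (P n)) → ∀ n → P n → ∃ λ m → P m × (∀ k → k < m → ¬ P k)
  least {P} P? = <-rec (λ n → P n → ∃ λ m → P m × (∀ k → k < m → ¬ P k)) λ n rec Pn → case n rec Pn (ℕ.anyUpTo? P? n)
    where
    case : ∀ n → (∀ {k} → k < n → P k → ∃ λ m → P m × (∀ k → k < m → ¬ P k)) → P n →
      Dec (∃ λ k → k < n × P k) → ∃ λ m → P m × (∀ k → k < m → ¬ P k)
    case n rec Pn (yes (k , k<n , Pk)) = rec k<n Pk
    case n rec Pn (no none)            = n , Pn , λ k k<n Pk → none (k , k<n , Pk)

  -- A rooting expressed without distances: in place of levels, every vertex but u is a non-parent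
  -- vertex of exactly one edge.
  record Rooted (T : Hypergraph) (u : Vertex T) : Set where
    field
      par           : Edge T → Vertex T
      par∈          : ∀ e → par e ∈ˢ edge T e
      root≡par      : ∀ {e} → u ∈ˢ edge T e → u ≡ par e
      parentEdge    : ∀ v → v ≢ u → ∃ λ e → v ∈ˢ edge T e × v ≢ par e
      parent-unique : ∀ {v e f} → v ∈ˢ edge T e → v ≢ par e → v ∈ˢ edge T f → v ≢ par f → e ≡ f

  module _ {T : Hypergraph} (connected : Connected T) (linear : Linear T) (acyclic : ∀ l → ¬ LooseCycle T l) (u : Vertex T) where
    open Walks T
    open Tree linear acyclic

    private
      Unrestricted : Edge T → Set
      Unrestricted _ = ⊤

      path⇒walk : ∀ {d} (vertex : Fin (suc d) → Vertex T) (through : Fin d → Edge T) →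
        (∀ i → vertex (inject₁ i) ∈ˢ edge T (through i)) → (∀ i → vertex (fsuc i) ∈ˢ edge T (through i)) →
        Walk Unrestricted (vertex (fromℕ d)) (vertex fzero) d
      path⇒walk {zero}  vertex through s t = stop
      path⇒walk {suc d} vertex through s t = step (through fzero) tt (s fzero) (t fzero)
        (path⇒walk (λ i → vertex (fsuc i)) (λ i → through (fsuc i)) (λ i → s (fsuc i)) λ i → t (fsuc i))

      walk? : ∀ n v → Dec (Walk Unrestricted u v n)
      walk? zero    v = map′ (λ { refl → stop }) (λ { stop → refl }) (v Fin.≟ u)
      walk? (suc n) v = map′ (λ (e , x , v∈e , x∈e , W) → step e tt v∈e x∈e W)
                             (λ { (step e _ v∈e x∈e W) → e , _ , v∈e , x∈e , W })
        (Fin.any? λ e → Fin.any? λ x → (v ∈? edge T e) ×-dec ((x ∈? edge T e) ×-dec walk? n x))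

      Shortest-walk : Vertex T → ℕ → Set
      Shortest-walk v n = Walk Unrestricted u v n × (∀ k → k < n → ¬ Walk Unrestricted u v k)

      shortest : ∀ v → ∃ (Shortest-walk v)
      shortest v = let d , P = connected v u in
        least (λ n → walk? n v) d (subst (λ x → Walk Unrestricted x v d) (Path.end P)
          (subst (λ x → Walk Unrestricted (Path.vertex P (fromℕ d)) x d) (Path.start P)
            (path⇒walk (Path.vertex P) (Path.through P) (Path.source P) (Path.target P))))

      -- Otherwise the walk could begin with that later edge and would be shorter.
      late-edge-avoids : ∀ {v n} ((W , _) : Shortest-walk v n) (i : Fin n) → v ∈ˢ edge T (edgeAt W i) → toℕ i ≡ 0
      late-edge-avoids {v} {n} (W , min) i v∈ with toℕ i in eq
      ... | zero  = refl
      ... | suc k = ⊥-elim (min (suc (n ℕ.∸ suc (toℕ i)))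
          (ℕ.≤-trans (s≤s (ℕ.≤-trans (ℕ.+-monoˡ-≤ (n ℕ.∸ suc (toℕ i)) (subst (1 ≤_) (sym eq) (s≤s z≤n))) ℕ.≤-refl)) (ℕ.≤-reflexive (ℕ.m+[n∸m]≡n (Fin.toℕ<n i))))
          (step (edgeAt W i) tt v∈ (targetAt W i) (drop W (fsuc i))))

      -- A shortest walk from a vertex of e uses e in its first step or never; in the former case it
      -- avoids e from its second vertex on.
      toRoot : ∀ {v n} → Shortest-walk v n → ∀ {e} → v ∈ˢ edge T e →
        Walk (_≢ e) u v n ⊎ (∃₂ λ x m → x ≢ v × x ∈ˢ edge T e × Walk (_≢ e) u x m)
      toRoot (stop , _) v∈e = inj₁ stop
      toRoot {v} S@(step g _ v∈g x∈g W , min) {e} v∈e with g Fin.≟ e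
      ... | yes refl = inj₂ (_ , _ , (λ { refl → min _ ℕ.≤-refl W }) , x∈g , map-walk W λ i eq → 0≢suc (late-edge-avoids S (fsuc i) (subst (λ f → v ∈ˢ edge T f) (sym eq) v∈e)))
        where
        0≢suc : ∀ {k} → suc k ≡ 0 → ⊥
        0≢suc ()
      ... | no g≢e = inj₁ (map-walk (proj₁ S) avoid)
        where
        avoid : ∀ i → edgeAt (proj₁ S) i ≢ e
        avoid fzero    eq = g≢e eq
        avoid (fsuc i) eq with late-edge-avoids S (fsuc i) (subst (λ f → v ∈ˢ edge T f) (sym eq) v∈e)
        ... | ()

      Towards : Edge T → Vertex T → Set
      Towards e x = x ∈ˢ edge T e × ∃ λ n → Walk (_≢ e) u x n

      towards : ∀ e → ∃ (Towards e)
      towards e with nonempty T e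
      ... | x , x∈e with toRoot (proj₂ (shortest x)) x∈e
      ...   | inj₁ W = x , x∈e , _ , W
      ...   | inj₂ (y , m , _ , y∈e , W) = y , y∈e , m , W

      -- Two such vertices would be joined through the root by a detour around e. The parent of e is
      -- therefore well defined.
      towards-unique : ∀ {e x y} → Towards e x → Towards e y → x ≡ y
      towards-unique {e} {x} {y} (x∈e , m , V) (y∈e , n , W) with x Fin.≟ y
      ... | yes x≡y = x≡y
      ... | no x≢y = ⊥-elim (no-detour _ (e , x , y , x≢y , x∈e , y∈e , append V (reverse W)))

      p : Edge T → Vertex T
      p e = proj₁ (towards e)

      Towards⇒≡p : ∀ {e x} → Towards e x → x ≡ p e
      Towards⇒≡p {e} t = towards-unique t (proj₂ (towards e))

      -- g is the first edge of a shortest walk from v to the root. The next vertex of the walk is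
      -- the parent of g and differs from v by minimality. The walk avoids every other edge through
      -- v, so v is the parent of each of those.
      first : ∀ v → v ≢ u → ∃ λ g → v ∈ˢ edge T g × v ≢ p g × (∀ e → v ∈ˢ edge T e → v ≢ p e → e ≡ g)
      first v v≢u with shortest v
      ... | _ , (stop , _) = ⊥-elim (v≢u refl)
      ... | _ , S@(step g tt v∈g x∈g W , min) = g , v∈g , v≢p , unique
        where
        avoid : ∀ e → v ∈ˢ edge T e → ∀ i → edgeAt W i ≢ e
        avoid e v∈e i eq with late-edge-avoids S (fsuc i) (subst (λ f → v ∈ˢ edge T f) (sym eq) v∈e)
        ... | ()
        v≢p : v ≢ p g
        v≢p eq = min _ ℕ.≤-refl (subst (λ x → Walk Unrestricted u x _) (trans (Towards⇒≡p (x∈g , _ , map-walk W (avoid g v∈g))) (sym eq)) W)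
        unique : ∀ e → v ∈ˢ edge T e → v ≢ p e → e ≡ g
        unique e v∈e v≢pe with e Fin.≟ g
        ... | yes e≡g = e≡g
        ... | no e≢g = ⊥-elim (v≢pe (Towards⇒≡p (v∈e , _ , map-walk (proj₁ S) λ { fzero eq → e≢g (sym eq) ; (fsuc i) → avoid e v∈e i })))

    rooted : Rooted T u
    rooted = record
      { par = p
      ; par∈ = λ e → proj₁ (proj₂ (towards e))
      ; root≡par = λ u∈e → Towards⇒≡p (u∈e , 0 , stop)
      ; parentEdge = λ v v≢u → let g , v∈g , v≢p , _ = first v v≢u in g , v∈g , v≢p
      ; parent-unique = λ {v} {e} {f} v∈e v≢pe v∈f v≢pf →
          let v≢u : v ≢ u
              v≢u = λ { refl → v≢pe (Towards⇒≡p (v∈e , 0 , stop)) }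
              _ , _ , _ , unique = first v v≢u
          in trans (unique e v∈e v≢pe) (sym (unique f v∈f v≢pf))
      }

  transpose-first : ∀ {n} (i j : Fin n) → transpose i j i ≡ j
  transpose-first i j rewrite dec-true (i Fin.≟ i) refl = refl

  transpose-other : ∀ {n} {i j k : Fin n} → k ≢ i → k ≢ j → transpose i j k ≡ k
  transpose-other {i = i} {j} {k} k≢i k≢j rewrite dec-false (k Fin.≟ i) k≢i | dec-false (k Fin.≟ j) k≢j = refl

  transpose-injective : ∀ {n} (i j : Fin n) → Injective _≡_ _≡_ (transpose i j)
  transpose-injective i j {x} {y} eq =
    trans (sym (transpose-inverse j i)) (trans (cong (transpose j i) eq) (transpose-inverse j i))

  record Listing {N} (k : ℕ) (p : Subset N) : Set where
    field
      at         : Fin k → Fin N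
      injective  : Injective _≡_ _≡_ at
      at∈        : ∀ i → at i ∈ˢ p
      surjective : ∀ {x} → x ∈ˢ p → ∃ λ i → at i ≡ x

  open Listing

  listing : ∀ {N} (p : Subset N) → Listing ∣ p ∣ p
  listing p = record { at = enum p ; injective = enum-injective p ; at∈ = enum∈ p ; surjective = enum-surjective p }

  exchanged : ∀ {N k} {p : Subset N} → Fin k → Fin k → Listing k p → Listing k p
  exchanged i j L = record
    { at = λ k → at L (transpose i j k)
    ; injective = λ {x} {y} eq → transpose-injective i j {x} {y} (injective L eq)
    ; at∈ = λ k → at∈ L (transpose i j k)
    ; surjective = λ x∈p → let k , eq = surjective L x∈p in
        transpose j i k , trans (cong (at L) (transpose-inverse i j)) eq
    }

  abstract
    -- Two transpositions bring a and b to the front; the second one leaves position 0 alone because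
    -- a and b differ.
    listing-from : ∀ {N n} {p : Subset N} {a b} → ∣ p ∣ ≡ suc (suc n) → a ∈ˢ p → b ∈ˢ p → a ≢ b →
      ∃ λ (L : Listing (suc (suc n)) p) → at L fzero ≡ a × at L (fsuc fzero) ≡ b
    listing-from {n = n} {p = p} {a} {b} size a∈p b∈p a≢b = L₂ , at₀ , at₁
      where
      L₀ : Listing (suc (suc n)) p
      L₀ = subst (λ k → Listing k p) size (listing p)
      i : ∃ λ i → at L₀ i ≡ a
      i = surjective L₀ a∈p
      L₁ L₂ : Listing (suc (suc n)) p
      L₁ = exchanged fzero (proj₁ i) L₀
      L₁₀ : at L₁ fzero ≡ a
      L₁₀ = trans (cong (at L₀) (transpose-first fzero (proj₁ i))) (proj₂ i)
      j : ∃ λ i → at L₁ i ≡ b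
      j = surjective L₁ b∈p
      L₂ = exchanged (fsuc fzero) (proj₁ j) L₁
      at₁ : at L₂ (fsuc fzero) ≡ b
      at₁ = trans (cong (at L₁) (transpose-first (fsuc fzero) (proj₁ j))) (proj₂ j)
      at₀ : at L₂ fzero ≡ a
      at₀ = trans (cong (at L₁) (transpose-other {i = fsuc fzero} {proj₁ j} {fzero} (λ ()) λ eq → a≢b (trans (sym L₁₀) (trans (cong (at L₁) eq) (proj₂ j))))) L₁₀

  ∣∣≤2⇒⊥ : ∀ {N} {p : Subset N} {x y z} → ∣ p ∣ ≤ 2 → x ∈ˢ p → y ∈ˢ p → z ∈ˢ p → x ≢ y → x ≢ z → y ≢ z → ⊥
  ∣∣≤2⇒⊥ {p = p} {x} {y} {z} h x∈p y∈p z∈p x≢y x≢z y≢z = ℕ.1+n≰n (ℕ.≤-trans (injection⇒≤∣∣ p f f-injective f∈) h)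
    where
    f : Fin 3 → Fin _
    f fzero               = x
    f (fsuc fzero)        = y
    f (fsuc (fsuc fzero)) = z
    f-injective : Injective _≡_ _≡_ f
    f-injective {fzero}  {fzero}  _  = refl
    f-injective {fzero}  {fsuc fzero} eq = ⊥-elim (x≢y eq)
    f-injective {fzero}  {fsuc (fsuc fzero)} eq = ⊥-elim (x≢z eq)
    f-injective {fsuc fzero}  {fzero} eq = ⊥-elim (x≢y (sym eq))
    f-injective {fsuc fzero}  {fsuc fzero} eq = refl
    f-injective {fsuc fzero}  {fsuc (fsuc fzero)} eq = ⊥-elim (y≢z eq)
    f-injective {fsuc (fsuc fzero)}  {fzero} eq = ⊥-elim (x≢z (sym eq))
    f-injective {fsuc (fsuc fzero)}  {fsuc fzero} eq = ⊥-elim (y≢z (sym eq))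
    f-injective {fsuc (fsuc fzero)}  {fsuc (fsuc fzero)} eq = refl
    f∈ : ∀ i → f i ∈ˢ p
    f∈ fzero               = x∈p
    f∈ (fsuc fzero)        = y∈p
    f∈ (fsuc (fsuc fzero)) = z∈p

  two-edges⇒nonPendant : ∀ H {v e f} → v ∈ˢ edge H e → v ∈ˢ edge H f → e ≢ f → v ∈ˢ nonPendant H
  two-edges⇒nonPendant H {v} {e} {f} v∈e v∈f e≢f = lookup⇒[]= v (nonPendant H)
    (trans (lookup∘tabulate _ v) (dec-true (1 ℕ.<? degree H v) (injection⇒≤∣∣ _ g g-injective g∈)))
    where
    g : Fin 2 → Edge H
    g fzero    = e
    g (fsuc _) = f
    g-injective : Injective _≡_ _≡_ g
    g-injective {fzero}  {fzero}  _  = refl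
    g-injective {fzero}  {fsuc _} eq = ⊥-elim (e≢f eq)
    g-injective {fsuc _} {fzero}  eq = ⊥-elim (e≢f (sym eq))
    g-injective {fsuc fzero} {fsuc fzero} _ = refl
    incident : ∀ {e} → v ∈ˢ edge H e → e ∈ˢ Vec.tabulate (λ e → Vec.lookup (edge H e) v)
    incident {e} v∈e = lookup⇒[]= e _ (trans (lookup∘tabulate _ e) ([]=⇒lookup v∈e))
    g∈ : ∀ i → g i ∈ˢ Vec.tabulate (λ e → Vec.lookup (edge H e) v)
    g∈ fzero    = incident v∈e
    g∈ (fsuc _) = incident v∈f

  -- Every edge e consists of a vertex par e and n + 1 further vertices child e t; every vertex but
  -- the root is child e t for exactly one e, and the only child that can lie in a further edge is
  -- child e 0.
  record RootedBlocks (T : Hypergraph) (n : ℕ) : Set where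
    field
      root       : Vertex T
      par        : Edge T → Vertex T
      child      : Edge T → Fin (suc n) → Vertex T
      decode     : ∀ v → v ≡ root ⊎ ∃₂ λ e t → v ≡ child e t
      child≢root : ∀ {e t} → child e t ≢ root
      child-inj  : ∀ {e f s t} → child e s ≡ child f t → e ≡ f × s ≡ t
      child≢par  : ∀ {e t} → child e t ≢ par e
      par∈       : ∀ e → par e ∈ˢ edge T e
      child∈     : ∀ e t → child e t ∈ˢ edge T e
      members    : ∀ {e v} → v ∈ˢ edge T e → v ≡ par e ⊎ ∃ λ t → v ≡ child e t
      par-top    : ∀ e → par e ≡ root ⊎ ∃ λ f → par e ≡ child f fzero

  module _ {T : Hypergraph} {n : ℕ} (uniform : Uniform (suc (suc n)) T)
    (twoNonPendant : ∀ e → ∣ edge T e ∩ nonPendant T ∣ ≤ 2)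
    {u} (R : Rooted T u) (u-nonPendant : u ∈ˢ nonPendant T) where
    private
      open Rooted R

      -- A parent other than the root lies in the edge it heads and in its own parent edge. As the
      -- root is non-pendant too, each edge has room for only one further non-pendant vertex.
      par-nonPendant : ∀ e → par e ∈ˢ nonPendant T
      par-nonPendant e with par e Fin.≟ u
      ... | yes eq = subst (_∈ˢ nonPendant T) (sym eq) u-nonPendant
      ... | no par≢u = let f , ∈f , ≢f = parentEdge (par e) par≢u in
        two-edges⇒nonPendant T (par∈ e) ∈f λ e≡f → ≢f (cong par e≡f)

      -- The future child 0: the one vertex besides the parent that may lie in another edge. If all
      -- of them are pendant, any will do.
      Chosen : Edge T → Vertex T → Set
      Chosen e c = c ∈ˢ edge T e × c ≢ par e × (∀ x → x ∈ˢ edge T e → x ≢ par e → x ∈ˢ nonPendant T → x ≡ c)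

      chosen : ∀ e → ∃ (Chosen e)
      chosen e with Fin.any? (λ x → (x ∈? edge T e) ×-dec (¬? (x Fin.≟ par e) ×-dec (x ∈? nonPendant T)))
      ... | yes (c , c∈e , c≢par , c∈N) = c , c∈e , c≢par , λ x x∈e x≢par x∈N → unique x x∈e x≢par x∈N
        where
        unique : ∀ x → x ∈ˢ edge T e → x ≢ par e → x ∈ˢ nonPendant T → x ≡ c
        unique x x∈e x≢par x∈N with x Fin.≟ c
        ... | yes x≡c = x≡c
        ... | no x≢c = ⊥-elim (∣∣≤2⇒⊥ (twoNonPendant e) (x∈p∩q⁺ (x∈e , x∈N)) (x∈p∩q⁺ (c∈e , c∈N)) (x∈p∩q⁺ (par∈ e , par-nonPendant e)) x≢c x≢par c≢par)
      ... | no none = proj₁ other , proj₁ (proj₂ other) , proj₂ (proj₂ other)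
                    , λ x x∈e x≢par x∈N → ⊥-elim (none (x , x∈e , x≢par , x∈N))
        where
        L : Listing (suc (suc n)) (edge T e)
        L = subst (λ k → Listing k (edge T e)) (uniform e) (listing (edge T e))
        other : ∃ λ x → x ∈ˢ edge T e × x ≢ par e
        other with at L fzero Fin.≟ par e
        ... | no ≢par = at L fzero , at∈ L fzero , ≢par
        ... | yes ≡par = at L (fsuc fzero) , at∈ L (fsuc fzero) , λ eq → case (injective L (trans ≡par (sym eq)))
          where
          case : ∀ {k} {i : Fin k} → fzero ≡ fsuc i → ⊥
          case ()

      L : ∀ e → ∃ λ (L : Listing (suc (suc n)) (edge T e)) → at L fzero ≡ par e × at L (fsuc fzero) ≡ proj₁ (chosen e)
      L e = let c , c∈e , c≢par , _ = chosen e in listing-from (uniform e) (par∈ e) c∈e λ eq → c≢par (sym eq)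

      child : Edge T → Fin (suc n) → Vertex T
      child e t = at (proj₁ (L e)) (fsuc t)

      child≢par : ∀ e t → child e t ≢ par e
      child≢par e t eq with injective (proj₁ (L e)) (trans eq (sym (proj₁ (proj₂ (L e)))))
      ... | ()

      child∈ : ∀ e t → child e t ∈ˢ edge T e
      child∈ e t = at∈ (proj₁ (L e)) (fsuc t)

      members : ∀ {e v} → v ∈ˢ edge T e → v ≡ par e ⊎ ∃ λ t → v ≡ child e t
      members {e} v∈e with surjective (proj₁ (L e)) v∈e
      ... | fzero  , eq = inj₁ (trans (sym eq) (proj₁ (proj₂ (L e))))
      ... | fsuc t , eq = inj₂ (t , sym eq)

      memberOf : ∀ {e v} → v ∈ˢ edge T e → v ≢ par e → ∃ λ t → v ≡ child e t
      memberOf v∈e v≢par with members v∈e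
      ... | inj₁ eq = ⊥-elim (v≢par eq)
      ... | inj₂ h  = h

    toBlocks : RootedBlocks T n
    toBlocks = record
      { root = u
      ; par = par
      ; child = child
      ; decode = decode
      ; child≢root = λ {e} {t} eq → child≢par e t (trans eq (root≡par (subst (_∈ˢ edge T e) eq (child∈ e t))))
      ; child-inj = λ {e} {f} {s} {t} → child-inj e f s t
      ; child≢par = λ {e} {t} → child≢par e t
      ; par∈ = par∈
      ; child∈ = child∈
      ; members = members
      ; par-top = par-top
      }
      where
      decode : ∀ v → v ≡ u ⊎ ∃₂ λ e t → v ≡ child e t
      decode v with v Fin.≟ u
      ... | yes v≡u = inj₁ v≡u
      ... | no v≢u = let e , v∈e , v≢par = parentEdge v v≢u ; t , eq = memberOf v∈e v≢par in inj₂ (e , t , eq)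
      child-inj : ∀ e f s t → child e s ≡ child f t → e ≡ f × s ≡ t
      child-inj e f s t eq with parent-unique (child∈ e s) (child≢par e s) (subst (_∈ˢ edge T f) (sym eq) (child∈ f t)) (λ h → child≢par f t (trans (sym eq) h))
      ... | refl = refl , Fin.suc-injective (injective (proj₁ (L e)) eq)
      par-top : ∀ e → par e ≡ u ⊎ ∃ λ f → par e ≡ child f fzero
      par-top e with par e Fin.≟ u
      ... | yes eq = inj₁ eq
      ... | no par≢u = let f , ∈f , ≢f = parentEdge (par e) par≢u in
        inj₂ (f , trans (proj₂ (proj₂ (proj₂ (chosen f))) (par e) ∈f ≢f (par-nonPendant e)) (sym (proj₂ (proj₂ (L f)))))

  complement : ∀ {A : Set} (xs zs : List A) → Unique xs → (∀ {x} → x ∈ xs → x ∈ zs) → ∃ λ ys → zs ↭ xs ++ ys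
  complement []       zs _          _  = zs , ↭-refl
  complement (x ∷ xs) zs (x∉xs ∷ u) h with ∈-∃++ (h (here refl))
  ... | as , bs , refl = let ys , π = complement xs (as ++ bs) u inside in
          ys , ↭-trans (shift x as bs) (prep x π)
    where
    inside : ∀ {y} → y ∈ xs → y ∈ as ++ bs
    inside y∈xs with ∈-resp-↭ (shift x as bs) (h (there y∈xs))
    ... | here y≡x = ⊥-elim (All.lookup x∉xs y∈xs (sym y≡x))
    ... | there y∈ = y∈

  module Chains {T : Hypergraph} {n : ℕ} (B : RootedBlocks T n) where
    open RootedBlocks B

    Below : Edge T → List (Edge T) → Set
    Below e []       = ⊤
    Below e (f ∷ fs) = par f ≡ child e fzero × Below f fs

    Descending : List (Edge T) → Set
    Descending []       = ⊤
    Descending (e ∷ es) = Below e es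

    -- The vertex is a child of e, and by `par-top` a child that is a parent can only be child 0.
    lower-vertex : ∀ {e f v} → v ∈ˢ edge T e → v ≢ par e → par f ≡ v → par f ≡ child e fzero
    lower-vertex {e} {f} v∈e v≢par parf≡v with members v∈e
    ... | inj₁ v≡par = ⊥-elim (v≢par v≡par)
    ... | inj₂ (t , v≡child) with par-top f
    ...   | inj₁ parf≡root = ⊥-elim (child≢root (trans (sym v≡child) (trans (sym parf≡v) parf≡root)))
    ...   | inj₂ (g , parf≡) with child-inj (trans (sym parf≡) (trans parf≡v v≡child))
    ...     | refl , refl = parf≡

    other-edge : ∀ {e f v} → v ∈ˢ edge T e → v ≢ par e → v ∈ˢ edge T f → f ≢ e → par f ≡ v
    other-edge v∈e v≢par v∈f f≢e with members v∈f
    ... | inj₁ v≡par = sym v≡par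
    ... | inj₂ (s , v≡s) with members v∈e
    ...   | inj₁ v≡par = ⊥-elim (v≢par v≡par)
    ...   | inj₂ (t , v≡t) = ⊥-elim (f≢e (proj₁ (child-inj (trans (sym v≡s) v≡t))))

    -- A path with unnamed ends, which is closed under dropping the first edge.
    record Trail (d : ℕ) : Set where
      field
        vertex     : Fin (suc d) → Vertex T
        through    : Fin d → Edge T
        vertex-inj : Injective _≡_ _≡_ vertex
        edge-inj   : Injective _≡_ _≡_ through
        source     : ∀ i → vertex (inject₁ i) ∈ˢ edge T (through i)
        target     : ∀ i → vertex (fsuc i) ∈ˢ edge T (through i)

    open Trail

    rest : ∀ {d} → Trail (suc d) → Trail d
    rest P = record
      { vertex = λ i → vertex P (fsuc i) ; through = λ i → through P (fsuc i)
      ; vertex-inj = λ eq → Fin.suc-injective (vertex-inj P eq) ; edge-inj = λ eq → Fin.suc-injective (edge-inj P eq)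
      ; source = λ i → source P (fsuc i) ; target = λ i → target P (fsuc i) }

    0≢1 : ∀ {k} {i : Fin k} → fzero ≢ fsuc i
    0≢1 ()

    -- A vertex is a child in one edge only. So a path that leaves e through a child v enters an
    -- edge whose parent is v, and its next vertex, being different from v, is again a child.
    descend : ∀ {d} (P : Trail d) e → (∀ i → through P i ≢ e) → vertex P fzero ∈ˢ edge T e → vertex P fzero ≢ par e →
      Below e (tabulate (through P))
    descend {zero}  P e _   v∈e v≢par = tt
    descend {suc d} P e new v∈e v≢par =
        lower-vertex v∈e v≢par par≡
      , descend (rest P) (through P fzero) (λ i eq → 0≢1 (sym (edge-inj P eq))) (target P fzero)
          λ eq → 0≢1 (vertex-inj P (trans (sym par≡) (sym eq)))
      where
      par≡ : par (through P fzero) ≡ vertex P fzero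
      par≡ = other-edge v∈e v≢par (source P fzero) (new fzero)

    Above : Vertex T → List (Edge T) → Set
    Above v []       = ⊤
    Above v (e ∷ es) = par e ≡ v × Below e es

    above⇒descending : ∀ {v} es → Above v es → Descending es
    above⇒descending []       _       = tt
    above⇒descending (e ∷ es) (_ , h) = h

    -- A path first ascends towards the root and then descends from it.
    split : ∀ {d} (P : Trail d) (up : List (Edge T)) → Above (vertex P fzero) up →
      ∃₂ λ Ls Rs → Descending Ls × Descending Rs × Ls ++ Rs ↭ up ++ tabulate (through P)
    split {zero}  P up h = up , [] , above⇒descending up h , tt , ↭-refl
    split {suc d} P up h with par (through P fzero) Fin.≟ vertex P (fsuc fzero)
    ... | no ≢par = up , tabulate (through P) , above⇒descending up h
                  , descend (rest P) (through P fzero) (λ i eq → 0≢1 (sym (edge-inj P eq))) (target P fzero) (λ eq → ≢par (sym eq))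
                  , ↭-refl
    -- The edge leads upwards. Put in front of the part collected so far, it makes the ascent appear
    -- as a descending chain.
    ... | yes ≡par =
      let Ls , Rs , dL , dR , π = split (rest P) (through P fzero ∷ up) (≡par , extend up h) in
      Ls , Rs , dL , dR , ↭-trans π (↭-sym (shift (through P fzero) up (tabulate λ i → through P (fsuc i))))
      where
      extend : ∀ up → Above (vertex P fzero) up → Below (through P fzero) up
      extend []       _         = tt
      extend (f ∷ fs) (par≡ , b) = lower-vertex (source P fzero) (λ eq → 0≢1 (vertex-inj P (trans eq ≡par))) par≡ , b

    -- All edges, sorted into the two halves of a path of length d and the edges off that path.
    record Sorted (d : ℕ) : Set where
      field
        Ls Rs Os     : List (Edge T)
        Ls-descend   : Descending Ls
        Rs-descend   : Descending Rs
        length-path  : length (Ls ++ Rs) ≡ d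
        all-edges    : allFin (∣E∣ T) ↭ (Ls ++ Rs) ++ Os

    sorted : ∀ {d v w} → Path T v w d → Sorted d
    sorted {d} P = record
      { Ls = Ls ; Rs = Rs ; Os = proj₁ others ; Ls-descend = dL ; Rs-descend = dR
      ; length-path = trans (↭-length π) (List.length-tabulate (through trail))
      ; all-edges = ↭-trans (proj₂ others) (++⁺ʳ (proj₁ others) (↭-sym π)) }
      where
      trail : Trail d
      trail = record { vertex = Path.vertex P ; through = Path.through P ; vertex-inj = Path.vertex-inj P ; edge-inj = Path.edge-inj P
                     ; source = Path.source P ; target = Path.target P }
      halves = split trail [] tt
      Ls = proj₁ halves
      Rs = proj₁ (proj₂ halves)
      dL = proj₁ (proj₂ (proj₂ halves))
      dR = proj₁ (proj₂ (proj₂ (proj₂ halves)))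
      π = proj₂ (proj₂ (proj₂ (proj₂ halves)))
      others = complement (tabulate (through trail)) (allFin (∣E∣ T)) (tabulate⁺ (edge-inj trail)) (λ _ → ∈-allFin _)

open Trees

-- The adjacency form on rooted hypertrees, its perturbation, and eigenvectors

module Forms where
  open import Data.Bool using (if_then_else_)
  open import Data.Empty using (⊥; ⊥-elim)
  open import Data.Fin using (Fin; fromℕ; inject₁) renaming (zero to fzero; suc to fsuc)
  import Data.Fin.Properties as Fin
  open import Data.Fin.Subset using (Subset; _∩_; ∣_∣) renaming (_∈_ to _∈ˢ_)
  open import Data.Fin.Subset.Properties using (_∈?_; x∈p∩q⁺; x∈p∩q⁻)
  import Data.List as List
  open import Data.List using (List; []; _∷_; _++_; length; map; allFin; tabulate)
  open import Data.List.Membership.Propositional using (_∈_; _∉_)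
  open import Data.List.Membership.Propositional.Properties using (∈-++⁺ˡ; ∈-++⁺ʳ; ∈-++⁻; ∈-allFin)
  import Data.List.Properties as List
  open import Data.List.Relation.Binary.Permutation.Propositional as Perm using (_↭_; ↭-trans; prep)
  open import Data.List.Relation.Binary.Permutation.Propositional using (_↭_; ↭-trans; prep; ↭⇒↭ₛ)
  open import Data.List.Relation.Binary.Permutation.Propositional.Properties using (++-comm; ++⁺ʳ; ↭-length; ∈-resp-↭)
  import Data.List.Relation.Binary.Permutation.Setoid.Properties as Permutation
  open import Data.List.Relation.Binary.Pointwise using (Pointwise; []; _∷_)
  import Data.List.Relation.Unary.All as All
  open import Data.List.Relation.Unary.All using (All; []; _∷_)
  open import Data.List.Relation.Unary.AllPairs using ([]; _∷_)
  import Data.List.Relation.Unary.Any as Any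
  open import Data.List.Relation.Unary.Any using (Any; here; there)
  open import Data.List.Relation.Unary.Unique.Propositional using (Unique)
  open import Data.List.Relation.Unary.Unique.Propositional.Properties using (allFin⁺)
  import Data.Nat as ℕ
  open import Data.Nat using (ℕ; zero; suc)
  open import Data.Nat.Induction using (<-rec)
  import Data.Nat.Properties as ℕ
  open import Data.Product using (∃; ∃₂; _×_; _,_; proj₁; proj₂)
  import Data.Rational as ℚ
  open import Data.Rational using (ℚ; 0ℚ; 1ℚ; ½)
  import Data.Rational.Properties as ℚ
  open import Data.Sum using (_⊎_; inj₁; inj₂; [_,_]′)
  open import Data.Unit using (⊤; tt)
  open import Data.Vec.Functional using (Vector)
  open import Defs hiding (_≈_; bounded)
  open import Relation.Binary.PropositionalEquality as ≡ using (_≡_; _≢_)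
  open import Relation.Nullary using (¬_; Dec; yes; no; does)
  open import Relation.Nullary.Decidable using (_×-dec_; ¬?; _⊎-dec_; toWitness; dec-true; dec-false)

  Adjacent : ∀ T → Vertex T → Vertex T → Set
  Adjacent T i j = i ≢ j × ∃ λ e → i ∈ˢ edge T e × j ∈ˢ edge T e

  adjacent? : ∀ T i j → Dec (Adjacent T i j)
  adjacent? T i j = ¬? (i Fin.≟ j) ×-dec Fin.any? (λ e → (i ∈? edge T e) ×-dec (j ∈? edge T e))

  module Sums (𝓡 : OrderedAlgebra) where
    open OrderedAlgebra 𝓡
    open import Algebra.Properties.Semiring.Sum semiring public using (sum; sum-cong-≋; ∑-distrib-+; ∑-comm; *-distribˡ-sum; *-distribʳ-sum; sum-replicate-zero)

    𝟙 : ∀ {P : Set} → Dec P → Carrier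
    𝟙 P? = if does P? then 1# else 0#

    𝟙-cong : ∀ {P Q : Set} (P? : Dec P) (Q? : Dec Q) → (P → Q) → (Q → P) → 𝟙 P? ≈ 𝟙 Q?
    𝟙-cong (yes p) (yes q) f g = refl
    𝟙-cong (yes p) (no ¬q) f g = ⊥-elim (¬q (f p))
    𝟙-cong (no ¬p) (yes q) f g = ⊥-elim (¬p (g q))
    𝟙-cong (no ¬p) (no ¬q) f g = refl

    𝟙-yes : ∀ {P : Set} (P? : Dec P) → P → 𝟙 P? ≈ 1#
    𝟙-yes (yes _) p = refl
    𝟙-yes (no ¬p) p = ⊥-elim (¬p p)

    𝟙-no : ∀ {P : Set} (P? : Dec P) → ¬ P → 𝟙 P? ≈ 0#
    𝟙-no (yes p) ¬p = ⊥-elim (¬p p)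
    𝟙-no (no _)  ¬p = refl

    𝟙-⊎ : ∀ {P Q R : Set} (P? : Dec P) (Q? : Dec Q) (R? : Dec R) →
      (P → ¬ Q) → (R → P ⊎ Q) → (P → R) → (Q → R) → 𝟙 R? ≈ 𝟙 P? + 𝟙 Q?
    𝟙-⊎ (yes p) (yes q) R? d f g h = ⊥-elim (d p q)
    𝟙-⊎ (yes p) (no ¬q) R? d f g h = trans (𝟙-yes R? (g p)) (sym (+-identityʳ 1#))
    𝟙-⊎ (no ¬p) (yes q) R? d f g h = trans (𝟙-yes R? (h q)) (sym (+-identityˡ 1#))
    𝟙-⊎ (no ¬p) (no ¬q) R? d f g h = trans (𝟙-no R? λ r → [ ¬p , ¬q ]′ (f r)) (sym (+-identityˡ 0#))

    𝟙-× : ∀ {P Q : Set} (P? : Dec P) (Q? : Dec Q) → 𝟙 (P? ×-dec Q?) ≈ 𝟙 P? * 𝟙 Q?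
    𝟙-× (yes p) (yes q) = sym (*-identityˡ 1#)
    𝟙-× (yes p) (no ¬q) = sym (zeroʳ 1#)
    𝟙-× (no ¬p) Q?      = sym (zeroˡ _)

    sum-0 : ∀ {m} (f : Vector Carrier m) → (∀ i → f i ≈ 0#) → sum f ≈ 0#
    sum-0 {m} f h = trans (sum-cong-≋ h) (sum-replicate-zero m)

    sum-δ : ∀ {m} (w : Fin m) (f : Vector Carrier m) → sum (λ j → 𝟙 (w Fin.≟ j) * f j) ≈ f w
    sum-δ {suc m} fzero    f = trans (+-cong (*-identityˡ _) (sum-0 (λ j → 𝟙 (fzero Fin.≟ fsuc j) * f (fsuc j)) λ j → zeroˡ _)) (+-identityʳ _)
    sum-δ {suc m} (fsuc w) f = trans (+-cong (zeroˡ _) (trans (sum-cong-≋ λ j → *-congʳ (𝟙-cong (fsuc w Fin.≟ fsuc j) (w Fin.≟ j) Fin.suc-injective (≡.cong fsuc)))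
      (sum-δ w (λ j → f (fsuc j))))) (+-identityˡ _)

    sum-unique : ∀ {m} {P : Fin m → Set} {Q : Set} (P? : ∀ a → Dec (P a)) (Q? : Dec Q) →
      (∀ a → P a → Q) → (Q → ∃ P) → (∀ a b → P a → P b → a ≡ b) → sum (λ a → 𝟙 (P? a)) ≈ 𝟙 Q?
    sum-unique P? (yes q) f g u = let a , pa = g q in
      trans (sum-cong-≋ λ b → trans (𝟙-cong (P? b) (a Fin.≟ b) (u a b pa) λ { ≡.refl → pa }) (sym (*-identityʳ _))) (sum-δ a (λ _ → 1#))
    sum-unique P? (no ¬q) f g u = sum-0 _ λ a → 𝟙-no (P? a) λ p → ¬q (f a p)

    -- The matrix here has entries 0 and 1: it is rA with r = m - 1, and all eigenvalues below are
    -- scaled accordingly.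
    row : ∀ T → Vector Carrier (∣V∣ T) → Vertex T → Carrier
    row T x i = sum λ j → 𝟙 (adjacent? T i j) * x j

    form : ∀ T → Vector Carrier (∣V∣ T) → Carrier
    form T x = sum λ i → x i * row T x i

    norm : ∀ {m} → Vector Carrier m → Carrier
    norm x = sum λ i → x i * x i

    module _ {T : Hypergraph} {n : ℕ} (B : RootedBlocks T n) where
      open RootedBlocks B
      open BlockForms 𝓡 n using (Block; blockSum; blockNorm; edgeForm)

      edgeSum : Edge T → Vector Carrier (∣V∣ T) → Carrier
      edgeSum e x = x (par e) + sum λ t → x (child e t)

      block : Vector Carrier (∣V∣ T) → Edge T → Block
      block x e = x (child e fzero) , λ t → x (child e (fsuc t))

      private
        child? : ∀ e j → Dec (∃ λ t → child e t ≡ j)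
        child? e j = Fin.any? λ t → child e t Fin.≟ j

        sum-child? : ∀ e j → sum (λ t → 𝟙 (child e t Fin.≟ j)) ≈ 𝟙 (child? e j)
        sum-child? e j = sum-unique (λ t → child e t Fin.≟ j) (child? e j) (λ t eq → t , eq) (λ h → h)
          λ a b p q → proj₂ (child-inj (≡.trans p (≡.sym q)))

        sum-δs : ∀ {m k} (w : Fin m → Fin k) (f : Vector Carrier k) →
          sum (λ j → sum (λ t → 𝟙 (w t Fin.≟ j)) * f j) ≈ sum (λ t → f (w t))
        sum-δs w f = trans (sum-cong-≋ λ j → *-distribʳ-sum (f j) (λ t → 𝟙 (w t Fin.≟ j)))
          (trans (∑-comm λ j t → 𝟙 (w t Fin.≟ j) * f j) (sum-cong-≋ λ t → sum-δ (w t) f))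

      sum-edge : ∀ e (f : Vector Carrier (∣V∣ T)) → sum (λ j → 𝟙 (j ∈? edge T e) * f j) ≈ edgeSum e f
      sum-edge e f = trans (sum-cong-≋ λ j → trans (*-congʳ (𝟙∈ j)) (distribʳ _ _ _))
        (trans (∑-distrib-+ (λ j → 𝟙 (par e Fin.≟ j) * f j) (λ j → sum (λ t → 𝟙 (child e t Fin.≟ j)) * f j))
          (+-cong (sum-δ (par e) f) (sum-δs (child e) f)))
        where
        𝟙∈ : ∀ j → 𝟙 (j ∈? edge T e) ≈ 𝟙 (par e Fin.≟ j) + sum (λ t → 𝟙 (child e t Fin.≟ j))
        𝟙∈ j = trans (𝟙-⊎ (par e Fin.≟ j) (child? e j) (j ∈? edge T e)
              (λ { ≡.refl (t , eq) → child≢par eq })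
              (λ j∈e → [ (λ eq → inj₁ (≡.sym eq)) , (λ (t , eq) → inj₂ (t , ≡.sym eq)) ]′ (members j∈e))
              (λ { ≡.refl → par∈ e }) (λ { (t , ≡.refl) → child∈ e t }))
            (+-congˡ (sym (sum-child? e j)))

      sum-vertices : ∀ (f : Vector Carrier (∣V∣ T)) → sum f ≈ f root + sum (λ e → sum λ t → f (child e t))
      sum-vertices f = trans (sum-cong-≋ λ j → trans (sym (*-identityˡ _)) (trans (*-congʳ (1≈ j)) (distribʳ _ _ _)))
        (trans (∑-distrib-+ (λ j → 𝟙 (root Fin.≟ j) * f j) (λ j → sum (λ e → sum (λ t → 𝟙 (child e t Fin.≟ j))) * f j))
          (+-cong (sum-δ root f)
            (trans (sum-cong-≋ λ j → *-distribʳ-sum (f j) (λ e → sum (λ t → 𝟙 (child e t Fin.≟ j))))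
            (trans (∑-comm λ j e → sum (λ t → 𝟙 (child e t Fin.≟ j)) * f j) (sum-cong-≋ λ e → sum-δs (child e) f)))))
        where
        somewhere? : ∀ j → Dec (∃₂ λ e t → child e t ≡ j)
        somewhere? j = Fin.any? λ e → child? e j
        1≈ : ∀ j → 1# ≈ 𝟙 (root Fin.≟ j) + sum (λ e → sum (λ t → 𝟙 (child e t Fin.≟ j)))
        1≈ j = trans (𝟙-⊎ (root Fin.≟ j) (somewhere? j) (yes (≡.refl {x = j}))
              (λ { ≡.refl (e , t , eq) → child≢root eq })
              (λ _ → [ (λ eq → inj₁ (≡.sym eq)) , (λ (e , t , eq) → inj₂ (e , t , ≡.sym eq)) ]′ (decode j))
              (λ _ → ≡.refl) (λ _ → ≡.refl))
            (+-congˡ (sym (trans (sum-cong-≋ λ e → sum-child? e j)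
              (sum-unique (λ e → child? e j) (somewhere? j) (λ e h → e , h) (λ h → h)
                λ a b (_ , p) (_ , q) → proj₁ (child-inj (≡.trans p (≡.sym q)))))))

      norm-edges : ∀ x → norm x ≈ x root * x root + sum (λ e → blockNorm (block x e))
      norm-edges x = sum-vertices λ i → x i * x i

      module _ (linear : Linear T) where
        open OrderedAlgebraProperties 𝓡
        open ι-Solver using (solve; _:=_; _:+_; _:*_; _:-_; :-_; con)

        private
          together? : ∀ i j e → Dec (i ≢ j × i ∈ˢ edge T e × j ∈ˢ edge T e)
          together? i j e = ¬? (i Fin.≟ j) ×-dec ((i ∈? edge T e) ×-dec (j ∈? edge T e))

          -- By linearity two distinct vertices share at most one edge, so nothing is counted twice.
          𝟙-adjacent : ∀ i j → 𝟙 (adjacent? T i j) ≈ sum (λ e → 𝟙 (together? i j e))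
          𝟙-adjacent i j = sym (sum-unique (together? i j) (adjacent? T i j) (λ e (i≢j , h) → i≢j , e , h)
            (λ (i≢j , e , h) → e , i≢j , h) unique)
            where
            unique : ∀ e f → i ≢ j × i ∈ˢ edge T e × j ∈ˢ edge T e → i ≢ j × i ∈ˢ edge T f × j ∈ˢ edge T f → e ≡ f
            unique e f (i≢j , i∈e , j∈e) (_ , i∈f , j∈f) with e Fin.≟ f
            ... | yes e≡f = e≡f
            ... | no e≢f = ⊥-elim (i≢j (∣∣≤1⇒≡ (linear e f e≢f) (x∈p∩q⁺ (i∈e , i∈f)) (x∈p∩q⁺ (j∈e , j∈f))))

          -- Adding the diagonal turns the indicator into a product, which can be summed over j edge
          -- by edge.
          𝟙-together : ∀ i j e → 𝟙 (together? i j e) + 𝟙 (i ∈? edge T e) * 𝟙 (i Fin.≟ j) ≈ 𝟙 (i ∈? edge T e) * 𝟙 (j ∈? edge T e)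
          𝟙-together i j e = trans (+-congˡ (sym (𝟙-× (i ∈? edge T e) (i Fin.≟ j)))) (trans
            (sym (𝟙-⊎ (together? i j e) ((i ∈? edge T e) ×-dec (i Fin.≟ j)) ((i ∈? edge T e) ×-dec (j ∈? edge T e))
              (λ (i≢j , _) (_ , i≡j) → i≢j i≡j)
              cases (λ (_ , h) → h) (λ { (i∈e , ≡.refl) → i∈e , i∈e })))
            (𝟙-× (i ∈? edge T e) (j ∈? edge T e)))
            where
            cases : i ∈ˢ edge T e × j ∈ˢ edge T e → (i ≢ j × i ∈ˢ edge T e × j ∈ˢ edge T e) ⊎ (i ∈ˢ edge T e × i ≡ j)
            cases (i∈e , j∈e) with i Fin.≟ j
            ... | yes i≡j = inj₂ (i∈e , i≡j)
            ... | no i≢j  = inj₁ (i≢j , i∈e , j∈e)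

          sum-together : ∀ x i e → sum (λ j → 𝟙 (together? i j e) * x j) ≈ 𝟙 (i ∈? edge T e) * (edgeSum e x - x i)
          sum-together x i e = begin
            R                                    ≈⟨ solve 2 (λ R D → R := (R :+ D) :- D) refl R D ⟩
            (R + D) - D                          ≈⟨ +-cong R+D (-‿cong D≈) ⟩
            I * edgeSum e x - I * x i            ≈⟨ solve 3 (λ I S y → I :* S :- I :* y := I :* (S :- y)) refl I (edgeSum e x) (x i) ⟩
            I * (edgeSum e x - x i)              ∎
            where
            open import Relation.Binary.Reasoning.Setoid setoid
            I = 𝟙 (i ∈? edge T e)
            R = sum (λ j → 𝟙 (together? i j e) * x j)
            D = sum (λ j → I * (𝟙 (i Fin.≟ j) * x j))
            D≈ : D ≈ I * x i
            D≈ = trans (sym (*-distribˡ-sum I (λ j → 𝟙 (i Fin.≟ j) * x j))) (*-congˡ (sum-δ i x))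
            R+D : R + D ≈ I * edgeSum e x
            R+D = begin
              R + D ≈⟨ ∑-distrib-+ (λ j → 𝟙 (together? i j e) * x j) (λ j → I * (𝟙 (i Fin.≟ j) * x j)) ⟨
              sum (λ j → 𝟙 (together? i j e) * x j + I * (𝟙 (i Fin.≟ j) * x j))
                ≈⟨ sum-cong-≋ (λ j → trans (+-congˡ (sym (*-assoc _ _ _))) (trans (sym (distribʳ _ _ _)) (trans (*-congʳ (𝟙-together i j e)) (*-assoc _ _ _)))) ⟩
              sum (λ j → I * (𝟙 (j ∈? edge T e) * x j)) ≈⟨ *-distribˡ-sum I (λ j → 𝟙 (j ∈? edge T e) * x j) ⟨
              I * sum (λ j → 𝟙 (j ∈? edge T e) * x j)   ≈⟨ *-congˡ (sum-edge e x) ⟩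
              I * edgeSum e x ∎

        row-edges : ∀ x i → row T x i ≈ sum (λ e → 𝟙 (i ∈? edge T e) * (edgeSum e x - x i))
        row-edges x i = trans (sum-cong-≋ λ j → trans (*-congʳ (𝟙-adjacent i j)) (*-distribʳ-sum (x j) (λ e → 𝟙 (together? i j e))))
          (trans (∑-comm λ j e → 𝟙 (together? i j e) * x j) (sum-cong-≋ λ e → sum-together x i e))

        form-edges : ∀ x → form T x ≈ sum (λ e → edgeForm (x (par e)) (block x e))
        form-edges x = trans (sum-cong-≋ λ i → trans (*-congˡ (row-edges x i))
              (trans (*-distribˡ-sum (x i) (λ e → 𝟙 (i ∈? edge T e) * (edgeSum e x - x i)))
                (sum-cong-≋ λ e → solve 3 (λ y I S → y :* (I :* S) := I :* (y :* S)) refl (x i) (𝟙 (i ∈? edge T e)) (edgeSum e x - x i))))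
          (trans (∑-comm λ i e → 𝟙 (i ∈? edge T e) * (x i * (edgeSum e x - x i)))
            (sum-cong-≋ λ e → trans (sum-edge e (λ i → x i * (edgeSum e x - x i))) (expand e)))
          where
          squares : ∀ {m} (S : Carrier) (y : Vector Carrier m) → sum (λ t → y t * (S - y t)) + sum (λ t → y t * y t) ≈ S * sum y
          squares S y = trans (sym (∑-distrib-+ (λ t → y t * (S - y t)) (λ t → y t * y t)))
            (trans (sum-cong-≋ λ t → solve 2 (λ y S → y :* (S :- y) :+ y :* y := S :* y) refl (y t) S) (sym (*-distribˡ-sum S y)))
          expand : ∀ e → edgeSum e (λ i → x i * (edgeSum e x - x i)) ≈ edgeForm (x (par e)) (block x e)
          expand e = trans (solve 4 (λ q S R N → q :* (S :- q) :+ R := (q :* S :+ (R :+ N)) :- (q :* q :+ N)) refl (x (par e)) S (sum λ t → x (child e t) * (S - x (child e t))) N)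
            (trans (+-congʳ (+-congˡ (squares S λ t → x (child e t)))) (+-congʳ (trans (+-congʳ (*-comm _ _)) (sym (distribˡ S (x (par e)) (sum λ t → x (child e t)))))))
            where
            S = edgeSum e x
            N = sum λ t → x (child e t) * x (child e t)

  module ListSums (𝓡 : OrderedAlgebra) where
    open OrderedAlgebra 𝓡
    open OrderedAlgebraProperties 𝓡
    open Sums 𝓡

    listSum : ∀ {A : Set} → (A → Carrier) → List A → Carrier
    listSum f []       = 0#
    listSum f (x ∷ xs) = f x + listSum f xs

    listSum-++ : ∀ {A : Set} (f : A → Carrier) xs ys → listSum f (xs ++ ys) ≈ listSum f xs + listSum f ys
    listSum-++ f []       ys = sym (+-identityˡ _)
    listSum-++ f (x ∷ xs) ys = trans (+-congˡ (listSum-++ f xs ys)) (sym (+-assoc _ _ _))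

    listSum-↭ : ∀ {A : Set} (f : A → Carrier) {xs ys} → xs ↭ ys → listSum f xs ≈ listSum f ys
    listSum-↭ f Perm.refl         = refl
    listSum-↭ f (Perm.prep x π)   = +-congˡ (listSum-↭ f π)
    listSum-↭ f (Perm.swap x y π) = trans (sym (+-assoc _ _ _)) (trans (+-cong (+-comm _ _) (listSum-↭ f π)) (+-assoc _ _ _))
    listSum-↭ f (Perm.trans π ρ)  = trans (listSum-↭ f π) (listSum-↭ f ρ)

    sum≈listSum : ∀ {m} (f : Vector Carrier m) → sum f ≈ listSum f (allFin m)
    sum≈listSum f = tabulated f λ i → i
      where
      tabulated : ∀ {m k} (f : Vector Carrier m) (g : Fin k → Fin m) → sum (λ i → f (g i)) ≈ listSum f (tabulate g)
      tabulated {k = zero}  f g = refl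
      tabulated {k = suc k} f g = +-congˡ (tabulated f λ i → g (fsuc i))

  module BlockCongruence (𝓡 : OrderedAlgebra) (n : ℕ) where
    open OrderedAlgebra 𝓡
    open OrderedAlgebraProperties 𝓡
    open BlockForms 𝓡 n
    open Sums 𝓡 using (sum-cong-≋)

    infix 4 _≈ᴮ_
    _≈ᴮ_ : Block → Block → Set
    (c , W) ≈ᴮ (d , V) = c ≈ d × (∀ i → W i ≈ V i)

    edgeForm-cong : ∀ {q q′ B B′} → q ≈ q′ → B ≈ᴮ B′ → edgeForm q B ≈ edgeForm q′ B′
    edgeForm-cong q≈ (c≈ , W≈) = +-cong (*-cong s s) (-‿cong (+-cong (*-cong q≈ q≈) (+-cong (*-cong c≈ c≈) (sum-cong-≋ λ i → *-cong (W≈ i) (W≈ i)))))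
      where s = +-cong q≈ (+-cong c≈ (sum-cong-≋ W≈))

    arm-cong : ∀ {q q′ Bs Bs′} → q ≈ q′ → Pointwise _≈ᴮ_ Bs Bs′ → arm q Bs ≈ arm q′ Bs′
    arm-cong q≈ []        = refl
    arm-cong q≈ (B≈ ∷ Bs≈) = +-cong (edgeForm-cong q≈ B≈) (arm-cong (proj₁ B≈) Bs≈)

    norms-cong : ∀ {Bs Bs′} → Pointwise _≈ᴮ_ Bs Bs′ → norms Bs ≈ norms Bs′
    norms-cong []        = refl
    norms-cong ((c≈ , W≈) ∷ Bs≈) = +-cong (+-cong (*-cong c≈ c≈) (sum-cong-≋ λ i → *-cong (W≈ i) (W≈ i))) (norms-cong Bs≈)

    shift-0 : ∀ Bs → Pointwise _≈ᴮ_ (map (shift 0ℚ) Bs) Bs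
    shift-0 []       = []
    shift-0 (B ∷ Bs) = (trans (+-congˡ ι-0) (+-identityʳ _) , λ i → refl) ∷ shift-0 Bs

  -- μ bounds the adjacency form on every broom with arms of lengths p + 1 and p and c pendant edges.
  BroomBound : (𝓡 : OrderedAlgebra) (n p c : ℕ) → OrderedAlgebra.Carrier 𝓡 → Set
  BroomBound 𝓡 n p c μ = ∀ q Ys Zs Ps → length Ys ≡ suc p → length Zs ≡ p → length Ps ≡ c →
      arm q Ys + arm q Zs + pendants q Ps ≤ μ * (q * q + (norms Ys + norms Zs + norms Ps))
    where
    open OrderedAlgebra 𝓡
    open BlockForms 𝓡 n

  module Balance (𝓡 : OrderedAlgebra) (n p c : ℕ) (μ : OrderedAlgebra.Carrier 𝓡) (bound : BroomBound 𝓡 n p c μ) where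
    open OrderedAlgebra 𝓡
    open OrderedAlgebraProperties 𝓡
    open BlockForms 𝓡 n
    open BlockCongruence 𝓡 n
    open ι-Solver using (solve; _:=_; _:+_; _:*_; _:-_; :-_; con)

    total : Carrier → List Block → List Block → List Block → Carrier
    total q Ys Zs Ps = arm q Ys + arm q Zs + pendants q Ps

    totalNorm : Carrier → List Block → List Block → List Block → Carrier
    totalNorm q Ys Zs Ps = q * q + (norms Ys + norms Zs + norms Ps)

    -- Y₀ ++ Y₁ is too long an arm, Zs too short a one; lastTop q Y₀ does not depend on q.
    rebalance : ∀ q A Y₀ Y₁ Zs Ps → lastTop (top A) Y₀ ≤ q → All NonNegBlock Y₁ →
      suc (length Y₀) ℕ.+ length Zs ≡ p → length Y₁ ≡ suc p → length Ps ≡ c →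
      ¬ ¬ (∃₂ λ δ τ → 0ℚ ℚ.< τ × (All PosBlock Y₁ → 0# < δ) × (∀ t → 0ℚ ℚ.≤ t → t ℚ.≤ τ →
        total (q + ι t) (A ∷ Y₀ ++ Y₁) (map (shift t) Zs) Ps + ι t * δ ≤ μ * totalNorm (q + ι t) (A ∷ Y₀ ++ Y₁) (map (shift t) Zs) Ps))
    rebalance q A Y₀ Y₁ Zs Ps y≤q 0≤Y₁ len₀ len₁ lenP k =
      exchange (lastTop (top A) Y₀) q y≤q Y₁ Zs shorter 0≤Y₁ λ (δ , τ , 0<τ , pos , ex) → k (δ , τ , 0<τ , pos , λ t 0≤t t≤τ →
        let Ys′ , Zs′ , lenY , lenZ , norms≈ , le = ex t 0≤t t≤τ
            z = q + ι t
            P = pendants z Ps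
            S = map (shift t) Zs
        in ≤-trans
          (≤-trans (≤-reflexive (trans (+-congʳ (+-congʳ (+-congʳ (arm-++ z (A ∷ Y₀) Y₁))))
              (solve 5 (λ a b s P g → (((a :+ b) :+ s) :+ P) :+ g := (a :+ P) :+ ((b :+ s) :+ g)) refl (arm z (A ∷ Y₀)) (arm (lastTop (top A) Y₀) Y₁) (arm z S) P (ι t * δ))))
          (≤-trans (+-mono-≤ ≤-refl le)
            (≤-reflexive (trans (solve 4 (λ a b s P → (a :+ P) :+ (b :+ s) := (s :+ (a :+ b)) :+ P) refl (arm z (A ∷ Y₀)) (arm (lastTop (top A) Y₀) Ys′) (arm z Zs′) P)
              (+-congʳ (+-congˡ (sym (arm-++ z (A ∷ Y₀) Ys′))))))))
          (≤-respʳ (*-congˡ (+-congˡ (trans (+-congʳ (+-congˡ (norms-++ (A ∷ Y₀) Ys′)))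
              (trans (solve 4 (λ a y z P → (z :+ (a :+ y)) :+ P := (a :+ (y :+ z)) :+ P) refl (norms (A ∷ Y₀)) (norms Ys′) (norms Zs′) (norms Ps))
              (trans (+-congʳ (+-congˡ norms≈)) (+-congʳ (trans (sym (+-assoc _ _ _)) (+-congʳ (sym (norms-++ (A ∷ Y₀) Y₁)))))))) ))
            -- After the exchange the arm that was too short has length p + 1 and the other one p,
            -- so the two have changed roles.
            (bound z Zs′ (A ∷ Y₀ ++ Ys′) Ps (≡.trans lenZ len₁)
              (≡.trans (List.length-++ (A ∷ Y₀)) (≡.trans (≡.cong (suc (length Y₀) ℕ.+_) lenY) len₀)) lenP)))
      where
      shorter : length Zs ℕ.< length Y₁
      shorter = ≡.subst (length Zs ℕ.<_) (≡.sym len₁) (ℕ.s≤s (ℕ.≤-trans (ℕ.m≤n+m (length Zs) (suc (length Y₀))) (ℕ.≤-reflexive len₀)))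

    -- If `Y₀` is empty, the lengths are already right. Otherwise this is `rebalance` at t = 0,
    -- where shifting changes nothing and the gain term vanishes.
    balanced : ∀ q Y₀ Y₁ Zs Ps → lastTop q Y₀ ≤ q → All NonNegBlock Y₁ →
      length Y₀ ℕ.+ length Zs ≡ p → length Y₁ ≡ suc p → length Ps ≡ c →
      total q (Y₀ ++ Y₁) Zs Ps ≤ μ * totalNorm q (Y₀ ++ Y₁) Zs Ps
    balanced q []       Y₁ Zs Ps y≤q 0≤Y₁ len₀ len₁ lenP = bound q Y₁ Zs Ps len₁ len₀ lenP
    balanced q (A ∷ Y₀) Y₁ Zs Ps y≤q 0≤Y₁ len₀ len₁ lenP = ≤-stable λ k →
      rebalance q A Y₀ Y₁ Zs Ps y≤q 0≤Y₁ len₀ len₁ lenP λ (δ , τ , 0<τ , _ , h) → k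
        (≤-respˡ (trans (+-congˡ (trans (*-congʳ ι-0) (zeroˡ δ))) (trans (+-identityʳ _) total≈))
          (≤-respʳ (*-congˡ norm≈) (h 0ℚ ℚ.≤-refl (ℚ.<⇒≤ 0<τ))))
      where
      q≈ : q + ι 0ℚ ≈ q
      q≈ = trans (+-congˡ ι-0) (+-identityʳ q)
      ≈ᴮ-refl : ∀ Bs → Pointwise _≈ᴮ_ Bs Bs
      ≈ᴮ-refl []       = []
      ≈ᴮ-refl (B ∷ Bs) = (refl , λ i → refl) ∷ ≈ᴮ-refl Bs
      pendants-cong : ∀ Bs → pendants (q + ι 0ℚ) Bs ≈ pendants q Bs
      pendants-cong []       = refl
      pendants-cong (B ∷ Bs) = +-cong (edgeForm-cong {B = B} q≈ (refl , λ i → refl)) (pendants-cong Bs)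
      total≈ : total (q + ι 0ℚ) (A ∷ Y₀ ++ Y₁) (map (shift 0ℚ) Zs) Ps ≈ total q (A ∷ Y₀ ++ Y₁) Zs Ps
      total≈ = +-cong (+-cong (arm-cong q≈ (≈ᴮ-refl (A ∷ Y₀ ++ Y₁))) (arm-cong q≈ (shift-0 Zs))) (pendants-cong Ps)
      norm≈ : totalNorm (q + ι 0ℚ) (A ∷ Y₀ ++ Y₁) (map (shift 0ℚ) Zs) Ps ≈ totalNorm q (A ∷ Y₀ ++ Y₁) Zs Ps
      norm≈ = +-cong (*-cong q≈ q≈) (+-congʳ (+-congˡ (norms-cong (shift-0 Zs))))

  heads : ∀ {A : Set} → List A → List A
  heads []      = []
  heads (x ∷ _) = x ∷ []

  -- The two halves of a path, the shorter one being Zl and the longer one Y₀ ++ Y₁.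
  record Arms {T : Hypergraph} {n : ℕ} (B : RootedBlocks T n) (p c : ℕ) : Set where
    open Chains B
    field
      Zl Y₀ Y₁ Os : List (Edge T)
      Zl-descend  : Descending Zl
      Yl-descend  : Descending (Y₀ ++ Y₁)
      length-Zl   : length Y₀ ℕ.+ length Zl ≡ p
      length-Y₁   : length Y₁ ≡ suc p
      length-Os   : length Os ≡ c
      all-edges   : allFin (∣E∣ T) ↭ (Zl ++ (Y₀ ++ Y₁)) ++ Os

    -- The edges whose parent may change when both chains and all other edges are hung from the
    -- root; the rest stay below their predecessor in a chain.
    Reattached : Edge T → Set
    Reattached e = e ∈ heads Zl ⊎ e ∈ heads (Y₀ ++ Y₁) ⊎ e ∈ Os

  module _ {T : Hypergraph} {n : ℕ} (B : RootedBlocks T n) where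
    open Chains B

    sort-arms : ∀ {p c} → Sorted (p ℕ.+ suc p) → ∣E∣ T ≡ (p ℕ.+ suc p) ℕ.+ c → Arms B p c
    sort-arms {p} {c} S size = choose (ℕ.≤-<-connex (length Ls) p)
      where
      open Sorted S
      lengths : length Ls ℕ.+ length Rs ≡ p ℕ.+ suc p
      lengths = ≡.trans (≡.sym (List.length-++ Ls)) length-path
      length-others : length Os ≡ c
      length-others = ℕ.+-cancelˡ-≡ (p ℕ.+ suc p) _ _ (≡.trans (≡.trans (≡.cong (ℕ._+ length Os) (≡.sym length-path)) (≡.sym (List.length-++ (Ls ++ Rs))))
        (≡.trans (≡.sym (↭-length all-edges)) (≡.trans (List.length-tabulate {n = ∣E∣ T} (λ i → i)) size)))
      build : ∀ Zl Yl → Descending Zl → Descending Yl → length Zl ℕ.+ length Yl ≡ p ℕ.+ suc p → length Zl ℕ.≤ p →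
        allFin (∣E∣ T) ↭ (Zl ++ Yl) ++ Os → Arms B p c
      build Zl Yl dZ dY len short π = record
        { Zl = Zl ; Y₀ = List.take s Yl ; Y₁ = List.drop s Yl ; Os = Os
        ; Zl-descend = dZ ; Yl-descend = ≡.subst Descending (≡.sym cut) dY
        ; length-Zl = ≡.trans (≡.cong (ℕ._+ length Zl) length-take) (ℕ.m∸n+n≡m short)
        ; length-Y₁ = ≡.trans (List.length-drop s Yl) (ℕ.+-cancelˡ-≡ p _ _ (≡.trans (≡.cong (ℕ._+ (length Yl ℕ.∸ s)) (≡.sym (ℕ.m+[n∸m]≡n short)))
            (≡.trans (ℕ.+-assoc (length Zl) s _) (≡.trans (≡.cong (length Zl ℕ.+_) (ℕ.m+[n∸m]≡n s≤Y)) len))))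
        ; length-Os = length-others
        ; all-edges = ≡.subst (λ Yl → allFin (∣E∣ T) ↭ (Zl ++ Yl) ++ Os) (≡.sym cut) π }
        where
        -- The excess of the longer half over p + 1, so that exactly p + 1 edges remain behind the
        -- cut.
        s = p ℕ.∸ length Zl
        cut : List.take s Yl ++ List.drop s Yl ≡ Yl
        cut = List.take++drop≡id s Yl
        s≤Y : s ℕ.≤ length Yl
        s≤Y = ℕ.≤-trans (ℕ.m∸n≤m p (length Zl)) (ℕ.+-cancelˡ-≤ (length Zl) p (length Yl)
          (ℕ.≤-trans (ℕ.+-monoˡ-≤ p short) (ℕ.≤-trans (ℕ.+-monoʳ-≤ p (ℕ.n≤1+n p)) (ℕ.≤-reflexive (≡.sym len)))))
        length-take : length (List.take s Yl) ≡ s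
        length-take = ≡.trans (List.length-take s Yl) (ℕ.m≤n⇒m⊓n≡m s≤Y)
      choose : length Ls ℕ.≤ p ⊎ p ℕ.< length Ls → Arms B p c
      choose (inj₁ L≤p) = build Ls Rs Ls-descend Rs-descend lengths L≤p all-edges
      choose (inj₂ p<L) = build Rs Ls Rs-descend Ls-descend (≡.trans (ℕ.+-comm (length Rs) (length Ls)) lengths) R≤p
                            (↭-trans all-edges (++⁺ʳ Os (++-comm Ls Rs)))
        where
        R≤p : length Rs ℕ.≤ p
        R≤p = ℕ.+-cancelˡ-≤ (suc p) _ _ (ℕ.≤-trans (ℕ.+-monoˡ-≤ (length Rs) p<L) (ℕ.≤-reflexive (≡.trans lengths (ℕ.+-comm p (suc p)))))

  module AttachedForm (𝓡 : OrderedAlgebra) {T : Hypergraph} {n : ℕ} (linear : Linear T) (B : RootedBlocks T n) {p c : ℕ} (A : Arms B p c) where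
    open OrderedAlgebra 𝓡
    open OrderedAlgebraProperties 𝓡
    open BlockForms 𝓡 n hiding (sum)
    open BlockCongruence 𝓡 n
    open Sums 𝓡
    open ListSums 𝓡
    open RootedBlocks B
    open Chains B
    open Arms A
    open ι-Solver using (solve; _:=_; _:+_; _:*_; _:-_; :-_; con)

    blocks : Vector Carrier (∣V∣ T) → List (Edge T) → List Block
    blocks x = map (block B x)

    edgeTerm : Vector Carrier (∣V∣ T) → Edge T → Carrier
    edgeTerm x e = edgeForm (x (par e)) (block B x e)

    2ℚ : ℚ
    2ℚ = 1ℚ ℚ.+ 1ℚ

    -- The growth of one edge form when the root takes the place of the parent of e.
    gainOf : Vector Carrier (∣V∣ T) → Edge T → Carrier
    gainOf x e = ι 2ℚ * ((x root - x (par e)) * blockSum (block B x e))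

    edgeForm-gain : ∀ q q′ C → edgeForm q C + ι 2ℚ * ((q′ - q) * blockSum C) ≈ edgeForm q′ C
    edgeForm-gain q q′ C = solve 4 (λ q r S N → (((q :+ S) :* (q :+ S) :- (q :* q :+ N)) :+ con 2ℚ :* ((r :- q) :* S)) := ((r :+ S) :* (r :+ S) :- (r :* r :+ N)))
      refl q q′ (blockSum C) (blockNorm C)

    attached : Vector Carrier (∣V∣ T) → Carrier
    attached x = arm (x root) (blocks x (Y₀ ++ Y₁)) + arm (x root) (blocks x Zl) + pendants (x root) (blocks x Os)

    attachedNorm : Vector Carrier (∣V∣ T) → Carrier
    attachedNorm x = x root * x root + (norms (blocks x (Y₀ ++ Y₁)) + norms (blocks x Zl) + norms (blocks x Os))

    listSum-norms : ∀ x es → listSum (λ e → blockNorm (block B x e)) es ≈ norms (blocks x es)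
    listSum-norms x []       = refl
    listSum-norms x (e ∷ es) = +-congˡ (listSum-norms x es)

    listSum-edges : ∀ (f : Edge T → Carrier) → sum f ≈ listSum f (Y₀ ++ Y₁) + listSum f Zl + listSum f Os
    listSum-edges f = trans (sum≈listSum f) (trans (listSum-↭ f all-edges) (trans (listSum-++ f (Zl ++ (Y₀ ++ Y₁)) Os)
      (+-congʳ (trans (listSum-++ f Zl (Y₀ ++ Y₁)) (+-comm _ _)))))

    norm≈attachedNorm : ∀ x → norm x ≈ attachedNorm x
    norm≈attachedNorm x = trans (norm-edges B x) (+-congˡ (trans (listSum-edges _)
      (+-cong (+-cong (listSum-norms x (Y₀ ++ Y₁)) (listSum-norms x Zl)) (listSum-norms x Os))))

    module _ (x : Vector Carrier (∣V∣ T)) (0≤x : ∀ v → 0# ≤ x v) (x≤root : ∀ e → x (par e) ≤ x root) where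

      nonNegBlock : ∀ e → NonNegBlock (block B x e)
      nonNegBlock e = 0≤x _ , λ t → 0≤x _

      nonNegBlocks : ∀ es → All NonNegBlock (blocks x es)
      nonNegBlocks []       = []
      nonNegBlocks (e ∷ es) = nonNegBlock e ∷ nonNegBlocks es

      0≤gain : ∀ e → 0# ≤ gainOf x e
      0≤gain e = *-nonNeg (0≤ι (toWitness {a? = 0ℚ ℚ.≤? 2ℚ} _)) (*-nonNeg (0≤-diff (x≤root e)) (blockSum-nonNeg (nonNegBlock e)))

      edge-attach : ∀ e → edgeTerm x e ≤ edgeForm (x root) (block B x e)
      edge-attach e = ≤-by (gainOf x e) (0≤gain e) (sym (edgeForm-gain (x (par e)) (x root) (block B x e)))

      below-arm : ∀ e es → Below e es → listSum (edgeTerm x) es ≈ arm (x (child e fzero)) (blocks x es)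
      below-arm e []       _          = refl
      below-arm e (f ∷ fs) (par≡ , b) = +-cong (reflexive (≡.cong (λ v → edgeForm (x v) (block B x f)) par≡)) (below-arm f fs b)

      -- Only the first edge gets a new parent; along the rest of a descending chain the parents are
      -- already the preceding tops.
      chain-attach : ∀ es → Descending es → listSum (edgeTerm x) es ≤ arm (x root) (blocks x es)
      chain-attach []       _ = ≤-refl
      chain-attach (e ∷ es) b = +-mono-≤ (edge-attach e) (≤-reflexive (below-arm e es b))

      chain-attach-gain : ∀ es → Descending es → ∀ {e} → e ∈ heads es → listSum (edgeTerm x) es + gainOf x e ≤ arm (x root) (blocks x es)
      chain-attach-gain (e ∷ es) b (here ≡.refl) = ≤-reflexive (trans (solve 3 (λ a s g → (a :+ s) :+ g := (a :+ g) :+ s) refl _ _ _)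
        (+-cong (edgeForm-gain (x (par e)) (x root) (block B x e)) (below-arm e es b)))

      pendants-attach : ∀ es → listSum (edgeTerm x) es ≤ pendants (x root) (blocks x es)
      pendants-attach []       = ≤-refl
      pendants-attach (e ∷ es) = +-mono-≤ (edge-attach e) (pendants-attach es)

      pendants-attach-gain : ∀ es {e} → e ∈ es → listSum (edgeTerm x) es + gainOf x e ≤ pendants (x root) (blocks x es)
      pendants-attach-gain (e ∷ es) (here ≡.refl) = ≤-respˡ (solve 3 (λ a s g → (a :+ g) :+ s := (a :+ s) :+ g) refl _ _ _)
        (+-mono-≤ (≤-reflexive (edgeForm-gain (x (par e)) (x root) (block B x e))) (pendants-attach es))
      pendants-attach-gain (e ∷ es) (there e∈) = ≤-respˡ (sym (+-assoc _ _ _)) (+-mono-≤ (edge-attach e) (pendants-attach-gain es e∈))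

      form≈ : form T x ≈ listSum (edgeTerm x) (Y₀ ++ Y₁) + listSum (edgeTerm x) Zl + listSum (edgeTerm x) Os
      form≈ = trans (form-edges B linear x) (listSum-edges (edgeTerm x))

      attach : form T x ≤ attached x
      attach = ≤-respˡ (sym form≈) (+-mono-≤ (+-mono-≤ (chain-attach (Y₀ ++ Y₁) Yl-descend) (chain-attach Zl Zl-descend)) (pendants-attach Os))

      attach-gain : ∀ {e} → Reattached e → form T x + gainOf x e ≤ attached x
      attach-gain (inj₁ e∈) = ≤-respˡ (trans (solve 4 (λ a b c g → (a :+ (b :+ g)) :+ c := ((a :+ b) :+ c) :+ g) refl _ _ _ _) (+-congʳ (sym form≈)))
        (+-mono-≤ (+-mono-≤ (chain-attach (Y₀ ++ Y₁) Yl-descend) (chain-attach-gain Zl Zl-descend e∈)) (pendants-attach Os))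
      attach-gain (inj₂ (inj₁ e∈)) = ≤-respˡ (trans (solve 4 (λ a b c g → ((a :+ g) :+ b) :+ c := ((a :+ b) :+ c) :+ g) refl _ _ _ _) (+-congʳ (sym form≈)))
        (+-mono-≤ (+-mono-≤ (chain-attach-gain (Y₀ ++ Y₁) Yl-descend e∈) (chain-attach Zl Zl-descend)) (pendants-attach Os))
      attach-gain (inj₂ (inj₂ e∈)) = ≤-respˡ (trans (sym (+-assoc _ _ _)) (+-congʳ (sym form≈)))
        (+-mono-≤ (+-mono-≤ (chain-attach (Y₀ ++ Y₁) Yl-descend) (chain-attach Zl Zl-descend)) (pendants-attach-gain Os e∈))

      -- The edge f hangs from the vertex in question, which is therefore a parent. This matters
      -- because the root is known to carry the largest entry among parents only.
      lastTop-below : ∀ e es f fs → Below e (es ++ f ∷ fs) → lastTop (x (child e fzero)) (blocks x es) ≤ x root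
      lastTop-below e []       f fs (par≡ , _) = ≤-respˡ (reflexive (≡.cong x par≡)) (x≤root f)
      lastTop-below e (g ∷ es) f fs (_ , b)    = lastTop-below g es f fs b

    module _ {μ : Carrier} (bound : BroomBound 𝓡 n p c μ) (x : Vector Carrier (∣V∣ T)) (0≤x : ∀ v → 0# ≤ x v) (x≤root : ∀ e → x (par e) ≤ x root) where
      open Balance 𝓡 n p c μ bound

      private
        length-blocks : ∀ es → length (blocks x es) ≡ length es
        length-blocks es = List.length-map (block B x) es

        Y-split : blocks x (Y₀ ++ Y₁) ≡ blocks x Y₀ ++ blocks x Y₁
        Y-split = List.map-++ (block B x) Y₀ Y₁

      lastTop≤root : ∀ es fs → length fs ≡ suc p → Descending (es ++ fs) → lastTop (x root) (blocks x es) ≤ x root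
      lastTop≤root []       fs       len d = ≤-refl
      lastTop≤root (e ∷ es) (f ∷ fs) len d = lastTop-below x 0≤x x≤root e es f fs d

      attached≤ : attached x ≤ μ * norm x
      attached≤ = ≤-respʳ (*-congˡ (sym (norm≈attachedNorm x)))
        (≡.subst (λ Ys → total (x root) Ys (blocks x Zl) (blocks x Os) ≤ μ * totalNorm (x root) Ys (blocks x Zl) (blocks x Os)) (≡.sym Y-split)
          (balanced (x root) (blocks x Y₀) (blocks x Y₁) (blocks x Zl) (blocks x Os)
            (lastTop≤root Y₀ Y₁ length-Y₁ Yl-descend) (nonNegBlocks x 0≤x x≤root Y₁)
            (≡.trans (≡.cong₂ ℕ._+_ (length-blocks Y₀) (length-blocks Zl)) length-Zl) (≡.trans (length-blocks Y₁) length-Y₁) (≡.trans (length-blocks Os) length-Os)))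

      form≤ : form T x ≤ μ * norm x
      form≤ = ≤-trans (attach x 0≤x x≤root) attached≤

      form-gain≤ : ∀ {e} → Reattached e → form T x + gainOf x e ≤ μ * norm x
      form-gain≤ r = ≤-trans (attach-gain x 0≤x x≤root r) attached≤

  module Perturbation (𝓡 : OrderedAlgebra) (T : Hypergraph) where
    open OrderedAlgebra 𝓡
    open OrderedAlgebraProperties 𝓡
    open Sums 𝓡
    open BlockForms 𝓡 0 using (sum-nonNeg)
    open ι-Solver using (solve; _:=_; _:+_; _:*_; _:-_; :-_; con)

    private
      V = Vector Carrier (∣V∣ T)

      2ℚ : ℚ
      2ℚ = 1ℚ ℚ.+ 1ℚ

    infixl 6 _+[_]_
    _+[_]_ : V → ℚ → V → V
    (x +[ t ] η) v = x v + ι t * η v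

    adjacent-sym : ∀ {i j} → Adjacent T i j → Adjacent T j i
    adjacent-sym (i≢j , e , i∈e , j∈e) = (λ eq → i≢j (≡.sym eq)) , e , j∈e , i∈e

    row-sym : ∀ (x y : V) → sum (λ i → x i * row T y i) ≈ sum (λ i → y i * row T x i)
    row-sym x y = trans (sum-cong-≋ λ i → *-distribˡ-sum (x i) (λ j → 𝟙 (adjacent? T i j) * y j))
      (trans (∑-comm λ i j → x i * (𝟙 (adjacent? T i j) * y j))
        (sum-cong-≋ λ j → trans (sum-cong-≋ λ i → trans (*-congˡ (*-congʳ (𝟙-cong (adjacent? T i j) (adjacent? T j i) adjacent-sym adjacent-sym)))
            (solve 3 (λ x m y → x :* (m :* y) := y :* (m :* x)) refl (x i) (𝟙 (adjacent? T j i)) (y j)))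
          (sym (*-distribˡ-sum (y j) (λ i → 𝟙 (adjacent? T j i) * x i)))))

    sum-mono : ∀ {m} (f g : Vector Carrier m) → (∀ i → f i ≤ g i) → sum f ≤ sum g
    sum-mono {zero}  f g h = ≤-refl
    sum-mono {suc m} f g h = +-mono-≤ (h fzero) (sum-mono (λ i → f (fsuc i)) (λ i → g (fsuc i)) λ i → h (fsuc i))

    0≤𝟙 : ∀ {P : Set} (P? : Dec P) → 0# ≤ 𝟙 P?
    0≤𝟙 (yes _) = ≤-respʳ ι-1 (0≤ι (toWitness {a? = 0ℚ ℚ.≤? 1ℚ} _))
    0≤𝟙 (no _)  = ≤-refl

    row-nonNeg : ∀ (x : V) → (∀ v → 0# ≤ x v) → ∀ i → 0# ≤ row T x i
    row-nonNeg x 0≤x i = sum-nonNeg _ λ j → *-nonNeg (0≤𝟙 (adjacent? T i j)) (0≤x j)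

    form-nonNeg : ∀ (x : V) → (∀ v → 0# ≤ x v) → 0# ≤ form T x
    form-nonNeg x 0≤x = sum-nonNeg _ λ i → *-nonNeg (0≤x i) (row-nonNeg x 0≤x i)

    dot : V → V → Carrier
    dot x y = sum λ i → x i * y i

    dot-+[] : ∀ x (t : ℚ) (η z : V) → dot (x +[ t ] η) z ≈ dot x z + ι t * dot η z
    dot-+[] x t η z = trans (sum-cong-≋ λ i → solve 4 (λ x t η z → (x :+ t :* η) :* z := x :* z :+ t :* (η :* z)) refl (x i) (ι t) (η i) (z i))
      (trans (∑-distrib-+ (λ i → x i * z i) (λ i → ι t * (η i * z i))) (+-congˡ (sym (*-distribˡ-sum (ι t) (λ i → η i * z i)))))

    dot-sym : ∀ (x y : V) → dot x y ≈ dot y x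
    dot-sym x y = sum-cong-≋ {∣V∣ T} λ i → *-comm (x i) (y i)

    row-+[] : ∀ x t η i → row T (x +[ t ] η) i ≈ row T x i + ι t * row T η i
    row-+[] x t η i = trans (dot-sym (λ j → 𝟙 (adjacent? T i j)) (x +[ t ] η)) (trans (dot-+[] x t η (λ j → 𝟙 (adjacent? T i j)))
      (+-cong (dot-sym x _) (*-congˡ (dot-sym η _))))

    norm-+[] : ∀ x t η → norm (x +[ t ] η) ≈ norm x + ι 2ℚ * (ι t * dot η x) + ι t * (ι t * norm η)
    norm-+[] x t η = trans (dot-+[] x t η (x +[ t ] η)) (trans (+-cong (trans (dot-sym x _) (dot-+[] x t η x)) (*-congˡ (trans (dot-sym η _) (dot-+[] x t η η))))
      (trans (+-congˡ (*-congˡ (+-congʳ (dot-sym x η)))) (solve 4 (λ n t i m → (n :+ t :* i) :+ t :* (i :+ t :* m) := (n :+ con 2ℚ :* (t :* i)) :+ t :* (t :* m)) refl (norm x) (ι t) (dot η x) (norm η))))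

    form-+[] : ∀ x t η → form T (x +[ t ] η) ≈ form T x + ι 2ℚ * (ι t * dot η (row T x)) + ι t * (ι t * form T η)
    form-+[] x t η = trans (sum-cong-≋ λ i → *-congˡ (row-+[] x t η i))
      (trans (dot-sym (x +[ t ] η) _) (trans (dot-+[] (row T x) t (row T η) (x +[ t ] η))
        (trans (+-cong (trans (dot-sym (row T x) _) (dot-+[] x t η (row T x))) (*-congˡ (trans (dot-sym (row T η) _) (dot-+[] x t η (row T η)))))
          (trans (+-congˡ (*-congˡ (+-congʳ (row-sym x η)))) (solve 4 (λ n t i m → (n :+ t :* i) :+ t :* (i :+ t :* m) := (n :+ con 2ℚ :* (t :* i)) :+ t :* (t :* m)) refl (form T x) (ι t) (dot η (row T x)) (form T η))))))

    dot-row : ∀ (x η : V) μ → (∀ v → 0# ≤ η v) → (∀ i → μ * x i ≤ row T x i) → μ * dot η x ≤ dot η (row T x)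
    dot-row x η μ 0≤η h = ≤-respˡ
      (trans (sum-cong-≋ {∣V∣ T} λ i → solve 3 (λ η μ x → η :* (μ :* x) := μ :* (η :* x)) refl (η i) μ (x i)) (sym (*-distribˡ-sum μ λ i → η i * x i)))
      (sum-mono (λ i → η i * (μ * x i)) (λ i → η i * row T x i) λ i → *-monoˡ-≤ (0≤η i) (h i))

    module _ (x η : V) (μ : Carrier) (0≤η : ∀ v → 0# ≤ η v) where

      -- Expansion in t. The quadratic term of the form is nonnegative and dropped; that of the norm
      -- remains as the loss t² μ ‖η‖².
      perturbed : ∀ {δ} → μ * norm x ≤ form T x → μ * dot η x + δ ≤ dot η (row T x) → ∀ t → 0ℚ ℚ.≤ t →
        μ * norm (x +[ t ] η) + ι t * (ι 2ℚ * δ) ≤ form T (x +[ t ] η) + ι t * (ι t * (μ * norm η))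
      perturbed {δ} h k t 0≤t = ≤-respˡ
          (sym (trans (+-congʳ (*-congˡ (norm-+[] x t η))) (solve 6 (λ μ n t i m δ → μ :* ((n :+ con 2ℚ :* (t :* i)) :+ t :* (t :* m)) :+ t :* (con 2ℚ :* δ)
              := (μ :* n :+ con 2ℚ :* (t :* (μ :* i :+ δ))) :+ t :* (t :* (μ :* m))) refl μ (norm x) (ι t) (dot η x) (norm η) δ)))
        (+-mono-≤ (≤-trans (+-mono-≤ h (*-monoˡ-≤ (0≤ι (toWitness {a? = 0ℚ ℚ.≤? 2ℚ} _)) (*-monoˡ-≤ (0≤ι 0≤t) k)))
          (≤-trans (≤-by (ι t * (ι t * form T η)) (*-nonNeg (0≤ι 0≤t) (*-nonNeg (0≤ι 0≤t) (form-nonNeg η 0≤η))) refl)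
            (≤-reflexive (sym (form-+[] x t η))))) ≤-refl)

      private
        absurd : ∀ (g : Carrier) τ → 0# < g → 0ℚ ℚ.< τ → (∀ t → 0ℚ ℚ.≤ t → t ℚ.≤ τ → ι t * g ≤ ι t * (ι t * (μ * norm η))) → ⊥
        absurd g τ (δ , 0<δ , 0+δ≤g) 0<τ h = ℚLemmas.≰half 0<δ δ≤δ/2
          where
          B⁺ : ∃ λ B → 0ℚ ℚ.< B × μ * norm η ≤ ι B
          B⁺ = let B , h = bounded (μ * norm η) in
            1ℚ ℚ.+ ℚ.∣ B ∣ , ℚ.<-≤-trans (toWitness {a? = 0ℚ ℚ.<? 1ℚ} _) (ℚLemmas.≤-by ℚ.∣ B ∣ (ℚ.0≤∣p∣ B) ≡.refl)
            , ≤-trans h (ι-mono (ℚ.≤-trans (ℚLemmas.p≤∣p∣ B) (ℚLemmas.≤-by 1ℚ (toWitness {a? = 0ℚ ℚ.≤? 1ℚ} _) (ℚ.+-comm 1ℚ ℚ.∣ B ∣))))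
          B = proj₁ B⁺
          0<B = proj₁ (proj₂ B⁺)
          B⁻ = proj₁ (inverse 0<B)
          0<δ/2 : 0ℚ ℚ.< δ ℚ.* ½
          0<δ/2 = half-pos 0<δ
          -- For t ≤ s = δ/(2B), dividing t δ ≤ t² B by t leaves δ ≤ δ/2.
          s = (δ ℚ.* ½) ℚ.* B⁻
          sB : s ℚ.* B ≡ δ ℚ.* ½
          sB = ≡.trans (ℚ.*-assoc (δ ℚ.* ½) B⁻ B) (≡.trans (≡.cong ((δ ℚ.* ½) ℚ.*_) (proj₂ (proj₂ (inverse 0<B)))) (ℚ.*-identityʳ _))
          0<s : 0ℚ ℚ.< s
          0<s = ℚ.*-cancelʳ-<-nonNeg B {{ℚ.nonNegative (ℚ.<⇒≤ 0<B)}} (≡.subst₂ ℚ._<_ (≡.sym (ℚ.*-zeroˡ B)) (≡.sym sB) 0<δ/2)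
          t = τ ℚ.⊓ s
          0<t : 0ℚ ℚ.< t
          0<t with ℚ.≤-total τ s
          ... | inj₁ τ≤s = ≡.subst (0ℚ ℚ.<_) (≡.sym (ℚ.p≤q⇒p⊓q≡p τ≤s)) 0<τ
          ... | inj₂ s≤τ = ≡.subst (0ℚ ℚ.<_) (≡.sym (ℚ.p≥q⇒p⊓q≡q s≤τ)) 0<s
          tδ≤ttB : t ℚ.* δ ℚ.≤ t ℚ.* (t ℚ.* B)
          tδ≤ttB = ι-reflects (≤-respˡ (sym (ι-* t δ)) (≤-respʳ (sym (trans (ι-* t (t ℚ.* B)) (*-congˡ (ι-* t B))))
            (≤-trans (*-monoˡ-≤ 0≤t (≤-respˡ (+-identityˡ _) 0+δ≤g)) (≤-trans (h t (ℚ.<⇒≤ 0<t) (ℚ.p⊓q≤p τ s))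
              (*-monoˡ-≤ 0≤t (*-monoˡ-≤ 0≤t (proj₂ (proj₂ B⁺))))))))
            where 0≤t = 0≤ι (ℚ.<⇒≤ 0<t)
          δ≤δ/2 : δ ℚ.≤ δ ℚ.* ½
          δ≤δ/2 = ℚ.≤-trans (ℚ.*-cancelˡ-≤-pos t {{ℚ.positive 0<t}} tδ≤ttB)
            (ℚ.≤-trans (ℚ.*-monoʳ-≤-nonNeg B {{ℚ.nonNegative (ℚ.<⇒≤ 0<B)}} (ℚ.p⊓q≤q τ s)) (ℚ.≤-reflexive sB))

        cancel : ∀ {a b c} → a + b ≤ a + c → b ≤ c
        cancel {a} {b} {c} h = ≤-by ((a + c) - (a + b)) (0≤-diff h) (solve 3 (λ a b c → c := b :+ ((a :+ c) :- (a :+ b))) refl a b c)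

      -- A gain of first order in t outweighs the loss t² μ ‖η‖² of the perturbation.
      no-row-gain : (δ : Carrier) → 0# < δ → μ * norm x ≤ form T x → μ * dot η x + δ ≤ dot η (row T x) →
        (∀ t → 0ℚ ℚ.≤ t → form T (x +[ t ] η) ≤ μ * norm (x +[ t ] η)) → ⊥
      no-row-gain δ (ε , 0<ε , 0+ε≤δ) h k upper = absurd (ι 2ℚ * δ) 1ℚ
        (ε , 0<ε , ≤-trans 0+ε≤δ (≤-by δ (≤-trans (0≤ι (ℚ.<⇒≤ 0<ε)) (≤-respˡ (+-identityˡ _) 0+ε≤δ)) (solve 1 (λ d → con 2ℚ :* d := d :+ d) refl δ)))
        (toWitness {a? = 0ℚ ℚ.<? 1ℚ} _)
        λ t 0≤t _ → cancel (≤-trans (perturbed h k t 0≤t) (+-mono-≤ (upper t 0≤t) ≤-refl))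

      -- Here the first-order gain t δ comes from rearranging the tree under the perturbed vector,
      -- while x and the direction η only have to keep pace with μ.
      no-gain : (δ : Carrier) → 0# < δ → ∀ τ → 0ℚ ℚ.< τ → μ * norm x ≤ form T x → μ * dot η x ≤ dot η (row T x) →
        (∀ t → 0ℚ ℚ.≤ t → t ℚ.≤ τ → form T (x +[ t ] η) + ι t * δ ≤ μ * norm (x +[ t ] η)) → ⊥
      no-gain δ 0<δ τ 0<τ h k upper = absurd δ τ 0<δ 0<τ λ t 0≤t t≤τ → cancel
        (≤-trans (upper t 0≤t t≤τ)
          (≤-respˡ (trans (+-congˡ (trans (*-congˡ (zeroʳ _)) (zeroʳ _))) (+-identityʳ _))
            (perturbed h (≤-respˡ (sym (+-identityʳ _)) k) t 0≤t)))

  unique-++ : ∀ {A : Set} (xs : List A) {ys x} → Unique (xs ++ ys) → x ∈ xs → x ∈ ys → ⊥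
  unique-++ (x ∷ xs) (x∉ ∷ _) (here ≡.refl) x∈ys = All.lookup x∉ (∈-++⁺ʳ xs x∈ys) ≡.refl
  unique-++ (x ∷ xs) (_ ∷ u)  (there x∈xs)  x∈ys = unique-++ xs u x∈xs x∈ys

  unique-prefix : ∀ {A : Set} (xs : List A) {ys} → Unique (xs ++ ys) → Unique xs
  unique-prefix []       _        = []
  unique-prefix (x ∷ xs) (p ∷ u) = All.tabulate (λ y∈ → All.lookup p (∈-++⁺ˡ y∈)) ∷ unique-prefix xs u

  unique-resp-↭ : ∀ {A : Set} {xs ys : List A} → xs ↭ ys → Unique xs → Unique ys
  unique-resp-↭ π = Permutation.Unique-resp-↭ (≡.setoid _) (↭⇒↭ₛ π)

  module Unbalanced (𝓡 : OrderedAlgebra) {T : Hypergraph} {n : ℕ} (linear : Linear T) (B : RootedBlocks T n) {p c : ℕ} (A : Arms B p c) where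
    open OrderedAlgebra 𝓡
    open OrderedAlgebraProperties 𝓡
    open BlockForms 𝓡 n hiding (sum)
    open BlockCongruence 𝓡 n
    open Sums 𝓡
    open Perturbation 𝓡 T
    open AttachedForm 𝓡 linear B A
    open RootedBlocks B
    open Chains B
    open Arms A

    private
      unique : Unique ((Zl ++ (Y₀ ++ Y₁)) ++ Os)
      unique = unique-resp-↭ all-edges (allFin⁺ (∣E∣ T))

      Y∉Zl : ∀ {e} → e ∈ Y₀ ++ Y₁ → e ∉ Zl
      Y∉Zl e∈Y e∈Z = unique-++ Zl (unique-prefix (Zl ++ (Y₀ ++ Y₁)) unique) e∈Z e∈Y

      Os∉Zl : ∀ {e} → e ∈ Os → e ∉ Zl
      Os∉Zl e∈O e∈Z = unique-++ (Zl ++ (Y₀ ++ Y₁)) unique (∈-++⁺ˡ e∈Z) e∈O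

      Raised : Vertex T → Set
      Raised v = v ≡ root ⊎ Any (λ e → v ≡ child e fzero) Zl

      raised? : ∀ v → Dec (Raised v)
      raised? v = (v Fin.≟ root) ⊎-dec Any.any? (λ e → v Fin.≟ child e fzero) Zl

    -- The direction behind the increment t of `exchange`: it raises the root and the tops along
    -- `Zl`. On the shorter arm it thus acts as `shift t`, and the blocks of all other edges stay
    -- fixed.
    η : Vector Carrier (∣V∣ T)
    η v = 𝟙 (raised? v)

    0≤η : ∀ v → 0# ≤ η v
    0≤η v = 0≤𝟙 (raised? v)

    private
      𝟙≤1 : ∀ {P : Set} (P? : Dec P) → 𝟙 P? ≤ 1#
      𝟙≤1 (yes _) = ≤-refl
      -- The indicator of any `yes` computes to 1, so this is 0 ≤ 1.
      𝟙≤1 (no _)  = 0≤𝟙 (yes 0≤η)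

      η-root : η root ≈ 1#
      η-root = 𝟙-yes (raised? root) (inj₁ ≡.refl)

      η-top : ∀ {e} → e ∈ Zl → η (child e fzero) ≈ 1#
      η-top {e} e∈Z = 𝟙-yes (raised? (child e fzero)) (inj₂ (Any.map (λ { ≡.refl → ≡.refl }) e∈Z))

      raised-child : ∀ {e t} → Raised (child e t) → e ∈ Zl × t ≡ fzero
      raised-child (inj₁ eq) = ⊥-elim (child≢root eq)
      raised-child {e} {t} (inj₂ h) = Any.map (λ eq → proj₁ (child-inj eq)) h , top≡ h
        where
        top≡ : ∀ {Zl} → Any (λ f → child e t ≡ child f fzero) Zl → t ≡ fzero
        top≡ (here eq)  = proj₂ (child-inj eq)
        top≡ (there h) = top≡ h

      η-rest : ∀ e t → η (child e (fsuc t)) ≈ 0#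
      η-rest e t = 𝟙-no (raised? (child e (fsuc t))) λ h → suc≢zero (proj₂ (raised-child h))
        where
        suc≢zero : ∀ {k} {i : Fin k} → fsuc i ≢ fzero
        suc≢zero ()

      η-other : ∀ {e t} → e ∉ Zl → η (child e t) ≈ 0#
      η-other {e} {t} e∉Z = 𝟙-no (raised? (child e t)) λ h → e∉Z (proj₁ (raised-child h))

    module _ (x : Vector Carrier (∣V∣ T)) (0<x : ∀ v → 0# < x v) (x≤root : ∀ e → x (par e) ≤ x root) where
      private
        0≤x : ∀ v → 0# ≤ x v
        0≤x v = <⇒≤ (0<x v)

        fixed : ∀ t {v} → η v ≈ 0# → (x +[ t ] η) v ≈ x v
        fixed t η≈0 = trans (+-congˡ (trans (*-congˡ η≈0) (zeroʳ _))) (+-identityʳ _)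

        raised : ∀ t {v} → η v ≈ 1# → (x +[ t ] η) v ≈ x v + ι t
        raised t η≈1 = +-congˡ (trans (*-congˡ η≈1) (*-identityʳ _))

        blocks-fixed : ∀ t es → (∀ {e} → e ∈ es → e ∉ Zl) → Pointwise _≈ᴮ_ (blocks (x +[ t ] η) es) (blocks x es)
        blocks-fixed t []       h = []
        blocks-fixed t (e ∷ es) h = (fixed t (η-other (h (here ≡.refl))) , λ i → fixed t (η-rest e i)) ∷ blocks-fixed t es λ e∈ → h (there e∈)

        blocks-raised : ∀ t es → (∀ {e} → e ∈ es → e ∈ Zl) → Pointwise _≈ᴮ_ (blocks (x +[ t ] η) es) (map (shift t) (blocks x es))
        blocks-raised t []       h = []
        blocks-raised t (e ∷ es) h = (raised t (η-top (h (here ≡.refl))) , λ i → fixed t (η-rest e i)) ∷ blocks-raised t es λ e∈ → h (there e∈)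

        pendants-cong : ∀ {q q′ Bs Bs′} → q ≈ q′ → Pointwise _≈ᴮ_ Bs Bs′ → pendants q Bs ≈ pendants q′ Bs′
        pendants-cong q≈ []         = refl
        pendants-cong q≈ (B≈ ∷ Bs≈) = +-cong (edgeForm-cong q≈ B≈) (pendants-cong q≈ Bs≈)

        posBlocks : ∀ es → All PosBlock (blocks x es)
        posBlocks []       = []
        posBlocks (e ∷ es) = (0<x _ , λ t → 0≤x _) ∷ posBlocks es

      module _ {μ : Carrier} (bound : BroomBound 𝓡 n p c μ) where
        open Balance 𝓡 n p c μ bound

        private
          attached≈ : ∀ t → attached (x +[ t ] η) ≈ total (x root + ι t) (blocks x (Y₀ ++ Y₁)) (map (shift t) (blocks x Zl)) (blocks x Os)
          attached≈ t = +-cong (+-cong (arm-cong q≈ (blocks-fixed t (Y₀ ++ Y₁) Y∉Zl)) (arm-cong q≈ (blocks-raised t Zl λ h → h)))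
              (pendants-cong q≈ (blocks-fixed t Os Os∉Zl))
            where q≈ = raised t η-root

          attachedNorm≈ : ∀ t → attachedNorm (x +[ t ] η) ≈ totalNorm (x root + ι t) (blocks x (Y₀ ++ Y₁)) (map (shift t) (blocks x Zl)) (blocks x Os)
          attachedNorm≈ t = +-cong (*-cong q≈ q≈) (+-cong (+-cong (norms-cong (blocks-fixed t (Y₀ ++ Y₁) Y∉Zl)) (norms-cong (blocks-raised t Zl λ h → h)))
              (norms-cong (blocks-fixed t Os Os∉Zl)))
            where q≈ = raised t η-root

          0≤x′ : ∀ t → 0ℚ ℚ.≤ t → ∀ v → 0# ≤ (x +[ t ] η) v
          0≤x′ t 0≤t v = +-nonNeg (0≤x v) (*-nonNeg (0≤ι 0≤t) (0≤η v))

          x′≤root : ∀ t → 0ℚ ℚ.≤ t → ∀ e → (x +[ t ] η) (par e) ≤ (x +[ t ] η) root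
          x′≤root t 0≤t e = ≤-respʳ (sym (raised t η-root)) (+-mono-≤ (x≤root e) (≤-respʳ (*-identityʳ _) (*-monoˡ-≤ (0≤ι 0≤t) (𝟙≤1 (raised? (par e))))))

        -- An excess `Y₀` would allow a rebalancing, whose rate of gain is positive because x is. In
        -- the direction η this beats the bound that x attains.
        no-unbalanced : μ * norm x ≤ form T x → (∀ i → μ * x i ≤ row T x i) → Y₀ ≢ [] → ⊥
        no-unbalanced h k Y₀≢[] = unbalanced Y₀ ≡.refl
          where
          length-blocks : ∀ es → length (blocks x es) ≡ length es
          length-blocks es = List.length-map (block B x) es
          unbalanced : ∀ Y → Y ≡ Y₀ → ⊥
          unbalanced []       eq = Y₀≢[] (≡.sym eq)
          unbalanced (e ∷ es) eq = rebalance (x root) (block B x e) (blocks x es) (blocks x Y₁) (blocks x Zl) (blocks x Os)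
              (≡.subst (λ Y → lastTop (x root) (blocks x Y) ≤ x root) (≡.sym eq) (lastTop≤root bound x 0≤x x≤root Y₀ Y₁ length-Y₁ Yl-descend))
              (nonNegBlocks x 0≤x x≤root Y₁)
              (≡.trans (≡.cong₂ ℕ._+_ (≡.trans (length-blocks (e ∷ es)) (≡.cong length eq)) (length-blocks Zl)) length-Zl)
              (≡.trans (length-blocks Y₁) length-Y₁) (≡.trans (length-blocks Os) length-Os)
              λ (δ , τ , 0<τ , pos , gain) →
                no-gain x η μ 0≤η δ (pos (posBlocks Y₁)) τ 0<τ h (dot-row x η μ 0≤η k) λ t 0≤t t≤τ →
                  ≤-trans (+-mono-≤ (≤-trans (attach (x +[ t ] η) (0≤x′ t 0≤t) (x′≤root t 0≤t)) (≤-reflexive (attached≈ t))) ≤-refl)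
                    (≤-trans (≡.subst (λ Ys → total (x root + ι t) Ys (map (shift t) (blocks x Zl)) (blocks x Os) + ι t * δ
                                          ≤ μ * totalNorm (x root + ι t) Ys (map (shift t) (blocks x Zl)) (blocks x Os)) split≡ (gain t 0≤t t≤τ))
                      (≤-reflexive (*-congˡ (sym (trans (norm≈attachedNorm _) (attachedNorm≈ t))))))
            where
            split≡ : block B x e ∷ blocks x es ++ blocks x Y₁ ≡ blocks x (Y₀ ++ Y₁)
            split≡ = ≡.trans (≡.cong (λ Y → blocks x Y ++ blocks x Y₁) eq) (≡.sym (List.map-++ (block B x) Y₀ Y₁))

  -- For p ≥ 1 these are, up to isomorphism, the hypergraphs T_d(c_{p+1} = c) with d = 2p + 1. The
  -- description by lists of edges serves both the eigenvector and the isomorphism.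
  record Broom (T : Hypergraph) (n p c : ℕ) : Set where
    field
      rootedBlocks : RootedBlocks T n
      arms         : Arms rootedBlocks p c
    open RootedBlocks rootedBlocks public
    open Arms arms public
    field
      Y₀≡[]        : Y₀ ≡ []
      at-root      : ∀ {e} → Reattached e → par e ≡ root

  par-nonPendant : ∀ {T n} (B : RootedBlocks T n) → RootedBlocks.root B ∈ˢ nonPendant T → ∀ e → RootedBlocks.par B e ∈ˢ nonPendant T
  par-nonPendant {T} B root∈ e with RootedBlocks.par-top B e
  ... | inj₁ eq = ≡.subst (_∈ˢ nonPendant T) (≡.sym eq) root∈
  ... | inj₂ (f , eq) = two-edges⇒nonPendant T (par∈ e) (≡.subst (_∈ˢ edge T f) (≡.sym eq) (child∈ f fzero)) λ { ≡.refl → child≢par (≡.sym eq) }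
    where open RootedBlocks B

  ¬¬-all : ∀ {m} {P : Fin m → Set} → (∀ i → ¬ ¬ P i) → ¬ ¬ (∀ i → P i)
  ¬¬-all {zero}  h k = k λ ()
  ¬¬-all {suc m} h k = h fzero λ p₀ → ¬¬-all (λ i → h (fsuc i)) λ p → k λ { fzero → p₀ ; (fsuc i) → p i }

  ¬¬-allOrNot : ∀ {m} {P : Fin m → Set} → ¬ ¬ ((∀ i → P i) ⊎ ∃ λ i → ¬ P i)
  ¬¬-allOrNot k = ¬¬-all (λ i ¬Pi → k (inj₂ (i , ¬Pi))) λ h → k (inj₁ h)

  module Comparison (𝓡 : OrderedAlgebra) {T : Hypergraph} {n p c : ℕ} (isHypertree : IsHypertree T) (uniform : Uniform (suc (suc n)) T)
    {v w} (path : Path T v w (p ℕ.+ suc p)) (0<p : 0 ℕ.< p) (size : ∣E∣ T ≡ (p ℕ.+ suc p) ℕ.+ c)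
    {μ} (bound : BroomBound 𝓡 n p c μ) where
    open OrderedAlgebra 𝓡
    open OrderedAlgebraProperties 𝓡
    open BlockForms 𝓡 n using (blockSum; blockSum-pos; edgeForm)
    open Sums 𝓡
    open Perturbation 𝓡 T
    open IsHypertree isHypertree
    open ι-Solver using (solve; _:=_; _:+_; _:*_; _:-_; :-_; con)

    private
      V = Vector Carrier (∣V∣ T)

      rootedAt : ∀ u → u ∈ˢ nonPendant T → RootedBlocks T n
      rootedAt u u∈ = toBlocks uniform twoNonPendant (rooted connected linear acyclic u) u∈

      armsAt : ∀ u u∈ → Arms (rootedAt u u∈) p c
      armsAt u u∈ = sort-arms (rootedAt u u∈) (Chains.sorted (rootedAt u u∈) path) size

      some-nonPendant : ∃ λ u → u ∈ˢ nonPendant T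
      some-nonPendant = inner-vertex p 0<p path
        where
        inner-vertex : ∀ p → 0 ℕ.< p → Path T v w (p ℕ.+ suc p) → ∃ λ u → u ∈ˢ nonPendant T
        inner-vertex (suc zero) _ P = Path.vertex P (fsuc fzero) , two-edges⇒nonPendant T (Path.target P fzero) (Path.source P (fsuc fzero)) λ eq → ≢ (Path.edge-inj P eq)
          where
          ≢ : ∀ {k} {i : Fin k} → fzero ≢ fsuc i
          ≢ ()
        inner-vertex (suc (suc p)) _ P = Path.vertex P (fsuc fzero) , two-edges⇒nonPendant T (Path.target P fzero) (Path.source P (fsuc fzero)) λ eq → ≢ (Path.edge-inj P eq)
          where
          ≢ : ∀ {k} {i : Fin k} → fzero ≢ fsuc i
          ≢ ()

      maximum : ∀ {m} (f : Vector Carrier (suc m)) → ¬ ¬ (∃ λ i → ∀ j → f j ≤ f i)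
      maximum {zero}  f k = k (fzero , λ { fzero → ≤-refl })
      maximum {suc m} f k = maximum (λ i → f (fsuc i)) λ (i , h) → ≤-or-≥ (f fzero) (f (fsuc i))
        (λ le → k (fsuc i , λ { fzero → le ; (fsuc j) → h j }))
        (λ ge → k (fzero , λ { fzero → ≤-refl ; (fsuc j) → ≤-trans (h j) ge }))

    Peak : V → Set
    Peak x = ∃₂ λ u (u∈ : u ∈ˢ nonPendant T) → ∀ e → x (RootedBlocks.par (rootedAt u u∈) e) ≤ x u

    -- Which vertices are parents depends on the root. The maximum is therefore taken over all
    -- non-pendant vertices, among which the parents lie for every choice of a non-pendant root.
    peak : ∀ x → ¬ ¬ Peak x
    peak x k = maximum-on (proj₁ (enum-surjective (nonPendant T) (proj₂ some-nonPendant))) (enum (nonPendant T)) (enum∈ (nonPendant T)) (enum-surjective (nonPendant T))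
      where
      maximum-on : ∀ {m} → Fin m → (f : Fin m → Vertex T) → (∀ i → f i ∈ˢ nonPendant T) → (∀ {u} → u ∈ˢ nonPendant T → ∃ λ i → f i ≡ u) → ⊥
      maximum-on {suc m} _ f f∈ onto = maximum (λ i → x (f i)) λ (i , h) → k (f i , f∈ i , λ e →
        let j , eq = onto (par-nonPendant (rootedAt (f i) (f∈ i)) (f∈ i) e) in ≡.subst (λ v → x v ≤ x (f i)) eq (h j))

    upper : ∀ x → (∀ v → 0# ≤ x v) → form T x ≤ μ * norm x
    upper x 0≤x = ≤-stable λ k → peak x λ (u , u∈ , h) → k
      (AttachedForm.form≤ 𝓡 linear (rootedAt u u∈) (armsAt u u∈) bound x 0≤x h)

    -- The eigenvalue equation appears as an inequality because x will be the entrywise absolute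
    -- value of an eigenvector.
    module Equality (x : V) (0≤x : ∀ v → 0# ≤ x v) (nonzero : ¬ (∀ v → x v ≤ 0#)) (eigen : ∀ i → μ * x i ≤ row T x i) where

      maximal : μ * norm x ≤ form T x
      maximal = dot-row x x μ 0≤x eigen

      private
        dot-δ : ∀ v (y : V) → dot (λ i → 𝟙 (v Fin.≟ i)) y ≈ y v
        dot-δ v y = sum-δ v y

        ≤sum : ∀ {m} (f : Vector Carrier m) → (∀ i → 0# ≤ f i) → ∀ i → f i ≤ sum f
        ≤sum {suc m} f h fzero    = ≤-by (sum λ i → f (fsuc i)) (≤-respˡ (sum-0 {m} (λ _ → 0#) λ _ → refl) (sum-mono (λ _ → 0#) (λ i → f (fsuc i)) λ i → h (fsuc i))) refl
        ≤sum {suc m} f h (fsuc i) = ≤-trans (≤sum (λ i → f (fsuc i)) (λ i → h (fsuc i)) i) (≤-by (f fzero) (h fzero) (+-comm _ _))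

        -- If x v were 0, raising it to t would change the norm by t² but the form by at least 2 t
        -- times x w.
        spread : ∀ {v w} → Adjacent T v w → 0# < x w → ¬ ¬ (0# < x v)
        spread {v} {w} adj 0<xw k = ≤-or-> (x v) 0# (λ xv≤0 →
            no-row-gain x (λ i → 𝟙 (v Fin.≟ i)) μ (λ i → 0≤𝟙 (v Fin.≟ i)) (x w) 0<xw maximal
              (≤-respˡ (sym (trans (+-congʳ (trans (*-congˡ (trans (dot-δ v x) (≤-antisym xv≤0 (0≤x v)))) (zeroʳ μ))) (+-identityˡ _)))
                (≤-respʳ (sym (dot-δ v (row T x)))
                  (≤-respˡ (trans (*-congʳ (𝟙-yes (adjacent? T v w) adj)) (*-identityˡ _))
                    (≤sum (λ j → 𝟙 (adjacent? T v j) * x j) (λ j → *-nonNeg (0≤𝟙 (adjacent? T v j)) (0≤x j)) w))))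
              (λ t 0≤t → upper _ λ i → +-nonNeg (0≤x i) (*-nonNeg (0≤ι 0≤t) (0≤𝟙 (v Fin.≟ i)))))
          k

        along : ∀ {d} (vertex : Fin (suc d) → Vertex T) → (∀ i → vertex (fsuc i) ≢ vertex (inject₁ i)) →
          (through : Fin d → Edge T) → (∀ i → vertex (inject₁ i) ∈ˢ edge T (through i)) → (∀ i → vertex (fsuc i) ∈ˢ edge T (through i)) →
          0# < x (vertex fzero) → ¬ ¬ (0# < x (vertex (fromℕ d)))
        along {zero}  vertex _ through s t h k = k h
        along {suc d} vertex ≢ through s t h k = spread (≢ fzero , through fzero , t fzero , s fzero) h λ h′ →
          along (λ i → vertex (fsuc i)) (λ i → ≢ (fsuc i)) (λ i → through (fsuc i)) (λ i → s (fsuc i)) (λ i → t (fsuc i)) h′ k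

        suc≢inject₁ : ∀ {k} (i : Fin k) → fsuc i ≢ inject₁ i
        suc≢inject₁ fzero ()
        suc≢inject₁ (fsuc i) eq = suc≢inject₁ i (Fin.suc-injective eq)

      positive : ¬ ¬ (∀ v → 0# < x v)
      positive k = ¬¬-allOrNot λ where
        (inj₁ all≤0)   → nonzero all≤0
        (inj₂ (w , ≰)) → ≰⇒¬¬> ≰ λ 0<xw → ¬¬-all (λ v →
          let d , P = connected w v in λ k′ →
            along (Path.vertex P) (λ i eq → suc≢inject₁ i (Path.vertex-inj P eq)) (Path.through P) (Path.source P) (Path.target P)
              (≡.subst (λ u → 0# < x u) (≡.sym (Path.start P)) 0<xw) λ h → k′ (≡.subst (λ u → 0# < x u) (Path.end P) h)) k

      broom : ¬ ¬ Broom T n p c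
      broom k = positive λ 0<x → peak x λ (u , u∈ , x≤u) →
        let B = rootedAt u u∈
            A = armsAt u u∈
            open AttachedForm 𝓡 linear B A using (gainOf; form-gain≤)
            open Arms A
            open RootedBlocks B using (par; root; child; child≢root)
            0≤δ = λ i → 0≤𝟙 (u Fin.≟ i)
            η = λ i → 𝟙 (u Fin.≟ i)
            balanced : Y₀ ≡ []
            balanced = no-cons Y₀ λ ne → Unbalanced.no-unbalanced 𝓡 linear B A x 0<x x≤u bound maximal eigen ne
            at-root : ∀ {e} → Reattached e → par e ≡ root
            -- Raising x at u by t increases the gain from moving e to u by 2 t times the block sum
            -- of e, which is positive.
            at-root {e} r = decide (par e Fin.≟ u) λ par≢u →
              no-gain x η μ 0≤δ (ι (1ℚ ℚ.+ 1ℚ) * blockSum (block B x e)) (twice-pos (blockSum-pos (0<x _ , λ t → 0≤x _))) 1ℚ (toWitness {a? = 0ℚ ℚ.<? 1ℚ} _)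
                maximal (dot-row x η μ 0≤δ eigen) λ t 0≤t _ →
                  let x′ = x +[ t ] η
                      fixed : ∀ {v} → v ≢ u → x′ v ≈ x v
                      fixed v≢u = trans (+-congˡ (trans (*-congˡ (𝟙-no (u Fin.≟ _) λ eq → v≢u (≡.sym eq))) (zeroʳ _))) (+-identityʳ _)
                      raised : x′ u ≈ x u + ι t
                      raised = +-congˡ (trans (*-congˡ (𝟙-yes (u Fin.≟ u) ≡.refl)) (*-identityʳ _))
                      0≤x′ : ∀ v → 0# ≤ x′ v
                      0≤x′ v = +-nonNeg (0≤x v) (*-nonNeg (0≤ι 0≤t) (0≤δ v))
                      x′≤u : ∀ e → x′ (par e) ≤ x′ u
                      x′≤u e = ≤-respʳ (sym raised) (+-mono-≤ (x≤u e) (≤-respʳ (*-identityʳ _) (*-monoˡ-≤ (0≤ι 0≤t) (𝟙≤1 (u Fin.≟ par e)))))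
                      sums : blockSum (block B x′ e) ≈ blockSum (block B x e)
                      sums = +-cong (fixed (child≢root {e} {fzero})) (sum-cong-≋ {n} λ t → fixed (child≢root {e} {fsuc t}))
                  in ≤-trans (+-mono-≤ ≤-refl (raise t (x u) (x (par e)) (x≤u e) (<⇒≤ (blockSum-pos (0<x _ , λ t → 0≤x _)))
                        (+-cong raised (-‿cong (fixed par≢u))) sums))
                       (form-gain≤ bound x′ 0≤x′ x′≤u r)
        in k (record { rootedBlocks = B ; arms = A ; Y₀≡[] = balanced ; at-root = at-root })
        where
        no-cons : ∀ {A : Set} (xs : List A) → (xs ≢ [] → ⊥) → xs ≡ []
        no-cons []       _ = ≡.refl
        no-cons (x ∷ xs) h = ⊥-elim (h λ ())
        decide : ∀ {P : Set} → Dec P → (¬ P → ⊥) → P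
        decide (yes p) _ = p
        decide (no ¬p) h = ⊥-elim (h ¬p)
        𝟙≤1 : ∀ {P : Set} (P? : Dec P) → 𝟙 P? ≤ 1#
        𝟙≤1 (yes _) = ≤-refl
        𝟙≤1 (no _)  = 0≤𝟙 (yes 0≤x)
        twice-pos : ∀ {a} → 0# < a → 0# < ι (1ℚ ℚ.+ 1ℚ) * a
        twice-pos {a} 0<a = <-≤-trans 0<a (≤-by a (<⇒≤ 0<a) (solve 1 (λ a → con (1ℚ ℚ.+ 1ℚ) :* a := a :+ a) refl a))
        raise : ∀ t a b {d S S′} → b ≤ a → 0# ≤ S → d ≈ (a + ι t) - b → S′ ≈ S → ι t * (ι (1ℚ ℚ.+ 1ℚ) * S) ≤ ι (1ℚ ℚ.+ 1ℚ) * (d * S′)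
        raise t a b {d} {S} {S′} b≤a 0≤S d≈ S≈ = ≤-respʳ (*-congˡ (sym (*-cong d≈ S≈)))
          (≤-by (ι (1ℚ ℚ.+ 1ℚ) * ((a - b) * S)) (*-nonNeg (0≤ι (toWitness {a? = 0ℚ ℚ.≤? 1ℚ ℚ.+ 1ℚ} _)) (*-nonNeg (0≤-diff b≤a) 0≤S))
            (solve 4 (λ t a b S → con (1ℚ ℚ.+ 1ℚ) :* (((a :+ t) :- b) :* S) := t :* (con (1ℚ ℚ.+ 1ℚ) :* S) :+ con (1ℚ ℚ.+ 1ℚ) :* ((a :- b) :* S)) refl (ι t) a b S))

  unique-suffix : ∀ {A : Set} (xs : List A) {ys} → Unique (xs ++ ys) → Unique ys
  unique-suffix []       u       = u
  unique-suffix (x ∷ xs) (_ ∷ u) = unique-suffix xs u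

  module BroomLists {T n p c} (broom : Broom T n p c) where
    open Broom broom
    open Chains rootedBlocks

    all-edges′ : allFin (∣E∣ T) ↭ (Zl ++ Y₁) ++ Os
    all-edges′ = ≡.subst (λ Y → allFin (∣E∣ T) ↭ (Zl ++ (Y ++ Y₁)) ++ Os) Y₀≡[] all-edges

    unique : Unique ((Zl ++ Y₁) ++ Os)
    unique = unique-resp-↭ all-edges′ (allFin⁺ (∣E∣ T))

    unique-Zl : Unique Zl
    unique-Zl = unique-prefix Zl (unique-prefix (Zl ++ Y₁) unique)

    unique-Y₁ : Unique Y₁
    unique-Y₁ = unique-suffix Zl (unique-prefix (Zl ++ Y₁) unique)

    Y₁∉Zl : ∀ {e} → e ∈ Y₁ → e ∉ Zl
    Y₁∉Zl e∈Y e∈Z = unique-++ Zl (unique-prefix (Zl ++ Y₁) unique) e∈Z e∈Y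

    Os∉Zl : ∀ {e} → e ∈ Os → e ∉ Zl
    Os∉Zl e∈O e∈Z = unique-++ (Zl ++ Y₁) unique (∈-++⁺ˡ e∈Z) e∈O

    Os∉Y₁ : ∀ {e} → e ∈ Os → e ∉ Y₁
    Os∉Y₁ e∈O e∈Y = unique-++ (Zl ++ Y₁) unique (∈-++⁺ʳ Zl e∈Y) e∈O

    where-edge : ∀ e → e ∈ Zl ⊎ e ∈ Y₁ ⊎ e ∈ Os
    where-edge e = [ (λ h → [ inj₁ , (λ h → inj₂ (inj₁ h)) ]′ (∈-++⁻ Zl h)) , (λ h → inj₂ (inj₂ h)) ]′ (∈-++⁻ (Zl ++ Y₁) (∈-resp-↭ all-edges′ (∈-allFin e)))

    above : ∀ es → Descending es → (∀ {e} → e ∈ heads es → par e ≡ root) → Above root es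
    above []       _ _ = tt
    above (e ∷ es) d h = h (here ≡.refl) , d

    Zl-above : Above root Zl
    Zl-above = above Zl Zl-descend λ h → at-root (inj₁ h)

    Y₁-above : Above root Y₁
    Y₁-above = above Y₁ (≡.subst (λ Y → Descending (Y ++ Y₁)) Y₀≡[] Yl-descend)
      λ h → at-root (inj₂ (inj₁ (≡.subst (λ Y → _ ∈ heads (Y ++ Y₁)) (≡.sym Y₀≡[]) h)))

    length-Zl′ : length Zl ≡ p
    length-Zl′ = ≡.subst (λ Y → length Y ℕ.+ length Zl ≡ p) Y₀≡[] length-Zl

    Os-root : ∀ {e} → e ∈ Os → par e ≡ root
    Os-root h = at-root (inj₂ (inj₂ h))

    below-par : ∀ e es → Below e es → ∀ {f} → f ∈ es → ∃ λ g → g ∈ e ∷ es × par f ≡ child g fzero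
    below-par e (g ∷ es) (par≡ , b) (here ≡.refl) = e , here ≡.refl , par≡
    below-par e (g ∷ es) (par≡ , b) (there f∈)    = let g′ , g∈ , eq = below-par g es b f∈ in g′ , there g∈ , eq

    above-par : ∀ es → Above root es → ∀ {f} → f ∈ es → par f ≡ root ⊎ ∃ λ g → g ∈ es × par f ≡ child g fzero
    above-par (e ∷ es) (par≡ , b) (here ≡.refl) = inj₁ par≡
    above-par (e ∷ es) (par≡ , b) (there f∈)    = inj₂ (below-par e es b f∈)

    NoLoop : Edge T → Edge T → Set
    NoLoop e f = par e ≡ child f fzero → par f ≡ child e fzero → ⊥

    chain-noLoop : ∀ h es → Below h es → Unique (h ∷ es) → (∀ {f} → f ∈ h ∷ es → par h ≢ child f fzero) →
      ∀ {e f} → e ∈ h ∷ es → f ∈ h ∷ es → NoLoop e f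
    chain-noLoop h es       b          u        top (here ≡.refl) f∈          p q = top f∈ p
    chain-noLoop h es       b          u        top e∈          (here ≡.refl) p q = top e∈ q
    chain-noLoop h (g ∷ es) (par≡ , b) (h∉ ∷ u) top (there e∈)  (there f∈)  p q = chain-noLoop g es b u
      (λ f∈ eq → All.lookup h∉ f∈ (proj₁ (child-inj (≡.trans (≡.sym par≡) eq)))) e∈ f∈ p q

    above-noLoop : ∀ es → Above root es → Unique es → ∀ {e f} → e ∈ es → f ∈ es → NoLoop e f
    above-noLoop (h ∷ es) (par≡ , b) u = chain-noLoop h es b u λ _ eq → child≢root (≡.trans (≡.sym eq) par≡)

    parent-in : ∀ {es e f} → Above root es → e ∈ es → par e ≡ child f fzero → f ∈ es
    parent-in {es} above e∈ eq with above-par es above e∈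
    ... | inj₁ par≡          = ⊥-elim (child≢root (≡.trans (≡.sym eq) par≡))
    ... | inj₂ (g , g∈ , par≡) = ≡.subst (_∈ es) (proj₁ (child-inj (≡.trans (≡.sym par≡) eq))) g∈

    noLoop : ∀ e f → NoLoop e f
    noLoop e f p q with where-edge e
    ... | inj₁ e∈        = above-noLoop Zl Zl-above unique-Zl e∈ (parent-in Zl-above e∈ p) p q
    ... | inj₂ (inj₁ e∈) = above-noLoop Y₁ Y₁-above unique-Y₁ e∈ (parent-in Y₁-above e∈ p) p q
    ... | inj₂ (inj₂ e∈) = child≢root (≡.trans (≡.sym p) (Os-root e∈))

    mutual-parents : ∀ e f {s t} → par e ≡ child f s → par f ≡ child e t → ⊥
    mutual-parents e f p q = noLoop e f (lower-vertex (child∈ f _) child≢par p) (lower-vertex (child∈ e _) child≢par q)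

    -- A vertex is a child in at most one edge. Of two distinct common vertices, one would thus be
    -- the parent of e and a child of f and the other the reverse, so that each edge would hang from
    -- the other.
    common-unique : ∀ {e f x y} → e ≢ f → x ∈ˢ edge T e → x ∈ˢ edge T f → y ∈ˢ edge T e → y ∈ˢ edge T f → x ≡ y
    common-unique {e} {f} e≢f x∈e x∈f y∈e y∈f with members x∈e | members x∈f | members y∈e | members y∈f
    ... | inj₁ p       | _            | inj₁ q       | _            = ≡.trans p (≡.sym q)
    ... | _            | inj₁ p       | _            | inj₁ q       = ≡.trans p (≡.sym q)
    ... | inj₂ (_ , p) | inj₂ (_ , q) | _            | _            = ⊥-elim (e≢f (proj₁ (child-inj (≡.trans (≡.sym p) q))))
    ... | _            | _            | inj₂ (_ , p) | inj₂ (_ , q) = ⊥-elim (e≢f (proj₁ (child-inj (≡.trans (≡.sym p) q))))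
    ... | inj₁ p       | inj₂ (_ , q) | inj₂ (_ , u) | inj₁ w       = ⊥-elim (mutual-parents e f (≡.trans (≡.sym p) q) (≡.trans (≡.sym w) u))
    ... | inj₂ (_ , p) | inj₁ q       | inj₁ u       | inj₂ (_ , w) = ⊥-elim (mutual-parents e f (≡.trans (≡.sym u) w) (≡.trans (≡.sym q) p))

    -- T_d(c_{p+1} = k - d) is known only through its broom structure, so the linearity behind
    -- `row-edges` is read off from there.
    linear : Linear T
    linear e f e≢f = ≤1 _ λ x∈ y∈ → let x∈e , x∈f = x∈p∩q⁻ (edge T e) (edge T f) x∈ ; y∈e , y∈f = x∈p∩q⁻ (edge T e) (edge T f) y∈ in
        common-unique e≢f x∈e x∈f y∈e y∈f
      where
      ≤1 : ∀ {N} (p : Subset N) → (∀ {x y} → x ∈ˢ p → y ∈ˢ p → x ≡ y) → ∣ p ∣ ℕ.≤ 1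
      ≤1 p h = Fin.injective⇒≤ {f = λ (_ : Fin ∣ p ∣) → fzero {0}} λ {i} {j} _ → enum-injective p (h (enum∈ p i) (enum∈ p j))

  module BroomEigenvector (𝓡 : OrderedAlgebra) {T n p c} (broom : Broom T n (suc p) c) (s : OrderedAlgebra.Carrier 𝓡) where
    open OrderedAlgebra 𝓡
    open OrderedAlgebraProperties 𝓡
    open Sums 𝓡
    open ListSums 𝓡
    open PolyEvaluation 𝓡
    open PathPolynomials n using (Gᵖ; Hᵖ; Kᵖ; broomPoly)
    open Broom broom
    open BroomLists broom
    open Chains rootedBlocks
    open ι-Solver using (solve; _:=_; _:+_; _:*_; _:-_; :-_; con)

    G H K : ℕ → Carrier
    G j = eval (Gᵖ j) s
    H j = eval (Hᵖ j) s
    K j = eval (Kᵖ j) s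

    -- π is the entry on the pendant edges at the root and ρ the entry at the root. They are
    -- multiples of both values of G at the root, so that no division occurs along either arm.
    N π ρ : Carrier
    N = ι (fromℕℚ n)
    π = G (suc p) * G (suc (suc p))
    ρ = (s - N - ι 1ℚ) * π

    Values : Set
    Values = Edge T → Carrier × Carrier

    -- Top and other entries of the edges of an arm.
    chainValue : Carrier → List (Edge T) → Values → Values
    chainValue m []       default e = default e
    chainValue m (f ∷ fs) default e =
      if does (e Fin.≟ f) then (m * s * G (length fs) , m * H (length fs)) else chainValue (m * s) fs default e

    chainValue-∉ : ∀ m fs default {e} → e ∉ fs → chainValue m fs default e ≡ default e
    chainValue-∉ m []       default       e∉ = ≡.refl
    chainValue-∉ m (f ∷ fs) default {e} e∉ rewrite dec-false (e Fin.≟ f) (λ eq → e∉ (here eq)) =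
      chainValue-∉ (m * s) fs default λ e∈ → e∉ (there e∈)

    -- The scalings that join the arms at the root: α G (p + 1) and β G (p + 2) are both ρ, the arms
    -- having p + 1 and p + 2 edges here.
    αm βm : Carrier
    αm = (s - N - ι 1ℚ) * G (suc (suc p))
    βm = (s - N - ι 1ℚ) * G (suc p)

    valueY value : Values
    valueY = chainValue βm Y₁ (λ _ → π , π)
    value  = chainValue αm Zl valueY

    vector : Vector Carrier (∣V∣ T)
    vector v with decode v
    ... | inj₁ _                   = ρ
    ... | inj₂ (e , fzero  , _) = proj₁ (value e)
    ... | inj₂ (e , fsuc _ , _) = proj₂ (value e)

    vector-root : vector root ≡ ρ
    vector-root with decode root
    ... | inj₁ _             = ≡.refl
    ... | inj₂ (e , t , eq) = ⊥-elim (child≢root (≡.sym eq))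

    vector-top : ∀ e → vector (child e fzero) ≡ proj₁ (value e)
    vector-top e with decode (child e fzero)
    ... | inj₁ eq = ⊥-elim (child≢root eq)
    ... | inj₂ (f , fzero  , eq) = ≡.cong (λ e → proj₁ (value e)) (≡.sym (proj₁ (child-inj eq)))
    ... | inj₂ (f , fsuc _ , eq) with proj₂ (child-inj eq)
    ...   | ()

    vector-rest : ∀ e t → vector (child e (fsuc t)) ≡ proj₂ (value e)
    vector-rest e t with decode (child e (fsuc t))
    ... | inj₁ eq = ⊥-elim (child≢root eq)
    ... | inj₂ (f , fsuc _ , eq) = ≡.cong (λ e → proj₂ (value e)) (≡.sym (proj₁ (child-inj eq)))
    ... | inj₂ (f , fzero  , eq) with proj₂ (child-inj eq)
    ...   | ()

    ArmValues : Carrier → List (Edge T) → Set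
    ArmValues m []       = ⊤
    ArmValues m (e ∷ es) = value e ≡ (m * s * G (length es) , m * H (length es)) × ArmValues (m * s) es

    arm-values : ∀ m es default → Unique es → (∀ {e} → e ∈ es → value e ≡ chainValue m es default e) → ArmValues m es
    arm-values m []       default _        h = tt
    arm-values m (e ∷ es) default (e∉ ∷ u) h = ≡.trans (h (here ≡.refl)) first
        , arm-values (m * s) es default u λ {f} f∈ → ≡.trans (h (there f∈)) (later f λ f≡e → All.lookup e∉ f∈ (≡.sym f≡e))
      where
      first : chainValue m (e ∷ es) default e ≡ (m * s * G (length es) , m * H (length es))
      first rewrite dec-true (e Fin.≟ e) ≡.refl = ≡.refl
      later : ∀ f → f ≢ e → chainValue m (e ∷ es) default f ≡ chainValue (m * s) es default f
      later f f≢e rewrite dec-false (f Fin.≟ e) f≢e = ≡.refl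

    Zl-values : ArmValues αm Zl
    Zl-values = arm-values αm Zl valueY unique-Zl λ _ → ≡.refl

    Y₁-values : ArmValues βm Y₁
    Y₁-values = arm-values βm Y₁ (λ _ → π , π) unique-Y₁ λ e∈ → chainValue-∉ αm Zl valueY (Y₁∉Zl e∈)

    Os-values : ∀ {e} → e ∈ Os → value e ≡ (π , π)
    Os-values e∈ = ≡.trans (chainValue-∉ αm Zl valueY (Os∉Zl e∈)) (chainValue-∉ βm Y₁ _ (Os∉Y₁ e∈))

    sum-const : ∀ {m} (f : Vector Carrier m) a → (∀ i → f i ≈ a) → sum f ≈ ι (fromℕℚ m) * a
    sum-const {zero}  f a h = sym (trans (*-congʳ ι-0) (zeroˡ a))
    sum-const {suc m} f a h = trans (+-cong (h fzero) (sum-const (λ i → f (fsuc i)) a λ i → h (fsuc i)))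
      (sym (trans (*-congʳ (ι-+ 1ℚ (fromℕℚ m))) (solve 2 (λ m a → (con 1ℚ :+ m) :* a := a :+ m :* a) refl (ι (fromℕℚ m)) a)))

    edgeSum≈ : ∀ e {q a b} → vector (par e) ≈ q → value e ≡ (a , b) → edgeSum rootedBlocks e vector ≈ q + (a + N * b)
    edgeSum≈ e q≈ v≡ = +-cong q≈ (+-cong (reflexive (≡.trans (vector-top e) (≡.cong proj₁ v≡)))
      (sum-const _ _ λ t → reflexive (≡.trans (vector-rest e t) (≡.cong proj₂ v≡))))

    -- The eigenvalue equation for s - 1 at a vertex of e that lies in no other edge. It also
    -- evaluates the sum over e in the rows of the remaining vertices.
    EdgeEquation : Edge T → Set
    EdgeEquation e = edgeSum rootedBlocks e vector ≈ s * proj₂ (value e)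

    arm-edges : ∀ m e es → vector (par e) ≈ m * G (length (e ∷ es)) → Below e es → ArmValues m (e ∷ es) → ∀ {f} → f ∈ e ∷ es → EdgeEquation f
    arm-edges m e es q≈ b (v≡ , vs) (here ≡.refl) = trans (edgeSum≈ e q≈ v≡)
      (trans (solve 5 (λ m s N G H → m :* ((s :+ :- N) :* H :+ :- (s :* G)) :+ (m :* s :* G :+ N :* (m :* H)) := s :* (m :* H)) refl m s N (G (length es)) (H (length es)))
        (*-congˡ (reflexive (≡.cong proj₂ (≡.sym v≡)))))
    arm-edges m e (g ∷ es) q≈ (par≡ , b) (v≡ , vs) (there f∈) = arm-edges (m * s) g es
      (reflexive (≡.trans (≡.cong vector par≡) (≡.trans (vector-top e) (≡.cong proj₁ v≡)))) b vs f∈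

    arm-edges′ : ∀ m es → ρ ≈ m * G (length es) → Above root es → ArmValues m es → ∀ {f} → f ∈ es → EdgeEquation f
    arm-edges′ m (e ∷ es) ρ≈ (par≡ , b) vs f∈ = arm-edges m e es (trans (reflexive (≡.trans (≡.cong vector par≡) vector-root)) ρ≈) b vs f∈

    edge-equation : ∀ e → EdgeEquation e
    edge-equation e with where-edge e
    ... | inj₁ e∈ = arm-edges′ αm Zl (trans (solve 3 (λ k g h → k :* (g :* h) := (k :* h) :* g) refl (s - N - ι 1ℚ) (G (suc p)) (G (suc (suc p))))
                       (reflexive (≡.cong (λ k → αm * G k) (≡.sym length-Zl′)))) Zl-above Zl-values e∈
    ... | inj₂ (inj₁ e∈) = arm-edges′ βm Y₁ (trans (sym (*-assoc (s - N - ι 1ℚ) (G (suc p)) (G (suc (suc p)))))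
                       (reflexive (≡.cong (λ k → βm * G k) (≡.sym length-Y₁)))) Y₁-above Y₁-values e∈
    ... | inj₂ (inj₂ e∈) = trans (edgeSum≈ e (reflexive (≡.trans (≡.cong vector (Os-root e∈)) vector-root)) (Os-values e∈))
        (trans (solve 3 (λ s N π → (s :- N :- con 1ℚ) :* π :+ (π :+ N :* π) := s :* π) refl s N π) (*-congˡ (reflexive (≡.cong proj₂ (≡.sym (Os-values e∈))))))

    h : Edge T → Carrier
    h e = proj₂ (value e)

    upTerms : Vertex T → (Edge T → Carrier) → List (Edge T) → Carrier
    upTerms v F = listSum (λ f → 𝟙 (par f Fin.≟ v) * F f)

    member-split : ∀ e v → 𝟙 (v ∈? edge T e) ≈ 𝟙 (par e Fin.≟ v) + 𝟙 (Fin.any? λ t → child e t Fin.≟ v)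
    member-split e v = 𝟙-⊎ (par e Fin.≟ v) (Fin.any? λ t → child e t Fin.≟ v) (v ∈? edge T e)
      (λ { ≡.refl (t , eq) → child≢par eq })
      (λ v∈e → [ (λ eq → inj₁ (≡.sym eq)) , (λ (t , eq) → inj₂ (t , ≡.sym eq)) ]′ (members v∈e))
      (λ { ≡.refl → par∈ e }) (λ { (t , ≡.refl) → child∈ e t })

    -- The edges through v are the one in which it is a child, if any, and those that hang from it.
    row-split : ∀ v → row T vector v ≈ sum (λ f → 𝟙 (Fin.any? λ t → child f t Fin.≟ v) * (s * h f - vector v)) + upTerms v (λ f → s * h f - vector v) ((Zl ++ Y₁) ++ Os)
    row-split v = trans (row-edges rootedBlocks linear vector v)
      (trans (sum-cong-≋ λ f → trans (*-cong (member-split f v) (+-congʳ (edge-equation f))) (trans (distribʳ _ _ _) (+-comm _ _)))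
      (trans (∑-distrib-+ (λ f → 𝟙 (Fin.any? λ t → child f t Fin.≟ v) * (s * h f - vector v)) (λ f → 𝟙 (par f Fin.≟ v) * (s * h f - vector v)))
        (+-congˡ (trans (sum≈listSum (λ f → 𝟙 (par f Fin.≟ v) * (s * h f - vector v))) (listSum-↭ (λ f → 𝟙 (par f Fin.≟ v) * (s * h f - vector v)) all-edges′)))))

    row-child : ∀ e t → row T vector (child e t) ≈ (s * h e - vector (child e t)) + upTerms (child e t) (λ f → s * h f - vector (child e t)) ((Zl ++ Y₁) ++ Os)
    row-child e t = trans (row-split (child e t)) (+-congʳ (trans
      (sum-cong-≋ λ f → *-congʳ (𝟙-cong (Fin.any? λ t′ → child f t′ Fin.≟ child e t) (e Fin.≟ f) (λ (_ , eq) → ≡.sym (proj₁ (child-inj eq))) (λ { ≡.refl → t , ≡.refl })))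
      (sum-δ e (λ f → s * h f - vector (child e t)))))

    upTerms-none : ∀ v F es → (∀ {f} → f ∈ es → par f ≢ v) → upTerms v F es ≈ 0#
    upTerms-none v F []       _ = refl
    upTerms-none v F (f ∷ fs) k = trans (+-cong (trans (*-congʳ (𝟙-no (par f Fin.≟ v) (k (here ≡.refl)))) (zeroˡ _)) (upTerms-none v F fs λ f∈ → k (there f∈))) (+-identityˡ 0#)

    upTerms-++ : ∀ v F es fs → upTerms v F (es ++ fs) ≈ upTerms v F es + upTerms v F fs
    upTerms-++ v F = listSum-++ (λ f → 𝟙 (par f Fin.≟ v) * F f)

    upTerms-elsewhere : ∀ e F es → Above root es → e ∉ es → upTerms (child e fzero) F es ≈ 0#
    upTerms-elsewhere e F es above e∉ = upTerms-none _ F es λ f∈ eq → [ (λ h → child≢root (≡.trans (≡.sym eq) h))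
      , (λ (g , g∈ , h) → e∉ (≡.subst (_∈ es) (proj₁ (child-inj (≡.trans (≡.sym h) eq))) g∈)) ]′ (above-par es above f∈)

    upTerms-pendants : ∀ e F → upTerms (child e fzero) F Os ≈ 0#
    upTerms-pendants e F = upTerms-none _ F Os λ f∈ eq → child≢root (≡.trans (≡.sym eq) (Os-root f∈))

    -- The recursion for `Hᵖ` is the eigenvalue equation at a vertex between two edges of the arm,
    -- and K 0 = G 0 is the equation at its end.
    arm-row : ∀ m e es → Unique (e ∷ es) → Below e es → ArmValues m (e ∷ es) → ∀ {f} → f ∈ e ∷ es →
      (s * h f - proj₁ (value f)) + upTerms (child f fzero) (λ g → s * h g - proj₁ (value f)) es ≈ (s - ι 1ℚ) * proj₁ (value f)
    arm-row m e [] _ _ (v≡ , _) (here ≡.refl) = trans (+-identityʳ _)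
      (≡.subst (λ v → s * proj₂ v - proj₁ v ≈ (s - ι 1ℚ) * proj₁ v) (≡.sym v≡)
        (solve 2 (λ m s → s :* (m :* ((s :+ con 1ℚ) :* con 1ℚ :+ :- (con 1ℚ))) :- m :* s :* con 1ℚ := (s :- con 1ℚ) :* (m :* s :* con 1ℚ)) refl m s))
    arm-row m e (g ∷ es) ((e≢g ∷ e∉) ∷ u) (par≡ , b) (v≡ , w≡ , _) (here ≡.refl) =
      trans (+-congˡ (trans (+-cong (trans (*-congʳ (𝟙-yes (par g Fin.≟ child e fzero) par≡)) (*-identityˡ _))
          (upTerms-none _ _ es λ f∈ eq → let g′ , g∈ , h = below-par g es b f∈ in
            not-later g∈ (proj₁ (child-inj (≡.trans (≡.sym eq) h))))) (+-identityʳ _)))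
        (≡.subst₂ (λ v w → (s * proj₂ v - proj₁ v) + (s * proj₂ w - proj₁ v) ≈ (s - ι 1ℚ) * proj₁ v) (≡.sym v≡) (≡.sym w≡)
          (solve 4 (λ m s G H → (s :* (m :* ((s :+ con 1ℚ) :* G :+ :- (s :* H))) :- m :* s :* G) :+ (s :* (m :* s :* H) :- m :* s :* G)
             := (s :- con 1ℚ) :* (m :* s :* G)) refl m s (G (suc (length es))) (H (length es))))
      where
      not-later : ∀ {g′} → g′ ∈ g ∷ es → e ≡ g′ → ⊥
      not-later (here ≡.refl) eq = e≢g eq
      not-later (there g∈)    eq = All.lookup e∉ g∈ eq
    arm-row m e (g ∷ es) (e∉ ∷ u) (par≡ , b) (v≡ , vs) {f} (there f∈) =
      trans (+-congˡ (trans (+-congʳ (trans (*-congʳ (𝟙-no (par g Fin.≟ child f fzero) λ eq →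
          All.lookup e∉ f∈ (proj₁ (child-inj (≡.trans (≡.sym par≡) eq))))) (zeroˡ _))) (+-identityˡ _)))
        (arm-row (m * s) g es u b vs f∈)

    arm-row′ : ∀ m es → Unique es → Above root es → ArmValues m es → ∀ {f} → f ∈ es →
      (s * h f - proj₁ (value f)) + upTerms (child f fzero) (λ g → s * h g - proj₁ (value f)) es ≈ (s - ι 1ℚ) * proj₁ (value f)
    arm-row′ m (e ∷ es) u (par≡ , b) vs {f} f∈ =
      trans (+-congˡ (trans (+-congʳ (trans (*-congʳ (𝟙-no (par e Fin.≟ child f fzero) λ eq → child≢root (≡.trans (≡.sym eq) par≡))) (zeroˡ _))) (+-identityˡ _)))
        (arm-row m e es u b vs f∈)

    top-row : ∀ e → row T vector (child e fzero) ≈ (s - ι 1ℚ) * vector (child e fzero)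
    top-row e = trans (row-child e fzero) (≡.subst (λ a → (s * h e - a) + upTerms (child e fzero) (λ f → s * h f - a) ((Zl ++ Y₁) ++ Os) ≈ (s - ι 1ℚ) * a)
        (≡.sym (vector-top e)) (trans (+-congˡ (trans (upTerms-++ _ _ (Zl ++ Y₁) Os) (+-cong (upTerms-++ _ _ Zl Y₁) (upTerms-pendants e _)))) (cases (where-edge e))))
      where
      a = proj₁ (value e)
      F : Edge T → Carrier
      F f = s * h f - a
      cases : e ∈ Zl ⊎ e ∈ Y₁ ⊎ e ∈ Os → (s * h e - a) + (upTerms (child e fzero) F Zl + upTerms (child e fzero) F Y₁ + 0#) ≈ (s - ι 1ℚ) * a
      cases (inj₁ e∈) = trans (+-congˡ (trans (+-identityʳ _) (trans (+-congˡ (upTerms-elsewhere e F Y₁ Y₁-above λ e∈Y → Y₁∉Zl e∈Y e∈)) (+-identityʳ _))))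
        (arm-row′ αm Zl unique-Zl Zl-above Zl-values e∈)
      cases (inj₂ (inj₁ e∈)) = trans (+-congˡ (trans (+-identityʳ _) (trans (+-congʳ (upTerms-elsewhere e F Zl Zl-above (Y₁∉Zl e∈))) (+-identityˡ _))))
        (arm-row′ βm Y₁ unique-Y₁ Y₁-above Y₁-values e∈)
      cases (inj₂ (inj₂ e∈)) = trans (+-congˡ (trans (+-identityʳ _) (trans (+-cong (upTerms-elsewhere e F Zl Zl-above (Os∉Zl e∈)) (upTerms-elsewhere e F Y₁ Y₁-above (Os∉Y₁ e∈))) (+-identityˡ _))))
        (trans (+-identityʳ _) (≡.subst (λ v → s * proj₂ v - proj₁ v ≈ (s - ι 1ℚ) * proj₁ v) (≡.sym (Os-values e∈))
          (solve 2 (λ s π → s :* π :- π := (s :- con 1ℚ) :* π) refl s π)))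

    rest-row : ∀ e t → row T vector (child e (fsuc t)) ≈ (s - ι 1ℚ) * vector (child e (fsuc t))
    rest-row e t = trans (row-child e (fsuc t)) (trans (+-congˡ (upTerms-none _ _ ((Zl ++ Y₁) ++ Os) λ {f} _ eq → never f eq (par-top f)))
        (trans (+-identityʳ _) (≡.subst (λ a → s * h e - a ≈ (s - ι 1ℚ) * a) (≡.sym (vector-rest e t))
          (solve 2 (λ s a → s :* a :- a := (s :- con 1ℚ) :* a) refl s (h e)))))
      where
      never : ∀ f → par f ≡ child e (fsuc t) → par f ≡ root ⊎ (∃ λ g → par f ≡ child g fzero) → ⊥
      never f eq (inj₁ h)       = child≢root (≡.trans (≡.sym eq) h)
      never f eq (inj₂ (g , h)) with proj₂ (child-inj (≡.trans (≡.sym h) eq))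
      ... | ()

    arm-root : ∀ m e es → Above root (e ∷ es) → ArmValues m (e ∷ es) → upTerms root (λ f → s * h f - ρ) (e ∷ es) ≈ m * K (length (e ∷ es)) - ρ
    arm-root m e es (par≡ , b) (v≡ , _) = trans (+-cong (trans (*-congʳ (𝟙-yes (par e Fin.≟ root) par≡)) (*-identityˡ _))
        (upTerms-none _ _ es λ f∈ eq → let g , _ , h = below-par e es b f∈ in child≢root (≡.trans (≡.sym h) eq)))
      (trans (+-identityʳ _) (+-congʳ (trans (*-congˡ (reflexive (≡.cong proj₂ v≡))) (solve 3 (λ s m H → s :* (m :* H) := m :* (s :* H)) refl s m (H (length es))))))

    arm-root′ : ∀ m es {k} → length es ≡ suc k → Above root es → ArmValues m es → upTerms root (λ f → s * h f - ρ) es ≈ m * K (suc k) - ρ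
    arm-root′ m (e ∷ es) len above vs = trans (arm-root m e es above vs) (+-congʳ (reflexive (≡.cong (λ k → m * K k) len)))

    pendants-root : ∀ es → (∀ {e} → e ∈ es → e ∈ Os) → upTerms root (λ f → s * h f - ρ) es ≈ ι (fromℕℚ (length es)) * (s * π - ρ)
    pendants-root []       _ = sym (trans (*-congʳ ι-0) (zeroˡ _))
    pendants-root (e ∷ es) k = trans (+-cong (trans (*-congʳ (𝟙-yes (par e Fin.≟ root) (Os-root (k (here ≡.refl))))) (trans (*-identityˡ _)
          (+-congʳ (*-congˡ (reflexive (≡.cong proj₂ (Os-values (k (here ≡.refl))))))))) (pendants-root es λ e∈ → k (there e∈)))
      (sym (trans (*-congʳ (ι-+ 1ℚ _)) (solve 2 (λ m a → (con 1ℚ :+ m) :* a := a :+ m :* a) refl (ι (fromℕℚ (length es))) (s * π - ρ))))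

    root-row : eval (broomPoly (suc p) c) s ≈ 0# → row T vector root ≈ (s - ι 1ℚ) * vector root
    root-row P≈0 = trans (row-split root) (trans (+-congʳ (sum-0 _ λ f → trans (*-congʳ (𝟙-no (Fin.any? λ t → child f t Fin.≟ root) λ (_ , eq) → child≢root eq)) (zeroˡ _)))
        (trans (+-identityˡ _) (≡.subst (λ a → upTerms root (λ f → s * h f - a) ((Zl ++ Y₁) ++ Os) ≈ (s - ι 1ℚ) * a) (≡.sym vector-root)
          (trans (trans (upTerms-++ _ _ (Zl ++ Y₁) Os) (+-congʳ (upTerms-++ _ _ Zl Y₁)))
            (trans (+-cong (+-cong (arm-root′ αm Zl length-Zl′ Zl-above Zl-values) (arm-root′ βm Y₁ length-Y₁ Y₁-above Y₁-values))
                     (trans (pendants-root Os λ e∈ → e∈) (*-congʳ (reflexive (≡.cong (λ k → ι (fromℕℚ k)) length-Os)))))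
              -- The polynomial is the defect of the equation at the root. Adding its value, which
              -- is zero, leaves a ring identity.
              (trans (sym (+-identityʳ _)) (trans (+-congˡ (sym P≈0)) equation)))))))
      where
      equation : αm * K (suc p) - ρ + (βm * K (suc (suc p)) - ρ) + ι (fromℕℚ c) * (s * π - ρ) + eval (broomPoly (suc p) c) s ≈ (s - ι 1ℚ) * ρ
      equation = solve 7 (λ s N c g j k l →
          let d = s :- N :- con 1ℚ
              ρ = d :* (g :* j) in
          (d :* j) :* k :- ρ :+ ((d :* g) :* l :- ρ) :+ c :* (s :* (g :* j) :- ρ)
            :+ ((s :+ c :+ con 1ℚ) :* ((s :+ :- N :+ :- con 1ℚ) :* (g :* j)) :+ :- ((s :+ :- N :+ :- con 1ℚ) :* (j :* k :+ g :* l)) :+ :- (c :* (s :* (g :* j))))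
          := (s :- con 1ℚ) :* ρ)
        refl s N (ι (fromℕℚ c)) (G (suc p)) (G (suc (suc p))) (K (suc p)) (K (suc (suc p)))

    eigenvector : eval (broomPoly (suc p) c) s ≈ 0# → ∀ v → row T vector v ≈ (s - ι 1ℚ) * vector v
    eigenvector P≈0 v with decode v in eq
    ... | inj₁ ≡.refl = ≡.subst (λ a → row T vector root ≈ (s - ι 1ℚ) * a) (vector-root) (root-row P≈0)
    ... | inj₂ (e , fzero  , ≡.refl) = ≡.subst (λ a → row T vector (child e fzero) ≈ (s - ι 1ℚ) * a) (vector-top e) (top-row e)
    ... | inj₂ (e , fsuc t , ≡.refl) = ≡.subst (λ a → row T vector (child e (fsuc t)) ≈ (s - ι 1ℚ) * a) (vector-rest e t) (rest-row e t)

  module Squares (𝓡 : OrderedAlgebra) where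
    open OrderedAlgebra 𝓡
    open OrderedAlgebraProperties 𝓡
    open ι-Solver using (solve; _:=_; _:+_; _:*_; _:-_; :-_; con)

    *-pos : ∀ {x y} → 0# < x → 0# < y → 0# < x * y
    *-pos {x} {y} (δ , 0<δ , hδ) (ε , 0<ε , hε) = δ ℚ.* ε , ℚLemmas.*-pos 0<δ 0<ε
      , ≤-respˡ (sym (trans (+-identityˡ _) (ι-* δ ε)))
          (≤-trans (*-monoʳ-≤ (0≤ι (ℚ.<⇒≤ 0<ε)) (≤-respˡ (+-identityˡ _) hδ))
            (*-monoˡ-≤ (<⇒≤ (δ , 0<δ , hδ)) (≤-respˡ (+-identityˡ _) hε)))

    diff-pos : ∀ {x y} → x < y → 0# < y - x
    diff-pos {x} {y} (δ , 0<δ , h) = δ , 0<δ , ≤-respˡ (sym (+-identityˡ _))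
      (≤-by (y - (x + ι δ)) (0≤-diff h) (solve 3 (λ x y d → y :- x := d :+ (y :- (x :+ d))) refl x y (ι δ)))

    square-reflects-≤ : ∀ {x y} → 0# ≤ y → x * x ≤ y * y → x ≤ y
    square-reflects-≤ {x} {y} 0≤y xx≤yy = ≤-stable λ x≰y → ≰⇒¬¬> x≰y λ y<x →
      <⇒≱ (*-pos (diff-pos y<x) (<-≤-trans (diff-pos y<x) (≤-by (y + y) (+-nonNeg 0≤y 0≤y) (solve 2 (λ x y → x :+ y := (x :- y) :+ (y :+ y)) refl x y))))
        (≤-by (y * y - x * x) (0≤-diff xx≤yy) (trans (sym (-‿inverseʳ (x * x - y * y)))
          (solve 2 (λ x y → (x :* x :- y :* y) :- (x :* x :- y :* y) := (x :- y) :* (x :+ y) :+ (y :* y :- x :* x)) refl x y)))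

    square-zero : ∀ {x} → x * x ≤ 0# → x ≈ 0#
    square-zero {x} h = ≤-antisym (square-reflects-≤ ≤-refl (≤-respʳ (sym (zeroˡ 0#)) h))
      (≤-respʳ (trans (+-identityˡ _) (solve 1 (λ x → :- (:- x) := x) refl x)) (0≤-diff h′))
      where
      h′ : - x ≤ 0#
      h′ = square-reflects-≤ ≤-refl (≤-respˡ (solve 1 (λ x → x :* x := :- x :* :- x) refl x) (≤-respʳ (sym (zeroˡ 0#)) h))

    zero-product : ∀ {x y} → 0# < y → x * y ≈ 0# → x ≈ 0#
    zero-product {x} {y} 0<y xy≈0 = ≤-antisym
      (≤-stable λ x≰0 → ≰⇒¬¬> x≰0 λ 0<x → <⇒≱ (*-pos 0<x 0<y) (≤-reflexive xy≈0))
      (≤-stable λ 0≰x → ≰⇒¬¬> 0≰x λ x<0 → <⇒≱ (*-pos (diff-pos x<0) 0<y)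
        (≤-reflexive (trans (*-congʳ (+-identityˡ _)) (trans (solve 2 (λ x y → :- x :* y := :- (x :* y)) refl x y) (trans (-‿cong xy≈0) (trans (sym (+-identityˡ _)) (-‿inverseʳ 0#)))))))

  module Spectral (𝓡 : OrderedAlgebra) (T : Hypergraph) where
    open OrderedAlgebra 𝓡
    open OrderedAlgebraProperties 𝓡
    open Squares 𝓡
    open Sums 𝓡
    open Perturbation 𝓡 T
    open BlockForms 𝓡 0 using (sum-nonNeg)
    open ι-Solver using (solve; _:=_; _:+_; _:*_; _:-_; :-_; con)

    private
      V = Vector Carrier (∣V∣ T)

    ≤norm : ∀ {m} (x : Vector Carrier m) i → x i * x i ≤ norm x
    ≤norm {suc m} x fzero    = ≤-by (norm λ i → x (fsuc i)) (sum-nonNeg (λ i → x (fsuc i) * x (fsuc i)) λ i → square-nonNeg (x (fsuc i))) refl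
    ≤norm {suc m} x (fsuc i) = ≤-trans (≤norm (λ i → x (fsuc i)) i) (≤-by (x fzero * x fzero) (square-nonNeg _) (+-comm _ _))

    norm-nonNeg : ∀ (x : V) → 0# ≤ norm x
    norm-nonNeg x = sum-nonNeg (λ i → x i * x i) λ i → square-nonNeg (x i)

    norm-zero : ∀ {x : V} → norm x ≤ 0# → ∀ i → x i ≈ 0#
    norm-zero {x} h i = square-zero (≤-trans (≤norm x i) h)

    module _ {α β λ₁ q r : Carrier} (rq≈1 : r * q ≈ 1#) (a b : V)
      (row-a : ∀ i → q * row T a i ≈ α * a i + - (β * b i)) (row-b : ∀ i → q * row T b i ≈ α * b i + β * a i)
      (nonzero : ¬ (∀ i → a i ≈ 0# × b i ≈ 0#)) where

      -- A symmetric matrix has real eigenvalues.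
      imaginary≈0 : β ≈ 0#
      imaginary≈0 = ≤-antisym (≤-stable λ β≰0 → positive λ 0<S → β≰0 (≤-reflexive (zero-product 0<S βS≈0)))
                              (≤-stable λ 0≰β → positive λ 0<S → 0≰β (≤-reflexive (sym (zero-product 0<S βS≈0))))
        where
        S = norm a + norm b
        positive : ¬ ¬ (0# < S)
        positive k = ≤-or-> S 0# (λ S≤0 → nonzero λ i →
            norm-zero (≤-trans (≤-by (norm b) (norm-nonNeg b) refl) S≤0) i
          , norm-zero (≤-trans (≤-by (norm a) (norm-nonNeg a) (+-comm _ _)) S≤0) i) k
        scaled : ∀ (x y : V) → dot x (λ i → q * row T y i) ≈ q * dot x (row T y)
        scaled x y = trans (sum-cong-≋ {∣V∣ T} λ i → solve 3 (λ x q r → x :* (q :* r) := q :* (x :* r)) refl (x i) q (row T y i)) (sym (*-distribˡ-sum q λ i → x i * row T y i))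
        linear₁ : dot b (λ i → q * row T a i) ≈ α * dot b a - β * norm b
        linear₁ = trans (sum-cong-≋ {∣V∣ T} λ i → trans (*-congˡ (row-a i)) (solve 4 (λ α β a b → b :* (α :* a :+ :- (β :* b)) := α :* (b :* a) :+ (:- β) :* (b :* b)) refl α β (a i) (b i)))
          (trans (∑-distrib-+ (λ i → α * (b i * a i)) (λ i → - β * (b i * b i))) (+-cong (sym (*-distribˡ-sum α λ i → b i * a i))
            (trans (sym (*-distribˡ-sum (- β) λ i → b i * b i)) (solve 2 (λ β n → (:- β) :* n := :- (β :* n)) refl β (norm b)))))
        linear₂ : dot a (λ i → q * row T b i) ≈ α * dot b a + β * norm a
        linear₂ = trans (sum-cong-≋ {∣V∣ T} λ i → trans (*-congˡ (row-b i)) (solve 4 (λ α β a b → a :* (α :* b :+ β :* a) := α :* (b :* a) :+ β :* (a :* a)) refl α β (a i) (b i)))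
          (trans (∑-distrib-+ (λ i → α * (b i * a i)) (λ i → β * (a i * a i))) (+-cong (sym (*-distribˡ-sum α λ i → b i * a i)) (sym (*-distribˡ-sum β λ i → a i * a i))))
        -- By symmetry bᵀAa = aᵀAb, and the two eigenvalue equations make these differ by β (‖a‖² +
        -- ‖b‖²).
        βS≈0 : β * S ≈ 0#
        βS≈0 = trans (solve 4 (λ β m n d → β :* (m :+ n) := (d :+ β :* m) :- (d :- β :* n)) refl β (norm a) (norm b) (α * dot b a))
          (trans (+-congˡ (-‿cong (trans (sym linear₁) (trans (scaled b a) (trans (*-congˡ (row-sym b a)) (trans (sym (scaled a b)) linear₂)))))) (-‿inverseʳ _))

      module _ (0≤λ₁ : 0# ≤ λ₁) (modulus : α * α + β * β ≈ λ₁ * λ₁) where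

        absolute : V → V
        absolute v i = abs (v i)

        private
          αα≈λλ : α * α ≈ λ₁ * λ₁
          αα≈λλ = trans (sym (+-identityʳ _)) (trans (+-congˡ (sym (trans (*-congʳ imaginary≈0) (zeroˡ β)))) modulus)

          eigen : ∀ (v w : V) γ → γ ≈ 0# → (∀ i → q * row T v i ≈ α * v i + γ * w i) → ∀ i → row T v i ≈ (r * α) * v i
          eigen v w γ γ≈0 h i = trans (sym (*-identityˡ _)) (trans (*-congʳ (sym rq≈1)) (trans (*-assoc r q _) (trans (*-congˡ
            (trans (h i) (trans (+-congˡ (trans (*-congʳ γ≈0) (zeroˡ _))) (+-identityʳ _)))) (sym (*-assoc r α _)))))

        -- The triangle inequality in squared form: the squares of the rows of |v| and v differ by
        -- the product of the rows of |v| - v and |v| + v, both nonnegative.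
        absolute-eigen : ∀ (v : V) → (∀ i → row T v i ≈ (r * α) * v i) → ∀ i → (r * λ₁) * absolute v i ≤ row T (absolute v) i
        absolute-eigen v h i = square-reflects-≤ (row-nonNeg (absolute v) (λ j → 0≤abs (v j)) i)
          (≤-respˡ (trans (*-cong (h i) (h i)) (trans (solve 3 (λ r α v → (r :* α :* v) :* (r :* α :* v) := (r :* r) :* ((α :* α) :* (v :* v))) refl r α (v i))
              (trans (*-congˡ (*-cong αα≈λλ (sym (abs² (v i))))) (solve 3 (λ r l v → (r :* r) :* ((l :* l) :* (v :* v)) := (r :* l :* v) :* (r :* l :* v)) refl r λ₁ (abs (v i))))))
            (≤-by ((row T (absolute v) i - row T v i) * (row T (absolute v) i + row T v i))
              (*-nonNeg (0≤-diff (sum-mono (λ j → 𝟙 (adjacent? T i j) * v j) (λ j → 𝟙 (adjacent? T i j) * abs (v j)) λ j → *-monoˡ-≤ (0≤𝟙 (adjacent? T i j)) (x≤abs (v j))))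
                (≤-respʳ (∑-distrib-+ (λ j → 𝟙 (adjacent? T i j) * abs (v j)) (λ j → 𝟙 (adjacent? T i j) * v j))
                  (sum-nonNeg _ λ j → ≤-respʳ (distribˡ _ _ _) (*-nonNeg (0≤𝟙 (adjacent? T i j)) (≤-respʳ (solve 2 (λ a v → a :- (:- v) := a :+ v) refl (abs (v j)) (v j)) (0≤-diff (-x≤abs (v j))))))))
              (solve 2 (λ a v → a :* a := v :* v :+ (a :- v) :* (a :+ v)) refl (row T (absolute v) i) (row T v i))))

        absolute-zero : ∀ (v : V) → (∀ i → absolute v i ≤ 0#) → ∀ i → v i ≈ 0#
        absolute-zero v h i = ≤-antisym (≤-trans (x≤abs (v i)) (h i))
          (≤-respʳ (trans (+-identityˡ _) (solve 1 (λ x → :- (:- x) := x) refl (v i))) (0≤-diff (≤-trans (-x≤abs (v i)) (h i))))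

        -- The absolute value of a real eigenvector for ± λ₁.
        nonNegative-eigenvector : ¬ ¬ (∃ λ (y : V) → (∀ i → 0# ≤ y i) × ¬ (∀ i → y i ≤ 0#) × (∀ i → (r * λ₁) * y i ≤ row T y i))
        nonNegative-eigenvector k = k (absolute a , (λ i → 0≤abs (a i)) , (λ a≤0 →
            -- Which of a and b is nonzero cannot be decided. Here a = 0 may be assumed, and then b
            -- serves instead.
            k (absolute b , (λ i → 0≤abs (b i)) , (λ b≤0 → nonzero λ i → absolute-zero a a≤0 i , absolute-zero b b≤0 i)
              , absolute-eigen b (eigen b a β imaginary≈0 row-b)))
          , absolute-eigen a (eigen a b (- β) (trans (-‿cong imaginary≈0) (trans (sym (+-identityˡ _)) (-‿inverseʳ 0#)))
              λ i → trans (row-a i) (+-congˡ (solve 2 (λ β b → :- (β :* b) := (:- β) :* b) refl β (b i)))))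

  module BroomBounds (𝓡 : OrderedAlgebra) (n p c : ℕ) where
    open OrderedAlgebra 𝓡
    open OrderedAlgebraProperties 𝓡
    open BlockForms 𝓡 n
    open BlockBounds 𝓡 n using (broom-bound)
    open PathPolynomials n
    open ι-Solver using (solve; _:=_; _:+_; _:*_; _:-_; :-_; con)

    norms-nonNeg : ∀ Bs → 0# ≤ norms Bs
    norms-nonNeg []       = ≤-refl
    norms-nonNeg (B ∷ Bs) = +-nonNeg (+-nonNeg (square-nonNeg _) (sum-nonNeg (λ t → proj₂ B t * proj₂ B t) λ t → square-nonNeg (proj₂ B t))) (norms-nonNeg Bs)

    total-nonNeg : ∀ q Ys Zs Ps → 0# ≤ q * q + (norms Ys + norms Zs + norms Ps)
    total-nonNeg q Ys Zs Ps = +-nonNeg (square-nonNeg q) (+-nonNeg (+-nonNeg (norms-nonNeg Ys) (norms-nonNeg Zs)) (norms-nonNeg Ps))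

    bound-mono : ∀ {μ ν} → μ ≤ ν → BroomBound 𝓡 n p c μ → BroomBound 𝓡 n p c ν
    bound-mono μ≤ν bound q Ys Zs Ps hY hZ hP = ≤-trans (bound q Ys Zs Ps hY hZ hP) (*-monoʳ-≤ (total-nonNeg q Ys Zs Ps) μ≤ν)

    bound-at : ∀ s → lowest ℚ.≤ s → 0ℚ ℚ.≤ ⟦ broomPoly p c ⟧ s → BroomBound 𝓡 n p c (ι (s ℚ.- 1ℚ))
    bound-at s low 0≤P q Ys Zs Ps hY hZ hP = broom-bound κ κ₀ weights q Ys Zs Ps
      (≡.subst (λ l → (κ l ℚ.- 1ℚ) ℚ.+ (κ (length Zs) ℚ.- 1ℚ) ℚ.+ fromℕℚ (length Ps) ℚ.* (κ 1 ℚ.- 1ℚ) ℚ.≤ s ℚ.- 1ℚ) (≡.sym hY)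
      (≡.subst (λ l → (κ (suc p) ℚ.- 1ℚ) ℚ.+ (κ l ℚ.- 1ℚ) ℚ.+ fromℕℚ (length Ps) ℚ.* (κ 1 ℚ.- 1ℚ) ℚ.≤ s ℚ.- 1ℚ) (≡.sym hZ)
      (≡.subst (λ l → (κ (suc p) ℚ.- 1ℚ) ℚ.+ (κ p ℚ.- 1ℚ) ℚ.+ fromℕℚ l ℚ.* (κ 1 ℚ.- 1ℚ) ℚ.≤ s ℚ.- 1ℚ) (≡.sym hP)
        (broom-condition p c 0≤P))))
      where open At s low

    -- A defect δ would be at most ε x for every ε. With x ≤ C, the choice ε = δ/(2C) is too small
    -- for that.
    limit : ∀ {L x m} → 0# ≤ x → (∀ ε → 0ℚ ℚ.< ε → L ≤ (m + ι ε) * x) → L ≤ m * x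
    limit {L} {x} {m} 0≤x h = ≤-stable λ L≰ → ≰⇒¬¬> L≰ λ (δ , 0<δ , le) →
      let B , x≤B = bounded x
          C = 1ℚ ℚ.+ ℚ.∣ B ∣
          0<C = ℚ.<-≤-trans (toWitness {a? = 0ℚ ℚ.<? 1ℚ} _) (ℚLemmas.≤-by ℚ.∣ B ∣ (ℚ.0≤∣p∣ B) ≡.refl)
          x≤C = ≤-trans x≤B (ι-mono (ℚ.≤-trans (ℚLemmas.p≤∣p∣ B) (ℚLemmas.≤-by 1ℚ (toWitness {a? = 0ℚ ℚ.≤? 1ℚ} _) (ℚ.+-comm 1ℚ ℚ.∣ B ∣))))
          ε , 0<ε , Cε≡ = shrink C (ℚ.positive 0<C) (half-pos 0<δ)
          δ≤ : ι δ ≤ ι ε * x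
          δ≤ = ≤-by ((m * x + ι ε * x) - (m * x + ι δ)) (0≤-diff (≤-trans le (≤-respʳ (distribʳ _ _ _) (h ε 0<ε))))
                 (solve 3 (λ a d e → e := d :+ ((a :+ e) :- (a :+ d))) refl (m * x) (ι δ) (ι ε * x))
          δ≤½ : δ ℚ.≤ δ ℚ.* ½
          δ≤½ = ι-reflects (≤-trans δ≤ (≤-trans (*-monoˡ-≤ (0≤ι (ℚ.<⇒≤ 0<ε)) x≤C)
                  (≤-reflexive (trans (sym (ι-* ε C)) (reflexive (≡.cong ι (≡.trans (ℚ.*-comm ε C) Cε≡)))))))
      in ℚLemmas.≰half 0<δ δ≤½

    -- The weights involve quotients and live over ℚ, so the real root is reached through rational
    -- arguments.
    bound-limit : ∀ {s} → (∀ ε → 0ℚ ℚ.< ε → ∃ λ t → lowest ℚ.≤ t × 0ℚ ℚ.≤ ⟦ broomPoly p c ⟧ t × ι t ≤ s + ι ε) →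
      BroomBound 𝓡 n p c (s - ι 1ℚ)
    bound-limit {s} approx q Ys Zs Ps hY hZ hP = limit (total-nonNeg q Ys Zs Ps) λ ε 0<ε →
      let t , low , 0≤P , t≤ = approx ε 0<ε in
      ≤-trans (bound-at t low 0≤P q Ys Zs Ps hY hZ hP) (*-monoʳ-≤ (total-nonNeg q Ys Zs Ps)
        (≤-respˡ (sym (trans (ι-+ t (ℚ.- 1ℚ)) (+-congˡ (ι-neg 1ℚ))))
          (≤-respʳ (solve 3 (λ s e o → (s :+ e) :- o := (s :- o) :+ e) refl s (ι ε) (ι 1ℚ)) (+-mono-≤ t≤ (≤-refl { - ι 1ℚ})))))

  module MatrixRows (𝓡 : OrderedAlgebra) (T : Hypergraph) where
    open OrderedAlgebra 𝓡
    open OrderedAlgebraProperties 𝓡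
    open Sums 𝓡

    ι-if : ∀ {P : Set} (P? : Dec P) q → ι (if does P? then q else 0ℚ) ≈ ι q * 𝟙 P?
    ι-if (yes _) q = sym (*-identityʳ _)
    ι-if (no _)  q = trans ι-0 (sym (zeroʳ _))

    module _ (q : ℚ) where
      entry : Vertex T → Vertex T → ℚ
      entry i j = if does (adjacent? T i j) then q else 0ℚ

      entry-row : ∀ (a f : Vector Carrier (∣V∣ T)) i → (∀ j → f j ≈ ι (entry i j) * a j) → sum f ≈ ι q * row T a i
      entry-row a f i h = trans (sum-cong-≋ λ j → trans (h j) (trans (*-congʳ (ι-if (adjacent? T i j) q)) (*-assoc _ _ _)))
        (sym (*-distribˡ-sum (ι q) λ j → 𝟙 (adjacent? T i j) * a j))

      -- The summands have the shape that complex multiplication by a real entry produces, imaginary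
      -- part 0 included.
      re-row : ∀ (a b : Vector Carrier (∣V∣ T)) i → sum (λ j → ι (entry i j) * a j + - (0# * b j)) ≈ ι q * row T a i
      re-row a b i = entry-row a _ i λ j → trans (+-congˡ (trans (-‿cong (zeroˡ _)) (trans (sym (+-identityˡ _)) (-‿inverseʳ 0#)))) (+-identityʳ _)

      im-row : ∀ (a b : Vector Carrier (∣V∣ T)) i → sum (λ j → ι (entry i j) * b j + 0# * a j) ≈ ι q * row T b i
      im-row a b i = entry-row b _ i λ j → trans (+-congˡ (zeroˡ _)) (+-identityʳ _)

      zero-row : ∀ i → row T (λ _ → 0#) i ≈ 0#
      zero-row i = sum-0 (λ j → 𝟙 (adjacent? T i j) * 0#) λ j → zeroʳ _

  module FinalInequality (𝓡 : OrderedAlgebra) (T : Hypergraph) where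
    open OrderedAlgebra 𝓡
    open OrderedAlgebraProperties 𝓡
    open Squares 𝓡
    open Sums 𝓡
    open Spectral 𝓡 T
    open ι-Solver using (solve; _:=_; _:+_; _:*_; _:-_; :-_; con)

    radius-≤ : ∀ {r λ₁ λ₂} (y : Vector Carrier (∣V∣ T)) → 0# < r → ¬ (∀ i → y i ≤ 0#) →
      (r * λ₁) * norm y ≤ form T y → form T y ≤ (r * λ₂) * norm y → λ₁ ≤ λ₂
    radius-≤ {r} {λ₁} {λ₂} y 0<r nonzero lower upper = ≤-stable λ λ₁≰λ₂ → ≰⇒¬¬> λ₁≰λ₂ λ λ₂<λ₁ →
      ≤-or-> (norm y) 0# (λ norm≤0 → nonzero λ i → ≤-reflexive (norm-zero norm≤0 i)) λ 0<norm →
        <⇒≱ (*-pos (*-pos 0<r (diff-pos λ₂<λ₁)) 0<norm)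
          (≤-respˡ (solve 4 (λ r l m n → (r :* l) :* n :- (r :* m) :* n := (r :* (l :- m)) :* n) refl r λ₁ λ₂ (norm y))
            (≤-respʳ (-‿inverseʳ _) (+-mono-≤ (≤-trans lower upper) (≤-refl { - ((r * λ₂) * norm y)}))))

  -- Distances are obtained in this way: P is not assumed decidable, and the goal there is ⊥.
  ¬¬-least : ∀ {P : ℕ → Set} n → P n → ¬ ¬ (∃ λ m → P m × (∀ k → P k → m ℕ.≤ k))
  ¬¬-least {P} = <-rec (λ n → P n → ¬ ¬ (∃ λ m → P m × (∀ k → P k → m ℕ.≤ k))) λ n rec Pn ∄ →
    ∄ (n , Pn , λ k Pk → ℕ.≮⇒≥ λ k<n → rec k<n Pk ∄)

  -- Two edges and three vertices would give a detour.
  diameter-1 : ∀ {T n} → IsHypertree T → Uniform (suc (suc n)) T → IsDiameter T 1 → ∀ (e f : Edge T) → e ≢ f → ⊥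
  diameter-1 {T} {n} isHypertree uniform (_ , diameter) e f e≢f with list e | list f
    where
    list : ∀ e → Listing (suc (suc n)) (edge T e)
    list e = ≡.subst (λ k → Listing k (edge T e)) (uniform e) (listing (edge T e))
  ... | Le | Lf = outside λ (b , b∈f , b∉e) → adjacent (a≢ b∉e (Listing.at∈ Le fzero)) λ (g , a∈g , b∈g) →
      adjacent (a≢ b∉e (Listing.at∈ Le (fsuc fzero))) λ (g′ , a′∈g′ , b∈g′) →
        no-detour 2 (e , Listing.at Le fzero , Listing.at Le (fsuc fzero) , 0≢1 Le , Listing.at∈ Le fzero , Listing.at∈ Le (fsuc fzero)
          , step g (λ { ≡.refl → b∉e b∈g }) a∈g b∈g (step g′ (λ { ≡.refl → b∉e b∈g′ }) b∈g′ a′∈g′ stop))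
    where
    open IsHypertree isHypertree
    open Walks T
    open Tree linear acyclic
    a≢ : ∀ {a b} → ¬ b ∈ˢ edge T e → a ∈ˢ edge T e → a ≢ b
    a≢ b∉e a∈e ≡.refl = b∉e a∈e
    0≢1 : ∀ {p} (L : Listing (suc (suc n)) p) → Listing.at L fzero ≢ Listing.at L (fsuc fzero)
    0≢1 L eq with Listing.injective L eq
    ... | ()
    outside : ¬ ¬ (∃ λ b → b ∈ˢ edge T f × ¬ b ∈ˢ edge T e)
    outside k with Listing.at Lf fzero ∈? edge T e | Listing.at Lf (fsuc fzero) ∈? edge T e
    ... | no b∉e | _ = k (_ , Listing.at∈ Lf fzero , b∉e)
    ... | _ | no b∉e = k (_ , Listing.at∈ Lf (fsuc fzero) , b∉e)
    ... | yes b∈e | yes b′∈e = 0≢1 Lf (meet-unique e≢f b∈e (Listing.at∈ Lf fzero) b′∈e (Listing.at∈ Lf (fsuc fzero)))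
    adjacent : ∀ {a b} → a ≢ b → ¬ ¬ (∃ λ g → a ∈ˢ edge T g × b ∈ˢ edge T g)
    adjacent {a} {b} a≢b k = let d , P = connected a b in ¬¬-least d P λ (m , Q , min) → short m Q (diameter a b m (Q , min))
      where
      short : ∀ m → Path T a b m → m ℕ.≤ 1 → ⊥
      short zero    Q _ = a≢b (≡.trans (≡.sym (Path.start Q)) (Path.end Q))
      short (suc zero) Q _ = k (Path.through Q fzero , ≡.subst (_∈ˢ edge T _) (Path.start Q) (Path.source Q fzero)
        , ≡.subst (_∈ˢ edge T _) (Path.end Q) (Path.target Q fzero))
      short (suc (suc m)) Q (ℕ.s≤s ())

open Forms

-- The extremal hypertree as a broom, isomorphism of brooms, decidability

module Brooms where
  open import Data.Empty using (⊥; ⊥-elim)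
  open import Data.Fin using (Fin; toℕ; fromℕ; inject₁; splitAt; _↑ˡ_; _↑ʳ_; fromℕ<) renaming (zero to fzero; suc to fsuc)
  import Data.Fin.Properties as Fin
  open import Data.Fin.Subset using (Subset; ⁅_⁆) renaming (_∈_ to _∈ˢ_; ⊤ to full; ⊥ to empty)
  open import Data.Fin.Subset.Properties using (x∈⁅x⁆; x∈⁅y⁆⇒x≡y; ∈⊤; ∉⊥; _∈?_)
  open import Data.List using (List; []; _∷_; _++_; length; map; allFin; tabulate; foldr)
  open import Data.List.Membership.Propositional using (_∈_)
  open import Data.List.Membership.Propositional.Properties using (∈-map⁻)
  import Data.List.Properties as List
  open import Data.List.Relation.Binary.Permutation.Propositional using (_↭_; ↭-refl; ↭-sym; ↭-trans; ↭-reflexive; prep)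
  open import Data.List.Relation.Binary.Permutation.Propositional.Properties using (map⁺; shift; ++⁺ʳ; ↭-length)
  import Data.List.Relation.Unary.All as All
  open import Data.List.Relation.Unary.All using (All; []; _∷_)
  open import Data.List.Relation.Unary.AllPairs using ([]; _∷_)
  open import Data.List.Relation.Unary.Any using (here; there)
  open import Data.List.Relation.Unary.Unique.Propositional using (Unique)
  import Data.Nat as ℕ
  open import Data.Nat using (ℕ; zero; suc; _≤_; _<_; z≤n; s≤s; _<?_)
  import Data.Nat.DivMod as ℕ
  open import Data.Nat.GeneralisedArithmetic using (iterate)
  import Data.Nat.Properties as ℕ
  open import Data.Product using (∃; ∃₂; _×_; _,_; proj₁; proj₂)
  open import Data.Sum using (_⊎_; inj₁; inj₂; [_,_]′)
  open import Data.Unit using (⊤; tt)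
  import Data.Vec as Vec
  open import Data.Vec using ([]; _∷_; here; there; lookup; Vec) renaming (_++_ to _++ᵛ_)
  open import Data.Vec.Properties using (lookup∘tabulate; lookup⇒[]=; []=⇒lookup)
  open import Defs hiding (_≈_; bounded)
  open import Function using (_↔_; mk↔ₛ′; mk⇔; Inverse; Equivalence)
  open import Relation.Binary.Definitions using (tri<; tri≈; tri>)
  open import Relation.Binary.PropositionalEquality using (_≡_; _≢_; refl; sym; trans; cong; subst; cong₂; subst₂)
  open import Relation.Nullary using (Dec; yes; no; does)
  open import Relation.Nullary.Decidable using (dec-true; dec-false; _×-dec_; _→-dec_; map′)

  ∈-++ʳ : ∀ {a b} (p : Subset a) {q : Subset b} {x} → x ∈ˢ q → (a ↑ʳ x) ∈ˢ p ++ᵛ q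
  ∈-++ʳ []      x∈q = x∈q
  ∈-++ʳ (_ ∷ p) x∈q = there (∈-++ʳ p x∈q)

  ∈-++ˡ⁻ : ∀ {a b} (p : Subset a) {q : Subset b} {x} → (x ↑ˡ b) ∈ˢ p ++ᵛ q → x ∈ˢ p
  ∈-++ˡ⁻ (_ ∷ p) {x = fzero}  here       = here
  ∈-++ˡ⁻ (_ ∷ p) {x = fsuc x} (there x∈) = there (∈-++ˡ⁻ p x∈)

  ∈-++ʳ⁻ : ∀ {a b} (p : Subset a) {q : Subset b} {x} → (a ↑ʳ x) ∈ˢ p ++ᵛ q → x ∈ˢ q
  ∈-++ʳ⁻ []      x∈         = x∈
  ∈-++ʳ⁻ (_ ∷ p) (there x∈) = ∈-++ʳ⁻ p x∈

  ↑ˡ≢↑ʳ : ∀ {a b} {i : Fin a} {j : Fin b} → i ↑ˡ b ≢ a ↑ʳ j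
  ↑ˡ≢↑ʳ {a} {b} {i} {j} eq with trans (sym (Fin.splitAt-↑ˡ a i b)) (trans (cong (splitAt a) eq) (Fin.splitAt-↑ʳ a b j))
  ... | ()

  data SplitView (a b : ℕ) : Fin (a ℕ.+ b) → Set where
    left  : ∀ i → SplitView a b (i ↑ˡ b)
    right : ∀ j → SplitView a b (a ↑ʳ j)

  splitView : ∀ a b i → SplitView a b i
  splitView a b i with splitAt a i in eq
  ... | inj₁ j = subst (SplitView a b) (Fin.splitAt⁻¹-↑ˡ eq) (left j)
  ... | inj₂ j = subst (SplitView a b) (Fin.splitAt⁻¹-↑ʳ eq) (right j)

  module _ {H : Hypergraph} {n : ℕ} (B : RootedBlocks H n) where
    open RootedBlocks B

    private
      H′ : Hypergraph
      H′ = attachPendant (suc n) H root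

      par′ : Edge H′ → Vertex H′
      par′ fzero    = root ↑ˡ suc n
      par′ (fsuc e) = par e ↑ˡ suc n

      child′ : Edge H′ → Fin (suc n) → Vertex H′
      child′ fzero    t = ∣V∣ H ↑ʳ t
      child′ (fsuc e) t = child e t ↑ˡ suc n

      decode′ : ∀ v → v ≡ root ↑ˡ suc n ⊎ ∃₂ λ e t → v ≡ child′ e t
      decode′ v with splitView (∣V∣ H) (suc n) v
      ... | right t = inj₂ (fzero , t , refl)
      ... | left v with decode v
      ...   | inj₁ refl = inj₁ refl
      ...   | inj₂ (e , t , refl) = inj₂ (fsuc e , t , refl)

      child′-inj : ∀ e f {s t} → child′ e s ≡ child′ f t → e ≡ f × s ≡ t
      child′-inj fzero    fzero    eq = refl , Fin.↑ʳ-injective (∣V∣ H) _ _ eq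
      child′-inj fzero    (fsuc f) eq = ⊥-elim (↑ˡ≢↑ʳ (sym eq))
      child′-inj (fsuc e) fzero    eq = ⊥-elim (↑ˡ≢↑ʳ eq)
      child′-inj (fsuc e) (fsuc f) eq with child-inj (Fin.↑ˡ-injective (suc n) _ _ eq)
      ... | refl , refl = refl , refl

      child′≢par′ : ∀ e {t} → child′ e t ≢ par′ e
      child′≢par′ fzero    eq = ↑ˡ≢↑ʳ (sym eq)
      child′≢par′ (fsuc e) eq = child≢par (Fin.↑ˡ-injective (suc n) _ _ eq)

      child′≢root′ : ∀ e {t} → child′ e t ≢ root ↑ˡ suc n
      child′≢root′ fzero    eq = ↑ˡ≢↑ʳ (sym eq)
      child′≢root′ (fsuc e) eq = child≢root (Fin.↑ˡ-injective (suc n) _ _ eq)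

      par∈′ : ∀ e → par′ e ∈ˢ edge H′ e
      par∈′ fzero    = ∈-++ˡ full (x∈⁅x⁆ root)
      par∈′ (fsuc e) = ∈-++ˡ empty (par∈ e)

      child∈′ : ∀ e t → child′ e t ∈ˢ edge H′ e
      child∈′ fzero    t = ∈-++ʳ ⁅ root ⁆ {full} ∈⊤
      child∈′ (fsuc e) t = ∈-++ˡ empty (child∈ e t)

      members′ : ∀ e {v} → v ∈ˢ edge H′ e → v ≡ par′ e ⊎ ∃ λ t → v ≡ child′ e t
      members′ e {v} v∈ with splitView (∣V∣ H) (suc n) v
      members′ fzero    v∈ | left v  = inj₁ (cong (_↑ˡ suc n) (x∈⁅y⁆⇒x≡y root (∈-++ˡ⁻ ⁅ root ⁆ {full} v∈)))
      members′ fzero    v∈ | right t = inj₂ (t , refl)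
      members′ (fsuc e) v∈ | right t = ⊥-elim (∉⊥ (∈-++ʳ⁻ (edge H e) {empty} v∈))
      members′ (fsuc e) v∈ | left v with members (∈-++ˡ⁻ (edge H e) {empty} v∈)
      ... | inj₁ refl       = inj₁ refl
      ... | inj₂ (t , refl) = inj₂ (t , refl)

      par-top′ : ∀ e → par′ e ≡ root ↑ˡ suc n ⊎ ∃ λ f → par′ e ≡ child′ f fzero
      par-top′ fzero    = inj₁ refl
      par-top′ (fsuc e) with par-top e
      ... | inj₁ eq       = inj₁ (cong (_↑ˡ suc n) eq)
      ... | inj₂ (f , eq) = inj₂ (fsuc f , cong (_↑ˡ suc n) eq)

    attachedBlocks : RootedBlocks (attachPendant (suc n) H root) n
    attachedBlocks = record
      { root = root ↑ˡ suc n ; par = par′ ; child = child′ ; decode = decode′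
      ; child≢root = λ {e} → child′≢root′ e ; child-inj = λ {e} {f} → child′-inj e f ; child≢par = λ {e} → child′≢par′ e
      ; par∈ = par∈′ ; child∈ = child∈′ ; members = λ {e} → members′ e ; par-top = par-top′ }

    module Old = Chains B
    module New = Chains attachedBlocks

    lift-below : ∀ e es → Old.Below e es → New.Below (fsuc e) (map fsuc es)
    lift-below e []       _          = tt
    lift-below e (f ∷ fs) (par≡ , b) = cong (_↑ˡ suc n) par≡ , lift-below f fs b

    lift-descending : ∀ es → Old.Descending es → New.Descending (map fsuc es)
    lift-descending []       _ = tt
    lift-descending (e ∷ es) b = lift-below e es b

  -- The new edge joins `Os`; chains and parents are carried over.
  attach-broom : ∀ {H n p c} (b : Broom H n p c) → Broom (attachPendant (suc n) H (Broom.root b)) n p (suc c)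
  attach-broom {H} {n} {p} {c} b = record
    { rootedBlocks = attachedBlocks rootedBlocks
    ; arms = record
      { Zl = map fsuc Zl ; Y₀ = [] ; Y₁ = map fsuc Y₁ ; Os = fzero ∷ map fsuc Os
      ; Zl-descend = lift-descending rootedBlocks Zl Zl-descend
      ; Yl-descend = lift-descending rootedBlocks Y₁ (subst (λ Y → Chains.Descending rootedBlocks (Y ++ Y₁)) Y₀≡[] Yl-descend)
      ; length-Zl = trans (List.length-map fsuc Zl) (subst (λ Y → length Y ℕ.+ length Zl ≡ p) Y₀≡[] length-Zl)
      ; length-Y₁ = trans (List.length-map fsuc Y₁) length-Y₁
      ; length-Os = cong suc (trans (List.length-map fsuc Os) length-Os)
      ; all-edges = ↭-trans (prep fzero (↭-trans (↭-reflexive (sym (List.map-tabulate (λ i → i) fsuc)))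
            (↭-trans (map⁺ fsuc (subst (λ Y → allFin (∣E∣ H) ↭ (Zl ++ (Y ++ Y₁)) ++ Os) Y₀≡[] all-edges))
              (↭-reflexive (trans (List.map-++ fsuc (Zl ++ Y₁) Os) (cong (_++ map fsuc Os) (List.map-++ fsuc Zl Y₁)))))))
          (↭-sym (shift fzero (map fsuc Zl ++ map fsuc Y₁) (map fsuc Os)))
      }
    ; Y₀≡[] = refl
    ; at-root = λ where
        (inj₁ h)                     → lifted Zl (λ e∈ → at-root (inj₁ e∈)) h
        (inj₂ (inj₁ h))              → lifted Y₁ (λ e∈ → at-root (inj₂ (inj₁ (subst (λ Y → _ ∈ heads (Y ++ Y₁)) (sym Y₀≡[]) e∈)))) h
        (inj₂ (inj₂ (here refl)))    → refl
        (inj₂ (inj₂ (there h)))      → let e , e∈ , eq = ∈-map⁻ fsuc h in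
          trans (cong (RootedBlocks.par (attachedBlocks rootedBlocks)) eq) (cong (_↑ˡ suc n) (at-root (inj₂ (inj₂ e∈))))
    }
    where
    open Broom b
    lifted : ∀ es → (∀ {e} → e ∈ heads es → par e ≡ root) → ∀ {e} → e ∈ heads (map fsuc es) → RootedBlocks.par (attachedBlocks rootedBlocks) e ≡ root ↑ˡ suc n
    lifted (e ∷ es) h (here refl) = cong (_↑ˡ suc n) (h (here refl))

  -- Meant for coefficients c_i that vanish except at one place.
  foldr-only : ∀ {A : Set} {m} (F : Fin m → A → A) (j₀ : Fin m) → (∀ j → j ≢ j₀ → ∀ M → F j M ≡ M) → ∀ b → foldr F b (allFin m) ≡ F j₀ b
  foldr-only {A} {m} F j₀ idle b = onto (λ i → i) j₀ (λ eq → eq) refl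
    where
    none : ∀ {k} (g : Fin k → Fin m) → (∀ i → g i ≢ j₀) → foldr F b (tabulate g) ≡ b
    none {zero}  g h = refl
    none {suc k} g h = trans (idle (g fzero) (h fzero) _) (none (λ i → g (fsuc i)) λ i → h (fsuc i))
    onto : ∀ {k} (g : Fin k → Fin m) (i₀ : Fin k) → (∀ {i j} → g i ≡ g j → i ≡ j) → g i₀ ≡ j₀ → foldr F b (tabulate g) ≡ F j₀ b
    onto g fzero     inj refl = cong (F (g fzero)) (none (λ i → g (fsuc i)) λ i eq → absurd (inj eq))
      where
      absurd : ∀ {k} {i : Fin k} → fsuc i ≡ fzero → ⊥
      absurd ()
    onto g (fsuc i₀) inj refl = trans (idle (g fzero) (λ eq → absurd (inj eq)) _) (onto (λ i → g (fsuc i)) i₀ (λ eq → Fin.suc-injective (inj eq)) refl)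
      where
      absurd : ∀ {k} {i : Fin k} → fzero ≡ fsuc i → ⊥
      absurd ()

  quotient-unique : ∀ {n} a b {l m} → l < suc n → m < suc n → a ℕ.* suc n ℕ.+ l ≡ b ℕ.* suc n ℕ.+ m → a ≡ b × l ≡ m
  quotient-unique {n} a b {l} {m} l< m< eq = ℕ.*-cancelʳ-≡ a b (suc n) (ℕ.+-cancelʳ-≡ m _ _ (trans (cong (a ℕ.* suc n ℕ.+_) (sym l≡m)) eq)) , l≡m
    where
    remainder : ∀ a {l} → l < suc n → (a ℕ.* suc n ℕ.+ l) ℕ.% suc n ≡ l
    remainder a {l} l< = trans (cong (ℕ._% suc n) (ℕ.+-comm (a ℕ.* suc n) l)) (trans (ℕ.[m+kn]%n≡m%n l a (suc n)) (ℕ.m<n⇒m%n≡m l<))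
    l≡m : l ≡ m
    l≡m = trans (sym (remainder a l<)) (trans (cong (ℕ._% suc n) eq) (remainder b m<))

  module PathBroom (n p d : ℕ) (p≤d : p ≤ d) where
    private
      r = suc n
      H = loosePath r d

      ∈⇒bounds : ∀ {i v} → v ∈ˢ pathEdge r d i → toℕ i ℕ.* r ≤ toℕ v × toℕ v ≤ suc (toℕ i) ℕ.* r
      ∈⇒bounds {i} {v} v∈ = does⇒ (onEdge? r d i v) (trans (sym (lookup∘tabulate (λ w → does (onEdge? r d i w)) v)) ([]=⇒lookup v∈))

      bounds⇒∈ : ∀ {i v} → toℕ i ℕ.* r ≤ toℕ v → toℕ v ≤ suc (toℕ i) ℕ.* r → v ∈ˢ pathEdge r d i
      bounds⇒∈ {i} {v} lo hi = lookup⇒[]= v (pathEdge r d i) (trans (lookup∘tabulate (λ w → does (onEdge? r d i w)) v) (dec-true (onEdge? r d i v) (lo , hi)))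

      -- The loose path is rooted at position p r. The parent of edge i is the end of its interval
      -- that faces the root: the upper end for i < p, the lower one otherwise. Child 0 is the
      -- opposite end, and child t > 0 the interior vertex at offset t.
      parBase : ℕ → ℕ
      parBase i with i <? p
      ... | yes _ = suc i
      ... | no _  = i

      childBase : ∀ {k} → ℕ → Fin k → ℕ
      childBase i (fsuc _) = i
      childBase i fzero with i <? p
      ... | yes _ = i
      ... | no _  = suc i

      parBase-bounds : ∀ i → i ≤ parBase i × parBase i ≤ suc i
      parBase-bounds i with i <? p
      ... | yes _ = ℕ.n≤1+n i , ℕ.≤-refl
      ... | no _  = ℕ.≤-refl , ℕ.n≤1+n i

      i*r≤ : ∀ {i j} → i ≤ j → i ℕ.* r ≤ j ℕ.* r
      i*r≤ = ℕ.*-monoˡ-≤ r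

      child-bounds : ∀ i (t : Fin r) → i ℕ.* r ≤ childBase i t ℕ.* r ℕ.+ toℕ t × childBase i t ℕ.* r ℕ.+ toℕ t ≤ suc i ℕ.* r
      child-bounds i t@(fsuc _) = ℕ.m≤m+n (i ℕ.* r) (toℕ t) , ℕ.≤-trans (ℕ.+-monoʳ-≤ (i ℕ.* r) (ℕ.<⇒≤ (Fin.toℕ<n t))) (ℕ.≤-reflexive (ℕ.+-comm (i ℕ.* r) r))
      child-bounds i fzero with i <? p
      ... | yes _ = ℕ.m≤m+n (i ℕ.* r) 0 , ℕ.≤-trans (ℕ.≤-reflexive (ℕ.+-identityʳ (i ℕ.* r))) (i*r≤ (ℕ.n≤1+n i))
      ... | no _  = ℕ.≤-trans (i*r≤ (ℕ.n≤1+n i)) (ℕ.m≤m+n (suc i ℕ.* r) 0) , ℕ.≤-reflexive (ℕ.+-identityʳ (suc i ℕ.* r))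

      below-d : ∀ {k} (i : Fin d) → k ≤ suc (toℕ i) ℕ.* r → k < suc (d ℕ.* r)
      below-d i k≤ = s≤s (ℕ.≤-trans k≤ (i*r≤ (Fin.toℕ<n i)))

      par-bound : ∀ (i : Fin d) → parBase (toℕ i) ℕ.* r < suc (d ℕ.* r)
      par-bound i = below-d i (i*r≤ (proj₂ (parBase-bounds (toℕ i))))

      child-bound : ∀ (i : Fin d) t → childBase (toℕ i) t ℕ.* r ℕ.+ toℕ t < suc (d ℕ.* r)
      child-bound i t = below-d i (proj₂ (child-bounds (toℕ i) t))

      root : Vertex H
      root = fromℕ< {p ℕ.* r} (s≤s (i*r≤ p≤d))

      par : Edge H → Vertex H
      par i = fromℕ< (par-bound i)

      child : Edge H → Fin r → Vertex H
      child i t = fromℕ< (child-bound i t)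

      toℕ-root : toℕ root ≡ p ℕ.* r
      toℕ-root = Fin.toℕ-fromℕ< _

      toℕ-par : ∀ i → toℕ (par i) ≡ parBase (toℕ i) ℕ.* r
      toℕ-par i = Fin.toℕ-fromℕ< (par-bound i)

      toℕ-child : ∀ i t → toℕ (child i t) ≡ childBase (toℕ i) t ℕ.* r ℕ.+ toℕ t
      toℕ-child i t = Fin.toℕ-fromℕ< (child-bound i t)

      toℕ-child₀ : ∀ i → toℕ (child i fzero) ≡ childBase {r} (toℕ i) fzero ℕ.* r
      toℕ-child₀ i = trans (toℕ-child i fzero) (ℕ.+-identityʳ _)

      parBase-< : ∀ {i} → i < p → parBase i ≡ suc i
      parBase-< {i} i<p with i <? p
      ... | yes _  = refl
      ... | no i≮p = ⊥-elim (i≮p i<p)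

      parBase-≥ : ∀ {i} → p ≤ i → parBase i ≡ i
      parBase-≥ {i} p≤i with i <? p
      ... | yes i<p = ⊥-elim (ℕ.<⇒≱ i<p p≤i)
      ... | no _    = refl

      childBase-< : ∀ {i} → i < p → childBase {r} i fzero ≡ i
      childBase-< {i} i<p with i <? p
      ... | yes _  = refl
      ... | no i≮p = ⊥-elim (i≮p i<p)

      childBase-≥ : ∀ {i} → p ≤ i → childBase {r} i fzero ≡ suc i
      childBase-≥ {i} p≤i with i <? p
      ... | yes i<p = ⊥-elim (ℕ.<⇒≱ i<p p≤i)
      ... | no _    = refl

      childBase-injective : ∀ i j → childBase {r} i fzero ≡ childBase {r} j fzero → i ≡ j
      childBase-injective i j eq with i <? p | j <? p
      ... | yes _   | yes _   = eq
      ... | no _    | no _    = ℕ.suc-injective eq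
      ... | yes i<p | no j≮p  = ⊥-elim (j≮p (ℕ.<-trans (ℕ.≤-reflexive (sym eq)) i<p))
      ... | no i≮p  | yes j<p = ⊥-elim (i≮p (ℕ.<-trans (ℕ.≤-reflexive eq) j<p))

      child-inj : ∀ i j s t → child i s ≡ child j t → i ≡ j × s ≡ t
      child-inj i j s t eq with quotient-unique (childBase (toℕ i) s) (childBase (toℕ j) t) (Fin.toℕ<n s) (Fin.toℕ<n t) (trans (sym (toℕ-child i s)) (trans (cong toℕ eq) (toℕ-child j t)))
      ... | base≡ , s≡t with Fin.toℕ-injective s≡t
      child-inj i j fzero    t eq | base≡ , _ | refl = Fin.toℕ-injective (childBase-injective (toℕ i) (toℕ j) base≡) , refl
      child-inj i j (fsuc s) t eq | base≡ , _ | refl = Fin.toℕ-injective base≡ , refl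

      child≢multiple : ∀ i t b → toℕ (child i t) ≡ b ℕ.* r → t ≡ fzero × childBase {r} (toℕ i) fzero ≡ b
      child≢multiple i t b eq with quotient-unique (childBase (toℕ i) t) b (Fin.toℕ<n t) (s≤s z≤n) (trans (sym (toℕ-child i t)) (trans eq (sym (ℕ.+-identityʳ (b ℕ.* r)))))
      child≢multiple i fzero b eq | base≡ , _ = refl , base≡

      child≢root : ∀ i t → child i t ≢ root
      child≢root i t eq with child≢multiple i t p (trans (cong toℕ eq) toℕ-root)
      ... | refl , base≡ with toℕ i <? p
      ...   | yes i<p = ℕ.<⇒≢ i<p base≡
      ...   | no i≮p  = i≮p (ℕ.≤-reflexive base≡)

      child≢par : ∀ i t → child i t ≢ par i
      child≢par i t eq with child≢multiple i t (parBase (toℕ i)) (trans (cong toℕ eq) (toℕ-par i))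
      ... | refl , base≡ with toℕ i <? p
      ...   | yes _ = ℕ.1+n≢n (sym base≡)
      ...   | no _  = ℕ.1+n≢n base≡

      par∈ : ∀ i → par i ∈ˢ pathEdge r d i
      par∈ i = bounds⇒∈ {i} {par i} (subst (toℕ i ℕ.* r ≤_) (sym (toℕ-par i)) (i*r≤ (proj₁ (parBase-bounds (toℕ i)))))
        (subst (_≤ suc (toℕ i) ℕ.* r) (sym (toℕ-par i)) (i*r≤ (proj₂ (parBase-bounds (toℕ i)))))

      child∈ : ∀ i t → child i t ∈ˢ pathEdge r d i
      child∈ i t = bounds⇒∈ {i} {child i t} (subst (toℕ i ℕ.* r ≤_) (sym (toℕ-child i t)) (proj₁ (child-bounds (toℕ i) t)))
        (subst (_≤ suc (toℕ i) ℕ.* r) (sym (toℕ-child i t)) (proj₂ (child-bounds (toℕ i) t)))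

      end-of : ∀ i v → toℕ v ≡ toℕ i ℕ.* r ⊎ toℕ v ≡ suc (toℕ i) ℕ.* r → v ≡ par i ⊎ v ≡ child i fzero
      end-of i v h = cases (toℕ i <? p) h
        where
        cases : Dec (toℕ i < p) → toℕ v ≡ toℕ i ℕ.* r ⊎ toℕ v ≡ suc (toℕ i) ℕ.* r → v ≡ par i ⊎ v ≡ child i fzero
        cases (yes i<p) (inj₁ eq) = inj₂ (Fin.toℕ-injective (trans eq (trans (cong (ℕ._* r) (sym (childBase-< i<p))) (sym (toℕ-child₀ i)))))
        cases (yes i<p) (inj₂ eq) = inj₁ (Fin.toℕ-injective (trans eq (trans (cong (ℕ._* r) (sym (parBase-< i<p))) (sym (toℕ-par i)))))
        cases (no i≮p) (inj₁ eq) = inj₁ (Fin.toℕ-injective (trans eq (trans (cong (ℕ._* r) (sym (parBase-≥ (ℕ.≮⇒≥ i≮p)))) (sym (toℕ-par i)))))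
        cases (no i≮p) (inj₂ eq) = inj₂ (Fin.toℕ-injective (trans eq (trans (cong (ℕ._* r) (sym (childBase-≥ (ℕ.≮⇒≥ i≮p)))) (sym (toℕ-child₀ i)))))

      members : ∀ {i v} → v ∈ˢ pathEdge r d i → v ≡ par i ⊎ ∃ λ t → v ≡ child i t
      members {i} {v} v∈ with ∈⇒bounds {i} {v} v∈
      -- The offset of v in its interval decides: 0 and r are the two ends, anything between is an
      -- interior child.
      ... | lo , hi with toℕ v ℕ.∸ toℕ i ℕ.* r in eq
      ...   | zero = either (end-of i v (inj₁ (ℕ.≤-antisym (ℕ.m∸n≡0⇒m≤n eq) lo)))
        where
        either : v ≡ par i ⊎ v ≡ child i fzero → v ≡ par i ⊎ ∃ λ t → v ≡ child i t
        either (inj₁ h) = inj₁ h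
        either (inj₂ h) = inj₂ (fzero , h)
      ...   | suc m with m <? n
      ...     | yes m<n = inj₂ (fsuc (fromℕ< m<n) , Fin.toℕ-injective (trans (sym (ℕ.m+[n∸m]≡n lo))
                  (trans (cong (toℕ i ℕ.* r ℕ.+_) (trans eq (cong suc (sym (Fin.toℕ-fromℕ< m<n))))) (sym (toℕ-child i (fsuc (fromℕ< m<n)))))))
      ...     | no m≮n = either (end-of i v (inj₂ (ℕ.≤-antisym hi (ℕ.≤-trans (ℕ.≤-reflexive (ℕ.+-comm r (toℕ i ℕ.* r)))
                  (ℕ.≤-trans (ℕ.+-monoʳ-≤ (toℕ i ℕ.* r) (ℕ.≤-trans (s≤s (ℕ.≮⇒≥ m≮n)) (ℕ.≤-reflexive (sym eq)))) (ℕ.≤-reflexive (ℕ.m+[n∸m]≡n lo)))))))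
        where
        either : v ≡ par i ⊎ v ≡ child i fzero → v ≡ par i ⊎ ∃ λ t → v ≡ child i t
        either (inj₁ h) = inj₁ h
        either (inj₂ h) = inj₂ (fzero , h)

      multiple : ∀ v b → toℕ v ≡ b ℕ.* r → b ≤ d → v ≡ root ⊎ ∃ λ i → v ≡ child i fzero
      multiple v b eq b≤d with ℕ.<-cmp b p
      ... | tri≈ _ refl _ = inj₁ (Fin.toℕ-injective (trans eq (sym toℕ-root)))
      ... | tri< b<p _ _ = inj₂ (fromℕ< b<d , Fin.toℕ-injective (trans eq (trans (cong (ℕ._* r) (sym (trans (cong (λ i → childBase {r} i fzero) (Fin.toℕ-fromℕ< b<d)) (childBase-< b<p)))) (sym (toℕ-child₀ (fromℕ< b<d))))))
        where b<d = ℕ.<-≤-trans b<p p≤d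
      multiple v (suc b) eq b<d | tri> _ _ (s≤s p≤b) = inj₂ (fromℕ< b<d , Fin.toℕ-injective (trans eq (trans (cong (ℕ._* r) (sym (trans (cong (λ i → childBase {r} i fzero) (Fin.toℕ-fromℕ< b<d)) (childBase-≥ p≤b)))) (sym (toℕ-child₀ (fromℕ< b<d))))))

      v/r≤d : ∀ (v : Vertex H) → toℕ v ℕ./ r ≤ d
      v/r≤d v = ℕ.≤-trans (ℕ./-monoˡ-≤ r (ℕ.≤-pred (Fin.toℕ<n v))) (ℕ.≤-reflexive (ℕ.m*n/n≡m d r))

      decode : ∀ v → v ≡ root ⊎ ∃₂ λ i t → v ≡ child i t
      decode v with toℕ v ℕ.% r in eq
      ... | zero with multiple v (toℕ v ℕ./ r) (trans (ℕ.m≡m%n+[m/n]*n (toℕ v) r) (cong (ℕ._+ (toℕ v ℕ./ r) ℕ.* r) eq)) (v/r≤d v)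
      ...   | inj₁ h       = inj₁ h
      ...   | inj₂ (i , h) = inj₂ (i , fzero , h)
      decode v | suc m = inj₂ (i , t , Fin.toℕ-injective (trans v≡ (trans (cong₂ (λ a b → a ℕ.* r ℕ.+ b) (sym (Fin.toℕ-fromℕ< q<d)) (sym (cong suc (Fin.toℕ-fromℕ< m<n)))) (sym (toℕ-child i t)))))
        where
        q = toℕ v ℕ./ r
        v≡ : toℕ v ≡ q ℕ.* r ℕ.+ suc m
        v≡ = trans (ℕ.m≡m%n+[m/n]*n (toℕ v) r) (trans (cong (ℕ._+ q ℕ.* r) eq) (ℕ.+-comm (suc m) (q ℕ.* r)))
        m<n : m < n
        m<n = ℕ.≤-pred (subst (_< r) eq (ℕ.m%n<n (toℕ v) r))
        q<d : q < d
        q<d = ℕ.*-cancelʳ-< r q d (ℕ.<-≤-trans (ℕ.m<m+n (q ℕ.* r) (s≤s z≤n)) (ℕ.≤-trans (ℕ.≤-reflexive (sym v≡)) (ℕ.≤-pred (Fin.toℕ<n v))))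
        i = fromℕ< q<d
        t : Fin r
        t = fsuc (fromℕ< m<n)

      parBase≤d : ∀ (i : Fin d) → parBase (toℕ i) ≤ d
      parBase≤d i = ℕ.≤-trans (proj₂ (parBase-bounds (toℕ i))) (Fin.toℕ<n i)

    pathBlocks : RootedBlocks (loosePath (suc n) d) n
    pathBlocks = record
      { root = root ; par = par ; child = child ; decode = decode
      ; child≢root = λ {i} {t} → child≢root i t ; child-inj = λ {i} {j} {s} {t} → child-inj i j s t ; child≢par = λ {i} {t} → child≢par i t
      ; par∈ = par∈ ; child∈ = child∈ ; members = λ {i} {v} → members {i} {v}
      ; par-top = λ i → multiple (par i) (parBase (toℕ i)) (toℕ-par i) (parBase≤d i) }

    root≡pathVertex : ∀ (i : Fin (suc d)) → toℕ i ≡ p → root ≡ pathVertex r d i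
    root≡pathVertex i eq = Fin.toℕ-injective (trans toℕ-root (trans (cong (ℕ._* r) (sym eq)) (sym (toℕ-pathVertex r d i))))

    at : ∀ b → b ≤ d → Vertex H
    at b b≤d = fromℕ< {b ℕ.* r} (s≤s (i*r≤ b≤d))

    private
      ≡at : ∀ {v b c} (b≤d : b ≤ d) → toℕ v ≡ c ℕ.* r → c ≡ b → v ≡ at b b≤d
      ≡at b≤d v≡ refl = Fin.toℕ-injective (trans v≡ (sym (Fin.toℕ-fromℕ< _)))

    lower-child : ∀ i {b} (b≤d : b ≤ d) → toℕ i ≡ b → toℕ i < p → child i fzero ≡ at b b≤d
    lower-child i b≤d eq i<p = ≡at b≤d (toℕ-child₀ i) (trans (childBase-< i<p) eq)

    lower-par : ∀ i {b} (b≤d : b ≤ d) → suc (toℕ i) ≡ b → toℕ i < p → par i ≡ at b b≤d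
    lower-par i b≤d eq i<p = ≡at b≤d (toℕ-par i) (trans (parBase-< i<p) eq)

    upper-child : ∀ i {b} (b≤d : b ≤ d) → suc (toℕ i) ≡ b → p ≤ toℕ i → child i fzero ≡ at b b≤d
    upper-child i b≤d eq p≤i = ≡at b≤d (toℕ-child₀ i) (trans (childBase-≥ p≤i) eq)

    upper-par : ∀ i {b} (b≤d : b ≤ d) → toℕ i ≡ b → p ≤ toℕ i → par i ≡ at b b≤d
    upper-par i b≤d eq p≤i = ≡at b≤d (toℕ-par i) (trans (parBase-≥ p≤i) eq)

    at≡root : ∀ {b} (b≤d : b ≤ d) → b ≡ p → at b b≤d ≡ root
    at≡root b≤d eq = sym (≡at b≤d toℕ-root (sym eq))

    open Chains pathBlocks

    -- A chain read towards the root, the order in which the first p edges of the loose path come;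
    -- `reverseOnto` makes it descending.
    Ascending : Vertex H → List (Edge H) → Vertex H → Set
    Ascending v []       w = v ≡ w
    Ascending v (e ∷ es) w = v ≡ child e fzero × Ascending (par e) es w

    reverseOnto : List (Edge H) → List (Edge H) → List (Edge H)
    reverseOnto []       acc = acc
    reverseOnto (e ∷ es) acc = reverseOnto es (e ∷ acc)

    reverseOnto-↭ : ∀ es acc → reverseOnto es acc ↭ es ++ acc
    reverseOnto-↭ []       acc = ↭-refl
    reverseOnto-↭ (e ∷ es) acc = ↭-trans (reverseOnto-↭ es (e ∷ acc)) (shift e es acc)

    reverseOnto-above : ∀ {v w} es acc → Above v acc → Ascending v es w → Above w (reverseOnto es acc)
    reverseOnto-above []       acc      a          refl       = a
    reverseOnto-above (e ∷ es) []       _          (_ , h)    = reverseOnto-above es (e ∷ []) (refl , tt) h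
    reverseOnto-above (e ∷ es) (f ∷ fs) (eq , b) (v≡ , h) = reverseOnto-above es (e ∷ f ∷ fs) (refl , trans eq v≡ , b) h

    ascending-tabulate : ∀ k (g : Fin k → Edge H) (vs : Fin (suc k) → Vertex H) →
      (∀ i → child (g i) fzero ≡ vs (inject₁ i)) → (∀ i → par (g i) ≡ vs (fsuc i)) → Ascending (vs fzero) (tabulate g) (vs (fromℕ k))
    ascending-tabulate zero    g vs h k = refl
    ascending-tabulate (suc _) g vs h k = sym (h fzero) , subst (λ v → Ascending v (tabulate λ i → g (fsuc i)) (vs (fromℕ _))) (sym (k fzero))
      (ascending-tabulate _ (λ i → g (fsuc i)) (λ i → vs (fsuc i)) (λ i → h (fsuc i)) λ i → k (fsuc i))

    descending-tabulate : ∀ k (g : Fin k → Edge H) (vs : Fin (suc k) → Vertex H) →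
      (∀ i → par (g i) ≡ vs (inject₁ i)) → (∀ i → child (g i) fzero ≡ vs (fsuc i)) → Above (vs fzero) (tabulate g)
    descending-tabulate zero    g vs h k = tt
    descending-tabulate (suc zero) g vs h k = h fzero , tt
    descending-tabulate (suc (suc m)) g vs h k with descending-tabulate (suc m) (λ i → g (fsuc i)) (λ i → vs (fsuc i)) (λ i → h (fsuc i)) (λ i → k (fsuc i))
    ... | eq , b = h fzero , trans eq (sym (k fzero)) , b

  tabulate-++ : ∀ {A : Set} m {k} (f : Fin (m ℕ.+ k) → A) → tabulate f ≡ tabulate (λ i → f (i ↑ˡ k)) ++ tabulate (λ j → f (m ↑ʳ j))
  tabulate-++ zero    f = refl
  tabulate-++ (suc m) f = cong (f fzero ∷_) (tabulate-++ m λ i → f (fsuc i))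

  module _ (n p : ℕ) where
    private
      d = p ℕ.+ suc p
      p≤d : p ≤ d
      p≤d = ℕ.m≤m+n p (suc p)
      open PathBroom n p d p≤d
      open RootedBlocks pathBlocks
      open Chains pathBlocks

      lower : List (Edge (loosePath (suc n) d))
      lower = tabulate {n = p} (_↑ˡ suc p)

      Z Y : List (Edge (loosePath (suc n) d))
      Z = reverseOnto lower []
      Y = tabulate {n = suc p} (p ↑ʳ_)

      Z-↭ : Z ↭ lower
      Z-↭ = ↭-trans (reverseOnto-↭ lower []) (↭-reflexive (List.++-identityʳ lower))

      Z-above : Above root Z
      Z-above = subst (λ v → Above v Z) (at≡root (bound (fromℕ p)) (Fin.toℕ-fromℕ p))
        (reverseOnto-above {at 0 z≤n} lower [] tt
          (ascending-tabulate p (_↑ˡ suc p) (λ i → at (toℕ i) (bound i))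
            (λ i → lower-child (i ↑ˡ suc p) (bound (inject₁ i)) (trans (Fin.toℕ-↑ˡ i (suc p)) (sym (Fin.toℕ-inject₁ i))) (below i))
            (λ i → lower-par (i ↑ˡ suc p) (bound (fsuc i)) (cong suc (Fin.toℕ-↑ˡ i (suc p))) (below i))))
        where
        bound : ∀ (i : Fin (suc p)) → toℕ i ≤ d
        bound i = ℕ.≤-trans (ℕ.≤-pred (Fin.toℕ<n i)) p≤d
        below : ∀ (i : Fin p) → toℕ (i ↑ˡ suc p) < p
        below i = subst (_< p) (sym (Fin.toℕ-↑ˡ i (suc p))) (Fin.toℕ<n i)

      Y-above : Above root Y
      Y-above = subst (λ v → Above v Y) (at≡root (bound fzero) (ℕ.+-identityʳ p))
        (descending-tabulate (suc p) (p ↑ʳ_) (λ i → at (p ℕ.+ toℕ i) (bound i))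
          (λ i → upper-par (p ↑ʳ i) (bound (inject₁ i)) (trans (Fin.toℕ-↑ʳ p i) (cong (p ℕ.+_) (sym (Fin.toℕ-inject₁ i)))) (beyond i))
          (λ i → upper-child (p ↑ʳ i) (bound (fsuc i)) (trans (cong suc (Fin.toℕ-↑ʳ p i)) (sym (ℕ.+-suc p (toℕ i)))) (beyond i)))
        where
        bound : ∀ (i : Fin (suc (suc p))) → p ℕ.+ toℕ i ≤ d
        bound i = ℕ.+-monoʳ-≤ p (ℕ.≤-pred (Fin.toℕ<n i))
        beyond : ∀ (i : Fin (suc p)) → p ≤ toℕ (p ↑ʳ i)
        beyond i = subst (p ≤_) (sym (Fin.toℕ-↑ʳ p i)) (ℕ.m≤m+n p (toℕ i))

      above-heads : ∀ es → Above root es → ∀ {e} → e ∈ heads es → par e ≡ root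
      above-heads (e ∷ es) (eq , _) (here refl) = eq

    pathBroom : Broom (loosePath (suc n) d) n p 0
    pathBroom = record
      { rootedBlocks = pathBlocks
      ; arms = record
        { Zl = Z ; Y₀ = [] ; Y₁ = Y ; Os = []
        ; Zl-descend = above⇒descending Z Z-above ; Yl-descend = above⇒descending Y Y-above
        ; length-Zl = trans (↭-length Z-↭) (List.length-tabulate {n = p} (_↑ˡ suc p))
        ; length-Y₁ = List.length-tabulate {n = suc p} (p ↑ʳ_)
        ; length-Os = refl
        ; all-edges = ↭-trans (↭-reflexive (tabulate-++ p (λ i → i))) (↭-trans (++⁺ʳ Y (↭-sym Z-↭)) (↭-reflexive (sym (List.++-identityʳ (Z ++ Y)))))
        }
      ; Y₀≡[] = refl
      ; at-root = λ where
          (inj₁ h)         → above-heads Z Z-above h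
          (inj₂ (inj₁ h))  → above-heads Y Y-above h
          (inj₂ (inj₂ ()))
      }

    BroomAt : ∀ {d} → Marked d → Fin (suc d) → ℕ → Set
    BroomAt (H , v) i c = ∃ λ (b : Broom H n p c) → Broom.root b ≡ v i

    attach-at : ∀ {d} (M : Marked d) i {c} → BroomAt M i c → BroomAt (attachAt (suc n) i M) i (suc c)
    attach-at (H , v) i (b , eq) = subst (λ u → ∃ λ (b : Broom (attachPendant (suc n) H u) n p _) → Broom.root b ≡ v i ↑ˡ suc n) eq
      (attach-broom b , cong (_↑ˡ suc n) eq)

    iterate-attach : ∀ {d} i k (M : Marked d) {c} → BroomAt M i c → BroomAt (iterate (attachAt (suc n) i) M k) i (k ℕ.+ c)
    iterate-attach i zero    M b = b
    iterate-attach i (suc k) M {c} b = subst (BroomAt (iterate (attachAt (suc n) i) M (suc k)) i) (ℕ.+-suc k c) (iterate-attach i k _ (attach-at M i b))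

  starBroom : ∀ n p c → Broom (T⟨ suc p ℕ.+ suc (suc p) ⟩ (only (suc p ℕ.+ 1) c) {suc (suc n)} (s≤s (s≤s z≤n))) n (suc p) c
  starBroom n p c = subst (λ M → Broom (proj₁ M) n (suc p) c) (sym (trans
      (foldr-only _ j₀ (λ j j≢ M → cong (iterate (attachAt (suc n) (inner {d} j)) M) (idle j j≢)) base)
      (cong (iterate (attachAt (suc n) (inner {d} j₀)) base) active)))
    (subst (λ k → Broom (proj₁ (iterate (attachAt (suc n) (inner {d} j₀)) base c)) n (suc p) k) (ℕ.+-identityʳ c) (proj₁ (iterate-attach n (suc p) (inner {d} j₀) c base
      (pathBroom n (suc p) , PathBroom.root≡pathVertex n (suc p) d (ℕ.m≤m+n (suc p) (suc (suc p))) (inner {d} j₀) (cong suc (trans (Fin.toℕ-inject₁ j₀) toℕ-j₀))))))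
    where
    d = suc p ℕ.+ suc (suc p)
    base : Marked d
    base = loosePath (suc n) d , pathVertex (suc n) d
    p<d : p < d ℕ.∸ 1
    p<d = ℕ.m<m+n p (s≤s z≤n)
    -- The coefficients are counted from c₂ on, so c_{p+2} has index p; the parameter called p in
    -- the theorem is p + 1 here.
    j₀ : Fin (d ℕ.∸ 1)
    j₀ = fromℕ< p<d
    toℕ-j₀ : toℕ j₀ ≡ p
    toℕ-j₀ = Fin.toℕ-fromℕ< p<d
    j₀+2 : toℕ j₀ ℕ.+ 2 ≡ suc p ℕ.+ 1
    j₀+2 = trans (cong (ℕ._+ 2) toℕ-j₀) (ℕ.+-suc p 1)
    active : only (suc p ℕ.+ 1) c j₀ ≡ c
    active rewrite dec-true (toℕ j₀ ℕ.+ 2 ℕ.≟ suc p ℕ.+ 1) j₀+2 = refl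
    idle : ∀ j → j ≢ j₀ → only (suc p ℕ.+ 1) c j ≡ 0
    idle j j≢ rewrite dec-false (toℕ j ℕ.+ 2 ℕ.≟ suc p ℕ.+ 1) (λ eq → j≢ (Fin.toℕ-injective (ℕ.+-cancelʳ-≡ 2 _ _ (trans eq (sym j₀+2))))) = refl

  -- A relation in place of a lookup function: its inverse has the same form, which gives both
  -- directions of the isomorphism at once.
  data SamePosition {A B : Set} : List A → List B → A → B → Set where
    here  : ∀ {x y xs ys} → SamePosition (x ∷ xs) (y ∷ ys) x y
    there : ∀ {x y xs ys a b} → SamePosition xs ys a b → SamePosition (x ∷ xs) (y ∷ ys) a b

  module _ {A B : Set} where
    same-∈ : ∀ {xs : List A} {ys : List B} {a b} → SamePosition xs ys a b → a ∈ xs × b ∈ ys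
    same-∈ here      = here refl , here refl
    same-∈ (there s) = let a∈ , b∈ = same-∈ s in there a∈ , there b∈

    same-total : ∀ {xs : List A} {ys : List B} {a} → length xs ≡ length ys → a ∈ xs → ∃ (SamePosition xs ys a)
    same-total {xs = _ ∷ _} {_ ∷ _} eq (here refl) = _ , here
    same-total {xs = _ ∷ _} {_ ∷ _} eq (there a∈)  = let b , s = same-total (ℕ.suc-injective eq) a∈ in b , there s

    same-functional : ∀ {xs : List A} {ys : List B} {a b c} → Unique xs → SamePosition xs ys a b → SamePosition xs ys a c → b ≡ c
    same-functional _        here      here      = refl
    same-functional (x∉ ∷ _) here      (there t) = ⊥-elim (All.lookup x∉ (proj₁ (same-∈ t)) refl)
    same-functional (x∉ ∷ _) (there s) here      = ⊥-elim (All.lookup x∉ (proj₁ (same-∈ s)) refl)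
    same-functional (_ ∷ u)  (there s) (there t) = same-functional u s t

    same-sym : ∀ {xs : List A} {ys : List B} {a b} → SamePosition xs ys a b → SamePosition ys xs b a
    same-sym here      = here
    same-sym (there s) = there (same-sym s)

  module BroomMap {G H n p c} (bG : Broom G n p c) (bH : Broom H n p c) where
    private
      module G = Broom bG
      module H = Broom bH
      module LG = BroomLists bG
      module LH = BroomLists bH

    Matches : Edge G → Edge H → Set
    Matches e f = SamePosition G.Zl H.Zl e f ⊎ SamePosition G.Y₁ H.Y₁ e f ⊎ SamePosition G.Os H.Os e f

    matches : ∀ e → ∃ (Matches e)
    matches e with LG.where-edge e
    ... | inj₁ e∈        = let f , s = same-total (trans LG.length-Zl′ (sym LH.length-Zl′)) e∈ in f , inj₁ s
    ... | inj₂ (inj₁ e∈) = let f , s = same-total (trans G.length-Y₁ (sym H.length-Y₁)) e∈ in f , inj₂ (inj₁ s)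
    ... | inj₂ (inj₂ e∈) = let f , s = same-total (trans G.length-Os (sym H.length-Os)) e∈ in f , inj₂ (inj₂ s)

    matches-functional : ∀ {e f g} → Matches e f → Matches e g → f ≡ g
    matches-functional (inj₁ s)        (inj₁ t)        = same-functional LG.unique-Zl s t
    matches-functional (inj₁ s)        (inj₂ (inj₁ t)) = ⊥-elim (LG.Y₁∉Zl (proj₁ (same-∈ t)) (proj₁ (same-∈ s)))
    matches-functional (inj₁ s)        (inj₂ (inj₂ t)) = ⊥-elim (LG.Os∉Zl (proj₁ (same-∈ t)) (proj₁ (same-∈ s)))
    matches-functional (inj₂ (inj₁ s)) (inj₁ t)        = ⊥-elim (LG.Y₁∉Zl (proj₁ (same-∈ s)) (proj₁ (same-∈ t)))
    matches-functional (inj₂ (inj₁ s)) (inj₂ (inj₁ t)) = same-functional LG.unique-Y₁ s t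
    matches-functional (inj₂ (inj₁ s)) (inj₂ (inj₂ t)) = ⊥-elim (LG.Os∉Y₁ (proj₁ (same-∈ t)) (proj₁ (same-∈ s)))
    matches-functional (inj₂ (inj₂ s)) (inj₁ t)        = ⊥-elim (LG.Os∉Zl (proj₁ (same-∈ s)) (proj₁ (same-∈ t)))
    matches-functional (inj₂ (inj₂ s)) (inj₂ (inj₁ t)) = ⊥-elim (LG.Os∉Y₁ (proj₁ (same-∈ s)) (proj₁ (same-∈ t)))
    matches-functional (inj₂ (inj₂ s)) (inj₂ (inj₂ t)) = same-functional (unique-suffix (G.Zl ++ G.Y₁) LG.unique) s t

    edgeMap : Edge G → Edge H
    edgeMap e = proj₁ (matches e)

    vertexMap : Vertex G → Vertex H
    vertexMap v with G.decode v
    ... | inj₁ _           = H.root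
    ... | inj₂ (e , t , _) = H.child (edgeMap e) t

    vertexMap-root : vertexMap G.root ≡ H.root
    vertexMap-root with G.decode G.root
    ... | inj₁ _            = refl
    ... | inj₂ (e , t , eq) = ⊥-elim (G.child≢root (sym eq))

    vertexMap-child : ∀ e t → vertexMap (G.child e t) ≡ H.child (edgeMap e) t
    vertexMap-child e t with G.decode (G.child e t)
    ... | inj₁ eq           = ⊥-elim (G.child≢root eq)
    ... | inj₂ (f , s , eq) with G.child-inj eq
    ...   | refl , refl = refl

    ParentsMatch : (Edge G → Edge H → Set) → Edge G → Edge H → Set
    ParentsMatch M e f = (G.par e ≡ G.root × H.par f ≡ H.root) ⊎ ∃₂ λ e′ f′ → M e′ f′ × G.par e ≡ G.child e′ fzero × H.par f ≡ H.child f′ fzero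

    below-parents : ∀ {x y xs ys e f} → Chains.Below G.rootedBlocks x xs → Chains.Below H.rootedBlocks y ys →
      SamePosition xs ys e f → ∃₂ λ e′ f′ → SamePosition (x ∷ xs) (y ∷ ys) e′ f′ × G.par e ≡ G.child e′ fzero × H.par f ≡ H.child f′ fzero
    below-parents (eq , _) (eq′ , _) here      = _ , _ , here , eq , eq′
    below-parents (_ , b)  (_ , b′)  (there s) = let e′ , f′ , t , h = below-parents b b′ s in e′ , f′ , there t , h

    above-parents : ∀ {xs ys e f} → Chains.Above G.rootedBlocks G.root xs → Chains.Above H.rootedBlocks H.root ys →
      SamePosition xs ys e f → ParentsMatch (SamePosition xs ys) e f
    above-parents (eq , _) (eq′ , _) here      = inj₁ (eq , eq′)
    above-parents (_ , b)  (_ , b′)  (there s) = inj₂ (below-parents b b′ s)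

    parents : ∀ {e f} → Matches e f → ParentsMatch Matches e f
    parents (inj₁ s) = [ inj₁ , (λ (e′ , f′ , t , h) → inj₂ (e′ , f′ , inj₁ t , h)) ]′ (above-parents LG.Zl-above LH.Zl-above s)
    parents (inj₂ (inj₁ s)) = [ inj₁ , (λ (e′ , f′ , t , h) → inj₂ (e′ , f′ , inj₂ (inj₁ t) , h)) ]′ (above-parents LG.Y₁-above LH.Y₁-above s)
    parents (inj₂ (inj₂ s)) = inj₁ (LG.Os-root (proj₁ (same-∈ s)) , LH.Os-root (proj₂ (same-∈ s)))

    -- In either broom the parent of an edge is the root or the top of its predecessor in an arm,
    -- and predecessors of matching edges match.
    vertexMap-par : ∀ e → vertexMap (G.par e) ≡ H.par (edgeMap e)
    vertexMap-par e with parents (proj₂ (matches e))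
    ... | inj₁ (eq , eq′) = trans (cong vertexMap eq) (trans vertexMap-root (sym eq′))
    ... | inj₂ (e′ , f′ , m , eq , eq′) = trans (cong vertexMap eq) (trans (vertexMap-child e′ fzero)
        (trans (cong (λ f → H.child f fzero) (matches-functional (proj₂ (matches e′)) m)) (sym eq′)))

    incident : ∀ {v e} → v ∈ˢ edge G e → vertexMap v ∈ˢ edge H (edgeMap e)
    incident {v} {e} v∈e with G.members v∈e
    ... | inj₁ refl       = subst (_∈ˢ edge H (edgeMap e)) (sym (vertexMap-par e)) (H.par∈ (edgeMap e))
    ... | inj₂ (t , refl) = subst (_∈ˢ edge H (edgeMap e)) (sym (vertexMap-child e t)) (H.child∈ (edgeMap e) t)

  module _ {G H n p c} (bG : Broom G n p c) (bH : Broom H n p c) where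
    private
      module F = BroomMap bG bH
      module B = BroomMap bH bG
      module G = Broom bG

    matches-back : ∀ {e f} → F.Matches e f → B.Matches f e
    matches-back (inj₁ s)        = inj₁ (same-sym s)
    matches-back (inj₂ (inj₁ s)) = inj₂ (inj₁ (same-sym s))
    matches-back (inj₂ (inj₂ s)) = inj₂ (inj₂ (same-sym s))

    edges-inverse : ∀ e → B.edgeMap (F.edgeMap e) ≡ e
    edges-inverse e = B.matches-functional (proj₂ (B.matches (F.edgeMap e))) (matches-back (proj₂ (F.matches e)))

    vertices-inverse : ∀ v → B.vertexMap (F.vertexMap v) ≡ v
    vertices-inverse v with G.decode v
    ... | inj₁ refl           = B.vertexMap-root
    ... | inj₂ (e , t , refl) = trans (B.vertexMap-child (F.edgeMap e) t) (cong (λ e → G.child e t) (edges-inverse e))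

  broom-≅ : ∀ {G H n p c} → Broom G n p c → Broom H n p c → G ≅ H
  broom-≅ {G} {H} bG bH = record
    { vertices = mk↔ₛ′ F.vertexMap B.vertexMap (vertices-inverse bH bG) (vertices-inverse bG bH)
    ; edges = mk↔ₛ′ F.edgeMap B.edgeMap (edges-inverse bH bG) (edges-inverse bG bH)
    ; incidence = λ v e → mk⇔ F.incident λ h → subst₂ (λ v e → v ∈ˢ edge G e) (vertices-inverse bG bH v) (edges-inverse bG bH e) (B.incident h) }
    where
    module F = BroomMap bG bH
    module B = BroomMap bH bG

  any-vec? : ∀ {m} n {P : Vec (Fin m) n → Set} → (∀ v → Dec (P v)) → Dec (∃ P)
  any-vec? zero    P? = map′ (λ p → [] , p) (λ { ([] , p) → p }) (P? [])
  any-vec? (suc n) P? = map′ (λ (x , v , p) → x ∷ v , p) (λ { (x ∷ v , p) → x , v , p })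
    (Fin.any? λ x → any-vec? n λ v → P? (x ∷ v))

  Inverses : ∀ {a b} → Vec (Fin b) a → Vec (Fin a) b → Set
  Inverses f g = (∀ x → Vec.lookup f (Vec.lookup g x) ≡ x) × (∀ x → Vec.lookup g (Vec.lookup f x) ≡ x)

  inverses? : ∀ {a b} (f : Vec (Fin b) a) (g : Vec (Fin a) b) → Dec (Inverses f g)
  inverses? f g = Fin.all? (λ x → Vec.lookup f (Vec.lookup g x) Fin.≟ x) ×-dec Fin.all? (λ x → Vec.lookup g (Vec.lookup f x) Fin.≟ x)

  infix 4 _≅?_
  -- Bijections are searched for as pairs of mutually inverse vectors, of which there are finitely
  -- many. This is what lets the equality case be proved by contradiction.
  _≅?_ : ∀ G H → Dec (G ≅ H)
  G ≅? H = map′ fromData toData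
    (any-vec? (∣V∣ G) λ f → any-vec? (∣V∣ H) λ f⁻ → any-vec? (∣E∣ G) λ g → any-vec? (∣E∣ H) λ g⁻ →
      inverses? f f⁻ ×-dec (inverses? g g⁻ ×-dec Fin.all? λ v → Fin.all? λ e →
        ((v ∈? edge G e) →-dec (Vec.lookup f v ∈? edge H (Vec.lookup g e))) ×-dec ((Vec.lookup f v ∈? edge H (Vec.lookup g e)) →-dec (v ∈? edge G e))))
    where
    Data : Set
    Data = ∃ λ (f : Vec (Vertex H) (∣V∣ G)) → ∃ λ (f⁻ : Vec (Vertex G) (∣V∣ H)) → ∃ λ (g : Vec (Edge H) (∣E∣ G)) → ∃ λ (g⁻ : Vec (Edge G) (∣E∣ H)) →
      Inverses f f⁻ × Inverses g g⁻ × (∀ v e → (v ∈ˢ edge G e → Vec.lookup f v ∈ˢ edge H (Vec.lookup g e)) × (Vec.lookup f v ∈ˢ edge H (Vec.lookup g e) → v ∈ˢ edge G e))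
    fromData : Data → G ≅ H
    fromData (f , f⁻ , g , g⁻ , (ff⁻ , f⁻f) , (gg⁻ , g⁻g) , inc) = record
      { vertices = mk↔ₛ′ (Vec.lookup f) (Vec.lookup f⁻) ff⁻ f⁻f
      ; edges = mk↔ₛ′ (Vec.lookup g) (Vec.lookup g⁻) gg⁻ g⁻g
      ; incidence = λ v e → mk⇔ (proj₁ (inc v e)) (proj₂ (inc v e)) }
    tabulated : ∀ {a b} (π : Fin a ↔ Fin b) → Inverses (Vec.tabulate (Inverse.to π)) (Vec.tabulate (Inverse.from π))
    tabulated π = (λ x → trans (lookup∘tabulate _ (Vec.lookup (Vec.tabulate (Inverse.from π)) x)) (trans (cong (Inverse.to π) (lookup∘tabulate _ x)) (Inverse.strictlyInverseˡ π x)))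
                , (λ x → trans (lookup∘tabulate _ (Vec.lookup (Vec.tabulate (Inverse.to π)) x)) (trans (cong (Inverse.from π) (lookup∘tabulate _ x)) (Inverse.strictlyInverseʳ π x)))
    toData : G ≅ H → Data
    toData iso = Vec.tabulate (Inverse.to vertices) , Vec.tabulate (Inverse.from vertices) , Vec.tabulate (Inverse.to edges) , Vec.tabulate (Inverse.from edges)
      , tabulated vertices , tabulated edges
      , λ v e → (λ v∈ → subst₂ (λ v e → v ∈ˢ edge H e) (sym (lookup∘tabulate _ v)) (sym (lookup∘tabulate _ e)) (Equivalence.to (incidence v e) v∈))
              , (λ v∈ → Equivalence.from (incidence v e) (subst₂ (λ v e → v ∈ˢ edge H e) (lookup∘tabulate _ v) (lookup∘tabulate _ e) v∈))
      where open _≅_ iso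

open Brooms

-- Spectral radii and the theorem

open import Data.Empty using (⊥; ⊥-elim)
open import Data.Fin using (Fin) renaming (zero to fzero; suc to fsuc)
import Data.Integer as ℤ
import Data.Integer.Properties as ℤ
open import Data.Nat using (ℕ; zero; suc; _+_; _*_; _∸_; _≤_; s≤s; z≤n)
import Data.Nat.Properties as ℕ
open import Data.Product using (∃; _×_; _,_; proj₁; proj₂)
import Data.Rational as ℚ
open import Data.Rational using (ℚ; 0ℚ; 1ℚ)
import Data.Rational.Properties as ℚ
open import Data.Rational.Solver using (module +-*-Solver)
import Data.Rational.Unnormalised as ℚᵘ
import Data.Rational.Unnormalised.Properties as ℚᵘ
open import Defs
open import Relation.Binary.PropositionalEquality as ≡ using (_≡_; refl; sym; trans; cong; subst)
open import Relation.Binary.PropositionalEquality using (_≡_; _≢_; refl; sym; trans; cong; subst)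
open import Relation.Nullary using (¬_; no)
open import Relation.Nullary.Decidable using (decidable-stable; toWitness)

private
  module R = RealProperties
  𝓡 : OrderedAlgebra
  𝓡 = R.orderedAlgebra
  module O = OrderedAlgebra 𝓡
  module OP = OrderedAlgebraProperties 𝓡
  module S = Sums 𝓡

1/r*r : ∀ n → fromℕℚ (suc n) ℚ.* (ℤ.+ 1 ℚ./ suc n) ≡ 1ℚ
1/r*r n = trans (cong (ℚ._* (ℤ.+ 1 ℚ./ suc n)) (fromℕℚ≡/1 (suc n))) (ℚ.toℚᵘ-injective (ℚᵘ.≃-trans
  (ℚ.toℚᵘ-homo-* (ℤ.+ suc n ℚ./ 1) (ℤ.+ 1 ℚ./ suc n))
  (ℚᵘ.≃-trans (ℚᵘ.*-cong (ℚ.toℚᵘ-fromℚᵘ (ℚᵘ.mkℚᵘ (ℤ.+ suc n) 0)) (ℚ.toℚᵘ-fromℚᵘ (ℚᵘ.mkℚᵘ (ℤ.+ 1) n)))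
    (ℚᵘ.*≡* (trans (ℤ.*-identityʳ (ℤ.+ suc n ℤ.* ℤ.+ 1)) (trans (ℤ.*-identityʳ (ℤ.+ suc n)) (sym (trans (ℤ.*-identityˡ _) (cong ℤ.+_ (ℕ.*-identityˡ (suc n)))))))))))

re-∑ : ∀ {n} (f : Fin n → ℂ) → re (∑ f) ≡ S.sum (λ j → re (f j))
re-∑ {zero}  f = refl
re-∑ {suc n} f = cong (re (f fzero) +ᴿ_) (re-∑ λ i → f (fsuc i))

im-∑ : ∀ {n} (f : Fin n → ℂ) → im (∑ f) ≡ S.sum (λ j → im (f j))
im-∑ {zero}  f = refl
im-∑ {suc n} f = cong (im (f fzero) +ᴿ_) (im-∑ λ i → f (fsuc i))

module _ (n : ℕ) where
  private
    2≤m : 2 ≤ suc (suc n)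
    2≤m = s≤s (s≤s z≤n)
    q : ℚ
    q = ℤ.+ 1 ℚ./ suc n
    r : ℝ
    r = fromℚ (fromℕℚ (suc n))

    rq≈1 : (r *ᴿ fromℚ q) ≈ fromℚ 1ℚ
    rq≈1 = R.pointwise {r *ᴿ fromℚ q} {fromℚ 1ℚ} λ _ → 1/r*r n

  0<r : 0ᴿ R.<ᴿ fromℚ (fromℕℚ (suc n))
  0<r = 1ℚ , toWitness {a? = 0ℚ ℚ.<? 1ℚ} _ , R.pointwise-≤ {0ᴿ +ᴿ fromℚ 1ℚ} {r} (always λ _ →
      ℚLemmas.≤-by (fromℕℚ n) (0≤fromℕℚ n) (cong (ℚ._+ fromℕℚ n) (sym (ℚ.+-identityˡ 1ℚ))))

  module _ {T : Hypergraph} {λ₁ : ℝ} (radius : IsSpectralRadiusOf 2≤m T λ₁) where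
    open IsSpectralRadius radius

    real-eigenvector : ¬ ¬ (∃ λ (y : Vertex T → ℝ) → (∀ i → 0ᴿ ≤ᴿ y i) × ¬ (∀ i → y i ≤ᴿ 0ᴿ) × (∀ i → ((r *ᴿ λ₁) *ᴿ y i) ≤ᴿ S.row T y i))
    real-eigenvector with attained
    ... | z , (x , x≢0 , eigen) , modulus = Spectral.nonNegative-eigenvector 𝓡 T {re z} {im z} {λ₁} {fromℚ q} {r} rq≈1 a b row-a row-b
        (λ h → x≢0 λ i → h i) nonNegative modulus
      where
      a b : Vertex T → ℝ
      a i = re (x i)
      b i = im (x i)
      row-a : ∀ i → (fromℚ q *ᴿ S.row T a i) ≈ ((re z *ᴿ a i) +ᴿ (-ᴿ (im z *ᴿ b i)))
      row-a i = O.trans {fromℚ q *ᴿ S.row T a i} {S.sum λ j → re (ℝ→ℂ (fromℚ (adjacency 2≤m T i j)) *ᶜ x j)} {(re z *ᴿ a i) +ᴿ (-ᴿ (im z *ᴿ b i))}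
        (O.sym {S.sum λ j → re (ℝ→ℂ (fromℚ (adjacency 2≤m T i j)) *ᶜ x j)} {fromℚ q *ᴿ S.row T a i} (MatrixRows.re-row 𝓡 T q a b i))
        (subst (λ u → u ≈ ((re z *ᴿ a i) +ᴿ (-ᴿ (im z *ᴿ b i)))) (re-∑ (λ j → ℝ→ℂ (fromℚ (adjacency 2≤m T i j)) *ᶜ x j)) (proj₁ (eigen i)))
      row-b : ∀ i → (fromℚ q *ᴿ S.row T b i) ≈ ((re z *ᴿ b i) +ᴿ (im z *ᴿ a i))
      row-b i = O.trans {fromℚ q *ᴿ S.row T b i} {S.sum λ j → im (ℝ→ℂ (fromℚ (adjacency 2≤m T i j)) *ᶜ x j)} {(re z *ᴿ b i) +ᴿ (im z *ᴿ a i)}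
        (O.sym {S.sum λ j → im (ℝ→ℂ (fromℚ (adjacency 2≤m T i j)) *ᶜ x j)} {fromℚ q *ᴿ S.row T b i} (MatrixRows.im-row 𝓡 T q a b i))
        (subst (λ u → u ≈ ((re z *ᴿ b i) +ᴿ (im z *ᴿ a i))) (im-∑ (λ j → ℝ→ℂ (fromℚ (adjacency 2≤m T i j)) *ᶜ x j)) (proj₂ (eigen i)))

  module _ {S : Hypergraph} {p c : ℕ} (broom : Broom S n (suc p) (suc c)) (6≤cr : 6 ≤ c * suc n) {λ₁ : ℝ} (radius : IsSpectralRadiusOf 2≤m S λ₁) where
    open IsSpectralRadius radius
    open PathPolynomials n

    private
      P : Poly
      P = broomPoly (suc p) (suc c)

      P-root : ∃ λ x → evalᴿ P x ≈ 0ᴿ × (∀ i → lowest ℚ.≤ seq x i × 0ℚ ℚ.≤ ⟦ P ⟧ (seq x i))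
      P-root = poly-root P lowest (highest (suc c)) (lowest≤highest (suc c)) (broom-lowest p c 6≤cr) (broom-highest (suc p) (suc c))

      -- The root of the polynomial, the corresponding eigenvalue s - 1 of rA, and the eigenvalue of
      -- A itself.
      s μ λ̂ : ℝ
      s = proj₁ P-root
      μ = s +ᴿ (-ᴿ fromℚ 1ℚ)
      λ̂ = fromℚ q *ᴿ μ

      y : Vertex S → ℝ
      y = BroomEigenvector.vector 𝓡 broom s

      y-row : ∀ v → S.row S y v ≈ (μ *ᴿ y v)
      y-row = BroomEigenvector.eigenvector 𝓡 broom s (proj₁ (proj₂ P-root))

      -- The root entry of the eigenvector as a polynomial in s. It is at least 1 at every term of
      -- the sequence s, which shows that the vector is nonzero.
      ρᵖ : Poly
      ρᵖ = (X ⊕ ⊝ N ⊕ ⊝ const 1ℚ) ⊗ (Gᵖ (suc p) ⊗ Gᵖ (suc (suc p)))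

      1≤ρ : fromℚ 1ℚ ≤ᴿ evalᴿ ρᵖ s
      1≤ρ = R.pointwise-≤ {fromℚ 1ℚ} {evalᴿ ρᵖ s} (always λ i → subst (1ℚ ℚ.≤_) (sym (seq-evalᴿ ρᵖ s i)) (large (seq s i) (proj₁ (proj₂ (proj₂ P-root) i))))
        where
        1*≤ : ∀ {a b} → 1ℚ ℚ.≤ a → 1ℚ ℚ.≤ b → 1ℚ ℚ.≤ a ℚ.* b
        1*≤ {a} {b} 1≤a 1≤b = ℚ.≤-trans 1≤b (subst (ℚ._≤ a ℚ.* b) (ℚ.*-identityˡ b) (ℚ.*-monoʳ-≤-nonNeg b {{ℚ.nonNegative (ℚ.≤-trans 0≤1ℚ 1≤b)}} 1≤a))
        large : ∀ t → lowest ℚ.≤ t → 1ℚ ℚ.≤ ⟦ ρᵖ ⟧ t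
        large t low = 1*≤ 1≤a-1 (1*≤ (Growth.1≤G (growth (suc p))) (Growth.1≤G (growth (suc (suc p)))))
          where
          open At t low
          1≤a-1 : 1ℚ ℚ.≤ t ℚ.+ ℚ.- fromℕℚ n ℚ.+ ℚ.- 1ℚ
          1≤a-1 = ℚ.≤-trans (toWitness {a? = 1ℚ ℚ.≤? 4ℚ ℚ.- 1ℚ} _) (ℚ.+-monoˡ-≤ (ℚ.- 1ℚ) {4ℚ} {a} (ℚLemmas.≤-by (a ℚ.- 4ℚ) 0≤a-4 (a≡ a 4ℚ)))
            where
            a≡ : ∀ a f → a ≡ f ℚ.+ (a ℚ.- f)
            a≡ = solve 2 (λ a f → a := f :+ (a :- f)) refl
              where open +-*-Solver

      root-nonzero : ¬ (y (Broom.root broom) ≈ 0ᴿ)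
      root-nonzero h = R.<⇒≱ {evalᴿ ρᵖ s} {0ᴿ} (1ℚ , toWitness {a? = 0ℚ ℚ.<? 1ℚ} _
          , R.≤-trans {0ᴿ +ᴿ fromℚ 1ℚ} {fromℚ 1ℚ} {evalᴿ ρᵖ s} (R.≤-reflexive {0ᴿ +ᴿ fromℚ 1ℚ} {fromℚ 1ℚ} (O.+-identityˡ (fromℚ 1ℚ))) 1≤ρ)
        (R.≤-reflexive {evalᴿ ρᵖ s} {0ᴿ} (subst (λ u → u ≈ 0ᴿ) (BroomEigenvector.vector-root 𝓡 broom s) h))

      scaled : ∀ v → (fromℚ q *ᴿ S.row S y v) ≈ (λ̂ *ᴿ y v)
      scaled v = O.trans {fromℚ q *ᴿ S.row S y v} {fromℚ q *ᴿ (μ *ᴿ y v)} {λ̂ *ᴿ y v}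
        (O.*-congˡ {fromℚ q} {S.row S y v} {μ *ᴿ y v} (y-row v)) (O.sym {λ̂ *ᴿ y v} {fromℚ q *ᴿ (μ *ᴿ y v)} (O.*-assoc (fromℚ q) μ (y v)))

      eigenvalue : IsEigenvalue (λ i j → ℝ→ℂ (fromℚ (adjacency 2≤m S i j))) (ℝ→ℂ λ̂)
      eigenvalue = (λ v → ℝ→ℂ (y v)) , (λ h → root-nonzero (proj₁ (h (Broom.root broom)))) , λ v → real v , imaginary v
        where
        A : Vertex S → Vertex S → ℂ
        A i j = ℝ→ℂ (fromℚ (adjacency 2≤m S i j))
        real : ∀ v → re (∑ (λ j → A v j *ᶜ ℝ→ℂ (y j))) ≈ re (ℝ→ℂ λ̂ *ᶜ ℝ→ℂ (y v))
        real v = subst (λ u → u ≈ ((λ̂ *ᴿ y v) +ᴿ (-ᴿ (0ᴿ *ᴿ 0ᴿ)))) (sym (re-∑ λ j → A v j *ᶜ ℝ→ℂ (y j)))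
          (O.trans {S.sum λ j → re (A v j *ᶜ ℝ→ℂ (y j))} {fromℚ q *ᴿ S.row S y v} {(λ̂ *ᴿ y v) +ᴿ (-ᴿ (0ᴿ *ᴿ 0ᴿ))} (MatrixRows.re-row 𝓡 S q y (λ _ → 0ᴿ) v)
            (O.trans {fromℚ q *ᴿ S.row S y v} {λ̂ *ᴿ y v} {(λ̂ *ᴿ y v) +ᴿ (-ᴿ (0ᴿ *ᴿ 0ᴿ))} (scaled v)
              (R.pointwise {λ̂ *ᴿ y v} {(λ̂ *ᴿ y v) +ᴿ (-ᴿ (0ᴿ *ᴿ 0ᴿ))} λ i → sym (ℚ.+-identityʳ (seq (λ̂ *ᴿ y v) i)))))
        imaginary : ∀ v → im (∑ (λ j → A v j *ᶜ ℝ→ℂ (y j))) ≈ im (ℝ→ℂ λ̂ *ᶜ ℝ→ℂ (y v))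
        imaginary v = subst (λ u → u ≈ ((λ̂ *ᴿ 0ᴿ) +ᴿ (0ᴿ *ᴿ y v))) (sym (im-∑ λ j → A v j *ᶜ ℝ→ℂ (y j)))
          (O.trans {S.sum λ j → im (A v j *ᶜ ℝ→ℂ (y j))} {fromℚ q *ᴿ S.row S (λ _ → 0ᴿ) v} {(λ̂ *ᴿ 0ᴿ) +ᴿ (0ᴿ *ᴿ y v)} (MatrixRows.im-row 𝓡 S q y (λ _ → 0ᴿ) v)
            (O.trans {fromℚ q *ᴿ S.row S (λ _ → 0ᴿ) v} {fromℚ q *ᴿ 0ᴿ} {(λ̂ *ᴿ 0ᴿ) +ᴿ (0ᴿ *ᴿ y v)}
              (O.*-congˡ {fromℚ q} {S.row S (λ _ → 0ᴿ) v} {0ᴿ} (MatrixRows.zero-row 𝓡 S q v))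
              (R.pointwise {fromℚ q *ᴿ 0ᴿ} {(λ̂ *ᴿ 0ᴿ) +ᴿ (0ᴿ *ᴿ y v)} λ i →
                trans (ℚ.*-zeroʳ q) (sym (trans (≡.cong₂ ℚ._+_ (ℚ.*-zeroʳ (seq λ̂ i)) (ℚ.*-zeroˡ (seq (y v) i))) (ℚ.+-identityʳ 0ℚ))))))

      λ̂≤λ₁ : λ̂ ≤ᴿ λ₁
      λ̂≤λ₁ = Squares.square-reflects-≤ 𝓡 {λ̂} {λ₁} nonNegative
        (R.≤-trans {λ̂ *ᴿ λ̂} {(λ̂ *ᴿ λ̂) +ᴿ (0ᴿ *ᴿ 0ᴿ)} {λ₁ *ᴿ λ₁}
          (R.≤-reflexive {λ̂ *ᴿ λ̂} {(λ̂ *ᴿ λ̂) +ᴿ (0ᴿ *ᴿ 0ᴿ)} (R.pointwise {λ̂ *ᴿ λ̂} {(λ̂ *ᴿ λ̂) +ᴿ (0ᴿ *ᴿ 0ᴿ)} λ i → sym (ℚ.+-identityʳ (seq (λ̂ *ᴿ λ̂) i))))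
          (upperBound (ℝ→ℂ λ̂) eigenvalue))

      μ≤ : μ ≤ᴿ (r *ᴿ λ₁)
      μ≤ = R.≤-trans {μ} {r *ᴿ λ̂} {r *ᴿ λ₁}
        (R.≤-reflexive {μ} {r *ᴿ λ̂} (R.pointwise {μ} {r *ᴿ λ̂} λ i →
          sym (trans (sym (ℚ.*-assoc (fromℕℚ (suc n)) q (seq μ i))) (trans (cong (ℚ._* seq μ i) (1/r*r n)) (ℚ.*-identityˡ (seq μ i))))))
        (OP.*-monoˡ-≤ {λ̂} {λ₁} {r} (OP.<⇒≤ {0ᴿ} {r} 0<r) λ̂≤λ₁)

      -- The terms of s are upper ends of the bisection, where P is nonnegative, and late ones
      -- exceed s by at most ε.
      approximations : ∀ ε → 0ℚ ℚ.< ε → ∃ λ t → lowest ℚ.≤ t × 0ℚ ℚ.≤ ⟦ P ⟧ t × fromℚ t ≤ᴿ (s +ᴿ fromℚ ε)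
      approximations ε 0<ε = let K , close = cauchy s ε 0<ε in
        seq s K , proj₁ (proj₂ (proj₂ P-root) K) , proj₂ (proj₂ (proj₂ P-root) K)
        , R.pointwise-≤ {fromℚ (seq s K)} {s +ᴿ fromℚ ε} (K , λ j K≤j → ∣-∣≤⇒≤ {seq s K} {seq s j} (close K j ℕ.≤-refl K≤j))

    -- The form is bounded by s - 1, which is an eigenvalue of rA on the broom and hence at most r
    -- times its spectral radius.
    broom-bounded : BroomBound 𝓡 n (suc p) (suc c) (r *ᴿ λ₁)
    broom-bounded = bound-mono {μ} {r *ᴿ λ₁} μ≤ (bound-limit {s} approximations)
      where open BroomBounds 𝓡 n (suc p) (suc c)

Conclusion : ∀ {m} → 2 ≤ m → Hypergraph → (d p c : ℕ) → Set
Conclusion 2≤m T d p c = ∀ (λ₁ λ₁* : ℝ) → IsSpectralRadiusOf 2≤m T λ₁ →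
  IsSpectralRadiusOf 2≤m (T⟨ d ⟩ (only (p + 1) c) 2≤m) λ₁* →
  (λ₁ ≤ᴿ λ₁*) × (λ₁ ≈ λ₁* → T ≅ T⟨ d ⟩ (only (p + 1) c) 2≤m)

module _ (n p c : ℕ) (6≤cr : 6 ≤ c * suc n) where
  private
    d : ℕ
    d = suc p + suc (suc p)
    2≤m : 2 ≤ suc (suc n)
    2≤m = s≤s (s≤s z≤n)
    T* : Hypergraph
    T* = T⟨ d ⟩ (only (suc p + 1) (suc c)) 2≤m

  odd-diameter : ∀ T → Uniform (suc (suc n)) T → IsHypertree T → IsDiameter T d → ∣E∣ T ≡ d + suc c →
    Conclusion 2≤m T d (suc p) (suc c)
  odd-diameter T uniform isHypertree ((_ , _ , path , _) , _) size λ₁ λ₁* radius radius* = at-most , equality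
    where
    open OrderedAlgebra 𝓡 using (≤-stable; ≤-reflexive; *-congˡ) renaming (sym to ≈-sym)
    open BroomBounds 𝓡 n (suc p) (suc c) using (bound-mono)
    r : ℝ
    r = fromℚ (fromℕℚ (suc n))
    module With {μ : ℝ} (bound : BroomBound 𝓡 n (suc p) (suc c) μ) =
      Comparison 𝓡 isHypertree uniform path (s≤s z≤n) size {μ} bound
    bound* : BroomBound 𝓡 n (suc p) (suc c) (r *ᴿ λ₁*)
    bound* = broom-bounded n {T*} {p} {c} (starBroom n p (suc c)) 6≤cr {λ₁*} radius*
    at-most : λ₁ ≤ᴿ λ₁*
    at-most = ≤-stable {λ₁} {λ₁*} λ k → real-eigenvector n {T} {λ₁} radius λ (y , 0≤y , nonzero , eigen) → k
      (FinalInequality.radius-≤ 𝓡 T {r} {λ₁} {λ₁*} y (0<r n) nonzero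
        (Perturbation.dot-row 𝓡 T y y (r *ᴿ λ₁) 0≤y eigen) (With.upper {r *ᴿ λ₁*} bound* y 0≤y))
    equality : λ₁ ≈ λ₁* → T ≅ T*
    equality λ₁≈λ₁* = decidable-stable (T ≅? T*) λ k → real-eigenvector n {T} {λ₁} radius λ (y , 0≤y , nonzero , eigen) →
      With.Equality.broom {r *ᴿ λ₁} bound y 0≤y nonzero eigen λ broom → k (broom-≅ broom (starBroom n p (suc c)))
      where
      -- When the radii agree, the bound holds with the eigenvalue that belongs to y, and y attains
      -- it.
      bound : BroomBound 𝓡 n (suc p) (suc c) (r *ᴿ λ₁)
      bound = bound-mono {r *ᴿ λ₁*} {r *ᴿ λ₁} (≤-reflexive {r *ᴿ λ₁*} {r *ᴿ λ₁} (*-congˡ {r} {λ₁*} {λ₁} (≈-sym {λ₁} {λ₁*} λ₁≈λ₁*))) bound*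

odd-case : ∀ n p T k d → Uniform (suc (suc n)) T → IsHypertree T → ∣E∣ T ≡ k → IsDiameter T d → d ≡ suc p + suc (suc p) →
  ∀ c → k ∸ d ≡ c → 6 ≤ (c ∸ 1) * suc n → Conclusion {suc (suc n)} (s≤s (s≤s z≤n)) T d (suc p) c
-- For c = 0 the numerical hypothesis would read 6 ≤ 0.
odd-case n p T k .(suc p + suc (suc p)) uniform isHypertree size diameter refl (suc c) eq 6≤ =
  odd-diameter n p c 6≤ T uniform isHypertree diameter (trans size (trans (sym (ℕ.m+[n∸m]≡n d≤k)) (cong (suc p + suc (suc p) +_) eq)))
  where
  0≢suc : ∀ {x} → 0 ≢ suc x
  0≢suc ()
  -- Subtraction is truncated; that d ≤ k follows from k ∸ d being nonzero.
  d≤k : suc p + suc (suc p) ≤ k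
  d≤k = ℕ.<⇒≤ (ℕ.m∸n≢0⇒n<m λ zero≡ → 0≢suc (trans (sym zero≡) eq))

theorem2p1p2 : ∀ (m : ℕ) (2≤m : 2 ≤ m) (T : Hypergraph) (k d p : ℕ) →
    Uniform m T → IsHypertree T → ∣E∣ T ≡ k → IsDiameter T d → d ≡ 2 * p + 1 →
    6 ≤ (k ∸ d ∸ 1) * (m ∸ 1) →
    ∀ (λ₁ λ₁* : ℝ) →
    IsSpectralRadiusOf 2≤m T λ₁ →
    IsSpectralRadiusOf 2≤m (T⟨ d ⟩ (only (p + 1) (k ∸ d)) 2≤m) λ₁* →
    (λ₁ ≤ᴿ λ₁*) × (λ₁ ≈ λ₁* → T ≅ T⟨ d ⟩ (only (p + 1) (k ∸ d)) 2≤m)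
theorem2p1p2 (suc (suc n)) (s≤s (s≤s z≤n)) T k d zero uniform isHypertree size diameter refl 6≤ =
  -- For p = 0 the diameter is 1, which forbids a second edge, while the numerical hypothesis asks
  -- for one.
  ⊥-elim (impossible (∣E∣ T) (subst (λ k → 6 ≤ (k ∸ 1 ∸ 1) * suc n) (sym size) 6≤) λ e f → diameter-1 isHypertree uniform diameter e f)
  where
  impossible : ∀ k → 6 ≤ (k ∸ 1 ∸ 1) * suc n → (∀ (e f : Fin k) → e ≢ f → ⊥) → ⊥
  -- With fewer than two edges the product is 0, so those cases are absurd.
  impossible (suc (suc k)) _ h = h fzero (fsuc fzero) λ ()
theorem2p1p2 (suc (suc n)) (s≤s (s≤s z≤n)) T k d (suc p) uniform isHypertree size diameter d≡ 6≤ =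
  odd-case n p T k d uniform isHypertree size diameter (trans d≡ odd) (k ∸ d) refl 6≤
  where
  odd : 2 * suc p + 1 ≡ suc p + suc (suc p)
  odd = trans (cong (λ q → suc p + q + 1) (ℕ.+-identityʳ (suc p))) (trans (ℕ.+-assoc (suc p) (suc p) 1) (cong (suc p +_) (ℕ.+-comm (suc p) 1)))
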